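{- Let $n$ be a positive integer and write $8n+19=3^{\beta}n_1$ with $n_1$ a positive integer and $3\nmid n_1$. Then $$t(1,3,3,12;n)=\frac 12\Big(3^{\beta}\Big(\frac 3{n_1}\Big)-1\Big)\sum_{d\mid n_1}d\Big(\frac 3d\Big)+\frac12\sum_{\substack{a,b\in\mathbb N,\ a\equiv b\equiv 1\ (\mathrm{mod}\ 2)\\ 4(8n+19)=a^2+3b^2}}\big((-1)^{\frac{a-1}2}a+(-1)^{\frac{b-1}2}b\big),$$ where $d$ runs over positive divisors of $n_1$.
   Context: $\mathbb N$ is the set of positive integers and $\left(\frac{a}{m}\right)$ is the Legendre–Jacobi–Kronecker symbol. For positive integers $a,b,c,d$ and a nonnegative integer $n$, $t(a,b,c,d;n)$ denotes the number of $(x,y,z,w)\in\mathbb Z^4$ with $n=a\frac{x(x-1)}2+b\frac{y(y-1)}2+c\frac{z(z-1)}2+d\frac{w(w-1)}2$. -}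

module Defs where

open import Data.Bool using (Bool; true; false; if_then_else_)
open import Data.Nat as ℕ using (ℕ; zero; suc; _∸_; _%_; _/_)
open import Data.Nat.Divisibility using (_∣_; _∣?_)
open import Data.Integer as ℤ using (ℤ; +_; -[1+_]; ∣_∣)
open import Data.List using (List; []; _∷_; applyUpTo; filter; map; concatMap)
open import Data.Bool.ListAction using (any)
open import Data.Product using (Σ; _×_; _,_)
open import Relation.Nullary using (does)
open import Relation.Binary.PropositionalEquality using (_≡_)
open import Function.Bundles using (_↔_)
open import Data.Fin using (Fin)

-- x(x-1)/2 for an integer x (x(x-1) ≥ 0 and even)
tri : ℤ → ℕ
tri x = ∣ x ℤ.* (x ℤ.- ℤ.1ℤ) ∣ / 2

TSol : ℕ → ℕ → ℕ → ℕ → ℕ → Set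
TSol a b c d n = Σ (ℤ × ℤ × ℤ × ℤ) λ { (x , y , z , w) →
  n ≡ a ℕ.* tri x ℕ.+ b ℕ.* tri y ℕ.+ c ℕ.* tri z ℕ.+ d ℕ.* tri w }

HasCount : Set → ℕ → Set
HasCount S k = Fin k ↔ S

legendre : ℕ → ℕ → ℤ
legendre a zero = + 0
legendre a p@(suc _) =
  if does (p ∣? a) then + 0
  else if any (λ x → does ((x ℕ.* x) % p ℕ.≟ a % p)) (applyUpTo (λ i → i) p)
       then + 1 else -[1+ 0 ]

minDivFrom : ℕ → ℕ → ℕ → ℕ
minDivFrom zero k m = m
minDivFrom (suc f) k m = if does (k ∣? m) then k else minDivFrom f (suc k) m

lpf : ℕ → ℕ
lpf m = minDivFrom m 2 m

-- Jacobi symbol (a/m) for odd positive m: product of Legendre symbols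
-- over the prime factorisation of m (recursion on fuel ≥ number of prime factors)
jacobiAux : ℕ → ℕ → ℕ → ℤ
jacobiAux zero a m = + 1
jacobiAux (suc f) a zero = + 1
jacobiAux (suc f) a (suc zero) = + 1
jacobiAux (suc f) a m@(suc (suc _)) with lpf m
... | zero = + 1
... | p@(suc _) = legendre a p ℤ.* jacobiAux f a (m / p)

jacobi : ℕ → ℕ → ℤ
jacobi a m = jacobiAux m a m

sumℤ : List ℤ → ℤ
sumℤ [] = + 0
sumℤ (x ∷ xs) = x ℤ.+ sumℤ xs

divisors : ℕ → List ℕ
divisors m = filter (λ d → d ∣? m) (applyUpTo suc m)

divSum : ℕ → ℤ
divSum m = sumℤ (map (λ d → + d ℤ.* jacobi 3 d) (divisors m))

sgn : ℕ → ℤ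
sgn k = if does (2 ∣? k) then + 1 else -[1+ 0 ]

odd : ℕ → Bool
odd k = if does (2 ∣? k) then false else true

-- pairs (a,b) ∈ ℕ×ℕ (positive) with a ≡ b ≡ 1 (mod 2) and a² + 3b² = N.
-- Any such pair has 1 ≤ a,b ≤ N, so the search range 1..N is exhaustive.
repPairs : ℕ → List (ℕ × ℕ)
repPairs N = filter (λ { (a , b) → (a ℕ.* a ℕ.+ 3 ℕ.* (b ℕ.* b)) ℕ.≟ N })
  (filter (λ { (a , b) → odd a Data.Bool.∧ odd b Data.Bool.≟ true })
    (concatMap (λ a → map (λ b → (a , b)) (applyUpTo suc N)) (applyUpTo suc N)))
  where import Data.Bool

repSum : ℕ → ℤ
repSum N = sumℤ (map (λ { (a , b) → sgn ((a ∸ 1) / 2) ℤ.* + a ℤ.+ sgn ((b ∸ 1) / 2) ℤ.* + b })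
  (repPairs N))

{-# OPTIONS --safe #-}
module Submission where

-- Put N = 8n + 19. Solutions correspond to the points of x² + 3v² + 3c² + 3d² = N with x, v, c odd and
-- d ≡ 2 (mod 4). With κ(v) = cos(πv/2), parity considerations and a rotation of the hexagonal lattice of
-- (x , v) give 4t = Λ - ℭ, where Λ counts the points with x ≡ v (mod 2) and ℭ is the sum of κ(v) over
-- the points with x even.
--
-- On the points counted by Λ the form is 4(a² + ab + b²) + 3(c² + d²). The classical formulas for the
-- number of representations by the two binary forms turn Λ into a convolution of divisor sums, which is
-- evaluated by Liouville's method: on ax + by = N the function σ = (sgn a + sgn x)(sgn b + sgn y)
-- satisfies σ(a , b , x , y) = σ(a , b - a , x + y , y) + σ(b , a - b , x + y , x), so that sums of
-- suitable periodic weights collapse to sums over the divisors of N.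
--
-- For fixed even x the sum of κ(v) over v² + c² + d² = (N - x²)/3 is 4 Σ χ₄(y) y over y > 0 with
-- y² = (N - x²)/3, an elementary form of Jacobi's identity for η³. Hence ℭ is a sum over x² + 3y² = N, which
-- the substitution a = x + 3y, b = x - y carries to a² + 3b² = 4N.


-- The relation `4 t = Λ - ℭ` separates an Eisenstein part from a cuspidal part: `Λ` carries no
-- signs and turns out to be a difference of divisor sums, whereas the signs in `ℭ` bring in the
-- cube of η. After the two binary formulas, `Λ` contains the convolution `q₃` of `χ₃` and `χ₄` over
-- `3 d e + 4 b y = N`. None of the weights `G₁`, `G₂`, `G₃` isolates it: each also produces some of
-- the convolutions `p₁`, `p₃`, `q₁`. Taken with multiplicities 1, 1, 2 they leave `2 q₁ - 6 q₃`,
-- and `q₁` vanishes because `N ≡ 3` modulo 4. The boundary terms lie on planes where one variable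
-- is free; summing over it gives a linear function of another variable, up to characters, and so
-- divisor sums. Sums run over infinite sets with weights of finite support. Signs are kept on all
-- quadrants as long as possible, since terms even in one pair of variables then cancel; positive
-- quadrants are extracted only at the end. Halves, thirds and sixths are avoided by proving
-- multiples of the identities.

module FiniteSums where

  -- Sums of finitely supported integer functions.

  open import Data.Empty using (⊥; ⊥-elim)
  open import Data.Nat as ℕ using (ℕ; zero; suc)
  import Data.Nat.Properties as ℕₚ
  open import Data.Integer as ℤ using (ℤ; +_; -[1+_]; _+_; _*_; _-_; -_; ∣_∣; 0ℤ; 1ℤ)
  import Data.Integer.Properties as ℤₚ
  open import Data.Integer.Tactic.RingSolver using (solve-∀)
  open import Data.List using (List; []; _∷_; map; _++_; filter; concatMap; cartesianProduct; deduplicate; upTo)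
  open import Data.List.Membership.Propositional using (_∈_)
  open import Data.List.Membership.Propositional.Properties
  open import Data.List.Relation.Unary.Any using (here; there; any?)
  open import Data.List.Relation.Unary.All as All using (All; []; _∷_)
  open import Data.List.Relation.Unary.AllPairs using ([]; _∷_)
  open import Data.List.Relation.Unary.Unique.Propositional using (Unique)
  import Data.List.Relation.Unary.Unique.Propositional.Properties as Uniqueₚ
  import Data.List.Relation.Unary.Unique.DecPropositional.Properties as DecUniqueₚ
  open import Data.Product using (∃; _×_; _,_; proj₁; proj₂)
  open import Data.Product.Properties using (≡-dec)
  open import Function using (_∘_)
  open import Relation.Nullary using (Dec; yes; no)
  open import Relation.Binary.Definitions using (DecidableEquality)
  open import Relation.Binary.PropositionalEquality

  private variable
    A B C : Set

  ∑ : List A → (A → ℤ) → ℤ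
  ∑ []       f = 0ℤ
  ∑ (x ∷ xs) f = f x + ∑ xs f

  ∑-cong : ∀ (xs : List A) {f g : A → ℤ} → (∀ a → a ∈ xs → f a ≡ g a) → ∑ xs f ≡ ∑ xs g
  ∑-cong []       f≡g = refl
  ∑-cong (x ∷ xs) f≡g = cong₂ _+_ (f≡g x (here refl)) (∑-cong xs λ a a∈ → f≡g a (there a∈))

  ∑-zero : ∀ (xs : List A) {f : A → ℤ} → (∀ a → a ∈ xs → f a ≡ 0ℤ) → ∑ xs f ≡ 0ℤ
  ∑-zero []       f≡0 = refl
  ∑-zero (x ∷ xs) f≡0 = cong₂ _+_ (f≡0 x (here refl)) (∑-zero xs λ a a∈ → f≡0 a (there a∈))

  ∑-+ : ∀ (xs : List A) (f g : A → ℤ) → ∑ xs (λ a → f a + g a) ≡ ∑ xs f + ∑ xs g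
  ∑-+ []       f g = refl
  ∑-+ (x ∷ xs) f g = trans (cong (λ z → f x + g x + z) (∑-+ xs f g)) (interchange (f x) (g x) (∑ xs f) (∑ xs g))
    where
    interchange : ∀ a b c d → a + b + (c + d) ≡ a + c + (b + d)
    interchange = solve-∀

  ∑-* : ∀ (xs : List A) (c : ℤ) (f : A → ℤ) → ∑ xs (λ a → c * f a) ≡ c * ∑ xs f
  ∑-* []       c f = sym (ℤₚ.*-zeroʳ c)
  ∑-* (x ∷ xs) c f = trans (cong (λ z → c * f x + z) (∑-* xs c f)) (sym (ℤₚ.*-distribˡ-+ c (f x) (∑ xs f)))

  ∑-++ : ∀ (xs ys : List A) (f : A → ℤ) → ∑ (xs ++ ys) f ≡ ∑ xs f + ∑ ys f
  ∑-++ []       ys f = sym (ℤₚ.+-identityˡ _)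
  ∑-++ (x ∷ xs) ys f = trans (cong (λ z → f x + z) (∑-++ xs ys f)) (sym (ℤₚ.+-assoc (f x) _ _))

  ∑-map : ∀ (g : A → B) (xs : List A) (f : B → ℤ) → ∑ (map g xs) f ≡ ∑ xs (f ∘ g)
  ∑-map g []       f = refl
  ∑-map g (x ∷ xs) f = cong (λ z → f (g x) + z) (∑-map g xs f)

  ∑-swap : ∀ (xs : List A) (ys : List B) (f : A → B → ℤ) →
           ∑ xs (λ a → ∑ ys (f a)) ≡ ∑ ys (λ b → ∑ xs (λ a → f a b))
  ∑-swap []       ys f = sym (∑-zero ys λ _ _ → refl)
  ∑-swap (x ∷ xs) ys f = trans (cong (λ z → ∑ ys (f x) + z) (∑-swap xs ys f)) (sym (∑-+ ys _ _))

  ∑-cartesianProduct : ∀ (xs : List A) (ys : List B) (f : A × B → ℤ) →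
                       ∑ (cartesianProduct xs ys) f ≡ ∑ xs (λ a → ∑ ys (λ b → f (a , b)))
  ∑-cartesianProduct []       ys f = refl
  ∑-cartesianProduct (x ∷ xs) ys f =
    trans (∑-++ (map (x ,_) ys) _ f) (cong₂ _+_ (∑-map (x ,_) ys f) (∑-cartesianProduct xs ys f))

  ∑-single : ∀ {xs : List A} {f : A → ℤ} {b} → Unique xs → b ∈ xs → (∀ a → a ≢ b → f a ≡ 0ℤ) → ∑ xs f ≡ f b
  ∑-single {xs = x ∷ xs} {f} (x∉ ∷ _) (here refl) f≡0 =
    trans (cong (λ z → f x + z) (∑-zero xs λ a a∈ → f≡0 a λ a≡x → All.lookup x∉ a∈ (sym a≡x))) (ℤₚ.+-identityʳ _)
  ∑-single {xs = x ∷ xs} {f} {b} (x∉ ∷ u) (there b∈) f≡0 =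
    trans (cong (_+ ∑ xs f) (f≡0 x (All.lookup x∉ b∈))) (trans (ℤₚ.+-identityˡ _) (∑-single u b∈ f≡0))

  -- Decidable equality lets a weight be concentrated on a diagonal, which makes totals independent
  -- of the chosen support. The boxes turn an a priori bound on the size of solutions into a finite
  -- support.
  record Grid (A : Set) : Set where
    field
      _≟_        : DecidableEquality A
      box        : ℕ → List A
      box-unique : ∀ n → Unique (box n)
      size       : A → ℕ
      box-∈      : ∀ n a → size a ℕ.≤ n → a ∈ box n

  open Grid {{...}} public

  range : ℕ → List ℤ
  range n = map +_ (upTo (suc n)) ++ map -[1+_] (upTo n)

  instance
    ℤ-Grid : Grid ℤ
    ℤ-Grid = record
      { _≟_        = ℤ._≟_
      ; box        = range
      ; box-unique = λ n → Uniqueₚ.++⁺ (Uniqueₚ.map⁺ ℤₚ.+-injective (Uniqueₚ.upTo⁺ (suc n)))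
                                       (Uniqueₚ.map⁺ ℤₚ.-[1+-injective (Uniqueₚ.upTo⁺ n))
                                       (λ (p , q) → disjoint (∈-map⁻ _ p) (∈-map⁻ _ q))
      ; size       = ∣_∣
      ; box-∈      = λ { n (+ k) k≤n → ∈-++⁺ˡ (∈-map⁺ +_ (∈-upTo⁺ (ℕ.s≤s k≤n)))
                       ; n -[1+ k ] k<n → ∈-++⁺ʳ (map +_ (upTo (suc n))) (∈-map⁺ -[1+_] (∈-upTo⁺ k<n)) }
      }
      where
      disjoint : ∀ {z m n} → (∃ λ i → i ∈ upTo m × z ≡ + i) → (∃ λ i → i ∈ upTo n × z ≡ -[1+ i ]) → ⊥
      disjoint (_ , _ , refl) (_ , _ , ())

    ×-Grid : {{Grid A}} → {{Grid B}} → Grid (A × B)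
    ×-Grid = record
      { _≟_        = ≡-dec _≟_ _≟_
      ; box        = λ n → cartesianProduct (box n) (box n)
      ; box-unique = λ n → Uniqueₚ.cartesianProduct⁺ (box-unique n) (box-unique n)
      ; size       = λ (a , b) → size a ℕ.⊔ size b
      ; box-∈      = λ n (a , b) h → ∈-cartesianProduct⁺ (box-∈ n a (ℕₚ.m⊔n≤o⇒m≤o (size a) (size b) h))
                                                         (box-∈ n b (ℕₚ.m⊔n≤o⇒n≤o (size a) (size b) h))
      }

  -- The sum over all of A of a finitely supported function; the support only has to be
  -- contained in the list.
  record HasSum {A : Set} (w : A → ℤ) (s : ℤ) : Set where
    constructor hasSum
    field
      support : List A
      unique  : Unique support
      covers  : ∀ a → w a ≢ 0ℤ → a ∈ support
      total   : ∑ support w ≡ s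

  open HasSum

  module _ {{_ : Grid A}} where

    -- Both sides are iterated sums of one double sum over `xs` and `ys`, whose summand is `w` on
    -- the diagonal and zero off it. Summing over either list returns `w`, because a point missing
    -- from that list has weight zero.
    ∑-covered : ∀ {w : A → ℤ} {xs ys} → Unique xs → Unique ys →
                (∀ a → w a ≢ 0ℤ → a ∈ xs) → (∀ a → w a ≢ 0ℤ → a ∈ ys) → ∑ xs w ≡ ∑ ys w
    ∑-covered {w} {xs} {ys} ux uy cx cy = begin
      ∑ xs w                            ≡⟨ ∑-cong xs (λ a _ → sym (spread uy cy a)) ⟩
      ∑ xs (λ a → ∑ ys (diagonal a))    ≡⟨ ∑-swap xs ys diagonal ⟩
      ∑ ys (λ b → ∑ xs (λ a → diagonal a b)) ≡⟨ ∑-cong ys (λ b _ → ∑-cong xs λ a _ → diagonal-sym a b) ⟩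
      ∑ ys (λ b → ∑ xs (diagonal b))    ≡⟨ ∑-cong ys (λ b _ → spread ux cx b) ⟩
      ∑ ys w                            ∎
      where
      open ≡-Reasoning
      diagonal : A → A → ℤ
      diagonal a b with a ≟ b
      ... | yes _ = w b
      ... | no  _ = 0ℤ
      diagonal-≡ : ∀ a → diagonal a a ≡ w a
      diagonal-≡ a with a ≟ a
      ... | yes _ = refl
      ... | no ¬p = ⊥-elim (¬p refl)
      diagonal-≢ : ∀ a b → b ≢ a → diagonal a b ≡ 0ℤ
      diagonal-≢ a b b≢a with a ≟ b
      ... | yes p = ⊥-elim (b≢a (sym p))
      ... | no _  = refl
      diagonal-sym : ∀ a b → diagonal a b ≡ diagonal b a
      diagonal-sym a b with b ≟ a
      ... | yes refl = diagonal-≡ a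
      ... | no b≢a   = diagonal-≢ a b b≢a
      diagonal-0 : ∀ a b → w a ≡ 0ℤ → diagonal a b ≡ 0ℤ
      diagonal-0 a b wa≡0 with a ≟ b
      ... | yes refl = wa≡0
      ... | no _     = refl
      spread : ∀ {zs} → Unique zs → (∀ a → w a ≢ 0ℤ → a ∈ zs) → ∀ a → ∑ zs (diagonal a) ≡ w a
      spread {zs} uz cz a with w a ℤ.≟ 0ℤ
      ... | yes wa≡0 = trans (∑-zero zs λ b _ → diagonal-0 a b wa≡0) (sym wa≡0)
      ... | no  wa≢0 = trans (∑-single uz (cz a wa≢0) λ b b≢a → diagonal-≢ a b b≢a) (diagonal-≡ a)

    HasSum-unique : ∀ {w : A → ℤ} {s t} → HasSum w s → HasSum w t → s ≡ t
    HasSum-unique p q =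
      trans (sym (total p)) (trans (∑-covered (unique p) (unique q) (covers p) (covers q)) (total q))

    HasSum-on : ∀ {w : A → ℤ} {s} zs → Unique zs → (∀ a → w a ≢ 0ℤ → a ∈ zs) → HasSum w s → ∑ zs w ≡ s
    HasSum-on zs uz cz p = trans (∑-covered uz (unique p) cz (covers p)) (total p)

    HasSum-box : ∀ {w : A → ℤ} n → (∀ a → w a ≢ 0ℤ → size a ℕ.≤ n) → HasSum w (∑ (box n) w)
    HasSum-box n h = hasSum (box n) (box-unique n) (λ a w≢0 → box-∈ n a (h a w≢0)) refl

    HasSum-+ : ∀ {u v : A → ℤ} {s t} → HasSum u s → HasSum v t → HasSum (λ a → u a + v a) (s + t)
    HasSum-+ {u} {v} p q = hasSum zs uz covers′
      (trans (∑-+ zs u v) (cong₂ _+_ (HasSum-on zs uz cu p) (HasSum-on zs uz cv q)))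
      where
      zs = deduplicate _≟_ (support p ++ support q)
      uz = DecUniqueₚ.deduplicate-! _≟_ (support p ++ support q)
      cu : ∀ a → u a ≢ 0ℤ → a ∈ zs
      cu a h = ∈-deduplicate⁺ _≟_ (∈-++⁺ˡ (covers p a h))
      cv : ∀ a → v a ≢ 0ℤ → a ∈ zs
      cv a h = ∈-deduplicate⁺ _≟_ (∈-++⁺ʳ (support p) (covers q a h))
      covers′ : ∀ a → u a + v a ≢ 0ℤ → a ∈ zs
      covers′ a h with u a ℤ.≟ 0ℤ
      ... | no  u≢0 = cu a u≢0
      ... | yes u≡0 = cv a λ v≡0 → h (cong₂ _+_ u≡0 v≡0)

  HasSum-cong : ∀ {u v : A → ℤ} {s} → (∀ a → u a ≡ v a) → HasSum u s → HasSum v s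
  HasSum-cong u≡v p = hasSum (support p) (unique p) (λ a v≢0 → covers p a (v≢0 ∘ trans (sym (u≡v a))))
    (trans (∑-cong (support p) λ a _ → sym (u≡v a)) (total p))

  HasSum-subst : ∀ {w : A → ℤ} {s t} → s ≡ t → HasSum w s → HasSum w t
  HasSum-subst refl p = p

  HasSum-0 : ∀ {w : A → ℤ} → (∀ a → w a ≡ 0ℤ) → HasSum w 0ℤ
  HasSum-0 w≡0 = hasSum [] [] (λ a w≢0 → ⊥-elim (w≢0 (w≡0 a))) refl

  HasSum-* : ∀ {w : A → ℤ} {s} c → HasSum w s → HasSum (λ a → c * w a) (c * s)
  HasSum-* {w = w} c p = hasSum (support p) (unique p)
    (λ a h → covers p a λ w≡0 → h (trans (cong (c *_) w≡0) (ℤₚ.*-zeroʳ c)))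
    (trans (∑-* (support p) c w) (cong (c *_) (total p)))

  HasSum-restrict : ∀ {w : A → ℤ} {s} (u : A → ℤ) → HasSum w s → ∃ λ t → HasSum (λ a → u a * w a) t
  HasSum-restrict u p = _ , hasSum (support p) (unique p)
    (λ a h → covers p a λ w≡0 → h (trans (cong (u a *_) w≡0) (ℤₚ.*-zeroʳ (u a)))) refl

  HasSum-neg : ∀ {w : A → ℤ} {s} → HasSum w s → HasSum (λ a → - w a) (- s)
  HasSum-neg {w = w} {s} p = HasSum-subst (ℤₚ.-1*i≡-i s) (HasSum-cong (λ a → ℤₚ.-1*i≡-i (w a)) (HasSum-* (- 1ℤ) p))

  HasSum-- : ∀ {{_ : Grid A}} {u v : A → ℤ} {s t} → HasSum u s → HasSum v t → HasSum (λ a → u a - v a) (s - t)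
  HasSum-- p q = HasSum-+ p (HasSum-neg q)

  -- The maps have to be mutually inverse only where the weights are nonzero. The substitutions used
  -- later divide by 2, 3 or 4 with rounding and are invertible only on the residue classes that
  -- carry weight.
  HasSum-reindex : ∀ {u : A → ℤ} {v : B → ℤ} {s} (f : A → B) (g : B → A) →
    (∀ a → u a ≢ 0ℤ → g (f a) ≡ a × v (f a) ≡ u a) →
    (∀ b → v b ≢ 0ℤ → f (g b) ≡ b × u (g b) ≡ v b) →
    HasSum u s → HasSum v s
  HasSum-reindex {A} {B} {u} {v} f g fwd bwd p = hasSum (map f xs) (mapped xs (λ a∈ → proj₂ (∈-filter⁻ nonzero? {xs = support p} a∈)) (Uniqueₚ.filter⁺ nonzero? (unique p)))
    (λ b h → let (fgb , ug) = bwd b h in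
             subst (_∈ map f xs) fgb (∈-map⁺ f (∈-filter⁺ nonzero? (covers p (g b) (h ∘ trans (sym ug))) (h ∘ trans (sym ug)))))
    (trans (∑-map f xs v) (trans (∑-cong xs λ a a∈ → proj₂ (fwd a (proj₂ (∈-filter⁻ nonzero? {xs = support p} a∈))))
      (trans (∑-nonzero (support p)) (total p))))
    where
    nonzero? : ∀ a → Dec (u a ≢ 0ℤ)
    nonzero? a with u a ℤ.≟ 0ℤ
    ... | yes p = no λ ¬p → ¬p p
    ... | no ¬p = yes ¬p
    xs : List A
    xs = filter nonzero? (support p)
    mapped : ∀ zs → (∀ {a} → a ∈ zs → u a ≢ 0ℤ) → Unique zs → Unique (map f zs)
    mapped []       h uz        = []
    mapped (z ∷ zs) h (z∉ ∷ uz) = All.tabulate distinct ∷ mapped zs (h ∘ there) uz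
      where
      distinct : ∀ {b} → b ∈ map f zs → f z ≢ b
      distinct b∈ fz≡b with ∈-map⁻ f b∈
      ... | a , a∈ , refl = All.lookup z∉ a∈
        (trans (sym (proj₁ (fwd z (h (here refl))))) (trans (cong g fz≡b) (proj₁ (fwd a (h (there a∈))))))
    ∑-nonzero : ∀ zs → ∑ (filter nonzero? zs) u ≡ ∑ zs u
    ∑-nonzero []       = refl
    ∑-nonzero (z ∷ zs) with u z ℤ.≟ 0ℤ
    ... | yes p = trans (∑-nonzero zs) (trans (sym (ℤₚ.+-identityˡ _)) (cong (_+ ∑ zs u) (sym p)))
    ... | no _  = cong (λ rest → u z + rest) (∑-nonzero zs)

  HasSum-bijection : ∀ {w : A → ℤ} {s} (f : B → A) (g : A → B) → (∀ b → g (f b) ≡ b) → (∀ a → f (g a) ≡ a) →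
    HasSum w s → HasSum (w ∘ f) s
  HasSum-bijection {w = w} f g gf fg = HasSum-reindex g f
    (λ a _ → fg a , cong w (fg a)) (λ b _ → gf b , refl)

  HasSum-antisymmetric : ∀ {{_ : Grid A}} {w : A → ℤ} {s} (f : A → A) → (∀ a → f (f a) ≡ a) → (∀ a → w (f a) ≡ - w a) →
    HasSum w s → s ≡ 0ℤ
  HasSum-antisymmetric {w = w} {s} f ff anti p = double s (HasSum-unique (HasSum-cong anti (HasSum-bijection f f ff ff p)) (HasSum-neg p))
    where
    double : ∀ s → s ≡ - s → s ≡ 0ℤ
    double (+ zero) _ = refl
    double (+ suc n) ()
    double -[1+ n ] ()

  module _ {{_ : Grid A}} {{_ : Grid B}} where

    HasSum-fubini : ∀ {w : A × B → ℤ} {t : A → ℤ} {s} → HasSum w s → (∀ a → HasSum (λ b → w (a , b)) (t a)) → HasSum t s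
    HasSum-fubini {w} {t} {s} p q = hasSum xs ux covers′ (trans (sym sums) (HasSum-on _ (Uniqueₚ.cartesianProduct⁺ ux uy)
        (λ (a , b) h → ∈-cartesianProduct⁺ (∈-deduplicate⁺ _≟_ (∈-map⁺ proj₁ (covers p _ h))) (∈-deduplicate⁺ _≟_ (∈-map⁺ proj₂ (covers p _ h)))) p))
      where
      xs : List A
      xs = deduplicate _≟_ (map proj₁ (support p))
      ux = DecUniqueₚ.deduplicate-! _≟_ (map proj₁ (support p))
      ys : List B
      ys = deduplicate _≟_ (map proj₂ (support p))
      uy = DecUniqueₚ.deduplicate-! _≟_ (map proj₂ (support p))
      inner : ∀ a → ∑ ys (λ b → w (a , b)) ≡ t a
      inner a = HasSum-on ys uy (λ b h → ∈-deduplicate⁺ _≟_ (∈-map⁺ proj₂ (covers p (a , b) h))) (q a)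
      sums : ∑ (cartesianProduct xs ys) w ≡ ∑ xs t
      sums = trans (∑-cartesianProduct xs ys w) (∑-cong xs λ a _ → inner a)
      covers′ : ∀ a → t a ≢ 0ℤ → a ∈ xs
      covers′ a h with any? (a ≟_) xs
      ... | yes a∈ = a∈
      ... | no  a∉ = ⊥-elim (h (trans (sym (inner a)) (∑-zero ys λ b _ → vanish b)))
        where
        vanish : ∀ b → w (a , b) ≡ 0ℤ
        vanish b with w (a , b) ℤ.≟ 0ℤ
        ... | yes e = e
        ... | no ne = ⊥-elim (a∉ (∈-deduplicate⁺ _≟_ (∈-map⁺ proj₁ (covers p (a , b) ne))))

    -- Finite fibres do not bound the base, hence the finitely supported `u` that is nonzero
    -- wherever `w` is. The support is the product of that base with the union of the fibre supports
    -- over it.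
    HasSum-Σ : ∀ {u : A → ℤ} {w : A × B → ℤ} {t : A → ℤ} {s₀} → HasSum u s₀ → (∀ a b → w (a , b) ≢ 0ℤ → u a ≢ 0ℤ) →
      (∀ a → HasSum (λ b → w (a , b)) (t a)) → ∃ λ s → HasSum w s
    HasSum-Σ {u} {w} {t} p h q = _ , hasSum (cartesianProduct (support p) ys) (Uniqueₚ.cartesianProduct⁺ (unique p) uy) covers′ refl
      where
      ys : List B
      ys = deduplicate _≟_ (concatMap (λ a → support (q a)) (support p))
      uy = DecUniqueₚ.deduplicate-! _≟_ (concatMap (λ a → support (q a)) (support p))
      member : ∀ {a b} xs → a ∈ xs → b ∈ support (q a) → b ∈ concatMap (λ a → support (q a)) xs
      member (x ∷ xs) (here refl) b∈ = ∈-++⁺ˡ b∈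
      member (x ∷ xs) (there a∈)  b∈ = ∈-++⁺ʳ (support (q x)) (member xs a∈ b∈)
      covers′ : ∀ ab → w ab ≢ 0ℤ → ab ∈ cartesianProduct (support p) ys
      covers′ (a , b) w≢0 = ∈-cartesianProduct⁺ (covers p a (h a b w≢0))
        (∈-deduplicate⁺ _≟_ (member (support p) (covers p a (h a b w≢0)) (covers (q a) b w≢0)))

-- Indicator functions, congruences and finite verification of periodic identities.

module Congruences where

  open FiniteSums
  open import Data.Empty using (⊥-elim)
  open import Data.Fin using (Fin; zero; suc; toℕ; fromℕ<)
  import Data.Fin.Properties as Finₚ
  open import Data.Nat as ℕ using (ℕ; zero; suc; z≤n; s≤s)
  import Data.Nat.Properties as ℕₚ
  open import Data.Integer as ℤ using (ℤ; +_; +0; +[1+_]; -[1+_]; _+_; _*_; _-_; -_; ∣_∣; 0ℤ; 1ℤ; _≤_; _<_)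
  import Data.Integer.Properties as ℤₚ
  open import Data.Integer.DivMod using (_/ℕ_; n%ℕd<d; a≡a%ℕn+[a/ℕn]*n)
  open import Data.Integer.Tactic.RingSolver using (solve-∀)
  open import Function using (_∘_)
  open import Relation.Nullary using (yes; no)
  open import Relation.Nullary.Decidable using (True; toWitness)
  open import Relation.Binary.PropositionalEquality

  δ : ℤ → ℤ
  δ +0       = 1ℤ
  δ +[1+ _ ] = 0ℤ
  δ -[1+ _ ] = 0ℤ

  pos : ℤ → ℤ
  pos +0       = 0ℤ
  pos +[1+ _ ] = 1ℤ
  pos -[1+ _ ] = 0ℤ

  sgn : ℤ → ℤ
  sgn z = pos z - pos (- z)

  δ≢0 : ∀ z → δ z ≢ 0ℤ → z ≡ 0ℤ
  δ≢0 +0       _ = refl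
  δ≢0 +[1+ _ ] h = ⊥-elim (h refl)
  δ≢0 -[1+ _ ] h = ⊥-elim (h refl)

  δ-≢ : ∀ {z} → z ≢ 0ℤ → δ z ≡ 0ℤ
  δ-≢ {+0}       h = ⊥-elim (h refl)
  δ-≢ {+[1+ _ ]} _ = refl
  δ-≢ { -[1+ _ ]} _ = refl

  δ-≡ : ∀ {z} → z ≡ 0ℤ → δ z ≡ 1ℤ
  δ-≡ refl = refl

  δ-cong : ∀ {y z} → (y ≡ 0ℤ → z ≡ 0ℤ) → (z ≡ 0ℤ → y ≡ 0ℤ) → δ y ≡ δ z
  δ-cong {y} {z} f g with y ℤ.≟ 0ℤ
  ... | yes refl = sym (δ-≡ (f refl))
  ... | no y≢0   = trans (δ-≢ y≢0) (sym (δ-≢ (y≢0 ∘ g)))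

  δ-neg : ∀ z → δ (- z) ≡ δ z
  δ-neg +0       = refl
  δ-neg +[1+ _ ] = refl
  δ-neg -[1+ _ ] = refl

  δ-* : ∀ c z .{{_ : ℤ.NonZero c}} → δ (c * z) ≡ δ z
  δ-* c z = δ-cong (λ p → ℤₚ.*-cancelˡ-≡ c z 0ℤ (trans p (sym (ℤₚ.*-zeroʳ c)))) (λ { refl → ℤₚ.*-zeroʳ c })

  -- Transfers to weighted sums an identity that holds only on the solutions of `e ≡ 0ℤ`: away from
  -- them the factor `δ e` annihilates both sides.
  guard : ∀ {u v} e → (e ≡ 0ℤ → u ≡ v) → u * δ e ≡ v * δ e
  guard {u} {v} e h with e ℤ.≟ 0ℤ
  ... | yes p = cong (_* δ e) (h p)
  ... | no ¬p = trans (cong (u *_) (δ-≢ ¬p)) (trans (ℤₚ.*-zeroʳ u) (sym (trans (cong (v *_) (δ-≢ ¬p)) (ℤₚ.*-zeroʳ v))))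

  *≢0ˡ : ∀ {u v} → u * v ≢ 0ℤ → u ≢ 0ℤ
  *≢0ˡ {_} {v} h refl = h (ℤₚ.*-zeroˡ v)

  *≢0ʳ : ∀ {u v} → u * v ≢ 0ℤ → v ≢ 0ℤ
  *≢0ʳ {u} {_} h refl = h (ℤₚ.*-zeroʳ u)

  pos≢0 : ∀ {z} → pos z ≢ 0ℤ → 0ℤ < z
  pos≢0 {+0}       h = ⊥-elim (h refl)
  pos≢0 {+[1+ _ ]} _ = ℤ.+<+ (s≤s z≤n)
  pos≢0 { -[1+ _ ]} h = ⊥-elim (h refl)

  pos-> : ∀ {z} → 0ℤ < z → pos z ≡ 1ℤ
  pos-> {+[1+ _ ]} _ = refl
  pos-> {+0} (ℤ.+<+ ())

  square-ℕ : ∀ z → z * z ≡ + (∣ z ∣ ℕ.* ∣ z ∣)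
  square-ℕ (+ n)    = sym (ℤₚ.pos-* n n)
  square-ℕ -[1+ n ] = refl

  n≤n*n : ∀ n → n ℕ.≤ n ℕ.* n
  n≤n*n zero    = z≤n
  n≤n*n (suc n) = ℕₚ.m≤m*n (suc n) (suc n)

  infix 4 _≈_[_]

  -- The quotient is kept as data and the equation is additive, so that congruences combine through
  -- ring identities in the quotients.
  record _≈_[_] (y z : ℤ) (m : ℕ) : Set where
    constructor by
    field
      factor   : ℤ
      equation : y ≡ z + factor * + m

  open _≈_[_] public

  module _ {m : ℕ} where

    ≈-refl : ∀ {z} → z ≈ z [ m ]
    ≈-refl {z} = by 0ℤ (sym (trans (cong (λ w → z + w) (ℤₚ.*-zeroˡ (+ m))) (ℤₚ.+-identityʳ z)))

    ≈-sym : ∀ {y z} → y ≈ z [ m ] → z ≈ y [ m ]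
    ≈-sym {y} {z} (by q eq) = by (- q) (trans (l z q (+ m)) (cong (λ w → w + - q * + m) (sym eq)))
      where
      l : ∀ z q m → z ≡ z + q * m + - q * m
      l = solve-∀

    ≈-trans : ∀ {x y z} → x ≈ y [ m ] → y ≈ z [ m ] → x ≈ z [ m ]
    ≈-trans {z = z} (by q refl) (by q′ refl) = by (q + q′) (l z q q′ (+ m))
      where
      l : ∀ z q q′ m → z + q′ * m + q * m ≡ z + (q + q′) * m
      l = solve-∀

    ≈-+ : ∀ {y y′ z z′} → y ≈ y′ [ m ] → z ≈ z′ [ m ] → (y + z) ≈ (y′ + z′) [ m ]
    ≈-+ {y′ = y′} {z′ = z′} (by q refl) (by r refl) = by (q + r) (l y′ z′ q r (+ m))
      where
      l : ∀ a b c d m → a + c * m + (b + d * m) ≡ a + b + (c + d) * m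
      l = solve-∀

    ≈-* : ∀ {y y′ z z′} → y ≈ y′ [ m ] → z ≈ z′ [ m ] → (y * z) ≈ (y′ * z′) [ m ]
    ≈-* {y′ = y′} {z′ = z′} (by q refl) (by r refl) = by (y′ * r + q * z′ + q * r * + m) (l y′ z′ q r (+ m))
      where
      l : ∀ a b c d m → (a + c * m) * (b + d * m) ≡ a * b + (a * d + c * b + c * d * m) * m
      l = solve-∀

    ≈-neg : ∀ {y y′} → y ≈ y′ [ m ] → (- y) ≈ (- y′) [ m ]
    ≈-neg {y′ = y′} (by q refl) = by (- q) (l y′ q (+ m))
      where
      l : ∀ a c m → - (a + c * m) ≡ - a + - c * m
      l = solve-∀

    ≈-- : ∀ {y y′ z z′} → y ≈ y′ [ m ] → z ≈ z′ [ m ] → (y - z) ≈ (y′ - z′) [ m ]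
    ≈-- p q = ≈-+ p (≈-neg q)

  rep : ∀ {m} → Fin m → ℤ
  rep i = + toℕ i

  module _ (m : ℕ) .{{_ : ℕ.NonZero m}} where

    res : ℤ → Fin m
    res z = fromℕ< (n%ℕd<d z m)

    rep-res : ∀ z → z ≈ rep (res z) [ m ]
    rep-res z = by (z /ℕ m) (trans (a≡a%ℕn+[a/ℕn]*n z m)
      (cong (λ r → + r + (z /ℕ m) * + m) (sym (Finₚ.toℕ-fromℕ< (n%ℕd<d z m)))))

  private
    too-big : ∀ {m r} r′ k → r ℕ.< m → + r ≢ + r′ + +[1+ k ] * + m
    too-big {m} {r} r′ k r<m eq = ℕₚ.<⇒≱ r<m (ℕₚ.≤-trans (ℕₚ.m≤m+n m (k ℕ.* m)) (ℕₚ.≤-trans (ℕₚ.m≤n+m _ r′)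
      (ℕₚ.≤-reflexive (sym (ℤₚ.+-injective (trans eq (cong (λ z → + r′ + z) (sym (ℤₚ.pos-* (suc k) m)))))))))

  small-≈ : ∀ {m r r′} → r ℕ.< m → r′ ℕ.< m → (+ r) ≈ (+ r′) [ m ] → r ≡ r′
  small-≈ {m} {r} {r′} _ _ (by +0 eq) = ℤₚ.+-injective (trans eq (trans (cong (λ z → + r′ + z) (ℤₚ.*-zeroˡ (+ m))) (ℤₚ.+-identityʳ _)))
  small-≈ r<m _ (by +[1+ k ] eq) = ⊥-elim (too-big _ k r<m eq)
  small-≈ _ r′<m p@(by -[1+ k ] eq) = ⊥-elim (too-big _ k r′<m (equation (≈-sym p)))

  module _ {m : ℕ} .{{_ : ℕ.NonZero m}} where

    ≈⇒res : ∀ {y z} → y ≈ z [ m ] → res m y ≡ res m z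
    ≈⇒res {y} {z} p = Finₚ.toℕ-injective (small-≈ (Finₚ.toℕ<n (res m y)) (Finₚ.toℕ<n (res m z))
      (≈-trans (≈-sym (rep-res m y)) (≈-trans p (rep-res m z))))

    res⇒≈ : ∀ {y z} → res m y ≡ res m z → y ≈ z [ m ]
    res⇒≈ {y} {z} p = ≈-trans (subst (λ r → y ≈ rep r [ m ]) p (rep-res m y)) (≈-sym (rep-res m z))

  Periodic : ℕ → (ℤ → ℤ) → Set
  Periodic m f = ∀ {y z} → y ≈ z [ m ] → f y ≡ f z

  tab₃ : ℤ → ℤ → ℤ → ℤ → ℤ
  tab₃ a b c z = entry (res 3 z)
    where
    entry : Fin 3 → ℤ
    entry zero             = a
    entry (suc zero)       = b
    entry (suc (suc zero)) = c

  tab₄ : ℤ → ℤ → ℤ → ℤ → ℤ → ℤ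
  tab₄ a b c d z = entry (res 4 z)
    where
    entry : Fin 4 → ℤ
    entry zero                   = a
    entry (suc zero)             = b
    entry (suc (suc zero))       = c
    entry (suc (suc (suc zero))) = d

  tab₃-periodic : ∀ a b c → Periodic 3 (tab₃ a b c)
  tab₃-periodic a b c p rewrite ≈⇒res p = refl

  tab₄-periodic : ∀ a b c d → Periodic 4 (tab₄ a b c d)
  tab₄-periodic a b c d p rewrite ≈⇒res p = refl

  check₁ : ∀ {m} {f g : Fin m → ℤ} → {True (Finₚ.all? λ i → f i ℤ.≟ g i)} → ∀ i → f i ≡ g i
  check₁ {_} {_} {_} {t} = toWitness t

  check₂ : ∀ {m n} {f g : Fin m → Fin n → ℤ} → {True (Finₚ.all? λ i → Finₚ.all? λ j → f i j ℤ.≟ g i j)} → ∀ i j → f i j ≡ g i j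
  check₂ {_} {_} {_} {_} {t} = toWitness t

  check₃ : ∀ {m n o} {f g : Fin m → Fin n → Fin o → ℤ} →
    {True (Finₚ.all? λ i → Finₚ.all? λ j → Finₚ.all? λ k → f i j k ℤ.≟ g i j k)} → ∀ i j k → f i j k ≡ g i j k
  check₃ {_} {_} {_} {_} {_} {t} = toWitness t

  χ₃ χ₄ : ℤ → ℤ
  χ₃ = tab₃ 0ℤ 1ℤ (- 1ℤ)
  χ₄ = tab₄ 0ℤ 1ℤ 0ℤ (- 1ℤ)

  χ₃-periodic : Periodic 3 χ₃
  χ₃-periodic = tab₃-periodic 0ℤ 1ℤ (- 1ℤ)

  χ₄-periodic : Periodic 4 χ₄
  χ₄-periodic = tab₄-periodic 0ℤ 1ℤ 0ℤ (- 1ℤ)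

  module _ {m n : ℕ} .{{_ : ℕ.NonZero m}} .{{_ : ℕ.NonZero n}} where

    Periodic₂ : (ℤ → ℤ → ℤ) → Set
    Periodic₂ F = ∀ {x x′ y y′} → x ≈ x′ [ m ] → y ≈ y′ [ n ] → F x y ≡ F x′ y′

    -- Reduces an identity of periodic functions to finitely many residues, where the decision
    -- procedure behind `check₂` settles it by evaluation.
    by-residues₂ : ∀ {F G : ℤ → ℤ → ℤ} → Periodic₂ F → Periodic₂ G →
      (∀ (i : Fin m) (j : Fin n) → F (rep i) (rep j) ≡ G (rep i) (rep j)) → ∀ x y → F x y ≡ G x y
    by-residues₂ pF pG table x y = trans (pF (rep-res m x) (rep-res n y))
      (trans (table (res m x) (res n y)) (sym (pG (rep-res m x) (rep-res n y))))

  by-residues : ∀ {m} .{{_ : ℕ.NonZero m}} {f g : ℤ → ℤ} → Periodic m f → Periodic m g →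
    (∀ (i : Fin m) → f (rep i) ≡ g (rep i)) → ∀ x → f x ≡ g x
  by-residues {m} pf pg table x = trans (pf (rep-res m x)) (trans (table (res m x)) (sym (pg (rep-res m x))))

  χ₃-* : ∀ x y → χ₃ (x * y) ≡ χ₃ x * χ₃ y
  χ₃-* = by-residues₂ (λ p q → χ₃-periodic (≈-* p q)) (λ p q → cong₂ _*_ (χ₃-periodic p) (χ₃-periodic q)) check₂

  χ₄-* : ∀ x y → χ₄ (x * y) ≡ χ₄ x * χ₄ y
  χ₄-* = by-residues₂ (λ p q → χ₄-periodic (≈-* p q)) (λ p q → cong₂ _*_ (χ₄-periodic p) (χ₄-periodic q)) check₂

-- Liouville's identity for sums over `a x + b y = N`.

module LiouvilleIdentity where

  open FiniteSums
  open Congruences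
  open import Data.Empty using (⊥-elim)
  open import Data.Fin using (suc)
  open import Data.Nat as ℕ using (ℕ; suc)
  import Data.Nat.Properties as ℕₚ
  open import Data.Integer as ℤ using (ℤ; +_; +0; +[1+_]; -[1+_]; _+_; _*_; _-_; -_; ∣_∣; 0ℤ; 1ℤ; _≤_)
  import Data.Integer.Properties as ℤₚ
  open import Data.Integer.Tactic.RingSolver using (solve-∀)
  open import Data.Product using (∃; _×_; _,_)
  open import Function using (_∘_)
  open import Relation.Nullary using (¬_; yes; no)
  open import Relation.Binary.PropositionalEquality

  -- The sign of a point of the quadrants in which both coordinates have the same sign.
  c : ℤ → ℤ → ℤ
  c a x = pos a * pos x - pos (- a) * pos (- x)

  -- The part of `sgn a + sgn x` carried by the coordinate axes: off the axes the sum is `2 c`, on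
  -- an axis it is the sign of the other coordinate.
  h : ℤ → ℤ → ℤ
  h a x = δ a * sgn x + δ x * sgn a

  2c+h : ∀ a x → + 2 * c a x + h a x ≡ sgn a + sgn x
  2c+h +0       +0       = refl
  2c+h +0       +[1+ _ ] = refl
  2c+h +0       -[1+ _ ] = refl
  2c+h +[1+ _ ] +0       = refl
  2c+h +[1+ _ ] +[1+ _ ] = refl
  2c+h +[1+ _ ] -[1+ _ ] = refl
  2c+h -[1+ _ ] +0       = refl
  2c+h -[1+ _ ] +[1+ _ ] = refl
  2c+h -[1+ _ ] -[1+ _ ] = refl

  sgn-neg : ∀ z → sgn (- z) ≡ - sgn z
  sgn-neg +0       = refl
  sgn-neg +[1+ _ ] = refl
  sgn-neg -[1+ _ ] = refl

  -- For equal nonzero signs the first product is 1 and the second vanishes. Otherwise `a - b` has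
  -- the sign of `sgn a - sgn b`, so the second term is 2 against -1 for opposite signs, and 1
  -- against 0 if one of the numbers is zero.
  sgn-difference : ∀ a b → ¬ (a ≡ 0ℤ × b ≡ 0ℤ) → sgn a * sgn b + sgn (a - b) * (sgn a - sgn b) ≡ 1ℤ
  sgn-difference +0       +0       ≢0 = ⊥-elim (≢0 (refl , refl))
  sgn-difference +0       +[1+ _ ] _  = refl
  sgn-difference +0       -[1+ _ ] _  = refl
  sgn-difference +[1+ _ ] +0       _  = refl
  sgn-difference a@(+[1+ _ ]) b@(+[1+ _ ]) _ = cong (λ z → 1ℤ + z) (ℤₚ.*-zeroʳ (sgn (a - b)))
  sgn-difference +[1+ _ ] -[1+ _ ] _  = refl
  sgn-difference -[1+ _ ] +0       _  = refl
  sgn-difference -[1+ _ ] +[1+ _ ] _  = refl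
  sgn-difference a@(-[1+ _ ]) b@(-[1+ _ ]) _ = cong (λ z → 1ℤ + z) (ℤₚ.*-zeroʳ (sgn (a - b)))

  sgn-sum : ∀ x y → ¬ (x ≡ 0ℤ × y ≡ 0ℤ) → sgn x * sgn y - sgn (x + y) * (sgn x + sgn y) ≡ - 1ℤ
  sgn-sum x y ≢0 = trans (l (sgn x) (sgn y) (sgn (x + y)))
    (cong -_ (trans (cong₂ (λ u v → sgn x * u + sgn (x + v) * (sgn x - u)) (sym (sgn-neg y)) (sym (ℤₚ.neg-involutive y)))
      (sgn-difference x (- y) λ (p , q) → ≢0 (p , trans (sym (ℤₚ.neg-involutive y)) (cong -_ q)))))
    where
    l : ∀ a b d → a * b - d * (a + b) ≡ - (a * - b + d * (a - - b))
    l = solve-∀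

  c≢0 : ∀ a x → c a x ≢ 0ℤ → ∃ λ m → ∃ λ n → ∣ a ∣ ≡ suc m × ∣ x ∣ ≡ suc n × a * x ≡ + (suc m ℕ.* suc n)
  c≢0 +0       _        h = ⊥-elim (h refl)
  c≢0 +[1+ m ] +0       h = ⊥-elim (h refl)
  c≢0 +[1+ m ] +[1+ n ] _ = m , n , refl , refl , refl
  c≢0 +[1+ m ] -[1+ _ ] h = ⊥-elim (h refl)
  c≢0 -[1+ m ] +0       h = ⊥-elim (h refl)
  c≢0 -[1+ m ] +[1+ _ ] h = ⊥-elim (h refl)
  c≢0 -[1+ m ] -[1+ n ] _ = m , n , refl , refl , refl

  c-sym : ∀ a x → c a x ≡ c x a
  c-sym a x = cong₂ _-_ (ℤₚ.*-comm (pos a) (pos x)) (ℤₚ.*-comm (pos (- a)) (pos (- x)))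

  c-neg : ∀ a x → c (- a) (- x) ≡ - c a x
  c-neg a x = trans (cong₂ (λ u v → pos (- a) * pos (- x) - pos u * pos v) (ℤₚ.neg-involutive a) (ℤₚ.neg-involutive x))
    (l (pos a * pos x) (pos (- a) * pos (- x)))
    where
    l : ∀ u v → v - u ≡ - (u - v)
    l = solve-∀

  Quad : Set
  Quad = ℤ × ℤ × ℤ × ℤ


  module Convolution (N : ℕ) where

    eqn : Quad → ℤ
    eqn (a , b , x , y) = a * x + b * y - + N

    -- A signed count of solutions in which `a`, `x` agree in sign and `b`, `y` agree in sign. Both
    -- products are then positive, which bounds all four variables by `N`, and negating one pair
    -- changes the sign of the weight.
    ω₀ ω : Quad → ℤ
    ω₀ (a , b , x , y) = c a x * c b y
    ω v = ω₀ v * δ (eqn v)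

    eqn-≡ : ∀ a b x y → eqn (a , b , x , y) ≡ 0ℤ → a * x + b * y ≡ + N
    eqn-≡ a b x y p = ℤₚ.i-j≡0⇒i≡j _ _ p

    ω-bounded : ∀ v → ω v ≢ 0ℤ → size v ℕ.≤ N
    ω-bounded v@(a , b , x , y) ω≢0 with c≢0 a x (*≢0ˡ {_} {c b y} (*≢0ˡ {_} {δ (eqn v)} ω≢0)) | c≢0 b y (*≢0ʳ {c a x} (*≢0ˡ {_} {δ (eqn v)} ω≢0))
    ... | m , n , am , xn , ax | k , l , bk , yl , by′ = ℕₚ.⊔-lub (ℕₚ.≤-trans (ℕₚ.≤-reflexive am) (ℕₚ.≤-trans (ℕₚ.m≤m*n (suc m) (suc n)) le₁))
        (ℕₚ.⊔-lub (ℕₚ.≤-trans (ℕₚ.≤-reflexive bk) (ℕₚ.≤-trans (ℕₚ.m≤m*n (suc k) (suc l)) le₂))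
          (ℕₚ.⊔-lub (ℕₚ.≤-trans (ℕₚ.≤-reflexive xn) (ℕₚ.≤-trans (ℕₚ.m≤n*m (suc n) (suc m)) le₁))
                    (ℕₚ.≤-trans (ℕₚ.≤-reflexive yl) (ℕₚ.≤-trans (ℕₚ.m≤n*m (suc l) (suc k)) le₂))))
      where
      total-≡ : suc m ℕ.* suc n ℕ.+ suc k ℕ.* suc l ≡ N
      total-≡ = ℤₚ.+-injective (trans (sym (cong₂ _+_ ax by′)) (eqn-≡ a b x y (δ≢0 (eqn v) (*≢0ʳ {ω₀ v} ω≢0))))
      le₁ : suc m ℕ.* suc n ℕ.≤ N
      le₁ = ℕₚ.≤-trans (ℕₚ.m≤m+n (suc m ℕ.* suc n) (suc k ℕ.* suc l)) (ℕₚ.≤-reflexive total-≡)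
      le₂ : suc k ℕ.* suc l ℕ.≤ N
      le₂ = ℕₚ.≤-trans (ℕₚ.m≤n+m (suc k ℕ.* suc l) (suc m ℕ.* suc n)) (ℕₚ.≤-reflexive total-≡)

    abstract
      ⟨_⟩ : (Quad → ℤ) → ℤ
      ⟨ F ⟩ = ∑ (box N) (λ v → F v * ω v)

      ⟨⟩-HasSum : ∀ F → HasSum (λ v → F v * ω v) ⟨ F ⟩
      ⟨⟩-HasSum F = HasSum-box N λ v h → ω-bounded v (*≢0ʳ {F v} h)

    ⟨⟩-cong : ∀ {F G} → (∀ a b x y → a * x + b * y ≡ + N → F (a , b , x , y) ≡ G (a , b , x , y)) → ⟨ F ⟩ ≡ ⟨ G ⟩
    ⟨⟩-cong {F} {G} F≡G = HasSum-unique (HasSum-cong pointwise (⟨⟩-HasSum F)) (⟨⟩-HasSum G)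
      where
      pointwise : ∀ v → F v * ω v ≡ G v * ω v
      pointwise v@(a , b , x , y) = trans (sym (ℤₚ.*-assoc (F v) (ω₀ v) _))
        (trans (guard (eqn v) λ p → cong (_* ω₀ v) (F≡G a b x y (eqn-≡ a b x y p))) (ℤₚ.*-assoc (G v) (ω₀ v) _))

    ⟨⟩-+ : ∀ F G → ⟨ (λ v → F v + G v) ⟩ ≡ ⟨ F ⟩ + ⟨ G ⟩
    ⟨⟩-+ F G = HasSum-unique (⟨⟩-HasSum (λ v → F v + G v))
      (HasSum-cong (λ v → sym (ℤₚ.*-distribʳ-+ (ω v) (F v) (G v))) (HasSum-+ (⟨⟩-HasSum F) (⟨⟩-HasSum G)))

    ⟨⟩-* : ∀ k F → ⟨ (λ v → k * F v) ⟩ ≡ k * ⟨ F ⟩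
    ⟨⟩-* k F = HasSum-unique (⟨⟩-HasSum (λ v → k * F v))
      (HasSum-cong (λ v → sym (ℤₚ.*-assoc k (F v) (ω v))) (HasSum-* k (⟨⟩-HasSum F)))

    module _ (f g : Quad → Quad) (gf : ∀ v → g (f v) ≡ v) (fg : ∀ v → f (g v) ≡ v) where

      ⟨⟩-invariant : (∀ v → ω (f v) ≡ ω v) → ∀ F → ⟨ F ∘ f ⟩ ≡ ⟨ F ⟩
      ⟨⟩-invariant ωf F = HasSum-unique (⟨⟩-HasSum (F ∘ f))
        (HasSum-cong (λ v → cong (F (f v) *_) (ωf v)) (HasSum-bijection f g gf fg (⟨⟩-HasSum F)))

      ⟨⟩-anti-invariant : (∀ v → ω (f v) ≡ - ω v) → ∀ F → ⟨ F ∘ f ⟩ ≡ - ⟨ F ⟩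
      ⟨⟩-anti-invariant ωf F = HasSum-unique (⟨⟩-HasSum (F ∘ f))
        (HasSum-cong (λ v → l (F (f v)) (ω v)) (HasSum-neg (HasSum-cong (λ v → cong (F (f v) *_) (ωf v)) (HasSum-bijection f g gf fg (⟨⟩-HasSum F)))))
        where
        l : ∀ u w → - (u * - w) ≡ u * w
        l = solve-∀

    swap transpose transpose₁ transpose₂ negate₁ negate₂ : Quad → Quad
    swap (a , b , x , y) = b , a , y , x
    transpose (a , b , x , y) = x , y , a , b
    transpose₁ (a , b , x , y) = x , b , a , y
    transpose₂ (a , b , x , y) = a , y , x , b
    negate₁ (a , b , x , y) = - a , b , - x , y
    negate₂ (a , b , x , y) = a , - b , x , - y

    ⟨⟩-swap : ∀ F → ⟨ F ∘ swap ⟩ ≡ ⟨ F ⟩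
    ⟨⟩-swap = ⟨⟩-invariant swap swap (λ _ → refl) (λ _ → refl) λ (a , b , x , y) →
      cong₂ _*_ (ℤₚ.*-comm (c b y) (c a x)) (cong (λ z → δ (z - + N)) (ℤₚ.+-comm (b * y) (a * x)))

    ⟨⟩-transpose₁ : ∀ F → ⟨ F ∘ transpose₁ ⟩ ≡ ⟨ F ⟩
    ⟨⟩-transpose₁ = ⟨⟩-invariant transpose₁ transpose₁ (λ _ → refl) (λ _ → refl) λ (a , b , x , y) →
      cong₂ _*_ (cong (_* c b y) (c-sym x a)) (cong (λ z → δ (z + b * y - + N)) (ℤₚ.*-comm x a))

    ⟨⟩-transpose₂ : ∀ F → ⟨ F ∘ transpose₂ ⟩ ≡ ⟨ F ⟩
    ⟨⟩-transpose₂ = ⟨⟩-invariant transpose₂ transpose₂ (λ _ → refl) (λ _ → refl) λ (a , b , x , y) →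
      cong₂ _*_ (cong (c a x *_) (c-sym y b)) (cong (λ z → δ (a * x + z - + N)) (ℤₚ.*-comm y b))

    ⟨⟩-transpose : ∀ F → ⟨ F ∘ transpose ⟩ ≡ ⟨ F ⟩
    ⟨⟩-transpose F = trans (⟨⟩-transpose₂ (F ∘ transpose₁)) (⟨⟩-transpose₁ F)

    ⟨⟩-negate₁ : ∀ F → ⟨ F ∘ negate₁ ⟩ ≡ - ⟨ F ⟩
    ⟨⟩-negate₁ = ⟨⟩-anti-invariant negate₁ negate₁ involutive involutive λ (a , b , x , y) →
      trans (cong₂ _*_ (cong (_* c b y) (c-neg a x)) (cong (λ z → δ (z + b * y - + N)) (l₁ a x))) (l₂ (c a x) (c b y) (δ (a * x + b * y - + N)))
      where
      involutive : ∀ v → negate₁ (negate₁ v) ≡ v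
      involutive (a , b , x , y) = cong₂ (λ u w → u , b , w , y) (ℤₚ.neg-involutive a) (ℤₚ.neg-involutive x)
      l₁ : ∀ a x → - a * - x ≡ a * x
      l₁ = solve-∀
      l₂ : ∀ p q r → - p * q * r ≡ - (p * q * r)
      l₂ = solve-∀

    self-negative : ∀ z → z ≡ - z → z ≡ 0ℤ
    self-negative +0 _ = refl

    -- Negating the pair `(a , x)` preserves the equation and reverses the sign of the weight.
    ⟨⟩-even₁ : ∀ F → (∀ v → F (negate₁ v) ≡ F v) → ⟨ F ⟩ ≡ 0ℤ
    ⟨⟩-even₁ F e = self-negative _ (trans (⟨⟩-cong λ a b x y _ → sym (e (a , b , x , y))) (⟨⟩-negate₁ F))

    -- `A₁` and `A₂` are the two substitutions in the relation satisfied by `σ`, and `M₁`, `M₂` are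
    -- their inverses. All four preserve `a x + b y`.
    M₁ M₂ A₁ A₂ : Quad → Quad
    M₁ (a , b , x , y) = a , a + b , x - y , y
    M₂ (a , b , x , y) = a + b , a , y , x - y
    A₁ (a , b , x , y) = a , b - a , x + y , y
    A₂ (a , b , x , y) = b , a - b , x + y , x

    -- The mixed terms of the product of the sums `2 c + h` of the two pairs. They live on
    -- coordinate hyperplanes, where the equation loses a variable.
    K : Quad → ℤ
    K (a , b , x , y) = c a x * h b y + c b y * h a x

    boundary : Quad → ℤ
    boundary v = K (A₁ v) + K (A₂ v) - K v

    eqn-A₁ : ∀ v → eqn (A₁ v) ≡ eqn v
    eqn-A₁ (a , b , x , y) = l a b x y (+ N)
      where
      l : ∀ a b x y n → a * (x + y) + (b - a) * y - n ≡ a * x + b * y - n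
      l = solve-∀

    eqn-A₂ : ∀ v → eqn (A₂ v) ≡ eqn v
    eqn-A₂ (a , b , x , y) = l a b x y (+ N)
      where
      l : ∀ a b x y n → b * (x + y) + (a - b) * x - n ≡ a * x + b * y - n
      l = solve-∀

    module _ (N≢0 : + N ≢ 0ℤ) where

      private
        -- A nonzero product needs a zero coordinate in each pair, and then `a x + b y` is 0 and not
        -- `N`.
        factor-≢0 : ∀ a b x y → eqn (a , b , x , y) ≡ 0ℤ → h a x * h b y ≡ 0ℤ
        factor-≢0 a b x y p with a ℤ.≟ 0ℤ | x ℤ.≟ 0ℤ | b ℤ.≟ 0ℤ | y ℤ.≟ 0ℤ
        ... | no a≢0 | no x≢0 | _ | _ = trans (cong (_* h b y) (cong₂ (λ u w → u * sgn x + w * sgn a) (δ-≢ a≢0) (δ-≢ x≢0))) refl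
        ... | _ | _ | no b≢0 | no y≢0 = trans (cong (h a x *_) (cong₂ (λ u w → u * sgn y + w * sgn b) (δ-≢ b≢0) (δ-≢ y≢0))) (ℤₚ.*-zeroʳ (h a x))
        ... | yes refl | _ | yes refl | _ = ⊥-elim (N≢0 (sym (eqn-≡ a b x y p)))
        ... | yes refl | _ | _ | yes refl = ⊥-elim (N≢0 (trans (sym (eqn-≡ a b x y p)) (trans (ℤₚ.+-identityˡ _) (ℤₚ.*-zeroʳ b))))
        ... | _ | yes refl | yes refl | _ = ⊥-elim (N≢0 (trans (sym (eqn-≡ a b x y p)) (trans (ℤₚ.+-identityʳ _) (ℤₚ.*-zeroʳ a))))
        ... | _ | yes refl | _ | yes refl = ⊥-elim (N≢0 (trans (sym (eqn-≡ a b x y p)) (cong₂ _+_ (ℤₚ.*-zeroʳ a) (ℤₚ.*-zeroʳ b))))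

        σ : Quad → ℤ
        σ (a , b , x , y) = (sgn a + sgn x) * (sgn b + sgn y)

        quadruple : ∀ v → eqn v ≡ 0ℤ → + 4 * ω₀ v + + 2 * K v ≡ σ v
        quadruple (a , b , x , y) p = trans (trans (sym (ℤₚ.+-identityʳ _)) (cong (λ z → + 4 * (c a x * c b y) + + 2 * K (a , b , x , y) + z) (sym (factor-≢0 a b x y p))))
          (trans (l (c a x) (c b y) (h a x) (h b y)) (cong₂ _*_ (2c+h a x) (2c+h b y)))
          where
          l : ∀ p q r s → + 4 * (p * q) + + 2 * (p * s + q * r) + r * s ≡ (+ 2 * p + r) * (+ 2 * q + s)
          l = solve-∀

        -- The difference of the two sides is the sum of the expressions in `sgn-difference` and
        -- `sgn-sum`, that is `1 - 1`. Both apply because neither `a` and `b` nor `x` and `y` vanish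
        -- together when `N` is nonzero.
        cocycle : ∀ v → eqn v ≡ 0ℤ → σ v ≡ σ (A₁ v) + σ (A₂ v)
        cocycle (a , b , x , y) p = begin
            σ (a , b , x , y) ≡⟨ l₁ (sgn a) (sgn b) (sgn x) (sgn y) (sgn (a - b)) (sgn (x + y)) ⟩
            main + ((sgn a * sgn b + sgn (a - b) * (sgn a - sgn b)) + (sgn x * sgn y - sgn (x + y) * (sgn x + sgn y)))
              ≡⟨ cong (λ z → main + z) (cong₂ _+_ (sgn-difference a b ab≢0) (sgn-sum x y xy≢0)) ⟩
            main + 0ℤ ≡⟨ ℤₚ.+-identityʳ main ⟩
            main ≡⟨ cong (λ z → (sgn a + sgn (x + y)) * (z + sgn y) + (sgn b + sgn (x + y)) * (sgn (a - b) + sgn x)) (trans (sym (sgn-neg (a - b))) (cong sgn (l₂ a b))) ⟩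
            σ (A₁ (a , b , x , y)) + σ (A₂ (a , b , x , y)) ∎
          where
          open ≡-Reasoning
          main : ℤ
          main = (sgn a + sgn (x + y)) * (- sgn (a - b) + sgn y) + (sgn b + sgn (x + y)) * (sgn (a - b) + sgn x)
          l₁ : ∀ A B X Y D Z → (A + X) * (B + Y) ≡ (A + Z) * (- D + Y) + (B + Z) * (D + X) + ((A * B + D * (A - B)) + (X * Y - Z * (X + Y)))
          l₁ = solve-∀
          l₂ : ∀ a b → - (a - b) ≡ b - a
          l₂ = solve-∀
          ab≢0 : ¬ (a ≡ 0ℤ × b ≡ 0ℤ)
          ab≢0 (refl , refl) = N≢0 (sym (eqn-≡ a b x y p))
          xy≢0 : ¬ (x ≡ 0ℤ × y ≡ 0ℤ)
          xy≢0 (refl , refl) = N≢0 (trans (sym (eqn-≡ a b x y p)) (cong₂ _+_ (ℤₚ.*-zeroʳ a) (ℤₚ.*-zeroʳ b)))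

        relation : ∀ v → eqn v ≡ 0ℤ → + 2 * (ω₀ v - ω₀ (A₁ v) - ω₀ (A₂ v)) ≡ boundary v
        relation v p = ℤₚ.*-cancelˡ-≡ (+ 2) _ _ (begin
          + 2 * (+ 2 * (ω₀ v - ω₀ (A₁ v) - ω₀ (A₂ v))) ≡⟨ l (ω₀ v) (ω₀ (A₁ v)) (ω₀ (A₂ v)) (K v) (K (A₁ v)) (K (A₂ v)) ⟩
          rhs + ((+ 4 * ω₀ v + + 2 * K v) - ((+ 4 * ω₀ (A₁ v) + + 2 * K (A₁ v)) + (+ 4 * ω₀ (A₂ v) + + 2 * K (A₂ v))))
            ≡⟨ cong (λ z → rhs + z) (cong₂ _-_ (trans (quadruple v p) (cocycle v p))
                 (cong₂ _+_ (quadruple (A₁ v) (trans (eqn-A₁ v) p)) (quadruple (A₂ v) (trans (eqn-A₂ v) p)))) ⟩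
          rhs + (σ (A₁ v) + σ (A₂ v) - (σ (A₁ v) + σ (A₂ v))) ≡⟨ cong (λ z → rhs + z) (ℤₚ.+-inverseʳ (σ (A₁ v) + σ (A₂ v))) ⟩
          rhs + 0ℤ ≡⟨ ℤₚ.+-identityʳ rhs ⟩
          rhs ∎)
          where
          open ≡-Reasoning
          rhs : ℤ
          rhs = + 2 * boundary v
          l : ∀ w w₁ w₂ k k₁ k₂ → + 2 * (+ 2 * (w - w₁ - w₂)) ≡ + 2 * (k₁ + k₂ - k) + ((+ 4 * w + + 2 * k) - ((+ 4 * w₁ + + 2 * k₁) + (+ 4 * w₂ + + 2 * k₂)))
          l = solve-∀

      -- Summed over all quadruples, the addition theorem for the sign function becomes Liouville's identity.
      liouville : ∀ G → HasSum (λ v → G v * boundary v * δ (eqn v)) (+ 2 * (⟨ G ⟩ - ⟨ G ∘ M₁ ⟩ - ⟨ G ∘ M₂ ⟩))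
      liouville G = HasSum-cong pointwise (HasSum-* (+ 2) (HasSum-- (HasSum-- (⟨⟩-HasSum G) shifted₁) shifted₂))
        where
        MA₁ : ∀ v → M₁ (A₁ v) ≡ v
        MA₁ (a , b , x , y) = cong₂ (λ u w → a , u , w , y) (l₁ a b) (l₂ x y)
          where
          l₁ : ∀ a b → a + (b - a) ≡ b
          l₁ = solve-∀
          l₂ : ∀ x y → x + y - y ≡ x
          l₂ = solve-∀
        AM₁ : ∀ v → A₁ (M₁ v) ≡ v
        AM₁ (a , b , x , y) = cong₂ (λ u w → a , u , w , y) (l₁ a b) (l₂ x y)
          where
          l₁ : ∀ a b → a + b - a ≡ b
          l₁ = solve-∀
          l₂ : ∀ x y → x - y + y ≡ x
          l₂ = solve-∀
        MA₂ : ∀ v → M₂ (A₂ v) ≡ v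
        MA₂ (a , b , x , y) = cong₂ (λ u w → u , b , x , w) (l₁ a b) (l₂ x y)
          where
          l₁ : ∀ a b → b + (a - b) ≡ a
          l₁ = solve-∀
          l₂ : ∀ x y → x + y - x ≡ y
          l₂ = solve-∀
        AM₂ : ∀ v → A₂ (M₂ v) ≡ v
        AM₂ (a , b , x , y) = cong₂ (λ u w → a , u , w , y) (l₁ a b) (l₂ x y)
          where
          l₁ : ∀ a b → a + b - a ≡ b
          l₁ = solve-∀
          l₂ : ∀ x y → y + (x - y) ≡ x
          l₂ = solve-∀
        shifted₁ : HasSum (λ v → G v * (ω₀ (A₁ v) * δ (eqn v))) ⟨ G ∘ M₁ ⟩
        shifted₁ = HasSum-cong (λ v → cong₂ (λ u e → G u * (ω₀ (A₁ v) * δ e)) (MA₁ v) (eqn-A₁ v))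
          (HasSum-bijection A₁ M₁ MA₁ AM₁ (⟨⟩-HasSum (G ∘ M₁)))
        shifted₂ : HasSum (λ v → G v * (ω₀ (A₂ v) * δ (eqn v))) ⟨ G ∘ M₂ ⟩
        shifted₂ = HasSum-cong (λ v → cong₂ (λ u e → G u * (ω₀ (A₂ v) * δ e)) (MA₂ v) (eqn-A₂ v))
          (HasSum-bijection A₂ M₂ MA₂ AM₂ (⟨⟩-HasSum (G ∘ M₂)))
        pointwise : ∀ v → + 2 * (G v * ω v - G v * (ω₀ (A₁ v) * δ (eqn v)) - G v * (ω₀ (A₂ v) * δ (eqn v))) ≡ G v * boundary v * δ (eqn v)
        pointwise v = trans (l (G v) (ω₀ v) (ω₀ (A₁ v)) (ω₀ (A₂ v)) (δ (eqn v))) (guard (eqn v) λ p → cong (G v *_) (relation v p))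
          where
          l : ∀ g w w₁ w₂ d → + 2 * (g * (w * d) - g * (w₁ * d) - g * (w₂ * d)) ≡ g * (+ 2 * (w - w₁ - w₂)) * d
          l = solve-∀

-- Sums of sign differences over arithmetic progressions.

module Progressions where

  open FiniteSums
  open Congruences
  open LiouvilleIdentity using (sgn-neg)
  open import Data.Empty using (⊥-elim)
  open import Data.Fin using (zero; suc)
  import Data.Fin.Properties as Finₚ
  open import Data.List using ([]; _∷_)
  open import Data.List.Relation.Unary.Any using (here)
  open import Data.List.Relation.Unary.All using ([]; _∷_)
  open import Data.List.Relation.Unary.AllPairs using ([]; _∷_)
  open import Data.Nat as ℕ using (ℕ; zero; suc)
  import Data.Nat.Properties as ℕₚ
  open import Data.Integer as ℤ using (ℤ; +_; +0; +[1+_]; -[1+_]; _+_; _*_; _-_; -_; 0ℤ; 1ℤ; _<_)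
  import Data.Integer.Properties as ℤₚ
  open import Data.Integer.DivMod using (_/ℕ_)
  open import Data.Integer.Tactic.RingSolver using (solve-∀)
  open import Data.Product using (_,_)
  open import Relation.Nullary using (¬_)
  open import Relation.Binary.PropositionalEquality

  module _ (m : ℕ) .{{_ : ℕ.NonZero m}} where

    -- The indicator of the multiples of `m`.
    D : ℤ → ℤ
    D z = δ (rep (res m z))

    D≢0 : ∀ z → D z ≢ 0ℤ → z ≈ 0ℤ [ m ]
    D≢0 z h = subst (λ r → z ≈ r [ m ]) (δ≢0 (rep (res m z)) h) (rep-res m z)

    D-1 : ∀ {z} → z ≈ 0ℤ [ m ] → D z ≡ 1ℤ
    D-1 {z} p = δ-≡ (cong +_ (small-≈ (Finₚ.toℕ<n (res m z)) (ℕ.>-nonZero⁻¹ m) (≈-trans (≈-sym (rep-res m z)) p)))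

    D-0 : ∀ {z} → ¬ (z ≈ 0ℤ [ m ]) → D z ≡ 0ℤ
    D-0 {z} h = δ-≢ λ e → h (subst (λ r → z ≈ r [ m ]) e (rep-res m z))

    D-cong : ∀ {y z} → (y ≈ 0ℤ [ m ] → z ≈ 0ℤ [ m ]) → (z ≈ 0ℤ [ m ] → y ≈ 0ℤ [ m ]) → D y ≡ D z
    D-cong {y} {z} f g = δ-cong
      (λ e → cong +_ (small-≈ (Finₚ.toℕ<n (res m z)) (ℕ.>-nonZero⁻¹ m) (≈-trans (≈-sym (rep-res m z)) (f (subst (λ r → y ≈ r [ m ]) e (rep-res m y))))))
      (λ e → cong +_ (small-≈ (Finₚ.toℕ<n (res m y)) (ℕ.>-nonZero⁻¹ m) (≈-trans (≈-sym (rep-res m y)) (g (subst (λ r → z ≈ r [ m ]) e (rep-res m z))))))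

    D-periodic : Periodic m D
    D-periodic p = D-cong (≈-trans (≈-sym p)) (≈-trans p)

    D-neg : ∀ z → D (- z) ≡ D z
    D-neg z = D-cong (λ p → subst (_≈ 0ℤ [ m ]) (ℤₚ.neg-involutive z) (≈-neg p)) ≈-neg

    multiple : ∀ z → z ≈ 0ℤ [ m ] → (z /ℕ m) * + m ≡ z
    multiple z p = trans (sym (ℤₚ.+-identityˡ _)) (trans (cong (λ r → r + (z /ℕ m) * + m) (sym rep≡0)) (sym (equation (rep-res m z))))
      where
      rep≡0 : rep (res m z) ≡ 0ℤ
      rep≡0 = cong +_ (small-≈ (Finₚ.toℕ<n (res m z)) (ℕ.>-nonZero⁻¹ m) (≈-trans (≈-sym (rep-res m z)) p))

    /ℕ-exact : ∀ k → (k * + m) /ℕ m ≡ k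
    /ℕ-exact k = ℤₚ.*-cancelʳ-≡ _ _ (+ m) {{ℤ.≢-nonZero λ e → ℕₚ.<⇒≢ (ℕ.>-nonZero⁻¹ m) (sym (ℤₚ.+-injective e))}}
      (multiple (k * + m) (by k (sym (ℤₚ.+-identityˡ (k * + m)))))

    HasSum-progression : ∀ {w : ℤ → ℤ} {s} r → HasSum (λ k → w (r + k * + m)) s → HasSum (λ y → D (y - r) * w y) s
    HasSum-progression {w} r = HasSum-reindex (λ k → r + k * + m) (λ y → (y - r) /ℕ m)
      (λ k _ → trans (cong (_/ℕ m) (l₁ r (k * + m))) (/ℕ-exact k) , value k)
      (λ y h → let e = back y (D≢0 (y - r) (*≢0ˡ {_} {w y} h)) in e , trans (sym (value ((y - r) /ℕ m))) (cong (λ z → D (z - r) * w z) e))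
      where
      l₁ : ∀ r z → r + z - r ≡ z
      l₁ = solve-∀
      l₂ : ∀ y r → r + (y - r) ≡ y
      l₂ = solve-∀
      value : ∀ k → D (r + k * + m - r) * w (r + k * + m) ≡ w (r + k * + m)
      value k = trans (cong (_* w (r + k * + m)) (D-1 (by k (trans (l₁ r (k * + m)) (sym (ℤₚ.+-identityˡ (k * + m))))))) (ℤₚ.*-identityˡ _)
      back : ∀ y → (y - r) ≈ 0ℤ [ m ] → r + ((y - r) /ℕ m) * + m ≡ y
      back y p = trans (cong (λ z → r + z) (multiple (y - r) p)) (l₂ y r)

  HasSum-shift : ∀ {w : ℤ → ℤ} {s} q → HasSum w s → HasSum (λ k → w (k + q)) s
  HasSum-shift q = HasSum-bijection (_+ q) (_- q) (λ k → l₁ k q) (λ k → l₂ k q)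
    where
    l₁ : ∀ k q → k + q - q ≡ k
    l₁ = solve-∀
    l₂ : ∀ k q → k - q + q ≡ k
    l₂ = solve-∀

  -- The sign of `r + k m` for a residue `0 < r < m`. Unlike `sgn` it is never zero, because such a
  -- progression avoids 0.
  step : ℤ → ℤ
  step (+ _)    = 1ℤ
  step -[1+ _ ] = - 1ℤ

  step-sum₁ : HasSum (λ k → step (k + 1ℤ) - step k) (+ 2)
  step-sum₁ = hasSum (- 1ℤ ∷ []) ([] ∷ [])
    (λ { (+ n) h → ⊥-elim (h refl) ; -[1+ zero ] _ → here refl ; -[1+ suc n ] h → ⊥-elim (h refl) }) refl

  -- Telescopes in unit shifts: `step (k + 1) - step k` is 2 at `k = -1` and zero elsewhere.
  step-sumℕ : ∀ q → HasSum (λ k → step (k + + q) - step k) (+ 2 * + q)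
  step-sumℕ zero = HasSum-0 λ k → trans (cong (λ z → step z - step k) (ℤₚ.+-identityʳ k)) (ℤₚ.+-inverseʳ (step k))
  step-sumℕ (suc q) = HasSum-subst (l₁ (+ q)) (HasSum-cong (λ k → trans (l₂ (step (k + + q + 1ℤ)) (step (k + + q)) (step k))
    (cong (λ z → step z - step k) (l₃ k (+ q)))) (HasSum-+ (HasSum-shift (+ q) step-sum₁) (step-sumℕ q)))
    where
    l₁ : ∀ q → + 2 + + 2 * q ≡ + 2 * (1ℤ + q)
    l₁ = solve-∀
    l₂ : ∀ u v w → u - v + (v - w) ≡ u - w
    l₂ = solve-∀
    l₃ : ∀ k q → k + q + 1ℤ ≡ k + (1ℤ + q)
    l₃ = solve-∀

  step-sum : ∀ q → HasSum (λ k → step (k + q) - step k) (+ 2 * q)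
  step-sum (+ q) = step-sumℕ q
  step-sum -[1+ q ] = HasSum-subst (l₁ (+[1+ q ])) (HasSum-cong
    (λ k → trans (l₂ (step (k + -[1+ q ] + +[1+ q ])) (step (k + -[1+ q ]))) (cong (λ z → step (k + -[1+ q ]) - step z) (l₃ k (+[1+ q ]))))
    (HasSum-shift -[1+ q ] (HasSum-neg (step-sumℕ (suc q)))))
    where
    l₁ : ∀ q → - (+ 2 * q) ≡ + 2 * - q
    l₁ = solve-∀
    l₂ : ∀ u v → - (u - v) ≡ v - u
    l₂ = solve-∀
    l₃ : ∀ k q → k + - q + q ≡ k
    l₃ = solve-∀

  sgn-progression : ∀ {m r} k → 0 ℕ.< r → r ℕ.< m → sgn (+ r + k * + m) ≡ step k
  sgn-progression {m} {suc r} (+ n) _ _ = cong (λ z → sgn (+ suc r + z)) (sym (ℤₚ.pos-* n m))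
  sgn-progression {m} {r} -[1+ n ] _ r<m = trans (cong sgn (trans (cong (λ z → + r + -[1+ n ] * z) m≡) (trans (l (+ r) (+ suc d) (+ n))
    (cong -_ (trans (cong (λ z → + suc d + z) (trans (cong (+ n *_) (sym m≡)) (sym (ℤₚ.pos-* n m)))) refl))))) refl
    where
    d : ℕ
    d = m ℕ.∸ suc r
    m≡ : + m ≡ + r + + suc d
    m≡ = cong +_ (trans (sym (ℕₚ.m+[n∸m]≡n r<m)) (sym (ℕₚ.+-suc r d)))
    l : ∀ r d n → r + - (1ℤ + n) * (r + d) ≡ - (d + n * (r + d))
    l = solve-∀

  sgn-multiple : ∀ m k .{{_ : ℕ.NonZero m}} → sgn (k * + m) ≡ sgn k
  sgn-multiple (suc m) +0       = refl
  sgn-multiple (suc m) +[1+ n ] = refl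
  sgn-multiple (suc m) -[1+ n ] = refl

  module _ {m : ℕ} .{{_ : ℕ.NonZero m}} where

    -- The differences count, with weight 2 and a sign, the members of the class of `r` whose sign
    -- changes when `x` is added. In the parameter `k` of the progression, adding `x` shifts the
    -- index by `q`, and neither progression passes through 0.
    window : ∀ {x} r r′ q → 0 ℕ.< r → r ℕ.< m → 0 ℕ.< r′ → r′ ℕ.< m → x + + r ≡ + r′ + q * + m →
      HasSum (λ y → D m (y - + r) * (sgn (x + y) - sgn y)) (+ 2 * q)
    window {x} r r′ q 0<r r<m 0<r′ r′<m eq = HasSum-progression m (+ r) (HasSum-cong
      (λ k → sym (cong₂ _-_ (trans (cong sgn (shifted k)) (sgn-progression (k + q) 0<r′ r′<m)) (sgn-progression k 0<r r<m))) (step-sum q))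
      where
      l₁ : ∀ x r z → x + (r + z) ≡ x + r + z
      l₁ = solve-∀
      l₂ : ∀ r q k m → r + q * m + k * m ≡ r + (k + q) * m
      l₂ = solve-∀
      shifted : ∀ k → x + (+ r + k * + m) ≡ + r′ + (k + q) * + m
      shifted k = trans (l₁ x (+ r) (k * + m)) (trans (cong (_+ k * + m) eq) (l₂ (+ r′) q k (+ m)))

    -- Here the progression contains 0, where `sgn` is 0 and `step` is 1. The correction
    -- `step - sgn` is supported there and contributes the extra 1.
    window₀ : ∀ {x} r′ q → 0 ℕ.< r′ → r′ ℕ.< m → x ≡ + r′ + q * + m →
      HasSum (λ y → D m y * (sgn (x + y) - sgn y)) (+ 2 * q + 1ℤ)
    window₀ {x} r′ q 0<r′ r′<m eq = HasSum-cong (λ y → cong (λ z → D m z * (sgn (x + y) - sgn y)) (ℤₚ.+-identityʳ y))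
      (HasSum-progression m 0ℤ (HasSum-cong value (HasSum-+ (step-sum q) step-sgn)))
      where
      step-sgn : HasSum (λ k → step k - sgn k) 1ℤ
      step-sgn = hasSum (0ℤ ∷ []) ([] ∷ []) (λ { +0 _ → here refl ; +[1+ n ] h → ⊥-elim (h refl) ; -[1+ n ] h → ⊥-elim (h refl) }) refl
      l₁ : ∀ r q k m → r + q * m + (0ℤ + k * m) ≡ r + (k + q) * m
      l₁ = solve-∀
      l₂ : ∀ u v w → u - v + (v - w) ≡ u - w
      l₂ = solve-∀
      value : ∀ k → step (k + q) - step k + (step k - sgn k) ≡ sgn (x + (0ℤ + k * + m)) - sgn (0ℤ + k * + m)
      value k = trans (l₂ (step (k + q)) (step k) (sgn k)) (sym (cong₂ _-_
        (trans (cong sgn (trans (cong (_+ (0ℤ + k * + m)) eq) (l₁ (+ r′) q k (+ m)))) (sgn-progression (k + q) 0<r′ r′<m))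
        (trans (cong sgn (ℤₚ.+-identityˡ (k * + m))) (sgn-multiple m k))))

-- The interior side of Liouville's identity for three weights.

module InteriorTerms where

  open FiniteSums
  open Congruences
  open LiouvilleIdentity
  open Progressions
  open import Data.Fin using (suc)
  open import Data.Nat as ℕ using (ℕ; suc)
  open import Data.Integer as ℤ using (ℤ; +_; +0; +[1+_]; -[1+_]; _+_; _*_; _-_; -_; ∣_∣; 0ℤ; 1ℤ)
  import Data.Integer.Properties as ℤₚ
  open import Data.Integer.DivMod using (_/ℕ_)
  open import Data.Integer.Tactic.RingSolver using (solve-∀)
  open import Data.Product using (Σ; _×_; _,_)
  open import Function using (_∘_; flip)
  open import Relation.Nullary using (yes; no)
  open import Relation.Binary.PropositionalEquality

  4⇒2 : ∀ {y z} → y ≈ z [ 4 ] → y ≈ z [ 2 ]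
  4⇒2 {z = z} (by q eq) = by (q * + 2) (trans eq (l z q))
    where
    l : ∀ z q → z + q * + 4 ≡ z + q * + 2 * + 2
    l = solve-∀

  t o two : ℤ → ℤ
  t z   = 1ℤ - D 3 z
  o z   = 1ℤ - D 2 z
  two z = D 2 z - D 4 z

  t-periodic : Periodic 3 t
  t-periodic p = cong (λ z → 1ℤ - z) (D-periodic 3 p)

  o-periodic : Periodic 4 o
  o-periodic p = cong (λ z → 1ℤ - z) (D-periodic 2 (4⇒2 p))

  two-periodic : Periodic 4 two
  two-periodic p = cong₂ _-_ (D-periodic 2 (4⇒2 p)) (D-periodic 4 p)

  χ₃-neg : ∀ z → χ₃ (- z) ≡ - χ₃ z
  χ₃-neg = by-residues {3} (λ p → χ₃-periodic (≈-neg p)) (λ p → cong -_ (χ₃-periodic p)) check₁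

  χ₄-neg : ∀ z → χ₄ (- z) ≡ - χ₄ z
  χ₄-neg = by-residues {4} (λ p → χ₄-periodic (≈-neg p)) (λ p → cong -_ (χ₄-periodic p)) check₁

  t-neg : ∀ z → t (- z) ≡ t z
  t-neg z = cong (λ u → 1ℤ - u) (D-neg 3 z)

  o-neg : ∀ z → o (- z) ≡ o z
  o-neg z = cong (λ u → 1ℤ - u) (D-neg 2 z)

  private
    -- On residues prime to 3 the indicator of `x ≡ y` is `(1 + χ₃ x χ₃ y) / 2`. This table and the
    -- following ones expand the congruences in `G₁`, `G₂`, `G₃` and in their shifts into products
    -- of functions of one variable, doubled where a half would occur.
    table₃-diagonal : ∀ x y → + 2 * (χ₃ x * D 3 (x - y)) ≡ χ₃ y * t x + χ₃ x * t y
    table₃-diagonal = by-residues₂ (λ p q → cong (+ 2 *_) (cong₂ _*_ (χ₃-periodic p) (D-periodic 3 (≈-- p q))))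
      (λ p q → cong₂ _+_ (cong₂ _*_ (χ₃-periodic q) (t-periodic p)) (cong₂ _*_ (χ₃-periodic p) (t-periodic q))) check₂

    table₃-M₁ : ∀ x y → + 2 * (χ₃ (x - y) * D 3 (x - y - y)) ≡ χ₃ y * t x - χ₃ x * t y
    table₃-M₁ = by-residues₂ (λ p q → cong (+ 2 *_) (cong₂ _*_ (χ₃-periodic (≈-- p q)) (D-periodic 3 (≈-- (≈-- p q) q))))
      (λ p q → cong₂ _-_ (cong₂ _*_ (χ₃-periodic q) (t-periodic p)) (cong₂ _*_ (χ₃-periodic p) (t-periodic q))) check₂

    table₃-M₂ : ∀ x y → + 2 * (χ₃ y * D 3 (y - (x - y))) ≡ χ₃ y * t x - χ₃ x * t y
    table₃-M₂ = by-residues₂ (λ p q → cong (+ 2 *_) (cong₂ _*_ (χ₃-periodic q) (D-periodic 3 (≈-- q (≈-- p q)))))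
      (λ p q → cong₂ _-_ (cong₂ _*_ (χ₃-periodic q) (t-periodic p)) (cong₂ _*_ (χ₃-periodic p) (t-periodic q))) check₂

    table₃-antidiagonal : ∀ a b → + 2 * (χ₃ a * D 3 (a + b)) ≡ χ₃ a * t b - χ₃ b * t a
    table₃-antidiagonal = by-residues₂ (λ p q → cong (+ 2 *_) (cong₂ _*_ (χ₃-periodic p) (D-periodic 3 (≈-+ p q))))
      (λ p q → cong₂ _-_ (cong₂ _*_ (χ₃-periodic p) (t-periodic q)) (cong₂ _*_ (χ₃-periodic q) (t-periodic p))) check₂

    table₃-axis : ∀ a b → χ₃ (a + b) * D 3 a ≡ χ₃ b * D 3 a
    table₃-axis = by-residues₂ (λ p q → cong₂ _*_ (χ₃-periodic (≈-+ p q)) (D-periodic 3 p))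
      (λ p q → cong₂ _*_ (χ₃-periodic q) (D-periodic 3 p)) check₂

    table₄-M₁ : ∀ x y → χ₄ (x - y) * two y ≡ - (χ₄ x * two y)
    table₄-M₁ = by-residues₂ (λ p q → cong₂ _*_ (χ₄-periodic (≈-- p q)) (two-periodic q))
      (λ p q → cong -_ (cong₂ _*_ (χ₄-periodic p) (two-periodic q))) check₂

    table₄-M₂ : ∀ x y → + 2 * (χ₄ y * two (x - y)) ≡ χ₄ y * o x - χ₄ x * o y
    table₄-M₂ = by-residues₂ (λ p q → cong (+ 2 *_) (cong₂ _*_ (χ₄-periodic q) (two-periodic (≈-- p q))))
      (λ p q → cong₂ _-_ (cong₂ _*_ (χ₄-periodic q) (o-periodic p)) (cong₂ _*_ (χ₄-periodic p) (o-periodic q))) check₂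

    table₄-antidiagonal : ∀ a b → + 2 * (χ₄ a * D 4 (a + b)) ≡ χ₄ a * o b - χ₄ b * o a
    table₄-antidiagonal = by-residues₂ (λ p q → cong (+ 2 *_) (cong₂ _*_ (χ₄-periodic p) (D-periodic 4 (≈-+ p q))))
      (λ p q → cong₂ _-_ (cong₂ _*_ (χ₄-periodic p) (o-periodic q)) (cong₂ _*_ (χ₄-periodic q) (o-periodic p))) check₂

    table₄-diagonal : ∀ x y → + 2 * (χ₄ y * D 4 (x - y)) ≡ χ₄ y * o x + χ₄ x * o y
    table₄-diagonal = by-residues₂ (λ p q → cong (+ 2 *_) (cong₂ _*_ (χ₄-periodic q) (D-periodic 4 (≈-- p q))))
      (λ p q → cong₂ _+_ (cong₂ _*_ (χ₄-periodic q) (o-periodic p)) (cong₂ _*_ (χ₄-periodic p) (o-periodic q))) check₂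

    table₄-axis : ∀ a b → χ₄ (a + b) * D 4 a ≡ χ₄ b * D 4 a
    table₄-axis = by-residues₂ (λ p q → cong₂ _*_ (χ₄-periodic (≈-+ p q)) (D-periodic 4 p))
      (λ p q → cong₂ _*_ (χ₄-periodic q) (D-periodic 4 p)) check₂

    table₄-axis′ : ∀ x y → χ₄ (x - y) * D 4 y ≡ χ₄ x * D 4 y
    table₄-axis′ = by-residues₂ (λ p q → cong₂ _*_ (χ₄-periodic (≈-- p q)) (D-periodic 4 q))
      (λ p q → cong₂ _*_ (χ₄-periodic p) (D-periodic 4 q)) check₂

  -- The three weights to which Liouville's identity is applied.
  G₁ G₂ G₃ : Quad → ℤ
  G₁ (a , b , x , y) = χ₃ x * D 3 (x - y) * (χ₄ x * two y)
  G₂ (a , b , x , y) = χ₃ x * D 3 (x - y) * (χ₄ a * D 4 b)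
  G₃ (a , b , x , y) = χ₃ a * D 3 b * (χ₄ x * D 4 y)

  module Interior (N : ℕ) where

    open Convolution N

    ⟨_∣_⟩ : (ℤ → ℤ → ℤ) → (ℤ → ℤ → ℤ) → ℤ
    ⟨ f ∣ g ⟩ = ⟨ (λ (a , b , x , y) → f b y * g a x) ⟩

    ∣-swap : ∀ f g → ⟨ f ∣ g ⟩ ≡ ⟨ g ∣ f ⟩
    ∣-swap f g = trans (sym (⟨⟩-swap _)) (⟨⟩-cong λ a b x y _ → ℤₚ.*-comm (f a x) (g b y))

    ∣-flip : ∀ f g → ⟨ f ∣ g ⟩ ≡ ⟨ f ∣ flip g ⟩
    ∣-flip f g = sym (⟨⟩-transpose₁ (λ (a , b , x , y) → f b y * g a x))

    ∣-cong : ∀ f {g g′} → (∀ a x → g a x ≡ g′ a x) → ⟨ f ∣ g ⟩ ≡ ⟨ f ∣ g′ ⟩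
    ∣-cong f g≡g′ = ⟨⟩-cong λ a b x y _ → cong (f b y *_) (g≡g′ a x)

    ∣-linear : ∀ f k g l g′ → ⟨ f ∣ (λ a x → k * g a x + l * g′ a x) ⟩ ≡ k * ⟨ f ∣ g ⟩ + l * ⟨ f ∣ g′ ⟩
    ∣-linear f k g l g′ = trans (⟨⟩-cong λ a b x y _ → rearrange (f b y) k (g a x) l (g′ a x))
      (trans (⟨⟩-+ (λ (a , b , x , y) → k * (f b y * g a x)) (λ (a , b , x , y) → l * (f b y * g′ a x)))
        (cong₂ _+_ (⟨⟩-* k (λ (a , b , x , y) → f b y * g a x)) (⟨⟩-* l (λ (a , b , x , y) → f b y * g′ a x))))
      where
      rearrange : ∀ u k v l w → u * (k * v + l * w) ≡ k * (u * v) + l * (u * w)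
      rearrange = solve-∀

    -- In the expansion of `k F` by the tables, the products collected in `E` are even in the pair
    -- `(a , x)` and cancel; only `P` survives.
    ⟨⟩-odd-part : ∀ k F P E → (∀ a b x y → k * F (a , b , x , y) ≡ P (a , b , x , y) + E (a , b , x , y)) →
      (∀ v → E (negate₁ v) ≡ E v) → k * ⟨ F ⟩ ≡ ⟨ P ⟩
    ⟨⟩-odd-part k F P E eq even = trans (sym (⟨⟩-* k F)) (trans (⟨⟩-cong λ a b x y _ → eq a b x y)
      (trans (⟨⟩-+ P E) (trans (cong (λ z → ⟨ P ⟩ + z) (⟨⟩-even₁ E even)) (ℤₚ.+-identityʳ _))))

    -- Moving a divisor m from one variable of a product to the other.
    ∣-move : ∀ (χ : ℤ → ℤ) m .{{_ : ℕ.NonZero m}} → (∀ x y → χ (x * y) ≡ χ x * χ y) → ∀ f →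
      ⟨ f ∣ (λ a x → D m x * χ x) ⟩ ≡ χ (+ m) * ⟨ f ∣ (λ a x → D m a * χ x) ⟩
    ∣-move χ m@(suc _) χ-* f = trans (HasSum-unique (⟨⟩-HasSum _) (HasSum-reindex forth back forth-ok back-ok (⟨⟩-HasSum (λ (a , b , x , y) → f b y * (χ (+ m) * (D m a * χ x))))))
      (trans (⟨⟩-cong λ a b x y _ → rearrange (f b y) (χ (+ m)) (D m a * χ x)) (⟨⟩-* (χ (+ m)) (λ (a , b , x , y) → f b y * (D m a * χ x))))
      where
      rearrange : ∀ u v w → u * (v * w) ≡ v * (u * w)
      rearrange = solve-∀
      forth back : Quad → Quad
      forth (a , b , x , y) = a /ℕ m , b , x * + m , y
      back  (a , b , x , y) = a * + m , b , x /ℕ m , y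
      u v : Quad → ℤ
      u (a , b , x , y) = f b y * (χ (+ m) * (D m a * χ x)) * ω (a , b , x , y)
      v (a , b , x , y) = f b y * (D m x * χ x) * ω (a , b , x , y)
      pos-* : ∀ z → pos (z * + m) ≡ pos z
      pos-* +0       = refl
      pos-* +[1+ _ ] = refl
      pos-* -[1+ _ ] = refl
      c-move : ∀ a x → c a (x * + m) ≡ c (a * + m) x
      c-move a x = cong₂ _-_ (trans (cong (pos a *_) (pos-* x)) (cong (_* pos x) (sym (pos-* a))))
        (trans (cong (pos (- a) *_) (neg-move x)) (cong (_* pos (- x)) (sym (neg-move a))))
        where
        neg-move : ∀ z → pos (- (z * + m)) ≡ pos (- z)
        neg-move z = trans (cong pos (ℤₚ.neg-distribˡ-* z (+ m))) (pos-* (- z))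
      value : ∀ a b x y → v (a , b , x * + m , y) ≡ u (a * + m , b , x , y)
      value a b x y = cong₂ _*_
        (cong (f b y *_) (trans (cong₂ _*_ (D-1 m {x * + m} (by x (sym (ℤₚ.+-identityˡ (x * + m))))) (trans (χ-* x (+ m)) (ℤₚ.*-comm (χ x) (χ (+ m)))))
          (trans (l₁ (χ (+ m)) (χ x)) (cong (λ z → χ (+ m) * (z * χ x)) (sym (D-1 m {a * + m} (by a (sym (ℤₚ.+-identityˡ (a * + m))))))))))
        (cong₂ (λ p e → p * c b y * δ (e + b * y - + N)) (c-move a x) (l₂ a x (+ m)))
        where
        l₁ : ∀ u v → 1ℤ * (u * v) ≡ u * (1ℤ * v)
        l₁ = solve-∀
        l₂ : ∀ a x m → a * (x * m) ≡ a * m * x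
        l₂ = solve-∀
      forth-ok : ∀ q → u q ≢ 0ℤ → back (forth q) ≡ q × v (forth q) ≡ u q
      forth-ok (a , b , x , y) h = cong₂ (λ p r → p , b , r , y) a≡ (/ℕ-exact m x) ,
        trans (value (a /ℕ m) b x y) (cong (λ p → u (p , b , x , y)) a≡)
        where
        a≡ : a /ℕ m * + m ≡ a
        a≡ = multiple m a (D≢0 m a (*≢0ˡ {_} {χ x} (*≢0ʳ {χ (+ m)} (*≢0ʳ {f b y} (*≢0ˡ {_} {ω (a , b , x , y)} h)))))
      back-ok : ∀ q → v q ≢ 0ℤ → forth (back q) ≡ q × u (back q) ≡ v q
      back-ok (a , b , x , y) h = cong₂ (λ p r → p , b , r , y) (/ℕ-exact m a) x≡ ,
        trans (sym (value a b (x /ℕ m) y)) (cong (λ p → v (a , b , p , y)) x≡)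
        where
        x≡ : x /ℕ m * + m ≡ x
        x≡ = multiple m x (D≢0 m x (*≢0ˡ {_} {χ x} (*≢0ʳ {f b y} (*≢0ˡ {_} {ω (a , b , x , y)} h))))

    -- The convolutions left after expansion: `p` has `y` odd, `q` has `4 ∣ y`, and the index 3
    -- marks the extra condition `3 ∣ a`. The one that occurs in `Λ` is `q₃`.
    p₁ p₃ q₁ q₃ : ℤ
    p₁ = ⟨ (λ b y → χ₃ b * o y) ∣ (λ a x → χ₄ x) ⟩
    p₃ = ⟨ (λ b y → χ₃ b * o y) ∣ (λ a x → D 3 a * χ₄ x) ⟩
    q₁ = ⟨ (λ b y → χ₃ b * D 4 y) ∣ (λ a x → χ₄ x) ⟩
    q₃ = ⟨ (λ b y → χ₃ b * D 4 y) ∣ (λ a x → D 3 a * χ₄ x) ⟩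

    private
      half : ∀ u v → + 2 * u ≡ + 2 * v → u ≡ v
      half u v = ℤₚ.*-cancelˡ-≡ (+ 2) u v

    t-split : ∀ f → ⟨ f ∣ (λ a x → χ₄ x * t a) ⟩ ≡ ⟨ f ∣ (λ a x → χ₄ x) ⟩ - ⟨ f ∣ (λ a x → D 3 a * χ₄ x) ⟩
    t-split f = trans (∣-cong f λ a x → l (χ₄ x) (D 3 a)) (trans (∣-linear f 1ℤ (λ a x → χ₄ x) (- 1ℤ) (λ a x → D 3 a * χ₄ x)) (l′ ⟨ f ∣ (λ a x → χ₄ x) ⟩ ⟨ f ∣ (λ a x → D 3 a * χ₄ x) ⟩))
      where
      l : ∀ u v → u * (1ℤ - v) ≡ 1ℤ * u + - 1ℤ * (v * u)
      l = solve-∀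
      l′ : ∀ u v → 1ℤ * u + - 1ℤ * v ≡ u - v
      l′ = solve-∀

    -- The condition `3 ∣ x` is moved to `a` at the cost of the factor `χ₄ 3 = -1`, which turns the
    -- minus sign of `t-split` into a plus.
    t-split′ : ∀ f → ⟨ f ∣ (λ a x → χ₄ x * t x) ⟩ ≡ ⟨ f ∣ (λ a x → χ₄ x) ⟩ + ⟨ f ∣ (λ a x → D 3 a * χ₄ x) ⟩
    t-split′ f = trans (∣-cong f λ a x → l (χ₄ x) (D 3 x)) (trans (∣-linear f 1ℤ (λ a x → χ₄ x) (- 1ℤ) (λ a x → D 3 x * χ₄ x))
      (trans (cong (λ z → 1ℤ * ⟨ f ∣ (λ a x → χ₄ x) ⟩ + - 1ℤ * z) (∣-move χ₄ 3 χ₄-* f)) (l′ ⟨ f ∣ (λ a x → χ₄ x) ⟩ ⟨ f ∣ (λ a x → D 3 a * χ₄ x) ⟩)))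
      where
      l : ∀ u v → u * (1ℤ - v) ≡ 1ℤ * u + - 1ℤ * (v * u)
      l = solve-∀
      l′ : ∀ u v → 1ℤ * u + - 1ℤ * (- 1ℤ * v) ≡ u + v
      l′ = solve-∀

    f₂ f₁ : ℤ → ℤ → ℤ
    f₂ b y = χ₃ y * two y
    f₁ b y = χ₃ y * o y

    -- Σ χ₃(y)(2[y ≡ 2 mod 4] + [y odd]) and Σ χ₃(b)([y odd] - 2[4 ∣ y]) agree on every product.
    f-split : ∀ g → + 2 * ⟨ f₂ ∣ g ⟩ + ⟨ f₁ ∣ g ⟩ ≡ ⟨ (λ b y → χ₃ b * o y) ∣ g ⟩ - + 2 * ⟨ (λ b y → χ₃ b * D 4 y) ∣ g ⟩
    f-split g = begin
      + 2 * ⟨ f₂ ∣ g ⟩ + ⟨ f₁ ∣ g ⟩ ≡⟨ cong₂ (λ u v → + 2 * u + v) (∣-swap f₂ g) (∣-swap f₁ g) ⟩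
      + 2 * ⟨ g ∣ f₂ ⟩ + ⟨ g ∣ f₁ ⟩ ≡⟨ cong₂ (λ u v → + 2 * u + v) two-part odd-part ⟩
      + 2 * (d₂ - d₄) + (d - d₂) ≡⟨ l₀ d d₂ d₄ ⟩
      d + d₂ - + 2 * d₄ ≡⟨ cong₂ (λ u v → d + u - + 2 * v) (∣-move χ₃ 2 χ₃-* g) (∣-move χ₃ 4 χ₃-* g) ⟩
      d + - 1ℤ * e₂ - + 2 * (1ℤ * e₄) ≡⟨ l₃ d e₂ e₄ ⟩
      (d - e₂) - + 2 * e₄ ≡⟨ cong₂ (λ u v → u - + 2 * v) odd-part′ four-part ⟩
      ⟨ (λ b y → χ₃ b * o y) ∣ g ⟩ - + 2 * ⟨ (λ b y → χ₃ b * D 4 y) ∣ g ⟩ ∎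
      where
      open ≡-Reasoning
      d d₂ d₄ e₂ e₄ : ℤ
      d  = ⟨ g ∣ (λ a x → χ₃ x) ⟩
      d₂ = ⟨ g ∣ (λ a x → D 2 x * χ₃ x) ⟩
      d₄ = ⟨ g ∣ (λ a x → D 4 x * χ₃ x) ⟩
      e₂ = ⟨ g ∣ (λ a x → D 2 a * χ₃ x) ⟩
      e₄ = ⟨ g ∣ (λ a x → D 4 a * χ₃ x) ⟩
      l₀ : ∀ d e f → + 2 * (e - f) + (d - e) ≡ d + e - + 2 * f
      l₀ = solve-∀
      l₁ : ∀ u v w → u * (v - w) ≡ 1ℤ * (v * u) + - 1ℤ * (w * u)
      l₁ = solve-∀
      l₂ : ∀ u v → u * (1ℤ - v) ≡ 1ℤ * u + - 1ℤ * (v * u)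
      l₂ = solve-∀
      l₃ : ∀ d e f → d + - 1ℤ * e - + 2 * (1ℤ * f) ≡ (d - e) - + 2 * f
      l₃ = solve-∀
      l₄ : ∀ u v → 1ℤ * u + - 1ℤ * v ≡ u - v
      l₄ = solve-∀
      two-part : ⟨ g ∣ f₂ ⟩ ≡ d₂ - d₄
      two-part = trans (∣-cong g λ a x → l₁ (χ₃ x) (D 2 x) (D 4 x)) (trans (∣-linear g 1ℤ (λ a x → D 2 x * χ₃ x) (- 1ℤ) (λ a x → D 4 x * χ₃ x)) (l₄ d₂ d₄))
      odd-part : ⟨ g ∣ f₁ ⟩ ≡ d - d₂
      odd-part = trans (∣-cong g λ a x → l₂ (χ₃ x) (D 2 x)) (trans (∣-linear g 1ℤ (λ a x → χ₃ x) (- 1ℤ) (λ a x → D 2 x * χ₃ x)) (l₄ d d₂))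
      odd-part′ : d - e₂ ≡ ⟨ (λ b y → χ₃ b * o y) ∣ g ⟩
      odd-part′ = trans (sym (trans (∣-cong g λ a x → l₂ (χ₃ x) (D 2 a)) (trans (∣-linear g 1ℤ (λ a x → χ₃ x) (- 1ℤ) (λ a x → D 2 a * χ₃ x)) (l₄ d e₂))))
        (trans (∣-flip g (λ a x → χ₃ x * o a)) (∣-swap g (λ a x → χ₃ a * o x)))
      four-part : e₄ ≡ ⟨ (λ b y → χ₃ b * D 4 y) ∣ g ⟩
      four-part = trans (∣-cong g λ a x → ℤₚ.*-comm (D 4 a) (χ₃ x)) (trans (∣-flip g (λ a x → χ₃ x * D 4 a)) (∣-swap g (λ a x → χ₃ a * D 4 x)))

    g : ℤ → ℤ → ℤ
    g a x = χ₄ x * t x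

    -- `G₁` and `G₁ ∘ M₁` contribute the class `y ≡ 2` modulo 4, and `G₁ ∘ M₂` contributes the odd
    -- `y`. `f-split` trades `χ₃ y` for `χ₃ b`, and `t-split′` resolves the factor `t x`.
    interior₁ : + 2 * (⟨ G₁ ⟩ - ⟨ G₁ ∘ M₁ ⟩ - ⟨ G₁ ∘ M₂ ⟩) ≡ p₁ + p₃ - + 2 * q₁ - + 2 * q₃
    interior₁ = begin
      + 2 * (⟨ G₁ ⟩ - ⟨ G₁ ∘ M₁ ⟩ - ⟨ G₁ ∘ M₂ ⟩) ≡⟨ l₀ ⟨ G₁ ⟩ ⟨ G₁ ∘ M₁ ⟩ ⟨ G₁ ∘ M₂ ⟩ ⟩
      + 2 * ⟨ G₁ ⟩ - + 2 * ⟨ G₁ ∘ M₁ ⟩ - + 2 * ⟨ G₁ ∘ M₂ ⟩ ≡⟨ cong₂ (λ u v → + 2 * ⟨ G₁ ⟩ - u - v) part₁ part₂ ⟩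
      + 2 * ⟨ G₁ ⟩ - - 1ℤ * ⟨ f₂ ∣ g ⟩ - - ⟨ f₁ ∣ g ⟩ ≡⟨ cong (λ u → u - - 1ℤ * ⟨ f₂ ∣ g ⟩ - - ⟨ f₁ ∣ g ⟩) part₀ ⟩
      ⟨ f₂ ∣ g ⟩ - - 1ℤ * ⟨ f₂ ∣ g ⟩ - - ⟨ f₁ ∣ g ⟩ ≡⟨ l₁ ⟨ f₂ ∣ g ⟩ ⟨ f₁ ∣ g ⟩ ⟩
      + 2 * ⟨ f₂ ∣ g ⟩ + ⟨ f₁ ∣ g ⟩ ≡⟨ f-split g ⟩
      ⟨ (λ b y → χ₃ b * o y) ∣ g ⟩ - + 2 * ⟨ (λ b y → χ₃ b * D 4 y) ∣ g ⟩
        ≡⟨ cong₂ (λ u v → u - + 2 * v) (t-split′ (λ b y → χ₃ b * o y)) (t-split′ (λ b y → χ₃ b * D 4 y)) ⟩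
      p₁ + p₃ - + 2 * (q₁ + q₃) ≡⟨ l₂ p₁ p₃ q₁ q₃ ⟩
      p₁ + p₃ - + 2 * q₁ - + 2 * q₃ ∎
      where
      open ≡-Reasoning
      l₀ : ∀ u v w → + 2 * (u - v - w) ≡ + 2 * u - + 2 * v - + 2 * w
      l₀ = solve-∀
      l₁ : ∀ u v → u - - 1ℤ * u - - v ≡ + 2 * u + v
      l₁ = solve-∀
      l₂ : ∀ p q r s → p + q - + 2 * (r + s) ≡ p + q - + 2 * r - + 2 * s
      l₂ = solve-∀
      E : Quad → ℤ
      E (a , b , x , y) = χ₃ x * t y * (χ₄ x * two y)
      E-even : ∀ v → E (negate₁ v) ≡ E v
      E-even (a , b , x , y) = trans (cong₂ (λ p q → p * t y * (q * two y)) (χ₃-neg x) (χ₄-neg x)) (l (χ₃ x) (χ₄ x) (t y) (two y))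
        where
        l : ∀ p q r s → - p * r * (- q * s) ≡ p * r * (q * s)
        l = solve-∀
      part₀ : + 2 * ⟨ G₁ ⟩ ≡ ⟨ f₂ ∣ g ⟩
      part₀ = ⟨⟩-odd-part (+ 2) G₁ _ E (λ a b x y → trans (sym (ℤₚ.*-assoc (+ 2) (χ₃ x * D 3 (x - y)) (χ₄ x * two y)))
        (trans (cong (_* (χ₄ x * two y)) (table₃-diagonal x y)) (l (χ₃ y) (t x) (χ₃ x) (t y) (χ₄ x) (two y)))) E-even
        where
        l : ∀ p q r s u v → (p * q + r * s) * (u * v) ≡ p * v * (u * q) + r * s * (u * v)
        l = solve-∀
      part₁ : + 2 * ⟨ G₁ ∘ M₁ ⟩ ≡ - 1ℤ * ⟨ f₂ ∣ g ⟩
      part₁ = trans (⟨⟩-odd-part (+ 2) (G₁ ∘ M₁) (λ (a , b , x , y) → - 1ℤ * (f₂ b y * g a x)) E (λ a b x y → trans (sym (ℤₚ.*-assoc (+ 2) (χ₃ (x - y) * D 3 (x - y - y)) (χ₄ (x - y) * two y)))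
        (trans (cong₂ _*_ (table₃-M₁ x y) (table₄-M₁ x y)) (l (χ₃ y) (t x) (χ₃ x) (t y) (χ₄ x) (two y)))) E-even) (⟨⟩-* (- 1ℤ) (λ (a , b , x , y) → f₂ b y * g a x))
        where
        l : ∀ p q r s u v → (p * q - r * s) * - (u * v) ≡ - 1ℤ * (p * v * (u * q)) + r * s * (u * v)
        l = solve-∀
      E′ : Quad → ℤ
      E′ (a , b , x , y) = χ₃ y * t x * (χ₄ y * o x) + χ₃ x * t y * (χ₄ x * o y)
      E′-even : ∀ v → E′ (negate₁ v) ≡ E′ v
      E′-even (a , b , x , y) = cong₂ _+_ (cong₂ (λ p q → χ₃ y * p * (χ₄ y * q)) (t-neg x) (o-neg x))
        (trans (cong₂ (λ p q → p * t y * (q * o y)) (χ₃-neg x) (χ₄-neg x)) (l (χ₃ x) (χ₄ x) (t y) (o y)))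
        where
        l : ∀ p q r s → - p * r * (- q * s) ≡ p * r * (q * s)
        l = solve-∀
      part₂ : + 2 * ⟨ G₁ ∘ M₂ ⟩ ≡ - ⟨ f₁ ∣ g ⟩
      part₂ = half _ _ (trans (sym (ℤₚ.*-assoc (+ 2) (+ 2) ⟨ G₁ ∘ M₂ ⟩)) (trans (⟨⟩-odd-part (+ 4) (G₁ ∘ M₂)
        (λ (a , b , x , y) → - 1ℤ * (f₁ b y * g a x) + - 1ℤ * (f₁ a x * g b y)) E′
        (λ a b x y → trans (l (χ₃ y * D 3 (y - (x - y))) (χ₄ y * two (x - y))) (trans (cong₂ _*_ (table₃-M₂ x y) (table₄-M₂ x y)) (l′ (χ₃ y) (t x) (χ₃ x) (t y) (χ₄ y) (o x) (χ₄ x) (o y)))) E′-even)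
        (trans (⟨⟩-+ (λ (a , b , x , y) → - 1ℤ * (f₁ b y * g a x)) (λ (a , b , x , y) → - 1ℤ * (f₁ a x * g b y)))
          (trans (cong₂ _+_ (⟨⟩-* (- 1ℤ) (λ (a , b , x , y) → f₁ b y * g a x)) (trans (⟨⟩-* (- 1ℤ) (λ (a , b , x , y) → f₁ a x * g b y)) (cong (- 1ℤ *_) (⟨⟩-swap (λ (a , b , x , y) → f₁ b y * g a x))))) (l″ ⟨ f₁ ∣ g ⟩)))))
        where
        l : ∀ u v → + 4 * (u * v) ≡ (+ 2 * u) * (+ 2 * v)
        l = solve-∀
        l′ : ∀ p q r s u v w z → (p * q - r * s) * (u * v - w * z) ≡ - 1ℤ * (p * z * (w * q)) + - 1ℤ * (r * v * (u * s)) + (p * q * (u * v) + r * s * (w * z))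
        l′ = solve-∀
        l″ : ∀ u → - 1ℤ * u + - 1ℤ * u ≡ + 2 * - u
        l″ = solve-∀

    private
      transposed : ∀ f g → ⟨ (λ (a , b , x , y) → f y b * g x a) ⟩ ≡ ⟨ f ∣ g ⟩
      transposed f g = ⟨⟩-transpose (λ (a , b , x , y) → f b y * g a x)

    -- The products arising here carry `χ₃` on `x`, `y` and `χ₄` on `a`, `b`. `transposed` restores
    -- the standard order; the factor prime to 3 then falls on `a`, so that `t-split` applies.
    interior₂ : + 2 * (⟨ G₂ ⟩ - ⟨ G₂ ∘ M₁ ⟩ - ⟨ G₂ ∘ M₂ ⟩) ≡ + 2 * (q₁ - q₃) - (p₁ - p₃)
    interior₂ = begin
      + 2 * (⟨ G₂ ⟩ - ⟨ G₂ ∘ M₁ ⟩ - ⟨ G₂ ∘ M₂ ⟩) ≡⟨ l₀ ⟨ G₂ ⟩ ⟨ G₂ ∘ M₁ ⟩ ⟨ G₂ ∘ M₂ ⟩ ⟩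
      + 2 * ⟨ G₂ ⟩ - + 2 * ⟨ G₂ ∘ M₁ ⟩ - + 2 * ⟨ G₂ ∘ M₂ ⟩ ≡⟨ cong₂ (λ u v → + 2 * ⟨ G₂ ⟩ - u - v) part₁ part₂ ⟩
      + 2 * ⟨ G₂ ⟩ - ⟨ fo ∣ gt ⟩ - - 1ℤ * ⟨ f4 ∣ gt ⟩ ≡⟨ cong (λ u → u - ⟨ fo ∣ gt ⟩ - - 1ℤ * ⟨ f4 ∣ gt ⟩) part₀ ⟩
      ⟨ f4 ∣ gt ⟩ - ⟨ fo ∣ gt ⟩ - - 1ℤ * ⟨ f4 ∣ gt ⟩ ≡⟨ l₁ ⟨ f4 ∣ gt ⟩ ⟨ fo ∣ gt ⟩ ⟩
      + 2 * ⟨ f4 ∣ gt ⟩ - ⟨ fo ∣ gt ⟩ ≡⟨ cong₂ (λ u v → + 2 * u - v) (t-split f4) (t-split fo) ⟩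
      + 2 * (q₁ - q₃) - (p₁ - p₃) ∎
      where
      open ≡-Reasoning
      fo f4 gt : ℤ → ℤ → ℤ
      fo b y = χ₃ b * o y
      f4 b y = χ₃ b * D 4 y
      gt a x = χ₄ x * t a
      l₀ : ∀ u v w → + 2 * (u - v - w) ≡ + 2 * u - + 2 * v - + 2 * w
      l₀ = solve-∀
      l₁ : ∀ u v → u - v - - 1ℤ * u ≡ + 2 * u - v
      l₁ = solve-∀
      E₀ : Quad → ℤ
      E₀ (a , b , x , y) = χ₃ x * t y * (χ₄ a * D 4 b)
      E₀-even : ∀ v → E₀ (negate₁ v) ≡ E₀ v
      E₀-even (a , b , x , y) = trans (cong₂ (λ p q → p * t y * (q * D 4 b)) (χ₃-neg x) (χ₄-neg a)) (l (χ₃ x) (χ₄ a) (t y) (D 4 b))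
        where
        l : ∀ p q r s → - p * r * (- q * s) ≡ p * r * (q * s)
        l = solve-∀
      part₀ : + 2 * ⟨ G₂ ⟩ ≡ ⟨ f4 ∣ gt ⟩
      part₀ = trans (⟨⟩-odd-part (+ 2) G₂ (λ (a , b , x , y) → f4 y b * gt x a) E₀ (λ a b x y → trans (sym (ℤₚ.*-assoc (+ 2) (χ₃ x * D 3 (x - y)) (χ₄ a * D 4 b)))
        (trans (cong (_* (χ₄ a * D 4 b)) (table₃-diagonal x y)) (l (χ₃ y) (t x) (χ₃ x) (t y) (χ₄ a) (D 4 b)))) E₀-even) (transposed f4 gt)
        where
        l : ∀ p q r s u v → (p * q + r * s) * (u * v) ≡ p * v * (u * q) + r * s * (u * v)
        l = solve-∀
      E₁ : Quad → ℤ
      E₁ (a , b , x , y) = - (χ₃ y * t x * (χ₄ b * o a)) + - (χ₃ x * t y * (χ₄ a * o b))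
      E₁-even : ∀ v → E₁ (negate₁ v) ≡ E₁ v
      E₁-even (a , b , x , y) = cong₂ (λ u v → - u + - v) (cong₂ (λ p q → χ₃ y * p * (χ₄ b * q)) (t-neg x) (o-neg a))
        (trans (cong₂ (λ p q → p * t y * (q * o b)) (χ₃-neg x) (χ₄-neg a)) (l (χ₃ x) (χ₄ a) (t y) (o b)))
        where
        l : ∀ p q r s → - p * r * (- q * s) ≡ p * r * (q * s)
        l = solve-∀
      part₁ : + 2 * ⟨ G₂ ∘ M₁ ⟩ ≡ ⟨ fo ∣ gt ⟩
      part₁ = half _ _ (trans (sym (ℤₚ.*-assoc (+ 2) (+ 2) ⟨ G₂ ∘ M₁ ⟩)) (trans (⟨⟩-odd-part (+ 4) (G₂ ∘ M₁)
        (λ (a , b , x , y) → fo y b * gt x a + fo x a * gt y b) E₁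
        (λ a b x y → trans (l (χ₃ (x - y) * D 3 (x - y - y)) (χ₄ a * D 4 (a + b))) (trans (cong₂ _*_ (table₃-M₁ x y) (table₄-antidiagonal a b)) (l′ (χ₃ y) (t x) (χ₃ x) (t y) (χ₄ a) (o b) (χ₄ b) (o a)))) E₁-even)
        (trans (⟨⟩-+ (λ (a , b , x , y) → fo y b * gt x a) (λ (a , b , x , y) → fo x a * gt y b))
          (trans (cong₂ _+_ (transposed fo gt) (trans (⟨⟩-swap (λ (a , b , x , y) → fo y b * gt x a)) (transposed fo gt))) (l″ ⟨ fo ∣ gt ⟩)))))
        where
        l : ∀ u v → + 4 * (u * v) ≡ (+ 2 * u) * (+ 2 * v)
        l = solve-∀
        l′ : ∀ p q r s u v w z → (p * q - r * s) * (u * v - w * z) ≡ p * v * (u * q) + r * z * (w * s) + (- (p * q * (w * z)) + - (r * s * (u * v)))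
        l′ = solve-∀
        l″ : ∀ u → u + u ≡ + 2 * u
        l″ = solve-∀
      E₂ : Quad → ℤ
      E₂ (a , b , x , y) = χ₃ y * t x * (χ₄ b * D 4 a)
      E₂-even : ∀ v → E₂ (negate₁ v) ≡ E₂ v
      E₂-even (a , b , x , y) = cong₂ (λ p q → χ₃ y * p * (χ₄ b * q)) (t-neg x) (D-neg 4 a)
      part₂ : + 2 * ⟨ G₂ ∘ M₂ ⟩ ≡ - 1ℤ * ⟨ f4 ∣ gt ⟩
      part₂ = trans (⟨⟩-odd-part (+ 2) (G₂ ∘ M₂) (λ (a , b , x , y) → - 1ℤ * (f4 x a * gt y b)) E₂
        (λ a b x y → trans (sym (ℤₚ.*-assoc (+ 2) (χ₃ y * D 3 (y - (x - y))) (χ₄ (a + b) * D 4 a)))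
          (trans (cong₂ _*_ (table₃-M₂ x y) (table₄-axis a b)) (l (χ₃ y) (t x) (χ₃ x) (t y) (χ₄ b) (D 4 a)))) E₂-even)
        (trans (⟨⟩-* (- 1ℤ) (λ (a , b , x , y) → f4 x a * gt y b)) (cong (- 1ℤ *_) (trans (⟨⟩-swap (λ (a , b , x , y) → f4 y b * gt x a)) (transposed f4 gt))))
        where
        l : ∀ p q r s u v → (p * q - r * s) * (u * v) ≡ - 1ℤ * (r * v * (u * s)) + p * q * (u * v)
        l = solve-∀

    interior₃ : + 2 * (⟨ G₃ ⟩ - ⟨ G₃ ∘ M₁ ⟩ - ⟨ G₃ ∘ M₂ ⟩) ≡ q₁ - q₃ - p₃
    interior₃ = begin
      + 2 * (⟨ G₃ ⟩ - ⟨ G₃ ∘ M₁ ⟩ - ⟨ G₃ ∘ M₂ ⟩) ≡⟨ l₀ ⟨ G₃ ⟩ ⟨ G₃ ∘ M₁ ⟩ ⟨ G₃ ∘ M₂ ⟩ ⟩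
      + 2 * ⟨ G₃ ⟩ - + 2 * ⟨ G₃ ∘ M₁ ⟩ - + 2 * ⟨ G₃ ∘ M₂ ⟩ ≡⟨ cong₂ (λ u v → + 2 * ⟨ G₃ ⟩ - u - v) part₁ part₂ ⟩
      + 2 * ⟨ G₃ ⟩ - - 1ℤ * ⟨ f4 ∣ gt ⟩ - p₃ ≡⟨ cong₂ (λ u v → + 2 * u - - 1ℤ * v - p₃) (⟨⟩-even₁ G₃ G₃-even) (t-split f4) ⟩
      + 2 * 0ℤ - - 1ℤ * (q₁ - q₃) - p₃ ≡⟨ l₁ q₁ q₃ p₃ ⟩
      q₁ - q₃ - p₃ ∎
      where
      open ≡-Reasoning
      f4 gt : ℤ → ℤ → ℤ
      f4 b y = χ₃ b * D 4 y
      gt a x = χ₄ x * t a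
      l₀ : ∀ u v w → + 2 * (u - v - w) ≡ + 2 * u - + 2 * v - + 2 * w
      l₀ = solve-∀
      l₁ : ∀ p q r → + 2 * 0ℤ - - 1ℤ * (p - q) - r ≡ p - q - r
      l₁ = solve-∀
      G₃-even : ∀ v → G₃ (negate₁ v) ≡ G₃ v
      G₃-even (a , b , x , y) = trans (cong₂ (λ p q → p * D 3 b * (q * D 4 y)) (χ₃-neg a) (χ₄-neg x)) (l (χ₃ a) (χ₄ x) (D 3 b) (D 4 y))
        where
        l : ∀ p q r s → - p * r * (- q * s) ≡ p * r * (q * s)
        l = solve-∀
      E₁ : Quad → ℤ
      E₁ (a , b , x , y) = χ₃ a * t b * (χ₄ x * D 4 y)
      E₁-even : ∀ v → E₁ (negate₁ v) ≡ E₁ v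
      E₁-even (a , b , x , y) = trans (cong₂ (λ p q → p * t b * (q * D 4 y)) (χ₃-neg a) (χ₄-neg x)) (l (χ₃ a) (χ₄ x) (t b) (D 4 y))
        where
        l : ∀ p q r s → - p * r * (- q * s) ≡ p * r * (q * s)
        l = solve-∀
      part₁ : + 2 * ⟨ G₃ ∘ M₁ ⟩ ≡ - 1ℤ * ⟨ f4 ∣ gt ⟩
      part₁ = trans (⟨⟩-odd-part (+ 2) (G₃ ∘ M₁) (λ (a , b , x , y) → - 1ℤ * (f4 b y * gt a x)) E₁
        (λ a b x y → trans (sym (ℤₚ.*-assoc (+ 2) (χ₃ a * D 3 (a + b)) (χ₄ (x - y) * D 4 y)))
          (trans (cong₂ _*_ (table₃-antidiagonal a b) (table₄-axis′ x y)) (l (χ₃ a) (t b) (χ₃ b) (t a) (χ₄ x) (D 4 y)))) E₁-even)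
        (⟨⟩-* (- 1ℤ) (λ (a , b , x , y) → f4 b y * gt a x))
        where
        l : ∀ p q r s u v → (p * q - r * s) * (u * v) ≡ - 1ℤ * (r * v * (u * s)) + p * q * (u * v)
        l = solve-∀
      E₂ : Quad → ℤ
      E₂ (a , b , x , y) = χ₃ b * D 3 a * (χ₄ y * o x)
      E₂-even : ∀ v → E₂ (negate₁ v) ≡ E₂ v
      E₂-even (a , b , x , y) = cong₂ (λ p q → χ₃ b * p * (χ₄ y * q)) (D-neg 3 a) (o-neg x)
      part₂ : + 2 * ⟨ G₃ ∘ M₂ ⟩ ≡ p₃
      part₂ = ⟨⟩-odd-part (+ 2) (G₃ ∘ M₂) _ E₂
        (λ a b x y → trans (l (χ₃ (a + b) * D 3 a) (χ₄ y * D 4 (x - y)))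
          (trans (cong₂ _*_ (table₃-axis a b) (table₄-diagonal x y)) (l′ (χ₃ b) (D 3 a) (χ₄ y) (o x) (χ₄ x) (o y)))) E₂-even
        where
        l : ∀ u v → + 2 * (u * v) ≡ u * (+ 2 * v)
        l = solve-∀
        l′ : ∀ p q u v w z → p * q * (u * v + w * z) ≡ p * z * (q * w) + p * q * (u * v)
        l′ = solve-∀

    -- The multiplicities 1, 1, 2 are chosen so that `p₁` and `p₃` cancel.
    interior : + 2 * (⟨ G₁ ⟩ - ⟨ G₁ ∘ M₁ ⟩ - ⟨ G₁ ∘ M₂ ⟩) + + 2 * (⟨ G₂ ⟩ - ⟨ G₂ ∘ M₁ ⟩ - ⟨ G₂ ∘ M₂ ⟩)
      + + 2 * (+ 2 * (⟨ G₃ ⟩ - ⟨ G₃ ∘ M₁ ⟩ - ⟨ G₃ ∘ M₂ ⟩)) ≡ + 2 * q₁ - + 6 * q₃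
    interior = trans (cong₂ _+_ (cong₂ _+_ interior₁ interior₂) (cong (+ 2 *_) interior₃)) (l p₁ p₃ q₁ q₃)
      where
      l : ∀ p₁ p₃ q₁ q₃ → p₁ + p₃ - + 2 * q₁ - + 2 * q₃ + (+ 2 * (q₁ - q₃) - (p₁ - p₃)) + + 2 * (q₁ - q₃ - p₃) ≡ + 2 * q₁ - + 6 * q₃
      l = solve-∀

    -- Since `4 ∣ y`, the equation gives `a x ≡ N ≡ 3` modulo 4, hence `χ₄ x = - χ₄ a` on the
    -- support. Exchanging `a` and `x` therefore negates the sum.
    q₁-vanishes : + N ≈ + 3 [ 4 ] → q₁ ≡ 0ℤ
    q₁-vanishes N≈3 = self-negative q₁ (trans (⟨⟩-cong reflected) (trans (trans (⟨⟩-* (- 1ℤ) (λ (a , b , x , y) → χ₃ b * D 4 y * χ₄ a)) (ℤₚ.-1*i≡-i ⟨ (λ (a , b , x , y) → χ₃ b * D 4 y * χ₄ a) ⟩))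
        (cong -_ (sym (∣-flip (λ b y → χ₃ b * D 4 y) (λ a x → χ₄ x))))))
      where
      character : ∀ a b x y → a * x + b * y ≡ + N → D 4 y ≢ 0ℤ → χ₄ a * χ₄ x ≡ - 1ℤ
      character a b x y eq h = trans (sym (χ₄-* a x)) (χ₄-periodic {a * x} {+ 3} (≈-trans (by (- (b * y₄)) (trans (l (a * x) (b * y))
        (trans (cong (λ z → z - b * y) eq) (trans (cong (λ z → + N - b * z) y≡) (l′ (+ N) b y₄))))) N≈3))
        where
        y₄ = factor (D≢0 4 y h)
        y≡ : y ≡ y₄ * + 4
        y≡ = trans (equation (D≢0 4 y h)) (ℤₚ.+-identityˡ _)
        l : ∀ u v → u ≡ u + v - v
        l = solve-∀
        l′ : ∀ n b q → n - b * (q * + 4) ≡ n + - (b * q) * + 4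
        l′ = solve-∀
      values : ∀ p q → p * q ≡ - 1ℤ → p * p ≡ 1ℤ → q ≡ - 1ℤ * p
      values p q pq pp = trans (sym (ℤₚ.*-identityˡ q)) (trans (cong (_* q) (sym pp)) (trans (l p q) (trans (cong (p *_) pq) (ℤₚ.*-comm p (- 1ℤ)))))
        where
        l : ∀ p q → p * p * q ≡ p * (p * q)
        l = solve-∀
      square : ∀ a → χ₄ a * χ₄ a ≡ o a
      square = by-residues {4} (λ p → cong₂ _*_ (χ₄-periodic p) (χ₄-periodic p)) o-periodic check₁
      reflected : ∀ a b x y → a * x + b * y ≡ + N → χ₃ b * D 4 y * χ₄ x ≡ - 1ℤ * (χ₃ b * D 4 y * χ₄ a)
      reflected a b x y eq with D 4 y ℤ.≟ 0ℤ
      ... | yes D≡0 = trans (cong (λ z → χ₃ b * z * χ₄ x) D≡0) (trans (l (χ₃ b) (χ₄ x) (χ₄ a)) (cong (λ z → - 1ℤ * (χ₃ b * z * χ₄ a)) (sym D≡0)))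
        where
        l : ∀ p q r → p * 0ℤ * q ≡ - 1ℤ * (p * 0ℤ * r)
        l = solve-∀
      ... | no D≢ = trans (cong (χ₃ b * D 4 y *_) (values (χ₄ a) (χ₄ x) ax (one (χ₄ a) (χ₄ x) (D 2 a) ax (square a) (boolean a))))
          (l (χ₃ b * D 4 y) (χ₄ a))
        where
        ax = character a b x y eq D≢
        l : ∀ u p → u * (- 1ℤ * p) ≡ - 1ℤ * (u * p)
        l = solve-∀
        boolean : ∀ a → χ₄ a * D 2 a ≡ 0ℤ
        boolean = by-residues {4} (λ p → cong₂ _*_ (χ₄-periodic p) (D-periodic 2 (4⇒2 p))) (λ _ → refl) check₁
        one : ∀ p q d → p * q ≡ - 1ℤ → p * p ≡ 1ℤ - d → p * d ≡ 0ℤ → p * p ≡ 1ℤ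
        one p q d pq pp pd = trans pp (trans (cong (λ z → 1ℤ - z) d≡0) refl)
          where
          d≡0 : d ≡ 0ℤ
          d≡0 = trans (l₁ d) (trans (cong (λ z → - (z * d)) (sym pq)) (trans (l₂ p q d) (trans (cong (λ z → - (q * z)) pd) (l₃ q))))
            where
            l₁ : ∀ d → d ≡ - (- 1ℤ * d)
            l₁ = solve-∀
            l₂ : ∀ p q d → - (p * q * d) ≡ - (q * (p * d))
            l₂ = solve-∀
            l₃ : ∀ q → - (q * 0ℤ) ≡ 0ℤ
            l₃ = solve-∀

-- Sums over divisor pairs, and the inner sums on the boundary planes.

module DivisorPairs where

  open FiniteSums
  open Congruences
  open LiouvilleIdentity
  open Progressions
  open InteriorTerms
  import Data.Fin as Fin
  open import Data.Fin using (Fin; suc)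
  open import Data.Fin.Patterns
  open import Data.Nat as ℕ using (ℕ; suc; z≤n; s≤s)
  import Data.Nat.Properties as ℕₚ
  open import Data.Integer using (ℤ; +_; _+_; _*_; _-_; -_; 0ℤ; 1ℤ; _≤_; _<_)
  import Data.Integer.Properties as ℤₚ
  open import Data.Integer.Tactic.RingSolver using (solve-∀)
  open import Data.Product using (∃; _×_; _,_; proj₁; proj₂)
  open import Function using (flip)
  open import Relation.Binary.PropositionalEquality

  module Pairs (N : ℕ) where

    -- The analogue of `ω` for the single product `a x = N`. Divisors of both signs occur, so an odd
    -- function gives twice its sum over positive divisors.
    ϖ : ℤ × ℤ → ℤ
    ϖ (a , x) = c a x * δ (a * x - + N)

    abstract
      ⟪_⟫ : (ℤ → ℤ → ℤ) → ℤ
      ⟪ f ⟫ = ∑ {ℤ × ℤ} (box N) (λ (a , x) → f a x * ϖ (a , x))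

      ⟪⟫-HasSum : ∀ f → HasSum {ℤ × ℤ} (λ (a , x) → f a x * ϖ (a , x)) ⟪ f ⟫
      ⟪⟫-HasSum f = HasSum-box N λ (a , x) h → bounded a x (*≢0ʳ {f a x} h)
        where
        bounded : ∀ a x → ϖ (a , x) ≢ 0ℤ → size (a , x) ℕ.≤ N
        bounded a x h with c≢0 a x (*≢0ˡ {_} {δ (a * x - + N)} h)
        ... | m , n , am , xn , ax = ℕₚ.⊔-lub (ℕₚ.≤-trans (ℕₚ.≤-reflexive am) (ℕₚ.≤-trans (ℕₚ.m≤m*n (suc m) (suc n)) le))
                                              (ℕₚ.≤-trans (ℕₚ.≤-reflexive xn) (ℕₚ.≤-trans (ℕₚ.m≤n*m (suc n) (suc m)) le))
          where
          le : suc m ℕ.* suc n ℕ.≤ N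
          le = ℕₚ.≤-reflexive (ℤₚ.+-injective (trans (sym ax) (ℤₚ.i-j≡0⇒i≡j _ _ (δ≢0 (a * x - + N) (*≢0ʳ {c a x} h)))))

    ⟪⟫-cong : ∀ {f g} → (∀ a x → a * x ≡ + N → f a x ≡ g a x) → ⟪ f ⟫ ≡ ⟪ g ⟫
    ⟪⟫-cong {f} {g} f≡g = HasSum-unique (HasSum-cong pointwise (⟪⟫-HasSum f)) (⟪⟫-HasSum g)
      where
      pointwise : ∀ q → f (proj₁ q) (proj₂ q) * ϖ q ≡ g (proj₁ q) (proj₂ q) * ϖ q
      pointwise (a , x) = trans (sym (ℤₚ.*-assoc (f a x) (c a x) _))
        (trans (guard (a * x - + N) λ p → cong (_* c a x) (f≡g a x (ℤₚ.i-j≡0⇒i≡j _ _ p))) (ℤₚ.*-assoc (g a x) (c a x) _))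

    ⟪⟫-+ : ∀ f g → ⟪ (λ a x → f a x + g a x) ⟫ ≡ ⟪ f ⟫ + ⟪ g ⟫
    ⟪⟫-+ f g = HasSum-unique (⟪⟫-HasSum _)
      (HasSum-cong (λ (a , x) → sym (ℤₚ.*-distribʳ-+ (ϖ (a , x)) (f a x) (g a x))) (HasSum-+ (⟪⟫-HasSum f) (⟪⟫-HasSum g)))

    ⟪⟫-* : ∀ k f → ⟪ (λ a x → k * f a x) ⟫ ≡ k * ⟪ f ⟫
    ⟪⟫-* k f = HasSum-unique (⟪⟫-HasSum _)
      (HasSum-cong (λ (a , x) → sym (ℤₚ.*-assoc k (f a x) (ϖ (a , x)))) (HasSum-* k (⟪⟫-HasSum f)))

    ⟪⟫-linear : ∀ k f l g → ⟪ (λ a x → k * f a x + l * g a x) ⟫ ≡ k * ⟪ f ⟫ + l * ⟪ g ⟫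
    ⟪⟫-linear k f l g = trans (⟪⟫-+ (λ a x → k * f a x) (λ a x → l * g a x)) (cong₂ _+_ (⟪⟫-* k f) (⟪⟫-* l g))

    ⟪⟫-flip : ∀ f → ⟪ flip f ⟫ ≡ ⟪ f ⟫
    ⟪⟫-flip f = HasSum-unique (⟪⟫-HasSum (flip f)) (HasSum-cong
      (λ (a , x) → cong (f x a *_) (cong₂ (λ p q → p * δ (q - + N)) (c-sym x a) (ℤₚ.*-comm x a)))
      (HasSum-bijection (λ (a , x) → x , a) (λ (a , x) → x , a) (λ _ → refl) (λ _ → refl) (⟪⟫-HasSum f)))

  module _ where
    vanish : ∀ m .{{_ : ℕ.NonZero m}} {u e} → u * D m e ≡ 0ℤ → e ≡ 0ℤ → u ≡ 0ℤ
    vanish m {u} eq refl = trans (sym (ℤₚ.*-identityʳ u)) (trans (cong (u *_) (sym (D-1 m ≈-refl))) eq)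

    -- The factors of the weights modulo 3 and modulo 4. The vanishing tables for them and for `V₃`,
    -- `V₄` show on which hyperplanes a weight is zero, hence which boundary terms are absent.
    U₃ U₄ : ℤ → ℤ → ℤ
    U₃ x y = χ₃ x * D 3 (x - y)
    U₄ x y = χ₄ x * two y

    U₃-periodic : Periodic₂ {3} {3} U₃
    U₃-periodic p q = cong₂ _*_ (χ₃-periodic p) (D-periodic 3 (≈-- p q))

    U₄-periodic : Periodic₂ {4} {4} U₄
    U₄-periodic p q = cong₂ _*_ (χ₄-periodic p) (two-periodic q)

    U₃-x : ∀ x y → U₃ x y * D 3 x ≡ 0ℤ
    U₃-x = by-residues₂ (λ p q → cong₂ _*_ (U₃-periodic p q) (D-periodic 3 p)) (λ _ _ → refl) check₂

    U₃-y : ∀ x y → U₃ x y * D 3 y ≡ 0ℤ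
    U₃-y = by-residues₂ (λ p q → cong₂ _*_ (U₃-periodic p q) (D-periodic 3 q)) (λ _ _ → refl) check₂

    U₃-x+y : ∀ x y → U₃ x y * D 3 (x + y) ≡ 0ℤ
    U₃-x+y = by-residues₂ (λ p q → cong₂ _*_ (U₃-periodic p q) (D-periodic 3 (≈-+ p q))) (λ _ _ → refl) check₂

    V₃ V₄ : ℤ → ℤ → ℤ
    V₃ a b = χ₃ a * D 3 b
    V₄ a b = χ₄ a * D 4 b

    V₃-periodic : Periodic₂ {3} {3} V₃
    V₃-periodic p q = cong₂ _*_ (χ₃-periodic p) (D-periodic 3 q)

    V₄-periodic : Periodic₂ {4} {4} V₄
    V₄-periodic p q = cong₂ _*_ (χ₄-periodic p) (D-periodic 4 q)

    V₃-a : ∀ a b → V₃ a b * D 3 a ≡ 0ℤ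
    V₃-a = by-residues₂ (λ p q → cong₂ _*_ (V₃-periodic p q) (D-periodic 3 p)) (λ _ _ → refl) check₂

    V₃-difference : ∀ a b → V₃ a b * D 3 (b - a) ≡ 0ℤ
    V₃-difference = by-residues₂ (λ p q → cong₂ _*_ (V₃-periodic p q) (D-periodic 3 (≈-- q p))) (λ _ _ → refl) check₂

    V₃-difference′ : ∀ a b → V₃ a b * D 3 (a - b) ≡ 0ℤ
    V₃-difference′ = by-residues₂ (λ p q → cong₂ _*_ (V₃-periodic p q) (D-periodic 3 (≈-- p q))) (λ _ _ → refl) check₂

    V₄-a : ∀ a b → V₄ a b * D 4 a ≡ 0ℤ
    V₄-a = by-residues₂ (λ p q → cong₂ _*_ (V₄-periodic p q) (D-periodic 4 p)) (λ _ _ → refl) check₂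

    V₄-sum : ∀ a b → V₄ a b * D 4 (a + b) ≡ 0ℤ
    V₄-sum = by-residues₂ (λ p q → cong₂ _*_ (V₄-periodic p q) (D-periodic 4 (≈-+ p q))) (λ _ _ → refl) check₂

    V₄-difference : ∀ a b → V₄ a b * D 4 (b - a) ≡ 0ℤ
    V₄-difference = by-residues₂ (λ p q → cong₂ _*_ (V₄-periodic p q) (D-periodic 4 (≈-- q p))) (λ _ _ → refl) check₂

    V₄-difference′ : ∀ a b → V₄ a b * D 4 (a - b) ≡ 0ℤ
    V₄-difference′ = by-residues₂ (λ p q → cong₂ _*_ (V₄-periodic p q) (D-periodic 4 (≈-- p q))) (λ _ _ → refl) check₂

    *-0ˡ : ∀ {u} v → u ≡ 0ℤ → u * v ≡ 0ℤ
    *-0ˡ v refl = ℤₚ.*-zeroˡ v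

    kill : ∀ {g} e s → (e ≡ 0ℤ → g ≡ 0ℤ) → g * (δ e * s) ≡ 0ℤ
    kill {g} e s f = trans (l g (δ e) s) (trans (cong (s *_) (guard {g} {0ℤ} e f)) (trans (cong (s *_) (ℤₚ.*-zeroˡ (δ e))) (ℤₚ.*-zeroʳ s)))
      where
      l : ∀ g d s → g * (d * s) ≡ s * (g * d)
      l = solve-∀

    -- A weight that vanishes for `f ≡ 0ℤ` removes the second summand of `h`. `h-right` and `h-both`
    -- use the vanishing on the other axis or on both.
    h-left : ∀ {g} e f → (f ≡ 0ℤ → g ≡ 0ℤ) → g * h e f ≡ g * (δ e * sgn f)
    h-left {g} e f k = trans (ℤₚ.*-distribˡ-+ g (δ e * sgn f) (δ f * sgn e))
      (trans (cong (λ z → g * (δ e * sgn f) + z) (kill f (sgn e) k)) (ℤₚ.+-identityʳ _))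

    h-right : ∀ {g} e f → (e ≡ 0ℤ → g ≡ 0ℤ) → g * h e f ≡ g * (δ f * sgn e)
    h-right {g} e f k = trans (ℤₚ.*-distribˡ-+ g (δ e * sgn f) (δ f * sgn e))
      (trans (cong (_+ g * (δ f * sgn e)) (kill e (sgn f) k)) (ℤₚ.+-identityˡ _))

    h-both : ∀ {g} e f → (e ≡ 0ℤ → g ≡ 0ℤ) → (f ≡ 0ℤ → g ≡ 0ℤ) → g * h e f ≡ 0ℤ
    h-both e f k k′ = trans (h-left e f k′) (kill e (sgn f) k)

  module _ where
    -- The sum over the free variable `y` on the plane `b = 0` for `G₂`. Existence and value are
    -- recorded together, with the denominator 3 cleared.
    Inner₂ : ℤ → Set
    Inner₂ x = ∃ λ ι → HasSum (λ y → χ₃ x * (D 3 (x - y) * (sgn (x + y) - sgn y))) ι × + 3 * ι ≡ χ₃ x * (+ 2 * (x - χ₃ x))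

    inner₂-case : ∀ {x} (i : Fin 3) → x ≈ rep i [ 3 ] → Inner₂ x
    inner₂-case 0F (by q refl) = 0ℤ , HasSum-0 (λ y → *-0ˡ _ χ≡0) , sym (*-0ˡ _ χ≡0)
      where
      χ≡0 : χ₃ (+ 0 + q * + 3) ≡ 0ℤ
      χ≡0 = χ₃-periodic {z = + 0} (by q refl)
    inner₂-case 1F (by q refl) = 1ℤ * (+ 2 * q) , HasSum-cong (λ y → cong₂ (λ u v → u * (v * (sgn (+ 1 + q * + 3 + y) - sgn y))) (sym χ≡) (sym (D≡ y)))
        (HasSum-* 1ℤ (window {x = + 1 + q * + 3} 1 2 q (s≤s z≤n) (s≤s (s≤s z≤n)) (s≤s z≤n) (s≤s (s≤s (s≤s z≤n))) (l₁ q))) ,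
        trans (l₂ q) (cong (λ u → u * (+ 2 * (+ 1 + q * + 3 - u))) (sym χ≡))
      where
      χ≡ : χ₃ (+ 1 + q * + 3) ≡ 1ℤ
      χ≡ = χ₃-periodic {z = + 1} (by q refl)
      l₁ : ∀ q → + 1 + q * + 3 + + 1 ≡ + 2 + q * + 3
      l₁ = solve-∀
      l₂ : ∀ q → + 3 * (1ℤ * (+ 2 * q)) ≡ 1ℤ * (+ 2 * (+ 1 + q * + 3 - 1ℤ))
      l₂ = solve-∀
      l₃ : ∀ q y → - (+ 1 + q * + 3 - y) ≡ y - + 1 + - q * + 3
      l₃ = solve-∀
      D≡ : ∀ y → D 3 (+ 1 + q * + 3 - y) ≡ D 3 (y - + 1)
      D≡ y = trans (sym (D-neg 3 (+ 1 + q * + 3 - y))) (D-periodic 3 {z = y - + 1} (by (- q) (l₃ q y)))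
    inner₂-case 2F (by q refl) = - 1ℤ * (+ 2 * (q + 1ℤ)) , HasSum-cong (λ y → cong₂ (λ u v → u * (v * (sgn (+ 2 + q * + 3 + y) - sgn y))) (sym χ≡) (sym (D≡ y)))
        (HasSum-* (- 1ℤ) (window {x = + 2 + q * + 3} 2 1 (q + 1ℤ) (s≤s z≤n) (s≤s (s≤s (s≤s z≤n))) (s≤s z≤n) (s≤s (s≤s z≤n)) (l₁ q))) ,
        trans (l₂ q) (cong (λ u → u * (+ 2 * (+ 2 + q * + 3 - u))) (sym χ≡))
      where
      χ≡ : χ₃ (+ 2 + q * + 3) ≡ - 1ℤ
      χ≡ = χ₃-periodic {z = + 2} (by q refl)
      l₁ : ∀ q → + 2 + q * + 3 + + 2 ≡ + 1 + (q + 1ℤ) * + 3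
      l₁ = solve-∀
      l₂ : ∀ q → + 3 * (- 1ℤ * (+ 2 * (q + 1ℤ))) ≡ - 1ℤ * (+ 2 * (+ 2 + q * + 3 - - 1ℤ))
      l₂ = solve-∀
      l₃ : ∀ q y → - (+ 2 + q * + 3 - y) ≡ y - + 2 + - q * + 3
      l₃ = solve-∀
      D≡ : ∀ y → D 3 (+ 2 + q * + 3 - y) ≡ D 3 (y - + 2)
      D≡ y = trans (sym (D-neg 3 (+ 2 + q * + 3 - y))) (D-periodic 3 {z = y - + 2} (by (- q) (l₃ q y)))

  inner₂ : ∀ x → Inner₂ x
  inner₂ x = inner₂-case (res 3 x) (rep-res 3 x)

  module _ where
    Inner₃ : ℤ → Set
    Inner₃ x = ∃ λ ι → HasSum (λ y → χ₄ x * (D 4 y * (sgn (x + y) - sgn y))) ι × + 2 * ι ≡ χ₄ x * (x + χ₄ x)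

    inner₃-case : ∀ {x} (i : Fin 4) → x ≈ rep i [ 4 ] → Inner₃ x
    inner₃-case 0F (by q refl) = 0ℤ , HasSum-0 (λ y → *-0ˡ _ χ≡0) , sym (*-0ˡ _ χ≡0)
      where
      χ≡0 : χ₄ (+ 0 + q * + 4) ≡ 0ℤ
      χ≡0 = χ₄-periodic {z = + 0} (by q refl)
    inner₃-case 1F (by q refl) = 1ℤ * (+ 2 * q + 1ℤ) , HasSum-cong (λ y → cong (λ u → u * (D 4 y * (sgn (+ 1 + q * + 4 + y) - sgn y))) (sym χ≡))
        (HasSum-* 1ℤ (window₀ {x = + 1 + q * + 4} 1 q (s≤s z≤n) (s≤s (s≤s z≤n)) refl)) , trans (l q) (cong (λ u → u * (+ 1 + q * + 4 + u)) (sym χ≡))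
      where
      χ≡ : χ₄ (+ 1 + q * + 4) ≡ 1ℤ
      χ≡ = χ₄-periodic {z = + 1} (by q refl)
      l : ∀ q → + 2 * (1ℤ * (+ 2 * q + 1ℤ)) ≡ 1ℤ * (+ 1 + q * + 4 + 1ℤ)
      l = solve-∀
    inner₃-case 2F (by q refl) = 0ℤ , HasSum-0 (λ y → *-0ˡ _ χ≡0) , sym (*-0ˡ _ χ≡0)
      where
      χ≡0 : χ₄ (+ 2 + q * + 4) ≡ 0ℤ
      χ≡0 = χ₄-periodic {z = + 2} (by q refl)
    inner₃-case 3F (by q refl) = - 1ℤ * (+ 2 * q + 1ℤ) , HasSum-cong (λ y → cong (λ u → u * (D 4 y * (sgn (+ 3 + q * + 4 + y) - sgn y))) (sym χ≡))
        (HasSum-* (- 1ℤ) (window₀ {x = + 3 + q * + 4} 3 q (s≤s z≤n) (s≤s (s≤s (s≤s (s≤s z≤n)))) refl)) , trans (l q) (cong (λ u → u * (+ 3 + q * + 4 + u)) (sym χ≡))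
      where
      χ≡ : χ₄ (+ 3 + q * + 4) ≡ - 1ℤ
      χ≡ = χ₄-periodic {z = + 3} (by q refl)
      l : ∀ q → + 2 * (- 1ℤ * (+ 2 * q + 1ℤ)) ≡ - 1ℤ * (+ 3 + q * + 4 + - 1ℤ)
      l = solve-∀

  inner₃ : ∀ x → Inner₃ x
  inner₃ x = inner₃-case (res 4 x) (rep-res 4 x)

  module _ where
    Inner₃′ : ℤ → Set
    Inner₃′ a = ∃ λ ι → HasSum (λ b → χ₃ a * (D 3 b * (sgn (b - a) - sgn b))) ι × + 3 * ι ≡ χ₃ a * - (+ 2 * a + χ₃ a)

    inner₃′-case : ∀ {a} (i : Fin 3) → a ≈ rep i [ 3 ] → Inner₃′ a
    inner₃′-case 0F (by q refl) = 0ℤ , HasSum-0 (λ y → *-0ˡ _ χ≡0) , sym (*-0ˡ _ χ≡0)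
      where
      χ≡0 : χ₃ (+ 0 + q * + 3) ≡ 0ℤ
      χ≡0 = χ₃-periodic {z = + 0} (by q refl)
    inner₃′-case 1F (by q refl) = 1ℤ * (+ 2 * (- q - 1ℤ) + 1ℤ) , HasSum-cong (λ y → cong₂ (λ u v → u * (D 3 y * (sgn v - sgn y))) (sym χ≡) (ℤₚ.+-comm (- (+ 1 + q * + 3)) y))
        (HasSum-* 1ℤ (window₀ {x = - (+ 1 + q * + 3)} 2 (- q - 1ℤ) (s≤s z≤n) (s≤s (s≤s (s≤s z≤n))) (l₁ q))) , trans (l₂ q) (cong (λ u → u * - (+ 2 * (+ 1 + q * + 3) + u)) (sym χ≡))
      where
      χ≡ : χ₃ (+ 1 + q * + 3) ≡ 1ℤ
      χ≡ = χ₃-periodic {z = + 1} (by q refl)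
      l₁ : ∀ q → - (+ 1 + q * + 3) ≡ + 2 + (- q - 1ℤ) * + 3
      l₁ = solve-∀
      l₂ : ∀ q → + 3 * (1ℤ * (+ 2 * (- q - 1ℤ) + 1ℤ)) ≡ 1ℤ * - (+ 2 * (+ 1 + q * + 3) + 1ℤ)
      l₂ = solve-∀
    inner₃′-case 2F (by q refl) = - 1ℤ * (+ 2 * (- q - 1ℤ) + 1ℤ) , HasSum-cong (λ y → cong₂ (λ u v → u * (D 3 y * (sgn v - sgn y))) (sym χ≡) (ℤₚ.+-comm (- (+ 2 + q * + 3)) y))
        (HasSum-* (- 1ℤ) (window₀ {x = - (+ 2 + q * + 3)} 1 (- q - 1ℤ) (s≤s z≤n) (s≤s (s≤s z≤n)) (l₁ q))) , trans (l₂ q) (cong (λ u → u * - (+ 2 * (+ 2 + q * + 3) + u)) (sym χ≡))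
      where
      χ≡ : χ₃ (+ 2 + q * + 3) ≡ - 1ℤ
      χ≡ = χ₃-periodic {z = + 2} (by q refl)
      l₁ : ∀ q → - (+ 2 + q * + 3) ≡ + 1 + (- q - 1ℤ) * + 3
      l₁ = solve-∀
      l₂ : ∀ q → + 3 * (- 1ℤ * (+ 2 * (- q - 1ℤ) + 1ℤ)) ≡ - 1ℤ * - (+ 2 * (+ 2 + q * + 3) + - 1ℤ)
      l₂ = solve-∀

  inner₃′ : ∀ a → Inner₃′ a
  inner₃′ a = inner₃′-case (res 3 a) (rep-res 3 a)

  module _ where
    12⇒3 : ∀ {y z} → y ≈ z [ 12 ] → y ≈ z [ 3 ]
    12⇒3 {z = z} (by q eq) = by (q * + 4) (trans eq (l z q))
      where
      l : ∀ z q → z + q * + 12 ≡ z + q * + 4 * + 3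
      l = solve-∀

    12⇒4 : ∀ {y z} → y ≈ z [ 12 ] → y ≈ z [ 4 ]
    12⇒4 {z = z} (by q eq) = by (q * + 3) (trans eq (l z q))
      where
      l : ∀ z q → z + q * + 12 ≡ z + q * + 3 * + 4
      l = solve-∀

    χ₁₂ : ℤ → ℤ
    χ₁₂ x = χ₃ x * χ₄ x

    Inner₁ : ℤ → Set
    Inner₁ x = ∃ λ ι → HasSum (λ y → χ₁₂ x * (D 3 (x - y) * two y * (sgn (x + y) - sgn y))) ι × + 6 * ι ≡ χ₁₂ x * (x - + 3 * χ₄ x + + 2 * χ₃ x)

    inner₁-zero : ∀ {x} i → x ≈ i [ 12 ] → χ₁₂ i ≡ 0ℤ → Inner₁ x
    inner₁-zero {x} i p χi = 0ℤ , HasSum-0 (λ y → *-0ˡ _ χ≡0) , sym (*-0ˡ _ χ≡0)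
      where
      χ≡0 : χ₁₂ x ≡ 0ℤ
      χ≡0 = trans (cong₂ _*_ (χ₃-periodic (12⇒3 p)) (χ₄-periodic (12⇒4 p))) χi

    -- By the Chinese remainder theorem, `y ≡ x` modulo 3 and `y ≡ 2` modulo 4 single out one class
    -- `r` modulo 12.
    crt : ∀ ρ r → (∀ (i : Fin 12) → D 3 (+ ρ - rep i) * two (rep i) ≡ D 12 (rep i - + r)) → ∀ {x} → x ≈ + ρ [ 12 ] → ∀ y → D 3 (x - y) * two y ≡ D 12 (y - + r)
    crt ρ r table {x} p y = trans (cong (_* two y) (D-periodic 3 (≈-- {3} {x} {+ ρ} {y} {y} (12⇒3 p) ≈-refl)))
      (by-residues {12} (λ q → cong₂ _*_ (D-periodic 3 (≈-- {3} {+ ρ} {+ ρ} ≈-refl (12⇒3 q))) (two-periodic (12⇒4 q)))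
        (λ q → D-periodic 12 (≈-- q (≈-refl {z = + r}))) table y)

    -- `ρ` is the class of `x` modulo 12, `r` is the class of `y` from `crt`, and
    -- `ρ + r = r′ + 12 n` locates `x + y`. The hypothesis on `12 n` matches the value `2 (q + n)`
    -- of `window` with one linear function of `x` for all units `ρ`.
    inner₁-window : ∀ ρ r r′ n → 0 ℕ.< r → r ℕ.< 12 → 0 ℕ.< r′ → r′ ℕ.< 12 → + ρ + + r ≡ + r′ + + n * + 12 →
      (∀ (i : Fin 12) → D 3 (+ ρ - rep i) * two (rep i) ≡ D 12 (rep i - + r)) → + 12 * + n ≡ + ρ - + 3 * χ₄ (+ ρ) + + 2 * χ₃ (+ ρ) →
      ∀ {x} → x ≈ + ρ [ 12 ] → Inner₁ x
    inner₁-window ρ r r′ n 0<r r<12 0<r′ r′<12 sum table value {x} p@(by q refl) =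
      χ₁₂ x * (+ 2 * (q + + n)) , HasSum-* (χ₁₂ x) (HasSum-cong (λ y → cong (_* (sgn (x + y) - sgn y)) (sym (crt ρ r table p y)))
        (window {x = x} r r′ (q + + n) 0<r r<12 0<r′ r′<12 (trans (l₁ (+ ρ) q (+ r)) (trans (cong (λ z → z + q * + 12) sum) (l₂ (+ r′) (+ n) q))))) ,
      trans (l₃ (χ₁₂ x) q (+ n)) (cong (χ₁₂ x *_) (trans (cong (λ z → q * + 12 + z) value) (trans (l₄ q (+ ρ) (χ₄ (+ ρ)) (χ₃ (+ ρ)))
        (cong₂ (λ u v → x - + 3 * u + + 2 * v) (sym (χ₄-periodic (12⇒4 p))) (sym (χ₃-periodic (12⇒3 p)))))))
      where
      l₁ : ∀ ρ q r → ρ + q * + 12 + r ≡ ρ + r + q * + 12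
      l₁ = solve-∀
      l₂ : ∀ r n q → r + n * + 12 + q * + 12 ≡ r + (q + n) * + 12
      l₂ = solve-∀
      l₃ : ∀ χ q n → + 6 * (χ * (+ 2 * (q + n))) ≡ χ * (q * + 12 + + 12 * n)
      l₃ = solve-∀
      l₄ : ∀ q ρ u v → q * + 12 + (ρ - + 3 * u + + 2 * v) ≡ ρ + q * + 12 - + 3 * u + + 2 * v
      l₄ = solve-∀

  module _ where
    inner₁-case : ∀ {x} (i : Fin 12) → x ≈ rep i [ 12 ] → Inner₁ x
    inner₁-case 0F p = inner₁-zero (+ 0) p refl
    inner₁-case 1F p = inner₁-window 1 10 11 0 (s≤s z≤n) (ℕₚ.≤ᵇ⇒≤ 11 12 _) (s≤s z≤n) (ℕₚ.≤ᵇ⇒≤ 12 12 _) refl check₁ refl p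
    inner₁-case 2F p = inner₁-zero (+ 2) p refl
    inner₁-case 3F p = inner₁-zero (+ 3) p refl
    inner₁-case 4F p = inner₁-zero (+ 4) p refl
    inner₁-case 5F p = inner₁-window 5 2 7 0 (s≤s z≤n) (ℕₚ.≤ᵇ⇒≤ 3 12 _) (s≤s z≤n) (ℕₚ.≤ᵇ⇒≤ 8 12 _) refl check₁ refl p
    inner₁-case 6F p = inner₁-zero (+ 6) p refl
    inner₁-case 7F p = inner₁-window 7 10 5 1 (s≤s z≤n) (ℕₚ.≤ᵇ⇒≤ 11 12 _) (s≤s z≤n) (ℕₚ.≤ᵇ⇒≤ 6 12 _) refl check₁ refl p
    inner₁-case 8F p = inner₁-zero (+ 8) p refl
    inner₁-case 9F p = inner₁-zero (+ 9) p refl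
    inner₁-case (Fin.suc (Fin.suc (Fin.suc (Fin.suc (Fin.suc (Fin.suc (Fin.suc (Fin.suc (Fin.suc (Fin.suc 0F)))))))))) p = inner₁-zero (+ 10) p refl
    inner₁-case (Fin.suc (Fin.suc (Fin.suc (Fin.suc (Fin.suc (Fin.suc (Fin.suc (Fin.suc (Fin.suc (Fin.suc 1F)))))))))) p =
      inner₁-window 11 2 1 1 (s≤s z≤n) (ℕₚ.≤ᵇ⇒≤ 3 12 _) (s≤s z≤n) (ℕₚ.≤ᵇ⇒≤ 2 12 _) refl check₁ refl p

  inner₁ : ∀ x → Inner₁ x
  inner₁ x = inner₁-case (res 12 x) (rep-res 12 x)

-- The boundary side of Liouville's identity, and the value of the convolution sum.

module BoundaryTerms where

  open FiniteSums
  open Congruences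
  open LiouvilleIdentity
  open Progressions
  open InteriorTerms
  open DivisorPairs
  open import Data.Nat using (ℕ)
  open import Data.Integer using (ℤ; +_; _+_; _*_; _-_; -_; 0ℤ; 1ℤ)
  import Data.Integer.Properties as ℤₚ
  open import Data.Integer.Tactic.RingSolver using (solve-∀)
  open import Data.Product using (∃; _×_; _,_; proj₁; proj₂)
  open import Function using (_∘_; flip)
  open import Relation.Binary.PropositionalEquality
  open import Data.Sum using (_⊎_; inj₁; inj₂)
  open import Data.Fin using (Fin)
  open import Data.Fin.Patterns

  module Boundary (N : ℕ) (N≈3 : + N ≈ + 3 [ 4 ]) where

    open Convolution N
    open Interior N
    open Pairs N

    N≢0 : + N ≢ 0ℤ
    N≢0 eq with trans (sym (χ₄-periodic N≈3)) (cong χ₄ eq)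
    ... | ()

    expand : ∀ g a b x y → g * boundary (a , b , x , y) ≡
      c a (x + y) * (g * h (b - a) y) + c (b - a) y * (g * h a (x + y)) + (c b (x + y) * (g * h (a - b) x) + c (a - b) x * (g * h b (x + y)))
      - (c a x * (g * h b y) + c b y * (g * h a x))
    expand g a b x y = l g (c a (x + y)) (h (b - a) y) (c (b - a) y) (h a (x + y)) (c b (x + y)) (h (a - b) x) (c (a - b) x) (h b (x + y)) (c a x) (h b y) (c b y) (h a x)
      where
      l : ∀ g c₁ h₁ c₂ h₂ c₃ h₃ c₄ h₄ c₅ h₅ c₆ h₆ → g * (c₁ * h₁ + c₂ * h₂ + (c₃ * h₃ + c₄ * h₄) - (c₅ * h₅ + c₆ * h₆)) ≡
        c₁ * (g * h₁) + c₂ * (g * h₂) + (c₃ * (g * h₃) + c₄ * (g * h₄)) - (c₅ * (g * h₅) + c₆ * (g * h₆))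
      l = solve-∀

    -- On the plane `b = 0` the equation reads `a x = N` and `y` is free, so the sum over `y` is
    -- carried out for each pair `(a , x)` and a sum over divisor pairs remains.
    plane-sum : ∀ (k w : ℤ → ℤ → ℤ) (ι : ℤ → ℤ) → (∀ x → HasSum (w x) (ι x)) →
      HasSum (λ (a , b , x , y) → δ b * (c a x * (k a x * w x y)) * δ (eqn (a , b , x , y))) ⟪ (λ a x → k a x * ι x) ⟫
    plane-sum k w ι q = HasSum-reindex {A = (ℤ × ℤ) × ℤ} {B = Quad} {u = u} {v = v} (λ ((a , x) , y) → a , 0ℤ , x , y) (λ (a , b , x , y) → (a , x) , y)
      (λ ((a , x) , y) _ → refl , value a x y)
      (λ (a , b , x , y) ne → let b≡0 = δ≢0 b (*≢0ˡ {_} {c a x * (k a x * w x y)} (*≢0ˡ {_} {δ (eqn (a , b , x , y))} ne)) in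
        cong (λ z → a , z , x , y) (sym b≡0) , trans (sym (value a x y)) (cong (λ z → v (a , z , x , y)) (sym b≡0)))
      (HasSum-subst total-≡ (proj₂ exists))
      where
      u : (ℤ × ℤ) × ℤ → ℤ
      u ((a , x) , y) = ϖ (a , x) * (k a x * w x y)
      v : Quad → ℤ
      v (a , b , x , y) = δ b * (c a x * (k a x * w x y)) * δ (eqn (a , b , x , y))
      value : ∀ a x y → v (a , 0ℤ , x , y) ≡ u ((a , x) , y)
      value a x y = trans (cong (λ z → 1ℤ * (c a x * (k a x * w x y)) * δ (z - + N)) (ℤₚ.+-identityʳ (a * x))) (l (c a x) (k a x * w x y) (δ (a * x - + N)))
        where
        l : ∀ p q r → 1ℤ * (p * q) * r ≡ p * r * q
        l = solve-∀
      inner : ∀ p → HasSum (λ y → u (p , y)) (ϖ p * (k (proj₁ p) (proj₂ p) * ι (proj₂ p)))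
      inner (a , x) = HasSum-* (ϖ (a , x)) (HasSum-* (k a x) (q x))
      exists : ∃ λ s → HasSum u s
      exists = HasSum-Σ {A = ℤ × ℤ} {B = ℤ} {u = λ p → 1ℤ * ϖ p} {w = u} (⟪⟫-HasSum (λ _ _ → 1ℤ))
        (λ p y ne e → ne (trans (cong (_* (k (proj₁ p) (proj₂ p) * w (proj₂ p) y)) (trans (sym (ℤₚ.*-identityˡ (ϖ p))) e)) (ℤₚ.*-zeroˡ (k (proj₁ p) (proj₂ p) * w (proj₂ p) y)))) inner
      total-≡ : proj₁ exists ≡ ⟪ (λ a x → k a x * ι x) ⟫
      total-≡ = HasSum-unique {A = ℤ × ℤ} (HasSum-cong (λ p → ℤₚ.*-comm (ϖ p) (k (proj₁ p) (proj₂ p) * ι (proj₂ p)))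
        (HasSum-fubini {A = ℤ × ℤ} {B = ℤ} {w = u} (proj₂ exists) inner)) (⟪⟫-HasSum (λ a x → k a x * ι x))

    S₁ S₂ S₃ : ℤ
    S₁ = + 2 * (⟨ G₁ ⟩ - ⟨ G₁ ∘ M₁ ⟩ - ⟨ G₁ ∘ M₂ ⟩)
    S₂ = + 2 * (⟨ G₂ ⟩ - ⟨ G₂ ∘ M₁ ⟩ - ⟨ G₂ ∘ M₂ ⟩)
    S₃ = + 2 * (⟨ G₃ ⟩ - ⟨ G₃ ∘ M₁ ⟩ - ⟨ G₃ ∘ M₂ ⟩)

    private
      minus-0 : ∀ a → a - 0ℤ ≡ a
      minus-0 = ℤₚ.+-identityʳ

      on-plane : ∀ {p q r s} b → (b ≡ 0ℤ → p * q ≡ r * s) → p * (δ b * q) ≡ δ b * (r * s)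
      on-plane {p} {q} {r} {s} b f = trans (l₁ p (δ b) q) (trans (guard b f) (ℤₚ.*-comm (r * s) (δ b)))
        where
        l₁ : ∀ p d q → p * (d * q) ≡ p * q * d
        l₁ = solve-∀

      product-0ˡ : ∀ {u v} → u ≡ 0ℤ → u * v ≡ 0ℤ
      product-0ˡ {_} {v} refl = ℤₚ.*-zeroˡ v

      product-0ʳ : ∀ {u v} → v ≡ 0ℤ → u * v ≡ 0ℤ
      product-0ʳ {u} {_} refl = ℤₚ.*-zeroʳ u

    w₂ : ℤ → ℤ → ℤ
    w₂ x y = χ₃ x * (D 3 (x - y) * (sgn (x + y) - sgn y))

    -- The congruences in `G₂` annihilate four of the six terms. The other two lie on `b = 0` and
    -- combine to the difference `sgn (x + y) - sgn y`.
    boundary₂ : ∀ a b x y → G₂ (a , b , x , y) * boundary (a , b , x , y) ≡ δ b * (c a x * (χ₄ a * w₂ x y))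
    boundary₂ a b x y = trans (expand G a b x y) (trans (cong₂ _-_
        (cong₂ _+_ (cong₂ (λ u v → c a (x + y) * u + c (b - a) y * v) (h-both (b - a) y k-difference k-y) (h-both a (x + y) k-a k-x+y))
                   (cong₂ (λ u v → c b (x + y) * u + c (a - b) x * v) (h-both (a - b) x k-difference′ k-x) (h-left b (x + y) k-x+y)))
        (cong₂ (λ u v → c a x * u + c b y * v) (h-left b y k-y) (h-both a x k-a k-x)))
      (trans (l (c a (x + y)) (c (b - a) y) (c b (x + y)) (c (a - b) x) (c a x) (c b y) G (δ b) (sgn (x + y)) (sgn y))
        (on-plane {G} {c (a - b) x * sgn (x + y) - c a x * sgn y} {c a x} {χ₄ a * w₂ x y} b at-0)))
      where
      G : ℤ
      G = G₂ (a , b , x , y)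
      k-y : y ≡ 0ℤ → G ≡ 0ℤ
      k-y e = product-0ˡ {U₃ x y} {V₄ a b} (vanish 3 {U₃ x y} {y} (U₃-y x y) e)
      k-x : x ≡ 0ℤ → G ≡ 0ℤ
      k-x e = product-0ˡ {U₃ x y} {V₄ a b} (vanish 3 {U₃ x y} {x} (U₃-x x y) e)
      k-x+y : x + y ≡ 0ℤ → G ≡ 0ℤ
      k-x+y e = product-0ˡ {U₃ x y} {V₄ a b} (vanish 3 {U₃ x y} {x + y} (U₃-x+y x y) e)
      k-a : a ≡ 0ℤ → G ≡ 0ℤ
      k-a e = product-0ʳ {U₃ x y} {V₄ a b} (vanish 4 {V₄ a b} {a} (V₄-a a b) e)
      k-difference : b - a ≡ 0ℤ → G ≡ 0ℤ
      k-difference e = product-0ʳ {U₃ x y} {V₄ a b} (vanish 4 {V₄ a b} {b - a} (V₄-difference a b) e)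
      k-difference′ : a - b ≡ 0ℤ → G ≡ 0ℤ
      k-difference′ e = product-0ʳ {U₃ x y} {V₄ a b} (vanish 4 {V₄ a b} {a - b} (V₄-difference′ a b) e)
      l : ∀ c₁ c₂ c₃ c₄ c₅ c₆ g d s s′ → c₁ * 0ℤ + c₂ * 0ℤ + (c₃ * 0ℤ + c₄ * (g * (d * s))) - (c₅ * (g * (d * s′)) + c₆ * 0ℤ) ≡ g * (d * (c₄ * s - c₅ * s′))
      l = solve-∀
      at-0 : b ≡ 0ℤ → G * (c (a - b) x * sgn (x + y) - c a x * sgn y) ≡ c a x * (χ₄ a * w₂ x y)
      at-0 refl = trans (cong (λ z → G * (c z x * sgn (x + y) - c a x * sgn y)) (minus-0 a))
        (l′ (χ₃ x) (D 3 (x - y)) (χ₄ a) (c a x) (sgn (x + y)) (sgn y))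
        where
        l′ : ∀ u d v c s s′ → u * d * (v * 1ℤ) * (c * s - c * s′) ≡ c * (v * (u * (d * (s - s′))))
        l′ = solve-∀

    sum₂ : + 3 * S₂ ≡ ⟪ (λ a x → χ₄ a * (χ₃ x * (+ 2 * (x - χ₃ x)))) ⟫
    sum₂ = trans (cong (+ 3 *_) (HasSum-unique (HasSum-cong (λ (a , b , x , y) → cong (_* δ (eqn (a , b , x , y))) (boundary₂ a b x y)) (liouville N≢0 G₂))
        (plane-sum (λ a x → χ₄ a) w₂ (λ x → proj₁ (inner₂ x)) (λ x → proj₁ (proj₂ (inner₂ x))))))
      (trans (sym (⟪⟫-* (+ 3) (λ a x → χ₄ a * proj₁ (inner₂ x)))) (⟪⟫-cong λ a x _ → trans (l (χ₄ a) (proj₁ (inner₂ x))) (cong (χ₄ a *_) (proj₂ (proj₂ (inner₂ x))))))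
      where
      l : ∀ u v → + 3 * (u * v) ≡ u * (+ 3 * v)
      l = solve-∀

    w₃ w₃′ : ℤ → ℤ → ℤ
    w₃ x y = χ₄ x * (D 4 y * (sgn (x + y) - sgn y))
    w₃′ a b = χ₃ a * (D 3 b * (sgn (b - a) - sgn b))

    -- The conditions `3 ∣ b` and `4 ∣ y` admit zeros of both `b` and `y`, so two planes contribute;
    -- three of the six terms vanish.
    boundary₃ : ∀ a b x y → G₃ (a , b , x , y) * boundary (a , b , x , y) ≡ δ b * (c a x * (χ₃ a * w₃ x y)) + δ y * (c a x * (χ₄ x * w₃′ a b))
    boundary₃ a b x y = trans (expand G a b x y) (trans (cong₂ _-_
        (cong₂ _+_ (cong₂ (λ u v → c a (x + y) * u + c (b - a) y * v) (h-right (b - a) y k-difference) (h-both a (x + y) k-a k-x+y))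
                   (cong₂ (λ u v → c b (x + y) * u + c (a - b) x * v) (h-both (a - b) x k-difference′ k-x) (h-left b (x + y) k-x+y)))
        (cong₂ (λ u v → c a x * u + c b y * v) (refl {x = G * h b y}) (h-both a x k-a k-x)))
      (trans (l (c a (x + y)) (c (b - a) y) (c b (x + y)) (c (a - b) x) (c a x) (c b y) G (δ b) (δ y) (sgn (b - a)) (sgn (x + y)) (sgn y) (sgn b))
        (cong₂ _+_ (on-plane {G} {c (a - b) x * sgn (x + y) - c a x * sgn y} {c a x} {χ₃ a * w₃ x y} b at-b)
                   (on-plane {G} {c a (x + y) * sgn (b - a) - c a x * sgn b} {c a x} {χ₄ x * w₃′ a b} y at-y))))
      where
      G : ℤ
      G = G₃ (a , b , x , y)
      k-difference : b - a ≡ 0ℤ → G ≡ 0ℤ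
      k-difference e = product-0ˡ {V₃ a b} {V₄ x y} (vanish 3 {V₃ a b} {b - a} (V₃-difference a b) e)
      k-difference′ : a - b ≡ 0ℤ → G ≡ 0ℤ
      k-difference′ e = product-0ˡ {V₃ a b} {V₄ x y} (vanish 3 {V₃ a b} {a - b} (V₃-difference′ a b) e)
      k-a : a ≡ 0ℤ → G ≡ 0ℤ
      k-a e = product-0ˡ {V₃ a b} {V₄ x y} (vanish 3 {V₃ a b} {a} (V₃-a a b) e)
      k-x : x ≡ 0ℤ → G ≡ 0ℤ
      k-x e = product-0ʳ {V₃ a b} {V₄ x y} (vanish 4 {V₄ x y} {x} (V₄-a x y) e)
      k-x+y : x + y ≡ 0ℤ → G ≡ 0ℤ
      k-x+y e = product-0ʳ {V₃ a b} {V₄ x y} (vanish 4 {V₄ x y} {x + y} (V₄-sum x y) e)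
      l : ∀ c₁ c₂ c₃ c₄ c₅ c₆ g d e s₁ s₂ s₃ s₄ → c₁ * (g * (e * s₁)) + c₂ * 0ℤ + (c₃ * 0ℤ + c₄ * (g * (d * s₂))) - (c₅ * (g * (d * s₃ + e * s₄)) + c₆ * 0ℤ)
        ≡ g * (d * (c₄ * s₂ - c₅ * s₃)) + g * (e * (c₁ * s₁ - c₅ * s₄))
      l = solve-∀
      at-b : b ≡ 0ℤ → G * (c (a - b) x * sgn (x + y) - c a x * sgn y) ≡ c a x * (χ₃ a * w₃ x y)
      at-b refl = trans (cong (λ z → G * (c z x * sgn (x + y) - c a x * sgn y)) (minus-0 a)) (l′ (χ₃ a) (χ₄ x) (D 4 y) (c a x) (sgn (x + y)) (sgn y))
        where
        l′ : ∀ u v d c s s′ → u * 1ℤ * (v * d) * (c * s - c * s′) ≡ c * (u * (v * (d * (s - s′))))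
        l′ = solve-∀
      at-y : y ≡ 0ℤ → G * (c a (x + y) * sgn (b - a) - c a x * sgn b) ≡ c a x * (χ₄ x * w₃′ a b)
      at-y refl = trans (cong (λ z → G * (c a z * sgn (b - a) - c a x * sgn b)) (ℤₚ.+-identityʳ x)) (l′ (χ₃ a) (χ₄ x) (D 3 b) (c a x) (sgn (b - a)) (sgn b))
        where
        l′ : ∀ u v d c s s′ → u * d * (v * 1ℤ) * (c * s - c * s′) ≡ c * (v * (u * (d * (s - s′))))
        l′ = solve-∀

    -- Interchanging `(a , b)` with `(x , y)` carries the plane `y = 0` to the plane `b = 0`.
    transposed-sum : ∀ (k w : ℤ → ℤ → ℤ) (ι : ℤ → ℤ) → (∀ a → HasSum (w a) (ι a)) →
      HasSum (λ (a , b , x , y) → δ y * (c a x * (k x a * w a b)) * δ (eqn (a , b , x , y))) ⟪ (λ x a → k x a * ι a) ⟫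
    transposed-sum k w ι q = HasSum-cong (λ (a , b , x , y) → cong₂ (λ p r → δ y * (p * (k x a * w a b)) * δ (r - + N)) (c-sym x a) (cong₂ _+_ (ℤₚ.*-comm x a) (ℤₚ.*-comm y b)))
      (HasSum-bijection transpose transpose (λ _ → refl) (λ _ → refl) (plane-sum k w ι q))

    sum₃ : + 6 * S₃ ≡ + 3 * ⟪ (λ a x → χ₃ a * (χ₄ x * (x + χ₄ x))) ⟫ + + 2 * ⟪ (λ x a → χ₄ x * (χ₃ a * - (+ 2 * a + χ₃ a))) ⟫
    sum₃ = trans (cong (+ 6 *_) (HasSum-unique (HasSum-cong
        (λ (a , b , x , y) → trans (cong (_* δ (eqn (a , b , x , y))) (boundary₃ a b x y)) (ℤₚ.*-distribʳ-+ (δ (eqn (a , b , x , y))) (δ b * (c a x * (χ₃ a * w₃ x y))) (δ y * (c a x * (χ₄ x * w₃′ a b)))))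
        (liouville N≢0 G₃))
        (HasSum-+ (plane-sum (λ a x → χ₃ a) w₃ ι₃ (λ x → proj₁ (proj₂ (inner₃ x)))) (transposed-sum (λ x a → χ₄ x) w₃′ ι₃′ (λ a → proj₁ (proj₂ (inner₃′ a)))))))
      (trans (l ⟪ (λ a x → χ₃ a * ι₃ x) ⟫ ⟪ (λ x a → χ₄ x * ι₃′ a) ⟫) (cong₂ (λ u v → + 3 * u + + 2 * v)
        (trans (sym (⟪⟫-* (+ 2) (λ a x → χ₃ a * ι₃ x))) (⟪⟫-cong λ a x _ → trans (l₂ (+ 2) (χ₃ a) (ι₃ x)) (cong (χ₃ a *_) (proj₂ (proj₂ (inner₃ x))))))
        (trans (sym (⟪⟫-* (+ 3) (λ x a → χ₄ x * ι₃′ a))) (⟪⟫-cong λ x a _ → trans (l₂ (+ 3) (χ₄ x) (ι₃′ a)) (cong (χ₄ x *_) (proj₂ (proj₂ (inner₃′ a))))))))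
      where
      ι₃ ι₃′ : ℤ → ℤ
      ι₃ x = proj₁ (inner₃ x)
      ι₃′ a = proj₁ (inner₃′ a)
      l : ∀ u v → + 6 * (u + v) ≡ + 3 * (+ 2 * u) + + 2 * (+ 3 * v)
      l = solve-∀
      l₂ : ∀ k u v → k * (u * v) ≡ u * (k * v)
      l₂ = solve-∀

    w₁ : ℤ → ℤ → ℤ
    w₁ x y = χ₁₂ x * (D 3 (x - y) * two y * (sgn (x + y) - sgn y))

    two-vanishes : ∀ a b x y → a * x + b * y ≡ + N → a ≡ 0ℤ → two y ≡ 0ℤ
    two-vanishes a b x y eq refl = trans (sym (ℤₚ.*-identityʳ (two y))) (trans (cong (two y *_) (sym one)) (trans (l (two y) (χ₄ b) (χ₄ y))
        (trans (cong (λ z → - (χ₄ b * z)) (even y)) (cong -_ (ℤₚ.*-zeroʳ (χ₄ b))))))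
      where
      even : ∀ y → two y * χ₄ y ≡ 0ℤ
      even = by-residues {4} (λ p → cong₂ _*_ (two-periodic p) (χ₄-periodic p)) (λ _ → refl) check₁
      one : - (χ₄ b * χ₄ y) ≡ 1ℤ
      one = cong -_ (trans (sym (χ₄-* b y)) (trans (cong χ₄ (trans (sym (ℤₚ.+-identityˡ (b * y))) eq)) (χ₄-periodic N≈3)))
      l : ∀ u v w → u * - (v * w) ≡ - (v * (u * w))
      l = solve-∀

    -- Since `G₁` does not involve `a` and `b`, the plane `b = a` survives besides `b = 0`. The
    -- equation serves to exclude `a = 0`, where `b y ≡ 3` modulo 4 would make `y` odd.
    boundary₁ : ∀ a b x y → a * x + b * y ≡ + N → G₁ (a , b , x , y) * boundary (a , b , x , y) ≡
      δ b * (c a x * (1ℤ * w₁ x y)) + δ (b - a) * (c a (x + y) * (1ℤ * w₁ (x + y) (- y)))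
    boundary₁ a b x y eq = trans (expand G a b x y) (trans (cong₂ _-_
        (cong₂ _+_ (cong₂ (λ u v → c a (x + y) * u + c (b - a) y * v) (h-left (b - a) y k-y) (h-both a (x + y) k-a k-x+y))
                   (cong₂ (λ u v → c b (x + y) * u + c (a - b) x * v) (trans (h-left (a - b) x k-x) (cong (λ z → G * (z * sgn x)) (trans (cong δ (l₀ a b)) (δ-neg (b - a))))) (h-left b (x + y) k-x+y)))
        (cong₂ (λ u v → c a x * u + c b y * v) (h-left b y k-y) (h-both a x k-a k-x)))
      (trans (l (c a (x + y)) (c (b - a) y) (c b (x + y)) (c (a - b) x) (c a x) (c b y) G (δ b) (δ (b - a)) (sgn y) (sgn x) (sgn (x + y)))
        (cong₂ _+_ (on-plane {G} {c (a - b) x * sgn (x + y) - c a x * sgn y} {c a x} {1ℤ * w₁ x y} b at-b)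
                   (on-plane {G} {c a (x + y) * sgn y + c b (x + y) * sgn x} {c a (x + y)} {1ℤ * w₁ (x + y) (- y)} (b - a) at-difference))))
      where
      G : ℤ
      G = G₁ (a , b , x , y)
      l₀ : ∀ a b → a - b ≡ - (b - a)
      l₀ = solve-∀
      k-y : y ≡ 0ℤ → G ≡ 0ℤ
      k-y e = product-0ˡ {U₃ x y} {U₄ x y} (vanish 3 {U₃ x y} {y} (U₃-y x y) e)
      k-x : x ≡ 0ℤ → G ≡ 0ℤ
      k-x e = product-0ˡ {U₃ x y} {U₄ x y} (vanish 3 {U₃ x y} {x} (U₃-x x y) e)
      k-x+y : x + y ≡ 0ℤ → G ≡ 0ℤ
      k-x+y e = product-0ˡ {U₃ x y} {U₄ x y} (vanish 3 {U₃ x y} {x + y} (U₃-x+y x y) e)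
      k-a : a ≡ 0ℤ → G ≡ 0ℤ
      k-a e = product-0ʳ {U₃ x y} {U₄ x y} (product-0ʳ {χ₄ x} {two y} (two-vanishes a b x y eq e))
      l : ∀ c₁ c₂ c₃ c₄ c₅ c₆ g d e s₁ s₂ s₃ → c₁ * (g * (e * s₁)) + c₂ * 0ℤ + (c₃ * (g * (e * s₂)) + c₄ * (g * (d * s₃))) - (c₅ * (g * (d * s₁)) + c₆ * 0ℤ)
        ≡ g * (d * (c₄ * s₃ - c₅ * s₁)) + g * (e * (c₁ * s₁ + c₃ * s₂))
      l = solve-∀
      at-b : b ≡ 0ℤ → G * (c (a - b) x * sgn (x + y) - c a x * sgn y) ≡ c a x * (1ℤ * w₁ x y)
      at-b refl = trans (cong (λ z → G * (c z x * sgn (x + y) - c a x * sgn y)) (minus-0 a)) (l′ (χ₃ x) (χ₄ x) (D 3 (x - y)) (two y) (c a x) (sgn (x + y)) (sgn y))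
        where
        l′ : ∀ u v d e c s s′ → u * d * (v * e) * (c * s - c * s′) ≡ c * (1ℤ * (u * v * (d * e * (s - s′))))
        l′ = solve-∀
      three-part : ∀ x y → U₃ x y ≡ - (χ₃ (x + y) * D 3 (x + y - - y))
      three-part = by-residues₂ U₃-periodic (λ p q → cong -_ (cong₂ _*_ (χ₃-periodic (≈-+ p q)) (D-periodic 3 (≈-- (≈-+ p q) (≈-neg q))))) check₂
      four-part : ∀ x y → U₄ x y ≡ - (χ₄ (x + y) * two (- y))
      four-part = by-residues₂ U₄-periodic (λ p q → cong -_ (cong₂ _*_ (χ₄-periodic (≈-+ p q)) (two-periodic (≈-neg q)))) check₂
      at-difference : b - a ≡ 0ℤ → G * (c a (x + y) * sgn y + c b (x + y) * sgn x) ≡ c a (x + y) * (1ℤ * w₁ (x + y) (- y))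
      at-difference e = trans (cong (λ z → G * (c a (x + y) * sgn y + c z (x + y) * sgn x)) (ℤₚ.i-j≡0⇒i≡j b a e))
        (trans (cong₂ (λ u v → u * v * (c a (x + y) * sgn y + c a (x + y) * sgn x)) (three-part x y) (four-part x y))
        (trans (l′ (χ₃ (x + y)) (χ₄ (x + y)) (D 3 (x + y - - y)) (two (- y)) (c a (x + y)) (sgn x) (sgn y))
          (cong₂ (λ u v → c a (x + y) * (1ℤ * (χ₁₂ (x + y) * (D 3 (x + y - - y) * two (- y) * (u - v))))) (cong sgn (l″ x y)) (sym (sgn-neg y)))))
        where
        l′ : ∀ u v d e c s s′ → - (u * d) * - (v * e) * (c * s′ + c * s) ≡ c * (1ℤ * (u * v * (d * e * (s - - s′))))
        l′ = solve-∀
        l″ : ∀ x y → x ≡ x + y + - y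
        l″ = solve-∀

    -- Both planes contribute the same amount: (a, b, x, y) ↦ (a, b - a, x + y, -y) carries one to the other.
    sum₁ : + 3 * S₁ ≡ ⟪ (λ a x → 1ℤ * (χ₁₂ x * (x - + 3 * χ₄ x + + 2 * χ₃ x))) ⟫
    sum₁ = trans (cong (+ 3 *_) (HasSum-unique (HasSum-cong pointwise (liouville N≢0 G₁)) (HasSum-+ first second)))
      (trans (l ⟪ (λ a x → 1ℤ * ι₁ x) ⟫) (trans (sym (⟪⟫-* (+ 6) (λ a x → 1ℤ * ι₁ x)))
        (⟪⟫-cong λ a x _ → trans (l₂ (+ 6) (ι₁ x)) (cong (1ℤ *_) (proj₂ (proj₂ (inner₁ x)))))))
      where
      ι₁ : ℤ → ℤ
      ι₁ x = proj₁ (inner₁ x)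
      l : ∀ u → + 3 * (u + u) ≡ + 6 * u
      l = solve-∀
      l₂ : ∀ k u → k * (1ℤ * u) ≡ 1ℤ * (k * u)
      l₂ = solve-∀
      f₁′ f₂′ : Quad → ℤ
      f₁′ (a , b , x , y) = δ b * (c a x * (1ℤ * w₁ x y))
      f₂′ (a , b , x , y) = δ (b - a) * (c a (x + y) * (1ℤ * w₁ (x + y) (- y)))
      pointwise : ∀ v → G₁ v * boundary v * δ (eqn v) ≡ f₁′ v * δ (eqn v) + f₂′ v * δ (eqn v)
      pointwise v@(a , b , x , y) = trans (guard (eqn v) (λ p → boundary₁ a b x y (eqn-≡ a b x y p))) (ℤₚ.*-distribʳ-+ (δ (eqn v)) (f₁′ v) (f₂′ v))
      first : HasSum (λ v → f₁′ v * δ (eqn v)) ⟪ (λ a x → 1ℤ * ι₁ x) ⟫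
      first = plane-sum (λ _ _ → 1ℤ) w₁ ι₁ (λ x → proj₁ (proj₂ (inner₁ x)))
      τ τ⁻ : Quad → Quad
      τ (a , b , x , y) = a , b - a , x + y , - y
      τ⁻ (a , b , x , y) = a , b + a , x + y , - y
      reflected : HasSum {Quad} (λ (a , b , x , y) → f₁′ (a , b , x , y) * δ (a * x + b * - y - + N)) ⟪ (λ a x → 1ℤ * ι₁ x) ⟫
      reflected = HasSum-cong {A = Quad} (λ (a , b , x , y) → trans (l₃ (δ b) (c a x * (1ℤ * w₁ x y)) (δ (eqn (a , b , x , y))))
          (trans (cong (c a x * (1ℤ * w₁ x y) *_) (guard′ b (λ z → δ (a * x + z * y - + N)) (λ z → δ (a * x + z * - y - + N)) refl))
            (sym (l₃ (δ b) (c a x * (1ℤ * w₁ x y)) (δ (a * x + b * - y - + N)))))) first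
        where
        l₃ : ∀ d u e → d * u * e ≡ u * (e * d)
        l₃ = solve-∀
        guard′ : ∀ b (F G : ℤ → ℤ) → F 0ℤ ≡ G 0ℤ → F b * δ b ≡ G b * δ b
        guard′ b F G e = guard {F b} {G b} b λ { refl → e }
      second : HasSum (λ v → f₂′ v * δ (eqn v)) ⟪ (λ a x → 1ℤ * ι₁ x) ⟫
      second = HasSum-cong (λ (a , b , x , y) → cong (λ z → f₂′ (a , b , x , y) * δ z) (l₄ a b x y (+ N))) (HasSum-bijection τ τ⁻ τ⁻τ ττ⁻ reflected)
        where
        l₄ : ∀ a b x y n → a * (x + y) + (b - a) * - - y - n ≡ a * x + b * y - n
        l₄ = solve-∀
        l₅ : ∀ a b → b - a + a ≡ b
        l₅ = solve-∀
        l₆ : ∀ a b → b + a - a ≡ b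
        l₆ = solve-∀
        l₇ : ∀ x y → x + y + - y ≡ x
        l₇ = solve-∀
        τ⁻τ : ∀ v → τ⁻ (τ v) ≡ v
        τ⁻τ (a , b , x , y) = cong₂ (λ u q → a , u , q) (l₅ a b) (cong₂ _,_ (l₇ x y) (ℤₚ.neg-involutive y))
        ττ⁻ : ∀ v → τ (τ⁻ v) ≡ v
        ττ⁻ (a , b , x , y) = cong₂ (λ u q → a , u , q) (l₆ a b) (cong₂ _,_ (l₇ x y) (ℤₚ.neg-involutive y))

    -- `e₁` and `e₂` become the two terms of the coefficient of the divisor sum in the theorem. `s₀`
    -- matches the contribution of the zero vector of the hexagonal lattice to `Λ`.
    e₁ e₂ s₀ : ℤ
    e₁ = ⟪ (λ a x → χ₃ a * χ₄ a * x) ⟫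
    e₂ = ⟪ (λ a x → χ₃ x * χ₄ x * x) ⟫
    s₀ = ⟪ (λ a x → D 3 a * χ₄ x) ⟫

    character : ∀ {a x} → a * x ≡ + N → χ₄ a * χ₄ x ≡ - 1ℤ
    character {a} {x} eq = trans (sym (χ₄-* a x)) (trans (cong χ₄ eq) (χ₄-periodic N≈3))

    squares : ∀ p q → χ₄ p * χ₄ q ≡ - 1ℤ → χ₄ q * χ₄ q ≡ 1ℤ
    squares p q = signs (χ₄-values p) (χ₄-values q)
      where
      Sign : ℤ → Set
      Sign z = z ≡ 0ℤ ⊎ (z ≡ 1ℤ ⊎ z ≡ - 1ℤ)
      χ₄-values : ∀ z → Sign (χ₄ z)
      χ₄-values z = subst Sign (sym (χ₄-periodic (rep-res 4 z))) (table (res 4 z))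
        where
        table : ∀ (i : Fin 4) → Sign (χ₄ (rep i))
        table 0F = inj₁ refl
        table 1F = inj₂ (inj₁ refl)
        table 2F = inj₁ refl
        table 3F = inj₂ (inj₂ refl)
      signs : ∀ {u v} → Sign u → Sign v → u * v ≡ - 1ℤ → v * v ≡ 1ℤ
      signs {u} _ (inj₁ refl) e with trans (sym (ℤₚ.*-zeroʳ u)) e
      ... | ()
      signs _ (inj₂ (inj₁ refl)) _ = refl
      signs _ (inj₂ (inj₂ refl)) _ = refl

    -- The two character values multiply to `χ₄ N = -1`, and the square of `χ₄ x` is therefore 1.
    opposite : ∀ {a x} → a * x ≡ + N → χ₄ a ≡ - χ₄ x
    opposite {a} {x} eq = trans (sym (ℤₚ.*-identityʳ (χ₄ a))) (trans (cong (χ₄ a *_) (sym (squares a x (character {a} {x} eq))))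
      (trans (sym (ℤₚ.*-assoc (χ₄ a) (χ₄ x) (χ₄ x))) (trans (cong (_* χ₄ x) (character {a} {x} eq)) (ℤₚ.-1*i≡-i (χ₄ x)))))

    χ₃-square : ∀ z → χ₃ z * χ₃ z ≡ 1ℤ - D 3 z
    χ₃-square = by-residues {3} (λ p → cong₂ _*_ (χ₃-periodic p) (χ₃-periodic p)) (λ p → cong (λ z → 1ℤ - z) (D-periodic 3 p)) check₁

    ⟪χ₄⟫ : ⟪ (λ a x → χ₄ x) ⟫ ≡ 0ℤ
    ⟪χ₄⟫ = self-negative _ (trans (sym (⟪⟫-flip (λ a x → χ₄ x))) (trans (⟪⟫-cong λ a x eq → trans (opposite {a} {x} eq) (sym (ℤₚ.-1*i≡-i (χ₄ x))))
      (trans (⟪⟫-* (- 1ℤ) (λ a x → χ₄ x)) (ℤₚ.-1*i≡-i _))))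

    ⟪D₃χ₄⟫ : ⟪ (λ a x → D 3 x * χ₄ x) ⟫ ≡ - s₀
    ⟪D₃χ₄⟫ = trans (sym (⟪⟫-flip (λ a x → D 3 x * χ₄ x))) (trans (⟪⟫-cong λ a x eq → trans (cong (D 3 a *_) (opposite {a} {x} eq)) (l (D 3 a) (χ₄ x)))
      (trans (⟪⟫-* (- 1ℤ) (λ a x → D 3 a * χ₄ x)) (ℤₚ.-1*i≡-i s₀)))
      where
      l : ∀ u v → u * - v ≡ - 1ℤ * (u * v)
      l = solve-∀

    -- The coefficients are those of `6 (S₁ + S₂ + 2 S₃)` after `sum₁`, `sum₂` and `sum₃`.
    -- Exchanging the two members of a pair makes the sums of `χ₃ a` and `χ₃ x` cancel, annihilates
    -- the sum of `χ₄ x`, and shows that the sums of `D 3 x * χ₄ x` and `D 3 a * χ₄ x` are opposite.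
    total : + 2 * ⟪ (λ a x → 1ℤ * (χ₁₂ x * (x - + 3 * χ₄ x + + 2 * χ₃ x))) ⟫ + + 2 * ⟪ (λ a x → χ₄ a * (χ₃ x * (+ 2 * (x - χ₃ x)))) ⟫
      + (+ 6 * ⟪ (λ a x → χ₃ a * (χ₄ x * (x + χ₄ x))) ⟫ + + 4 * ⟪ (λ a x → χ₄ x * (χ₃ a * - (+ 2 * a + χ₃ a))) ⟫) ≡ + 6 * e₂ - + 6 * e₁ + + 12 * s₀
    total = begin
      + 2 * ⟪ f₁′ ⟫ + + 2 * ⟪ f₂′ ⟫ + (+ 6 * ⟪ f₃ ⟫ + + 4 * ⟪ f₄ ⟫)
        ≡⟨ sym (trans (⟪⟫-+ (λ a x → + 2 * f₁′ a x + + 2 * f₂′ a x) (λ a x → + 6 * f₃ a x + + 4 * f₄ a x)) (cong₂ _+_ (⟪⟫-linear (+ 2) f₁′ (+ 2) f₂′) (⟪⟫-linear (+ 6) f₃ (+ 4) f₄))) ⟩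
      ⟪ (λ a x → + 2 * f₁′ a x + + 2 * f₂′ a x + (+ 6 * f₃ a x + + 4 * f₄ a x)) ⟫ ≡⟨ ⟪⟫-cong pointwise ⟩
      ⟪ (λ a x → (- + 2 * g₁ a x + + 8 * flip g₁ a x) + ((- + 6 * g₂ a x + + 6 * g₃ a x) + ((- + 6 * flip g₃ a x + + 4 * g₄ a x) + (- + 8 * g₅ a x + + 4 * g₆ a x)))) ⟫
        ≡⟨ trans (⟪⟫-+ (λ a x → - + 2 * g₁ a x + + 8 * flip g₁ a x) (λ a x → (- + 6 * g₂ a x + + 6 * g₃ a x) + ((- + 6 * flip g₃ a x + + 4 * g₄ a x) + (- + 8 * g₅ a x + + 4 * g₆ a x))))
           (cong₂ _+_ (⟪⟫-linear (- + 2) g₁ (+ 8) (flip g₁)) (trans (⟪⟫-+ (λ a x → - + 6 * g₂ a x + + 6 * g₃ a x) (λ a x → (- + 6 * flip g₃ a x + + 4 * g₄ a x) + (- + 8 * g₅ a x + + 4 * g₆ a x)))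
           (cong₂ _+_ (⟪⟫-linear (- + 6) g₂ (+ 6) g₃) (trans (⟪⟫-+ (λ a x → - + 6 * flip g₃ a x + + 4 * g₄ a x) (λ a x → - + 8 * g₅ a x + + 4 * g₆ a x))
           (cong₂ _+_ (⟪⟫-linear (- + 6) (flip g₃) (+ 4) g₄) (⟪⟫-linear (- + 8) g₅ (+ 4) g₆)))))) ⟩
      (- + 2 * e₂ + + 8 * ⟪ flip g₁ ⟫) + ((- + 6 * e₁ + + 6 * ⟪ g₃ ⟫) + ((- + 6 * ⟪ flip g₃ ⟫ + + 4 * ⟪ g₄ ⟫) + (- + 8 * ⟪ g₅ ⟫ + + 4 * s₀)))
        ≡⟨ cong₂ (λ u v → (- + 2 * e₂ + + 8 * u) + ((- + 6 * e₁ + + 6 * ⟪ g₃ ⟫) + v)) (⟪⟫-flip g₁)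
           (cong₂ (λ u v → (- + 6 * u + + 4 * v) + (- + 8 * ⟪ g₅ ⟫ + + 4 * s₀)) (⟪⟫-flip g₃) ⟪χ₄⟫) ⟩
      (- + 2 * e₂ + + 8 * e₂) + ((- + 6 * e₁ + + 6 * ⟪ g₃ ⟫) + ((- + 6 * ⟪ g₃ ⟫ + + 4 * 0ℤ) + (- + 8 * ⟪ g₅ ⟫ + + 4 * s₀)))
        ≡⟨ cong (λ u → (- + 2 * e₂ + + 8 * e₂) + ((- + 6 * e₁ + + 6 * ⟪ g₃ ⟫) + ((- + 6 * ⟪ g₃ ⟫ + + 4 * 0ℤ) + (- + 8 * u + + 4 * s₀)))) ⟪D₃χ₄⟫ ⟩
      (- + 2 * e₂ + + 8 * e₂) + ((- + 6 * e₁ + + 6 * ⟪ g₃ ⟫) + ((- + 6 * ⟪ g₃ ⟫ + + 4 * 0ℤ) + (- + 8 * - s₀ + + 4 * s₀)))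
        ≡⟨ l e₁ e₂ ⟪ g₃ ⟫ s₀ ⟩
      + 6 * e₂ - + 6 * e₁ + + 12 * s₀ ∎
      where
      open ≡-Reasoning
      f₁′ f₂′ f₃ f₄ g₁ g₂ g₃ g₄ g₅ g₆ : ℤ → ℤ → ℤ
      f₁′ a x = 1ℤ * (χ₁₂ x * (x - + 3 * χ₄ x + + 2 * χ₃ x))
      f₂′ a x = χ₄ a * (χ₃ x * (+ 2 * (x - χ₃ x)))
      f₃ a x = χ₃ a * (χ₄ x * (x + χ₄ x))
      f₄ a x = χ₄ x * (χ₃ a * - (+ 2 * a + χ₃ a))
      g₁ a x = χ₃ x * χ₄ x * x
      g₂ a x = χ₃ a * χ₄ a * x
      g₃ a x = χ₃ a
      g₄ a x = χ₄ x
      g₅ a x = D 3 x * χ₄ x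
      g₆ a x = D 3 a * χ₄ x
      l : ∀ e₁ e₂ g s → (- + 2 * e₂ + + 8 * e₂) + ((- + 6 * e₁ + + 6 * g) + ((- + 6 * g + + 4 * 0ℤ) + (- + 8 * - s + + 4 * s))) ≡ + 6 * e₂ - + 6 * e₁ + + 12 * s
      l = solve-∀
      -- An identity in free variables. Its last summand is a combination of the relations `p² = 1`,
      -- `u² = 1 - d` and `w² = 1 - d′`, which hold for the character values in question, so it
      -- vanishes there.
      polynomial : ∀ u w p a x d d′ → + 2 * (1ℤ * (u * p * (x - + 3 * p + + 2 * u))) + + 2 * (- p * (u * (+ 2 * (x - u)))) + (+ 6 * (w * (p * (x + p))) + + 4 * (p * (w * - (+ 2 * a + w)))) ≡
        (- + 2 * (u * p * x) + + 8 * (w * - p * a)) + ((- + 6 * (w * - p * x) + + 6 * w) + ((- + 6 * u + + 4 * p) + (- + 8 * (d * p) + + 4 * (d′ * p))))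
        + ((+ 6 * w - + 6 * u) * (p * p - 1ℤ) + + 8 * p * (u * u - (1ℤ - d)) - + 4 * p * (w * w - (1ℤ - d′)))
      polynomial = solve-∀
      pointwise : ∀ a x → a * x ≡ + N → + 2 * f₁′ a x + + 2 * f₂′ a x + (+ 6 * f₃ a x + + 4 * f₄ a x) ≡
        (- + 2 * g₁ a x + + 8 * flip g₁ a x) + ((- + 6 * g₂ a x + + 6 * g₃ a x) + ((- + 6 * flip g₃ a x + + 4 * g₄ a x) + (- + 8 * g₅ a x + + 4 * g₆ a x)))
      pointwise a x eq = trans (cong (λ v → + 2 * f₁′ a x + + 2 * (v * (χ₃ x * (+ 2 * (x - χ₃ x)))) + (+ 6 * f₃ a x + + 4 * f₄ a x)) (opposite {a} {x} eq))
        (trans (polynomial (χ₃ x) (χ₃ a) (χ₄ x) a x (D 3 x) (D 3 a)) (trans (cong (λ z → rest (- χ₄ x) + z) zero-≡) (trans (ℤₚ.+-identityʳ (rest (- χ₄ x))) (cong rest (sym (opposite {a} {x} eq))))))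
        where
        rest : ℤ → ℤ
        rest v = (- + 2 * g₁ a x + + 8 * (χ₃ a * v * a)) + ((- + 6 * (χ₃ a * v * x) + + 6 * g₃ a x) + ((- + 6 * flip g₃ a x + + 4 * g₄ a x) + (- + 8 * g₅ a x + + 4 * g₆ a x)))
        zero-≡ : (+ 6 * χ₃ a - + 6 * χ₃ x) * (χ₄ x * χ₄ x - 1ℤ) + + 8 * χ₄ x * (χ₃ x * χ₃ x - (1ℤ - D 3 x)) - + 4 * χ₄ x * (χ₃ a * χ₃ a - (1ℤ - D 3 a)) ≡ 0ℤ
        zero-≡ = trans (cong₂ (λ u v → (+ 6 * χ₃ a - + 6 * χ₃ x) * (u - 1ℤ) + + 8 * χ₄ x * (v - (1ℤ - D 3 x)) - + 4 * χ₄ x * (χ₃ a * χ₃ a - (1ℤ - D 3 a))) (squares a x (character {a} {x} eq)) (χ₃-square x))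
          (trans (cong (λ v → (+ 6 * χ₃ a - + 6 * χ₃ x) * (1ℤ - 1ℤ) + + 8 * χ₄ x * ((1ℤ - D 3 x) - (1ℤ - D 3 x)) - + 4 * χ₄ x * (v - (1ℤ - D 3 a))) (χ₃-square a))
            (l₀ (χ₃ a) (χ₃ x) (χ₄ x) (D 3 x) (D 3 a)))
          where
          l₀ : ∀ w u p d d′ → (+ 6 * w - + 6 * u) * (1ℤ - 1ℤ) + + 8 * p * ((1ℤ - d) - (1ℤ - d)) - + 4 * p * ((1ℤ - d′) - (1ℤ - d′)) ≡ 0ℤ
          l₀ = solve-∀

    -- Compares two evaluations of `6 (S₁ + S₂ + 2 S₃)`: the interior terms give `-36 q₃`, as `q₁`
    -- vanishes, and the boundary terms give `total`.
    convolution-sum : e₁ - e₂ ≡ + 6 * q₃ + + 2 * s₀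
    convolution-sum = ℤₚ.*-cancelˡ-≡ (+ 6) _ _ (rearrange e₁ e₂ q₃ s₀ (trans (sym combined) (trans (l₁ S₁ S₂ S₃)
        (trans (cong₂ _+_ (cong₂ (λ u v → + 2 * u + + 2 * v) sum₁ sum₂) (cong (+ 2 *_) sum₃))
          (trans (l₂ ⟪ (λ a x → 1ℤ * (χ₁₂ x * (x - + 3 * χ₄ x + + 2 * χ₃ x))) ⟫ ⟪ (λ a x → χ₄ a * (χ₃ x * (+ 2 * (x - χ₃ x)))) ⟫ ⟪ (λ a x → χ₃ a * (χ₄ x * (x + χ₄ x))) ⟫ ⟪ f₄ ⟫)
            (trans (cong (λ z → + 2 * ⟪ (λ a x → 1ℤ * (χ₁₂ x * (x - + 3 * χ₄ x + + 2 * χ₃ x))) ⟫ + + 2 * ⟪ (λ a x → χ₄ a * (χ₃ x * (+ 2 * (x - χ₃ x)))) ⟫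
              + (+ 6 * ⟪ (λ a x → χ₃ a * (χ₄ x * (x + χ₄ x))) ⟫ + + 4 * z)) (sym (⟪⟫-flip f₄))) total))))))
      where
      f₄ : ℤ → ℤ → ℤ
      f₄ x a = χ₄ x * (χ₃ a * - (+ 2 * a + χ₃ a))
      combined : + 6 * (S₁ + S₂ + + 2 * S₃) ≡ + 6 * (- (+ 6 * q₃))
      combined = cong (+ 6 *_) (trans interior (trans (cong (λ z → + 2 * z - + 6 * q₃) (q₁-vanishes N≈3)) (ℤₚ.+-identityˡ _)))
      l₁ : ∀ s t u → + 6 * (s + t + + 2 * u) ≡ + 2 * (+ 3 * s) + + 2 * (+ 3 * t) + + 2 * (+ 6 * u)
      l₁ = solve-∀
      l₂ : ∀ p q r s → + 2 * p + + 2 * q + + 2 * (+ 3 * r + + 2 * s) ≡ + 2 * p + + 2 * q + (+ 6 * r + + 4 * s)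
      l₂ = solve-∀
      rearrange : ∀ e₁ e₂ q s → + 6 * (- (+ 6 * q)) ≡ + 6 * e₂ - + 6 * e₁ + + 12 * s → + 6 * (e₁ - e₂) ≡ + 6 * (+ 6 * q + + 2 * s)
      rearrange e₁ e₂ q s eq = trans (l₃ e₁ e₂ s) (trans (cong (λ z → + 12 * s - z) (sym eq)) (l₄ q s))
        where
        l₃ : ∀ e₁ e₂ s → + 6 * (e₁ - e₂) ≡ + 12 * s - (+ 6 * e₂ - + 6 * e₁ + + 12 * s)
        l₃ = solve-∀
        l₄ : ∀ q s → + 12 * s - + 6 * (- (+ 6 * q)) ≡ + 6 * (+ 6 * q + + 2 * s)
        l₄ = solve-∀

-- Jacobi's identity for the cube of η.

module CubeOfEtaFunction where

  open FiniteSums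
  open Congruences
  open LiouvilleIdentity
  open Progressions
  open InteriorTerms
  open import Data.Fin using (Fin)
  open import Data.List using ([]; _∷_)
  open import Data.List.Relation.Unary.Any using (here)
  open import Data.List.Relation.Unary.All using ([]; _∷_)
  open import Data.List.Relation.Unary.AllPairs using ([]; _∷_)
  open import Data.Nat as ℕ using (ℕ; zero; suc)
  import Data.Nat.Properties as ℕₚ
  open import Data.Integer as ℤ using (ℤ; +_; +0; +[1+_]; -[1+_]; _+_; _*_; _-_; -_; ∣_∣; 0ℤ; 1ℤ; _≤_; _<_)
  import Data.Integer.Properties as ℤₚ
  open import Data.Integer.DivMod using (_/ℕ_)
  open import Data.Integer.Tactic.RingSolver using (solve-∀)
  open import Data.Sum using (inj₁; inj₂)
  open import Data.Product using (_×_; _,_; proj₁; proj₂)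
  open import Relation.Binary.PropositionalEquality

  -- `u` cuts a reflection-stable piece out of a finitely supported weight; the finite support is
  -- inherited and oddness makes the total zero.
  HasSum-odd-0 : ∀ {A : Set} {{_ : Grid A}} {w : A → ℤ} {s} (u : A → ℤ) (σ : A → A) → (∀ a → σ (σ a) ≡ a) → HasSum w s →
    (∀ a → u (σ a) * w (σ a) ≡ - (u a * w a)) → HasSum (λ a → u a * w a) 0ℤ
  HasSum-odd-0 u σ σσ p odd with HasSum-restrict u p
  ... | s , q = HasSum-subst (HasSum-antisymmetric σ σσ odd q) q

  pos-neg-δ : ∀ z → pos z + pos (- z) + δ z ≡ 1ℤ
  pos-neg-δ +0       = refl
  pos-neg-δ +[1+ _ ] = refl
  pos-neg-δ -[1+ _ ] = refl

  pos-suc : ∀ z → pos (1ℤ + z) ≡ pos z + δ z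
  pos-suc +0              = refl
  pos-suc +[1+ _ ]        = refl
  pos-suc -[1+ zero ]     = refl
  pos-suc -[1+ suc _ ]    = refl

  pos-double : ∀ z → pos (+ 2 * z) ≡ pos z
  pos-double +0       = refl
  pos-double +[1+ _ ] = refl
  pos-double -[1+ _ ] = refl

  pos-double-1 : ∀ z → pos (+ 2 * z - 1ℤ) ≡ pos z
  pos-double-1 +0       = refl
  pos-double-1 +[1+ n ] = trans (cong pos (l (+ n))) (cong (λ z → pos (1ℤ + z)) (sym (ℤₚ.pos-* 2 n)))
    where
    l : ∀ n → + 2 * (1ℤ + n) - 1ℤ ≡ 1ℤ + + 2 * n
    l = solve-∀
  pos-double-1 -[1+ n ] = refl

  nonneg : ℤ → ℤ
  nonneg (+ _)    = 1ℤ
  nonneg -[1+ _ ] = 0ℤ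

  pos-double+1 : ∀ z → pos (1ℤ + z * + 2) ≡ nonneg z
  pos-double+1 +0              = refl
  pos-double+1 +[1+ n ]        = refl
  pos-double+1 -[1+ zero ]     = refl
  pos-double+1 -[1+ suc n ]    = refl

  interval : ∀ n → HasSum (λ k → nonneg k * pos (+ n - k)) (+ n)
  interval zero = HasSum-0 λ { +0 → refl ; +[1+ k ] → refl ; -[1+ k ] → refl }
  interval (suc n) = HasSum-subst (ℤₚ.+-comm (+ n) 1ℤ) (HasSum-cong (λ k → trans (sym (ℤₚ.*-distribˡ-+ (nonneg k) (pos (+ n - k)) (δ (+ n - k))))
    (cong (nonneg k *_) (trans (sym (pos-suc (+ n - k))) (cong pos (l (+ n) k))))) (HasSum-+ (interval n) point))
    where
    l : ∀ n k → 1ℤ + (n - k) ≡ 1ℤ + n - k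
    l = solve-∀
    point : HasSum (λ k → nonneg k * δ (+ n - k)) 1ℤ
    point = hasSum (+ n ∷ []) ([] ∷ []) (λ k h → here (sym (ℤₚ.i-j≡0⇒i≡j (+ n) k (δ≢0 (+ n - k) (*≢0ʳ {nonneg k} h)))))
      (trans (ℤₚ.+-identityʳ _) (trans (ℤₚ.*-identityˡ _) (δ-≡ (ℤₚ.+-inverseʳ (+ n)))))

  interval-ℤ : ∀ y → HasSum (λ k → nonneg k * pos (y - k)) (pos y * y)
  interval-ℤ +0         = interval 0
  interval-ℤ y@(+[1+ n ]) = HasSum-subst (sym (ℤₚ.*-identityˡ y)) (interval (suc n))
  interval-ℤ -[1+ n ]   = HasSum-0 λ { +0 → refl ; +[1+ k ] → refl ; -[1+ k ] → refl }

  -- With `z = 1 + 2 k` the conditions become `0 ≤ k < y`. This count is the factor `y` in the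
  -- expansion of the cube of η.
  odd-interval : ∀ y → HasSum (λ z → o z * (pos z * pos (+ 2 * y - z))) (pos y * y)
  odd-interval y = HasSum-cong (λ z → cong (_* (pos z * pos (+ 2 * y - z))) (sym (o-shift z)))
    (HasSum-progression 2 1ℤ (HasSum-cong (λ k → sym (cong₂ _*_ (pos-double+1 k) (trans (cong pos (l y k)) (pos-double-1 (y - k))))) (interval-ℤ y)))
    where
    l : ∀ y k → + 2 * y - (1ℤ + k * + 2) ≡ + 2 * (y - k) - 1ℤ
    l = solve-∀
    o-shift : ∀ z → o z ≡ D 2 (z - 1ℤ)
    o-shift = by-residues {4} o-periodic (λ p → D-periodic 2 (≈-- (4⇒2 p) ≈-refl)) check₁

  κ : ℤ → ℤ
  κ = tab₄ 1ℤ 0ℤ (- 1ℤ) 0ℤ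

  κ-periodic : Periodic 4 κ
  κ-periodic = tab₄-periodic 1ℤ 0ℤ (- 1ℤ) 0ℤ

  Triple : Set
  Triple = ℤ × ℤ × ℤ

  by-residues₃ : ∀ {m} .{{_ : ℕ.NonZero m}} {F G : ℤ → ℤ → ℤ → ℤ} →
    (∀ {x x′ y y′ z z′} → x ≈ x′ [ m ] → y ≈ y′ [ m ] → z ≈ z′ [ m ] → F x y z ≡ F x′ y′ z′) →
    (∀ {x x′ y y′ z z′} → x ≈ x′ [ m ] → y ≈ y′ [ m ] → z ≈ z′ [ m ] → G x y z ≡ G x′ y′ z′) →
    (∀ (i j k : Fin m) → F (rep i) (rep j) (rep k) ≡ G (rep i) (rep j) (rep k)) → ∀ x y z → F x y z ≡ G x y z
  by-residues₃ {m} pF pG table x y z = trans (pF (rep-res m x) (rep-res m y) (rep-res m z))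
    (trans (table (res m x) (res m y) (res m z)) (sym (pG (rep-res m x) (rep-res m y) (rep-res m z))))

  module CubeOfEta (M : ℕ) (M≈1 : + M ≈ + 1 [ 4 ]) where

    w : Triple → ℤ
    w (i , d , e) = pos d * pos e * δ (i * i + d * e - + M)

    w-bounded : ∀ v → w v ≢ 0ℤ → size v ℕ.≤ M
    w-bounded (i , d , e) ne = bound i d e (pos≢0 {d} (*≢0ˡ {_} {pos e} (*≢0ˡ {_} {δ (i * i + d * e - + M)} ne))) (pos≢0 {e} (*≢0ʳ {pos d} (*≢0ˡ {_} {δ (i * i + d * e - + M)} ne)))
        (ℤₚ.i-j≡0⇒i≡j _ _ (δ≢0 (i * i + d * e - + M) (*≢0ʳ {pos d * pos e} ne)))
      where
      bound : ∀ i d e → 0ℤ < d → 0ℤ < e → i * i + d * e ≡ + M → ∣ i ∣ ℕ.⊔ (∣ d ∣ ℕ.⊔ ∣ e ∣) ℕ.≤ M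
      bound i +[1+ m ] +[1+ n ] _ _ eq = ℕₚ.⊔-lub (ℕₚ.≤-trans (n≤n*n ∣ i ∣) (ℕₚ.≤-trans (ℕₚ.m≤m+n (∣ i ∣ ℕ.* ∣ i ∣) (suc m ℕ.* suc n)) (ℕₚ.≤-reflexive sum)))
        (ℕₚ.⊔-lub (ℕₚ.≤-trans (ℕₚ.m≤m*n (suc m) (suc n)) below) (ℕₚ.≤-trans (ℕₚ.m≤n*m (suc n) (suc m)) below))
        where
        sum : ∣ i ∣ ℕ.* ∣ i ∣ ℕ.+ suc m ℕ.* suc n ≡ M
        sum = ℤₚ.+-injective (trans (cong (_+ + (suc m ℕ.* suc n)) (sym (square-ℕ i))) eq)
        below : suc m ℕ.* suc n ℕ.≤ M
        below = ℕₚ.≤-trans (ℕₚ.m≤n+m (suc m ℕ.* suc n) (∣ i ∣ ℕ.* ∣ i ∣)) (ℕₚ.≤-reflexive sum)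
      bound _ +0 _ (ℤ.+<+ ()) _ _
      bound _ +[1+ _ ] +0 _ (ℤ.+<+ ()) _

    abstract
      W : (Triple → ℤ) → ℤ
      W F = ∑ {Triple} (box M) (λ v → F v * w v)

      W-HasSum : ∀ F → HasSum {Triple} (λ v → F v * w v) (W F)
      W-HasSum F = HasSum-box M λ v h → w-bounded v (*≢0ʳ {F v} h)

    -- Summed over `d e = M - i²`, `main` counts representations by two squares, and `cubic` is a
    -- product of characters of three linear forms that diagonalise `i² + d e`. On the solutions
    -- they differ by `odd-i`, which is odd in `i` and sums to zero.
    main odd-i cubic : Triple → ℤ
    main (i , d , e) = κ i * χ₄ d
    odd-i (i , d , e) = - (χ₄ i * (D 4 d * o e))
    cubic (i , d , e) = χ₄ (e - + 2 * i) * χ₄ (d + i) * χ₄ (+ 2 * (d + i) - e)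

    cubic-split : ∀ i d e → cubic (i , d , e) * D 4 (i * i + d * e - 1ℤ) ≡ (main (i , d , e) + odd-i (i , d , e)) * D 4 (i * i + d * e - 1ℤ)
    cubic-split = by-residues₃ {4}
      (λ p q r → cong₂ _*_ (cong₂ _*_ (cong₂ _*_ (χ₄-periodic (≈-- r (≈-* {4} {+ 2} ≈-refl p))) (χ₄-periodic (≈-+ q p))) (χ₄-periodic (≈-- (≈-* {4} {+ 2} ≈-refl (≈-+ q p)) r))) (D-periodic 4 (≈-- (≈-+ (≈-* p p) (≈-* q r)) ≈-refl)))
      (λ p q r → cong₂ _*_ (cong₂ _+_ (cong₂ _*_ (κ-periodic p) (χ₄-periodic q)) (cong -_ (cong₂ _*_ (χ₄-periodic p) (cong₂ _*_ (D-periodic 4 q) (o-periodic r))))) (D-periodic 4 (≈-- (≈-+ (≈-* p p) (≈-* q r)) ≈-refl)))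
      check₃

    W-odd-i : W odd-i ≡ 0ℤ
    W-odd-i = HasSum-antisymmetric {A = Triple} (λ (i , d , e) → - i , d , e) (λ (i , d , e) → cong (_, d , e) (ℤₚ.neg-involutive i))
      (λ (i , d , e) → trans (cong₂ (λ u v → - (u * (D 4 d * o e)) * (pos d * pos e * δ (v + d * e - + M))) (χ₄-neg i) (l₁ i)) (l₂ (χ₄ i) (D 4 d * o e) (w (i , d , e)))) (W-HasSum odd-i)
      where
      l₁ : ∀ i → - i * - i ≡ i * i
      l₁ = solve-∀
      l₂ : ∀ u v z → - (- u * v) * z ≡ - (- (u * v) * z)
      l₂ = solve-∀

    W-cubic : W cubic ≡ W main
    W-cubic = trans (HasSum-unique {A = Triple} (W-HasSum cubic) (HasSum-cong {A = Triple} pointwise (HasSum-+ {A = Triple} (W-HasSum main) (W-HasSum odd-i))))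
      (trans (cong (λ z → W main + z) W-odd-i) (ℤₚ.+-identityʳ _))
      where
      pointwise : ∀ v → main v * w v + odd-i v * w v ≡ cubic v * w v
      pointwise v@(i , d , e) = trans (sym (ℤₚ.*-distribʳ-+ (w v) (main v) (odd-i v))) (trans (sym (ℤₚ.*-assoc (main v + odd-i v) (pos d * pos e) (δ (i * i + d * e - + M))))
        (trans (guard (i * i + d * e - + M) λ p → cong (_* (pos d * pos e)) (sym (at p))) (ℤₚ.*-assoc (cubic v) (pos d * pos e) (δ (i * i + d * e - + M)))))
        where
        at : i * i + d * e - + M ≡ 0ℤ → cubic v ≡ main v + odd-i v
        at p = trans (sym (ℤₚ.*-identityʳ (cubic v))) (trans (cong (cubic v *_) (sym one)) (trans (cubic-split i d e) (trans (cong ((main v + odd-i v) *_) one) (ℤₚ.*-identityʳ _))))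
          where
          one : D 4 (i * i + d * e - 1ℤ) ≡ 1ℤ
          one = D-1 4 {i * i + d * e - 1ℤ} (subst (λ z → z - 1ℤ ≈ 0ℤ [ 4 ]) (sym (ℤₚ.i-j≡0⇒i≡j (i * i + d * e) (+ M) p)) (≈-- {4} {+ M} {+ 1} {+ 1} M≈1 ≈-refl))

    -- In the coordinates x = e - 2i, y = d + i, z = 2d + 2i - e the form 4(i² + de) is 4y² + x² - z².
    q : Triple → ℤ
    q (x , y , z) = + 4 * (y * y) + x * x - z * z - + 4 * + M

    v₀ : Triple → ℤ
    v₀ (x , y , z) = χ₄ x * χ₄ y * χ₄ z * δ (q (x , y , z))

    -- The conditions `d > 0` and `e > 0` in the new coordinates, where `x + z = 2 d` and
    -- `2 y - z = e`.
    region : Triple → ℤ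
    region (x , y , z) = pos (x + z) * pos (+ 2 * y - z)

    -- The inverse substitution has `d = (x + z) / 2`, which is integral wherever `χ₄ x` and `χ₄ z`
    -- are nonzero.
    cubic-sum : HasSum (λ v → region v * v₀ v) (W main)
    cubic-sum = HasSum-subst W-cubic (HasSum-reindex {A = Triple} {B = Triple} {v = λ v → region v * v₀ v} forth back
      (λ v _ → back-forth v , value v) (λ v ne → let e = forth-back v ne in e , trans (sym (value (back v))) (cong (λ u → region u * v₀ u) e)) (W-HasSum cubic))
      where
      forth back : Triple → Triple
      forth (i , d , e) = e - + 2 * i , d + i , + 2 * (d + i) - e
      back (x , y , z) = y - (x + z) /ℕ 2 , (x + z) /ℕ 2 , + 2 * y - z
      value : ∀ v → region (forth v) * v₀ (forth v) ≡ cubic v * w v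
      value (i , d , e) = trans (cong₂ _*_ (cong₂ _*_ (trans (cong pos (l₁ i d e)) (pos-double d)) (cong pos (l₂ i d e)))
          (cong (cubic (i , d , e) *_) (trans (cong δ (l₃ i d e (+ M))) (δ-* (+ 4) (i * i + d * e - + M)))))
          (l₄ (pos d * pos e) (cubic (i , d , e)) (δ (i * i + d * e - + M)))
        where
        l₁ : ∀ i d e → e - + 2 * i + (+ 2 * (d + i) - e) ≡ + 2 * d
        l₁ = solve-∀
        l₂ : ∀ i d e → + 2 * (d + i) - (+ 2 * (d + i) - e) ≡ e
        l₂ = solve-∀
        l₃ : ∀ i d e M → + 4 * ((d + i) * (d + i)) + (e - + 2 * i) * (e - + 2 * i) - (+ 2 * (d + i) - e) * (+ 2 * (d + i) - e) - + 4 * M ≡ + 4 * (i * i + d * e - M)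
        l₃ = solve-∀
        l₄ : ∀ p c d → p * (c * d) ≡ c * (p * d)
        l₄ = solve-∀
      half-≡ : ∀ i d e → (e - + 2 * i + (+ 2 * (d + i) - e)) /ℕ 2 ≡ d
      half-≡ i d e = trans (cong (_/ℕ 2) (l i d e)) (/ℕ-exact 2 d)
        where
        l : ∀ i d e → e - + 2 * i + (+ 2 * (d + i) - e) ≡ d * + 2
        l = solve-∀
      back-forth : ∀ v → back (forth v) ≡ v
      back-forth (i , d , e) = trans (cong (λ z → d + i - z , z , + 2 * (d + i) - (+ 2 * (d + i) - e)) (half-≡ i d e))
        (cong₂ (λ u r → u , d , r) (l₁ i d) (l₂ i d e))
        where
        l₁ : ∀ i d → d + i - d ≡ i
        l₁ = solve-∀
        l₂ : ∀ i d e → + 2 * (d + i) - (+ 2 * (d + i) - e) ≡ e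
        l₂ = solve-∀
      even-sum : ∀ x z → χ₄ x ≢ 0ℤ → χ₄ z ≢ 0ℤ → x + z ≈ 0ℤ [ 2 ]
      even-sum x z hx hz = D≢0 2 (x + z) λ D≡0 → one≢0 (trans (sym (table x z)) (trans (cong (χ₄ x * χ₄ x * (χ₄ z * χ₄ z) *_) D≡0) (ℤₚ.*-zeroʳ (χ₄ x * χ₄ x * (χ₄ z * χ₄ z)))))
        where
        table : ∀ x z → χ₄ x * χ₄ x * (χ₄ z * χ₄ z) * D 2 (x + z) ≡ χ₄ x * χ₄ x * (χ₄ z * χ₄ z)
        table = by-residues₂ {4} {4} (λ p r → cong₂ _*_ (cong₂ _*_ (cong₂ _*_ (χ₄-periodic p) (χ₄-periodic p)) (cong₂ _*_ (χ₄-periodic r) (χ₄-periodic r))) (D-periodic 2 (4⇒2 (≈-+ p r))))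
          (λ p r → cong₂ _*_ (cong₂ _*_ (χ₄-periodic p) (χ₄-periodic p)) (cong₂ _*_ (χ₄-periodic r) (χ₄-periodic r))) check₂
        one≢0 : χ₄ x * χ₄ x * (χ₄ z * χ₄ z) ≢ 0ℤ
        one≢0 e with ℤₚ.i*j≡0⇒i≡0∨j≡0 (χ₄ x * χ₄ x) e
        ... | inj₁ e′ with ℤₚ.i*j≡0⇒i≡0∨j≡0 (χ₄ x) e′
        ...   | inj₁ e″ = hx e″
        ...   | inj₂ e″ = hx e″
        one≢0 e | inj₂ e′ with ℤₚ.i*j≡0⇒i≡0∨j≡0 (χ₄ z) e′
        ...   | inj₁ e″ = hz e″
        ...   | inj₂ e″ = hz e″
      forth-back : ∀ v → region v * v₀ v ≢ 0ℤ → forth (back v) ≡ v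
      forth-back (x , y , z) ne = cong₂ _,_ (trans (l₁ y z h₂) (trans (cong (_- z) double) (l₂ x z))) (cong₂ _,_ (l₃ y h₂) (l₄ y z h₂))
        where
        h₂ = (x + z) /ℕ 2
        double : h₂ * + 2 ≡ x + z
        double = multiple 2 (x + z) (even-sum x z
          (*≢0ˡ {_} {χ₄ y} (*≢0ˡ {_} {χ₄ z} (*≢0ˡ {_} {δ (q (x , y , z))} (*≢0ʳ {region (x , y , z)} ne))))
          (*≢0ʳ {χ₄ x * χ₄ y} (*≢0ˡ {_} {δ (q (x , y , z))} (*≢0ʳ {region (x , y , z)} ne))))
        l₁ : ∀ y z h → + 2 * y - z - + 2 * (y - h) ≡ h * + 2 - z
        l₁ = solve-∀
        l₂ : ∀ x z → x + z - z ≡ x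
        l₂ = solve-∀
        l₃ : ∀ y h → h + (y - h) ≡ y
        l₃ = solve-∀
        l₄ : ∀ y z h → + 2 * (h + (y - h)) - (+ 2 * y - z) ≡ z
        l₄ = solve-∀

    u : Triple → ℤ
    u v = region v * v₀ v

    private
      flip-x flip-y flip-z : Triple → Triple
      flip-x (x , y , z) = - x , y , z
      flip-y (x , y , z) = x , - y , z
      flip-z (x , y , z) = x , y , - z

      negate-square : ∀ x → - x * - x ≡ x * x
      negate-square = solve-∀

      v₀-x : ∀ v → v₀ (flip-x v) ≡ - v₀ v
      v₀-x (x , y , z) = trans (cong₂ (λ p r → p * χ₄ y * χ₄ z * δ (+ 4 * (y * y) + r - z * z - + 4 * + M)) (χ₄-neg x) (negate-square x)) (l (χ₄ x) (χ₄ y) (χ₄ z) (δ (q (x , y , z))))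
        where
        l : ∀ p r s d → - p * r * s * d ≡ - (p * r * s * d)
        l = solve-∀

      v₀-y : ∀ v → v₀ (flip-y v) ≡ - v₀ v
      v₀-y (x , y , z) = trans (cong₂ (λ p r → χ₄ x * p * χ₄ z * δ (+ 4 * r + x * x - z * z - + 4 * + M)) (χ₄-neg y) (negate-square y)) (l (χ₄ x) (χ₄ y) (χ₄ z) (δ (q (x , y , z))))
        where
        l : ∀ p r s d → p * - r * s * d ≡ - (p * r * s * d)
        l = solve-∀

      v₀-z : ∀ v → v₀ (flip-z v) ≡ - v₀ v
      v₀-z (x , y , z) = trans (cong₂ (λ p r → χ₄ x * χ₄ y * p * δ (+ 4 * (y * y) + x * x - r - + 4 * + M)) (χ₄-neg z) (negate-square z)) (l (χ₄ x) (χ₄ y) (χ₄ z) (δ (q (x , y , z))))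
        where
        l : ∀ p r s d → p * r * - s * d ≡ - (p * r * s * d)
        l = solve-∀

      -- The product of characters is odd in each coordinate and the form is even, so any piece of
      -- the region stable under one reflection has total zero. Here `x + z > 0` and `x - z < 0`, a
      -- pair of conditions exchanged by `x ↦ - x`.
      part₁ : HasSum {Triple} (λ (x , y , z) → pos (- (x - z)) * u (x , y , z)) 0ℤ
      part₁ = HasSum-odd-0 {Triple} (λ (x , y , z) → pos (- (x - z))) flip-x (λ (x , y , z) → cong (_, y , z) (ℤₚ.neg-involutive x)) cubic-sum
        (λ (x , y , z) → trans (cong₂ _*_ (cong pos (l₁ x z)) (cong₂ (λ p r → p * pos (+ 2 * y - z) * r) (cong pos (l₂ x z)) (v₀-x (x , y , z))))
          (l₃ (pos (x + z)) (pos (- (x - z))) (pos (+ 2 * y - z)) (v₀ (x , y , z))))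
        where
        l₁ : ∀ x z → - (- x - z) ≡ x + z
        l₁ = solve-∀
        l₂ : ∀ x z → - x + z ≡ - (x - z)
        l₂ = solve-∀
        l₃ : ∀ p r s t → p * (r * s * - t) ≡ - (r * (p * s * t))
        l₃ = solve-∀

      -- The reflection `z ↦ - z` permutes the four inequalities `x ± z > 0` and `2 y ± z > 0`.
      part₂ : HasSum {Triple} (λ (x , y , z) → pos (x - z) * pos (+ 2 * y + z) * u (x , y , z)) 0ℤ
      part₂ = HasSum-odd-0 {Triple} (λ (x , y , z) → pos (x - z) * pos (+ 2 * y + z)) flip-z (λ (x , y , z) → cong (λ r → x , y , r) (ℤₚ.neg-involutive z)) cubic-sum
        (λ (x , y , z) → trans (cong₂ (λ p r → pos p * pos (+ 2 * y - z) * (pos (x - z) * pos r * v₀ (x , y , - z))) (l₁ x z) (l₂ y z)) (trans (cong (λ r → pos (x + z) * pos (+ 2 * y - z) * (pos (x - z) * pos (+ 2 * y + z) * r)) (v₀-z (x , y , z)))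
          (l₃ (pos (x + z)) (pos (+ 2 * y - z)) (pos (x - z)) (pos (+ 2 * y + z)) (v₀ (x , y , z)))))
        where
        l₁ : ∀ x z → x - - z ≡ x + z
        l₁ = solve-∀
        l₂ : ∀ y z → + 2 * y - - z ≡ + 2 * y + z
        l₂ = solve-∀
        l₃ : ∀ p r s t m → p * r * (s * t * - m) ≡ - (s * t * (p * r * m))
        l₃ = solve-∀

      -- The reflection `y ↦ - y` exchanges `2 y - z > 0` with `2 y + z < 0`.
      part₃ : HasSum {Triple} (λ (x , y , z) → pos (x - z) * pos (- (+ 2 * y + z)) * u (x , y , z)) 0ℤ
      part₃ = HasSum-odd-0 {Triple} (λ (x , y , z) → pos (x - z) * pos (- (+ 2 * y + z))) flip-y (λ (x , y , z) → cong (λ r → x , r , z) (ℤₚ.neg-involutive y)) cubic-sum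
        (λ (x , y , z) → trans (cong₂ (λ p r → pos (x - z) * pos p * (pos (x + z) * pos r * v₀ (x , - y , z))) (l₁ y z) (l₂ y z)) (trans (cong (λ r → pos (x - z) * pos (+ 2 * y - z) * (pos (x + z) * pos (- (+ 2 * y + z)) * r)) (v₀-y (x , y , z)))
          (l₃ (pos (x - z)) (pos (+ 2 * y - z)) (pos (x + z)) (pos (- (+ 2 * y + z))) (v₀ (x , y , z)))))
        where
        l₁ : ∀ y z → - (+ 2 * - y + z) ≡ + 2 * y - z
        l₁ = solve-∀
        l₂ : ∀ y z → + 2 * - y - z ≡ - (+ 2 * y + z)
        l₂ = solve-∀
        l₃ : ∀ p r s t m → p * r * (s * t * - m) ≡ - (p * t * (s * r * m))
        l₃ = solve-∀

      -- On `2 y + z = 0` the coordinate `z` is even and `χ₄ z` vanishes.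
      part₄ : HasSum {Triple} (λ (x , y , z) → pos (x - z) * δ (+ 2 * y + z) * u (x , y , z)) 0ℤ
      part₄ = HasSum-0 λ (x , y , z) → trans (l (pos (x - z)) (δ (+ 2 * y + z)) (region (x , y , z)) (χ₄ x * χ₄ y) (χ₄ z) (δ (q (x , y , z))))
        (trans (cong (pos (x - z) * region (x , y , z) * (χ₄ x * χ₄ y) * δ (q (x , y , z)) *_) (trans (guard {χ₄ z} {0ℤ} (+ 2 * y + z) (even y z)) (ℤₚ.*-zeroˡ (δ (+ 2 * y + z))))) (ℤₚ.*-zeroʳ (pos (x - z) * region (x , y , z) * (χ₄ x * χ₄ y) * δ (q (x , y , z)))))
        where
        l : ∀ p d r c s e → p * d * (r * (c * s * e)) ≡ p * r * c * e * (s * d)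
        l = solve-∀
        table : ∀ z → χ₄ z * D 2 z ≡ 0ℤ
        table = by-residues {4} (λ p → cong₂ _*_ (χ₄-periodic p) (D-periodic 2 (4⇒2 p))) (λ _ → refl) check₁
        even : ∀ y z → + 2 * y + z ≡ 0ℤ → χ₄ z ≡ 0ℤ
        even y z e = trans (sym (ℤₚ.*-identityʳ (χ₄ z))) (trans (cong (χ₄ z *_) (sym (D-1 2 {z} (by (- y) (trans (l′ y z) (cong (λ r → r + - y * + 2) e)))))) (table z))
          where
          l′ : ∀ y z → z ≡ + 2 * y + z + - y * + 2
          l′ = solve-∀

      -- After removal of the four pieces only the wall `x = z` is left of the region, and on it the
      -- equation collapses to `y² = M`.
      diagonal-sum : HasSum {Triple} (λ (x , y , z) → δ (x - z) * u (x , y , z)) (W main)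
      diagonal-sum = HasSum-subst (l₀ (W main)) (HasSum-cong {A = Triple} pointwise
        (HasSum-- {A = Triple} (HasSum-- {A = Triple} cubic-sum part₁) (HasSum-+ {A = Triple} part₂ (HasSum-+ {A = Triple} part₃ part₄))))
        where
        l₀ : ∀ s → s - 0ℤ - (0ℤ + (0ℤ + 0ℤ)) ≡ s
        l₀ = solve-∀
        l : ∀ p n d p′ n′ d′ m → m - n * m - (p * p′ * m + (p * n′ * m + p * d′ * m)) ≡ m - n * m - p * (p′ + n′ + d′) * m
        l = solve-∀
        l′ : ∀ p n d m → m - n * m - p * 1ℤ * m ≡ (1ℤ - (p + n + d)) * m + d * m
        l′ = solve-∀
        pointwise : ∀ v → u v - pos (- (proj₁ v - proj₂ (proj₂ v))) * u v - (pos (proj₁ v - proj₂ (proj₂ v)) * pos (+ 2 * proj₁ (proj₂ v) + proj₂ (proj₂ v)) * u v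
          + (pos (proj₁ v - proj₂ (proj₂ v)) * pos (- (+ 2 * proj₁ (proj₂ v) + proj₂ (proj₂ v))) * u v + pos (proj₁ v - proj₂ (proj₂ v)) * δ (+ 2 * proj₁ (proj₂ v) + proj₂ (proj₂ v)) * u v))
          ≡ δ (proj₁ v - proj₂ (proj₂ v)) * u v
        pointwise v@(x , y , z) = trans (l (pos (x - z)) (pos (- (x - z))) (δ (x - z)) (pos (+ 2 * y + z)) (pos (- (+ 2 * y + z))) (δ (+ 2 * y + z)) (u v))
          (trans (cong (λ r → u v - pos (- (x - z)) * u v - pos (x - z) * r * u v) (pos-neg-δ (+ 2 * y + z)))
          (trans (l′ (pos (x - z)) (pos (- (x - z))) (δ (x - z)) (u v)) (trans (cong (λ r → (1ℤ - r) * u v + δ (x - z) * u v) (pos-neg-δ (x - z)))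
            (trans (cong (_+ δ (x - z) * u v) (ℤₚ.*-zeroˡ (u v))) (ℤₚ.+-identityˡ _)))))

      χ₄-square : ∀ z → χ₄ z * χ₄ z ≡ o z
      χ₄-square = by-residues {4} (λ p → cong₂ _*_ (χ₄-periodic p) (χ₄-periodic p)) o-periodic check₁

      plane-sum : HasSum {ℤ × ℤ} (λ (y , z) → o z * (pos z * pos (+ 2 * y - z)) * (χ₄ y * δ (y * y - + M))) (W main)
      plane-sum = HasSum-reindex {A = Triple} {B = ℤ × ℤ} (λ (x , y , z) → y , z) (λ (y , z) → z , y , z)
        (λ (x , y , z) ne → let x≡z = ℤₚ.i-j≡0⇒i≡j x z (δ≢0 (x - z) (*≢0ˡ {_} {u (x , y , z)} ne)) in
          cong (_, y , z) (sym x≡z) , trans (sym (value y z)) (cong (λ r → δ (r - z) * u (r , y , z)) (sym x≡z)))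
        (λ (y , z) _ → refl , value y z) diagonal-sum
        where
        value : ∀ y z → δ (z - z) * u (z , y , z) ≡ o z * (pos z * pos (+ 2 * y - z)) * (χ₄ y * δ (y * y - + M))
        value y z = trans (cong₂ (λ p r → p * (r * pos (+ 2 * y - z) * v₀ (z , y , z))) (δ-≡ (ℤₚ.+-inverseʳ z)) (trans (cong pos (l₁ z)) (pos-double z)))
          (trans (cong (λ r → 1ℤ * (pos z * pos (+ 2 * y - z) * (χ₄ z * χ₄ y * χ₄ z * r))) (trans (cong δ (l₂ y z (+ M))) (δ-* (+ 4) (y * y - + M))))
          (trans (l₃ (pos z) (pos (+ 2 * y - z)) (χ₄ z) (χ₄ y) (δ (y * y - + M))) (cong (λ r → r * (pos z * pos (+ 2 * y - z)) * (χ₄ y * δ (y * y - + M))) (χ₄-square z))))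
          where
          l₁ : ∀ z → z + z ≡ + 2 * z
          l₁ = solve-∀
          l₂ : ∀ y z M → + 4 * (y * y) + z * z - z * z - + 4 * M ≡ + 4 * (y * y - M)
          l₂ = solve-∀
          l₃ : ∀ p r c y d → 1ℤ * (p * r * (c * y * c * d)) ≡ c * c * (p * r) * (y * d)
          l₃ = solve-∀

    -- On the wall `z` is restricted only by `0 < z < 2 y` and oddness, so each `y` is counted `y`
    -- times.
    cube-of-eta : HasSum (λ y → pos y * y * (χ₄ y * δ (y * y - + M))) (W main)
    cube-of-eta = HasSum-fubini {A = ℤ} {B = ℤ} plane-sum (λ y → HasSum-cong (λ z → ℤₚ.*-comm (χ₄ y * δ (y * y - + M)) _)
      (HasSum-subst (ℤₚ.*-comm (χ₄ y * δ (y * y - + M)) (pos y * y)) (HasSum-* (χ₄ y * δ (y * y - + M)) (odd-interval y))))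

-- Fermat's theorem, roots of unity and anisotropic forms modulo a prime.

module PrimeModuli where

  open Congruences
  open import Data.Empty using (⊥; ⊥-elim)
  import Data.Fin.Properties as Finₚ
  open import Data.Nat as ℕ using (ℕ; zero; suc; z≤n; s≤s; _!)
  import Data.Nat.Properties as ℕₚ
  import Data.Nat.Divisibility as ℕ∣
  open import Data.Nat.Primality using (Prime; euclidsLemma; prime⇒nonZero; prime⇒nonTrivial)
  open import Data.Nat.Combinatorics using (_C_; nCn≡1; nCk+nC[k+1]≡[n+1]C[k+1]; nCk≡n!/k![n-k]!; k![n∸k]!∣n!)
  open import Data.Nat.DivMod using (m/n*n≡m)
  open import Data.Integer using (ℤ; +_; +[1+_]; -[1+_]; _+_; _*_; _-_; -_; _^_; ∣_∣; 0ℤ; 1ℤ)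
  import Data.Integer.Properties as ℤₚ
  open import Data.Integer.Tactic.RingSolver using (solve-∀)
  open import Data.Product using (∃; _×_; _,_)
  open import Data.Sum using (_⊎_; inj₁; inj₂; [_,_]′)
  open import Function using (id)
  open import Relation.Nullary using (¬_; Dec; yes; no)
  open import Relation.Nullary.Decidable using (¬?; map′; from-no; decidable-stable)
  open import Relation.Binary.PropositionalEquality

  -- Iterated forward differences, needed to see that a low power cannot be constant modulo `p` on
  -- many consecutive integers.
  Δ : ℕ → (ℤ → ℤ) → ℤ → ℤ
  Δ zero    f x = f x
  Δ (suc m) f x = Δ m f (x + 1ℤ) - Δ m f x

  Δ-leibniz : ∀ m f x → Δ (suc m) (λ y → y * f y) x ≡ x * Δ (suc m) f x + + suc m * Δ m f (x + 1ℤ)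
  Δ-leibniz zero f x = l x (f (x + 1ℤ)) (f x)
    where
    l : ∀ x u v → (x + 1ℤ) * u - x * v ≡ x * (u - v) + 1ℤ * u
    l = solve-∀
  Δ-leibniz (suc m) f x = trans (cong₂ _-_ (Δ-leibniz m f (x + 1ℤ)) (Δ-leibniz m f x))
    (l x (+ suc m) (Δ (suc m) f (x + 1ℤ)) (Δ (suc m) f x) (Δ m f (x + 1ℤ + 1ℤ)) (Δ m f (x + 1ℤ)) refl)
    where
    l₀ : ∀ x m u v a b → (x + 1ℤ) * u + m * a - (x * v + m * b) ≡ x * (u - v) + (u + m * (a - b))
    l₀ = solve-∀
    l₁ : ∀ m u → u + m * u ≡ (1ℤ + m) * u
    l₁ = solve-∀
    l : ∀ x m u v a b → u ≡ a - b → (x + 1ℤ) * u + m * a - (x * v + m * b) ≡ x * (u - v) + (1ℤ + m) * u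
    l x m u v a b e = trans (l₀ x m u v a b) (cong (λ z → x * (u - v) + z) (trans (cong (λ z → u + m * z) (sym e)) (l₁ m u)))

  Δ-power : ∀ m x → Δ m (_^ m) x ≡ + (m !)
  Δ-power-suc : ∀ m x → Δ (suc m) (_^ m) x ≡ 0ℤ

  Δ-power zero x = refl
  Δ-power (suc m) x = trans (Δ-leibniz m (_^ m) x) (trans (cong₂ (λ u v → x * u + + suc m * v) (Δ-power-suc m x) (Δ-power m (x + 1ℤ)))
    (trans (cong (_+ + suc m * + (m !)) (ℤₚ.*-zeroʳ x)) (trans (ℤₚ.+-identityˡ _) (sym (ℤₚ.pos-* (suc m) (m !))))))

  Δ-power-suc m x = trans (cong₂ _-_ (Δ-power m (x + 1ℤ)) (Δ-power m x)) (ℤₚ.+-inverseʳ (+ (m !)))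

  -- A first difference of congruent values vanishes, and so do all further ones; the difference of
  -- order `m + 1` involves exactly the `m + 2` values in the hypothesis.
  Δ-constant : ∀ {p} m f c x → (∀ i → i ℕ.≤ suc m → f (x + + i) ≈ c [ p ]) → Δ (suc m) f x ≈ 0ℤ [ p ]
  Δ-constant {p} zero f c x h = subst (λ z → f (x + 1ℤ) - f x ≈ z [ p ]) (ℤₚ.+-inverseʳ c)
    (≈-- (h 1 (s≤s z≤n)) (subst (λ z → f z ≈ c [ p ]) (ℤₚ.+-identityʳ x) (h 0 z≤n)))
  Δ-constant (suc m) f c x h = ≈-- (Δ-constant m f c (x + 1ℤ) λ i i≤ → subst (λ z → f z ≈ c [ _ ]) (sym (ℤₚ.+-assoc x 1ℤ (+ i))) (h (suc i) (s≤s i≤)))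
    (Δ-constant m f c x λ i i≤ → h i (ℕₚ.m≤n⇒m≤1+n i≤))

  -- Truncations of the binomial expansion. Separating the cut-off from the exponent allows an
  -- induction through Pascal's rule.
  partial : ℕ → ℕ → ℤ → ℤ
  partial n zero    a = 1ℤ
  partial n (suc m) a = partial n m a + + (n C suc m) * a ^ suc m

  partial-step : ∀ n m a → (1ℤ + a) * partial n m a ≡ partial (suc n) m a + + (n C m) * a ^ suc m
  partial-step n zero a = l a
    where
    l : ∀ a → (1ℤ + a) * 1ℤ ≡ 1ℤ + 1ℤ * (a * 1ℤ)
    l = solve-∀
  partial-step n (suc m) a = trans (ℤₚ.*-distribˡ-+ (1ℤ + a) (partial n m a) _) (trans (cong (_+ (1ℤ + a) * (+ (n C suc m) * a ^ suc m)) (partial-step n m a))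
    (trans (l (partial (suc n) m a) (+ (n C m)) (+ (n C suc m)) a (a ^ suc m)) (cong (λ z → partial (suc n) m a + z * a ^ suc m + + (n C suc m) * (a * a ^ suc m))
      (cong +_ (nCk+nC[k+1]≡[n+1]C[k+1] n m)))))
    where
    l : ∀ t b c a e → t + b * e + (1ℤ + a) * (c * e) ≡ t + (b + c) * e + c * (a * e)
    l = solve-∀

  binomial : ∀ n a → (1ℤ + a) ^ n ≡ partial n n a
  binomial zero a = refl
  binomial (suc n) a = trans (cong ((1ℤ + a) *_) (binomial n a)) (trans (partial-step n n a)
    (cong (λ z → partial (suc n) n a + + z * a ^ suc n) (trans (nCn≡1 n) (sym (nCn≡1 (suc n))))))

  ^-≈ : ∀ {m x y} n → x ≈ y [ m ] → x ^ n ≈ y ^ n [ m ]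
  ^-≈ zero    p = ≈-refl
  ^-≈ (suc n) p = ≈-* p (^-≈ n p)

  -- An opaque copy of the power, which keeps exponents such as 4 * k from being unfolded.
  infixr 8 _⋆_
  abstract
    _⋆_ : ℤ → ℕ → ℤ
    x ⋆ n = x ^ n

    ⋆-^ : ∀ x n → x ⋆ n ≡ x ^ n
    ⋆-^ x n = refl

    ⋆-suc : ∀ x n → x ⋆ suc n ≡ x * x ⋆ n
    ⋆-suc x n = refl

    ⋆-2 : ∀ x → x ⋆ 2 ≡ x * x
    ⋆-2 x = cong (x *_) (ℤₚ.*-identityʳ x)

    ⋆-3 : ∀ x → x ⋆ 3 ≡ x * (x * x)
    ⋆-3 x = cong (λ z → x * (x * z)) (ℤₚ.*-identityʳ x)

    ⋆-4 : ∀ x → x ⋆ 4 ≡ x * (x * (x * x))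
    ⋆-4 x = cong (λ z → x * (x * (x * z))) (ℤₚ.*-identityʳ x)

    ⋆-⋆ : ∀ x m n → (x ⋆ m) ⋆ n ≡ x ⋆ (m ℕ.* n)
    ⋆-⋆ = ℤₚ.^-*-assoc

    ⋆-≈ : ∀ {m x y} n → x ≈ y [ m ] → x ⋆ n ≈ y ⋆ n [ m ]
    ⋆-≈ = ^-≈

  ≈-scale : ∀ {m} k {z} → z ≈ 0ℤ [ m ] → k * z ≈ 0ℤ [ m ]
  ≈-scale {m} k {z} p = subst (λ w → k * z ≈ w [ m ]) (ℤₚ.*-zeroʳ k) (≈-* (≈-refl {z = k}) p)

  ≈-difference : ∀ {m y z} → y - z ≈ 0ℤ [ m ] → y ≈ z [ m ]
  ≈-difference {m} {y} {z} p = subst₂ (λ u v → u ≈ v [ m ]) (l y z) (ℤₚ.+-identityˡ z) (≈-+ p (≈-refl {z = z}))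
    where
    l : ∀ y z → y - z + z ≡ y
    l = solve-∀

  ∣⇒≈0 : ∀ {m n} → m ℕ∣.∣ n → + n ≈ 0ℤ [ m ]
  ∣⇒≈0 {m} (ℕ∣.divides q eq) = by (+ q) (trans (cong +_ eq) (trans (ℤₚ.pos-* q m) (sym (ℤₚ.+-identityˡ _))))

  ≈0⇒∣ : ∀ {m z} → z ≈ 0ℤ [ m ] → m ℕ∣.∣ ∣ z ∣
  ≈0⇒∣ {m} {z} (by q eq) = ℕ∣.divides ∣ q ∣ (trans (cong ∣_∣ (trans eq (ℤₚ.+-identityˡ (q * + m)))) (ℤₚ.∣i*j∣≡∣i∣*∣j∣ q (+ m)))

  ∣∣⇒≈0 : ∀ {m z} → m ℕ∣.∣ ∣ z ∣ → z ≈ 0ℤ [ m ]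
  ∣∣⇒≈0 {m} {+ n}     d = ∣⇒≈0 d
  ∣∣⇒≈0 {m} { -[1+ n ]} d = ≈-neg (∣⇒≈0 {m} {suc n} d)

  module PrimeModulus (p : ℕ) (p-prime : Prime p) where

    instance
      p-nonZero : ℕ.NonZero p
      p-nonZero = prime⇒nonZero p-prime

    1<p : 1 ℕ.< p
    1<p = ℕ.nonTrivial⇒n>1 p {{prime⇒nonTrivial p-prime}}

    euclid : ∀ x y → x * y ≈ 0ℤ [ p ] → x ≈ 0ℤ [ p ] ⊎ y ≈ 0ℤ [ p ]
    euclid x y h with euclidsLemma ∣ x ∣ ∣ y ∣ p-prime (subst (p ℕ∣.∣_) (ℤₚ.∣i*j∣≡∣i∣*∣j∣ x y) (≈0⇒∣ h))
    ... | inj₁ d = inj₁ (∣∣⇒≈0 d)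
    ... | inj₂ d = inj₂ (∣∣⇒≈0 d)

    small-≉0 : ∀ n → 0 ℕ.< n → n ℕ.< p → ¬ (+ n ≈ 0ℤ [ p ])
    small-≉0 n 0<n n<p h = ℕₚ.<⇒≢ 0<n (sym (small-≈ n<p (ℕₚ.<-trans (s≤s z≤n) 1<p) h))

    power-≈0 : ∀ x n → x ⋆ n ≈ 0ℤ [ p ] → x ≈ 0ℤ [ p ]
    power-≈0 x zero    h = ⊥-elim (small-≉0 1 (s≤s z≤n) 1<p (subst (λ z → z ≈ 0ℤ [ p ]) (⋆-^ x 0) h))
    power-≈0 x (suc n) h = [ id , power-≈0 x n ]′ (euclid x (x ⋆ n) (subst (λ z → z ≈ 0ℤ [ p ]) (⋆-suc x n) h))

    cancel : ∀ x {y z} → ¬ (x ≈ 0ℤ [ p ]) → x * y ≈ x * z [ p ] → y ≈ z [ p ]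
    cancel x {y} {z} x≉0 h = [ (λ e → ⊥-elim (x≉0 e)) , ≈-difference ]′
        (euclid x (y - z) (subst₂ (λ u v → u ≈ v [ p ]) (l x y z) (ℤₚ.+-inverseʳ (x * z)) (≈-- h (≈-refl {z = x * z}))))
      where
      l : ∀ x y z → x * y - x * z ≡ x * (y - z)
      l = solve-∀

    p∤small! : ∀ m → m ℕ.< p → ¬ (p ℕ∣.∣ m !)
    p∤small! zero m<p d = small-≉0 1 (s≤s z≤n) 1<p (∣⇒≈0 d)
    p∤small! (suc m) m<p d with euclidsLemma (suc m) (m !) p-prime d
    ... | inj₁ e = small-≉0 (suc m) (s≤s z≤n) m<p (∣⇒≈0 e)
    ... | inj₂ e = p∤small! m (ℕₚ.<-trans (ℕₚ.n<1+n m) m<p) e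

    -- `p` divides `p !`, which is `p C k` times `k ! (p - k) !`, and it divides neither of these
    -- two factorials.
    p∣pCk : ∀ k → 0 ℕ.< k → k ℕ.< p → p ℕ∣.∣ p C k
    p∣pCk k 0<k k<p with euclidsLemma (p C k) (k ! ℕ.* (p ℕ.∸ k) !) p-prime (subst (p ℕ∣.∣_) (sym product) (p∣p! p))
      where
      instance
        denominator-nonZero : ℕ.NonZero (k ! ℕ.* (p ℕ.∸ k) !)
        denominator-nonZero = ℕₚ.m*n≢0 (k !) ((p ℕ.∸ k) !) {{k ℕₚ.!≢0}} {{(p ℕ.∸ k) ℕₚ.!≢0}}
      product : (p C k) ℕ.* (k ! ℕ.* (p ℕ.∸ k) !) ≡ p !
      product = trans (cong (ℕ._* (k ! ℕ.* (p ℕ.∸ k) !)) (nCk≡n!/k![n-k]! (ℕₚ.<⇒≤ k<p))) (m/n*n≡m (k![n∸k]!∣n! (ℕₚ.<⇒≤ k<p)))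
      p∣p! : ∀ n .{{_ : ℕ.NonZero n}} → n ℕ∣.∣ n !
      p∣p! (suc n) = ℕ∣.m∣m*n (n !)
    ... | inj₁ d = d
    ... | inj₂ d with euclidsLemma (k !) ((p ℕ.∸ k) !) p-prime d
    ...   | inj₁ e = ⊥-elim (p∤small! k k<p e)
    ...   | inj₂ e = ⊥-elim (p∤small! (p ℕ.∸ k) (ℕₚ.∸-monoʳ-< 0<k (ℕₚ.<⇒≤ k<p)) e)

    partial-≈1 : ∀ m a → m ℕ.< p → partial p m a ≈ 1ℤ [ p ]
    partial-≈1 zero    a _ = ≈-refl
    partial-≈1 (suc m) a m<p = ≈-+ (partial-≈1 m a (ℕₚ.<-trans (ℕₚ.n<1+n m) m<p))
      (subst (λ z → z ≈ 0ℤ [ p ]) (ℤₚ.*-comm (a ^ suc m) (+ (p C suc m))) (≈-scale (a ^ suc m) (∣⇒≈0 (p∣pCk (suc m) (s≤s z≤n) m<p))))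

    freshman : ∀ a → (1ℤ + a) ^ p ≈ 1ℤ + a ^ p [ p ]
    freshman a = subst (λ z → z ≈ 1ℤ + a ^ p [ p ]) (sym (binomial p a)) (go p refl)
      where
      go : ∀ n → n ≡ p → partial p n a ≈ 1ℤ + a ^ n [ p ]
      go zero    0≡p = ⊥-elim (ℕₚ.<⇒≱ 1<p (subst (ℕ._≤ 1) 0≡p z≤n))
      go (suc n) eq = ≈-+ (partial-≈1 n a (subst (n ℕ.<_) eq (ℕₚ.n<1+n n)))
        (subst (λ z → z ≈ a ^ suc n [ p ]) (sym (trans (cong (λ z → + z * a ^ suc n) (trans (cong (_C suc n) (sym eq)) (nCn≡1 (suc n)))) (ℤₚ.*-identityˡ (a ^ suc n)))) ≈-refl)

    fermat-ℕ : ∀ n → (+ n) ^ p ≈ + n [ p ]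
    fermat-ℕ zero = go p 1<p
      where
      go : ∀ k → 1 ℕ.< k → 0ℤ ^ k ≈ 0ℤ [ p ]
      go (suc k) _ = ≈-refl
    fermat-ℕ (suc n) = ≈-trans (freshman (+ n)) (≈-+ (≈-refl {z = 1ℤ}) (fermat-ℕ n))

    fermat : ∀ x → x ^ p ≈ x [ p ]
    fermat x = ≈-trans (^-≈ p (rep-res p x)) (≈-trans (fermat-ℕ _) (≈-sym (rep-res p x)))

    fermat-unit : ∀ x m → p ≡ suc m → ¬ (x ≈ 0ℤ [ p ]) → x ⋆ m ≈ 1ℤ [ p ]
    fermat-unit x m eq x≉0 = cancel x x≉0 (subst₂ (λ u v → u ≈ v [ p ]) (trans (sym (⋆-^ x p)) (trans (cong (x ⋆_) eq) (⋆-suc x m))) (sym (ℤₚ.*-identityʳ x)) (fermat x))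

    abstract
      ≈? : ∀ y z → Dec (y ≈ z [ p ])
      ≈? y z = map′ res⇒≈ ≈⇒res (res p y Finₚ.≟ res p z)

    -- If x ^ m ≡ 1 for x = 1, …, m + 1, the m-th difference m! of x ^ m would vanish modulo p.
    nontrivial-power : ∀ m → 0 ℕ.< m → suc m ℕ.< p → ∃ λ x → ¬ (x ≈ 0ℤ [ p ]) × ¬ (x ⋆ m ≈ 1ℤ [ p ])
    nontrivial-power (suc m) _ m<p = search (ℕₚ.anyUpTo? (λ n → ¬? (≈? (power n) 1ℤ)) (suc (suc m)))
      where
      power : ℕ → ℤ
      power n = +[1+ n ] ⋆ suc m
      search : Dec (∃ λ n → n ℕ.< suc (suc m) × ¬ (power n ≈ 1ℤ [ p ])) → ∃ λ x → ¬ (x ≈ 0ℤ [ p ]) × ¬ (x ⋆ suc m ≈ 1ℤ [ p ])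
      search (yes (n , n< , h)) = +[1+ n ] , small-≉0 (suc n) (s≤s z≤n) (ℕₚ.≤-<-trans n< m<p) , h
      search (no none) = ⊥-elim (p∤small! (suc m) (ℕₚ.<-trans (ℕₚ.n<1+n (suc m)) m<p)
          (≈0⇒∣ (subst (λ z → z ≈ 0ℤ [ p ]) (Δ-power (suc m) 1ℤ) (Δ-constant m (_^ suc m) 1ℤ 1ℤ all-one))))
        where
        all-one : ∀ i → i ℕ.≤ suc m → (1ℤ + + i) ^ suc m ≈ 1ℤ [ p ]
        all-one i i≤ = subst (λ z → z ≈ 1ℤ [ p ]) (⋆-^ +[1+ i ] (suc m)) (decidable-stable (≈? (power i) 1ℤ) λ ne → none (i , s≤s i≤ , ne))

    -- Write `p = 1 + 4 n` and take a unit `x` with `x ^ (2 n)` different from 1. As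
    -- `x ^ (4 n) = 1`, that power is -1 and `x ^ n` is the root.
    sqrt-1 : ∀ k → p ≡ suc (4 ℕ.* k) → ∃ λ h → h * h + 1ℤ ≈ 0ℤ [ p ]
    sqrt-1 zero eq = ⊥-elim (ℕₚ.<⇒≢ 1<p (sym eq))
    sqrt-1 (suc k) eq = from (nontrivial-power (2 ℕ.* n) (s≤s z≤n) (subst (suc (2 ℕ.* n) ℕ.<_) (sym eq) (s≤s (ℕₚ.*-monoˡ-< n {2} {4} (s≤s (s≤s (s≤s z≤n)))))))
      where
      n : ℕ
      n = suc k
      l : ∀ y → y * (y * (y * y)) - 1ℤ ≡ (y * y - 1ℤ) * (y * y + 1ℤ)
      l = solve-∀
      fourth : ∀ x → x ⋆ (4 ℕ.* n) - 1ℤ ≡ (x ⋆ n * x ⋆ n - 1ℤ) * (x ⋆ n * x ⋆ n + 1ℤ)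
      fourth x = trans (cong (_- 1ℤ) (trans (cong (x ⋆_) (ℕₚ.*-comm 4 n)) (trans (sym (⋆-⋆ x n 4)) (⋆-4 (x ⋆ n))))) (l (x ⋆ n))
      square : ∀ x → x ⋆ n * x ⋆ n ≡ x ⋆ (2 ℕ.* n)
      square x = trans (sym (⋆-2 (x ⋆ n))) (trans (⋆-⋆ x n 2) (cong (x ⋆_) (ℕₚ.*-comm n 2)))
      from : (∃ λ x → ¬ (x ≈ 0ℤ [ p ]) × ¬ (x ⋆ (2 ℕ.* n) ≈ 1ℤ [ p ])) → ∃ λ h → h * h + 1ℤ ≈ 0ℤ [ p ]
      from (x , x≉0 , h) = [ (λ e → ⊥-elim (h (subst (λ z → z ≈ 1ℤ [ p ]) (square x) (≈-difference e)))) , (λ e → x ⋆ n , e) ]′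
        (euclid (x ⋆ n * x ⋆ n - 1ℤ) (x ⋆ n * x ⋆ n + 1ℤ) (subst (λ z → z ≈ 0ℤ [ p ]) (fourth x) (≈-- (fermat-unit x (4 ℕ.* n) eq x≉0) (≈-refl {z = 1ℤ}))))

    -- With `p = 1 + 3 n` and `x ^ n` different from 1, `x ^ n` is a root of `z² + z + 1`, and its
    -- negative is a root of `z² - z + 1`.
    cube-root : ∀ k → p ≡ suc (3 ℕ.* k) → ∃ λ h → h * h - h + 1ℤ ≈ 0ℤ [ p ]
    cube-root zero eq = ⊥-elim (ℕₚ.<⇒≢ 1<p (sym eq))
    cube-root (suc k) eq = from (nontrivial-power n (s≤s z≤n) (subst (suc n ℕ.<_) (sym eq) (s≤s (subst (n ℕ.<_) (ℕₚ.*-comm n 3) (ℕₚ.m<m*n n 3 (s≤s (s≤s z≤n)))))))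
      where
      n : ℕ
      n = suc k
      l : ∀ y → y * (y * y) - 1ℤ ≡ (y - 1ℤ) * (- y * - y - - y + 1ℤ)
      l = solve-∀
      third : ∀ x → x ⋆ (3 ℕ.* n) - 1ℤ ≡ (x ⋆ n - 1ℤ) * (- (x ⋆ n) * - (x ⋆ n) - - (x ⋆ n) + 1ℤ)
      third x = trans (cong (_- 1ℤ) (trans (cong (x ⋆_) (ℕₚ.*-comm 3 n)) (trans (sym (⋆-⋆ x n 3)) (⋆-3 (x ⋆ n))))) (l (x ⋆ n))
      from : (∃ λ x → ¬ (x ≈ 0ℤ [ p ]) × ¬ (x ⋆ n ≈ 1ℤ [ p ])) → ∃ λ h → h * h - h + 1ℤ ≈ 0ℤ [ p ]
      from (x , x≉0 , h) = [ (λ e → ⊥-elim (h (≈-difference e))) , (λ e → - (x ⋆ n) , e) ]′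
        (euclid (x ⋆ n - 1ℤ) (- (x ⋆ n) * - (x ⋆ n) - - (x ⋆ n) + 1ℤ) (subst (λ z → z ≈ 0ℤ [ p ]) (third x) (≈-- (fermat-unit x (3 ℕ.* n) eq x≉0) (≈-refl {z = 1ℤ}))))

    square-≈0 : ∀ y → y * y ≈ 0ℤ [ p ] → y ≈ 0ℤ [ p ]
    square-≈0 y h = [ id , id ]′ (euclid y y h)

    -- If `y` is a unit then so is `x`, and raising `x² = - y²` to the odd power `n = (p - 1) / 2`
    -- gives `1 = -1` by Fermat.
    inert₄ : ∀ k → p ≡ suc (2 ℕ.* suc (2 ℕ.* k)) → ∀ x y → x * x + y * y ≈ 0ℤ [ p ] → y ≈ 0ℤ [ p ]
    inert₄ k eq x y h = decidable-stable (≈? y 0ℤ) contradiction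
      where
      n : ℕ
      n = suc (2 ℕ.* k)
      2<p : 2 ℕ.< p
      2<p = subst (2 ℕ.<_) (sym eq) (s≤s (ℕₚ.*-monoʳ-≤ 2 {1} {n} (s≤s z≤n)))
      x²≈-y² : x * x ≈ - (y * y) [ p ]
      x²≈-y² = ≈-difference (subst (λ z → z ≈ 0ℤ [ p ]) (cong (λ z → x * x + z) (sym (ℤₚ.neg-involutive (y * y)))) h)
      power-2 : ∀ z m → z ⋆ (2 ℕ.* m) ≡ (z * z) ⋆ m
      power-2 z m = trans (sym (⋆-⋆ z 2 m)) (cong (_⋆ m) (⋆-2 z))
      odd-power : ∀ z → (- z) ⋆ n ≡ - (z ⋆ n)
      odd-power z = trans (⋆-suc (- z) (2 ℕ.* k)) (trans (cong (- z *_) (trans (power-2 (- z) k) (trans (cong (_⋆ k) (l z)) (sym (power-2 z k)))))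
        (trans (sym (ℤₚ.neg-distribˡ-* z (z ⋆ (2 ℕ.* k)))) (cong -_ (sym (⋆-suc z (2 ℕ.* k))))))
        where
        l : ∀ z → - z * - z ≡ z * z
        l = solve-∀
      contradiction : ¬ ¬ (y ≈ 0ℤ [ p ])
      contradiction y≉0 = small-≉0 2 (s≤s z≤n) 2<p (≈-+ (≈-refl {z = 1ℤ}) 1≈-1)
        where
        x≉0 : ¬ (x ≈ 0ℤ [ p ])
        x≉0 e = y≉0 (square-≈0 y (subst (λ z → z ≈ 0ℤ [ p ]) (l x y) (≈-- h (≈-scale x e))))
          where
          l : ∀ x y → x * x + y * y - x * x ≡ y * y
          l = solve-∀
        1≈-1 : 1ℤ ≈ - 1ℤ [ p ]
        1≈-1 = ≈-trans (≈-sym (fermat-unit x (2 ℕ.* n) eq x≉0)) (subst (λ z → z ≈ - 1ℤ [ p ]) (sym (power-2 x n)) (≈-trans (⋆-≈ n x²≈-y²)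
          (subst (λ z → z ≈ - 1ℤ [ p ]) (sym (trans (odd-power (y * y)) (cong -_ (sym (power-2 y n))))) (≈-neg (fermat-unit y (2 ℕ.* n) eq y≉0)))))

    -- Multiplication by `x - y` gives `x³ = y³`. As `p - 1 = 3 k + 1`, Fermat recovers a unit from
    -- its cube, so `x = y` and the form becomes `3 y²`, where 3 is a unit.
    inert₃ : ∀ k → p ≡ suc (suc (3 ℕ.* k)) → ∀ x y → x * x + x * y + y * y ≈ 0ℤ [ p ] → y ≈ 0ℤ [ p ]
    inert₃ k eq x y h = decidable-stable (≈? y 0ℤ) contradiction
      where
      3≉0 : ¬ (+ 3 ≈ 0ℤ [ p ])
      3≉0 e = by-size k eq
        where
        by-size : ∀ k → p ≡ suc (suc (3 ℕ.* k)) → ⊥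
        by-size zero    eq = from-no (2 ℕ∣.∣? 3) (subst (ℕ∣._∣ 3) eq (≈0⇒∣ e))
        by-size (suc j) eq = small-≉0 3 (s≤s z≤n) (subst (3 ℕ.<_) (sym eq) (s≤s (s≤s (ℕₚ.≤-trans (s≤s (s≤s z≤n)) (ℕₚ.m≤m*n 3 (suc j)))))) e
      contradiction : ¬ ¬ (y ≈ 0ℤ [ p ])
      contradiction y≉0 = 3≉0 (cancel-y (≈-trans (≈-sym difference) h))
        where
        x≉0 : ¬ (x ≈ 0ℤ [ p ])
        x≉0 e = y≉0 (square-≈0 y (subst (λ z → z ≈ 0ℤ [ p ]) (l x y) (≈-- h (≈-scale (x + y) e))))
          where
          l : ∀ x y → x * x + x * y + y * y - (x + y) * x ≡ y * y
          l = solve-∀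
        cube : x ⋆ 3 ≈ y ⋆ 3 [ p ]
        cube = subst₂ (λ u v → u ≈ v [ p ]) (sym (⋆-3 x)) (sym (⋆-3 y)) (≈-difference (subst (λ z → z ≈ 0ℤ [ p ]) (l x y) (≈-scale (x - y) h)))
          where
          l : ∀ x y → (x - y) * (x * x + x * y + y * y) ≡ x * (x * x) - y * (y * y)
          l = solve-∀
        powers : x ⋆ (3 ℕ.* k) ≈ y ⋆ (3 ℕ.* k) [ p ]
        powers = subst₂ (λ u v → u ≈ v [ p ]) (⋆-⋆ x 3 k) (⋆-⋆ y 3 k) (⋆-≈ k cube)
        unit : ∀ z → ¬ (z ≈ 0ℤ [ p ]) → z * z ⋆ (3 ℕ.* k) ≈ 1ℤ [ p ]
        unit z z≉0 = subst (λ u → u ≈ 1ℤ [ p ]) (⋆-suc z (3 ℕ.* k)) (fermat-unit z (suc (3 ℕ.* k)) eq z≉0)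
        x≈y : x ≈ y [ p ]
        x≈y = cancel (x ⋆ (3 ℕ.* k)) (λ e → x≉0 (power-≈0 x (3 ℕ.* k) e))
          (subst (λ u → u ≈ x ⋆ (3 ℕ.* k) * y [ p ]) (ℤₚ.*-comm x (x ⋆ (3 ℕ.* k))) (≈-trans (unit x x≉0)
            (≈-trans (≈-sym (unit y y≉0)) (subst (λ z → z ≈ x ⋆ (3 ℕ.* k) * y [ p ]) (ℤₚ.*-comm (y ⋆ (3 ℕ.* k)) y) (≈-* (≈-sym powers) (≈-refl {z = y}))))))
        difference : x * x + x * y + y * y ≈ + 3 * (y * y) [ p ]
        difference = subst (λ z → x * x + x * y + y * y ≈ z [ p ]) (l y) (≈-+ (≈-+ (≈-* x≈y x≈y) (≈-* x≈y (≈-refl {z = y}))) (≈-refl {z = y * y}))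
          where
          l : ∀ y → y * y + y * y + y * y ≡ + 3 * (y * y)
          l = solve-∀
        cancel-y : + 3 * (y * y) ≈ 0ℤ [ p ] → + 3 ≈ 0ℤ [ p ]
        cancel-y e = [ id , (λ e′ → ⊥-elim (y≉0 (square-≈0 y e′))) ]′ (euclid (+ 3) (y * y) e)

-- Representation numbers of binary forms of discriminant -3 and -4.

module BinaryForms where

  open FiniteSums
  open Congruences
  open Progressions
  open PrimeModuli
  open import Data.Empty using (⊥-elim)
  open import Data.Nat as ℕ using (ℕ; zero; suc; z≤n; s≤s)
  import Data.Nat.Properties as ℕₚ
  import Data.Nat.Divisibility as ℕ∣
  open import Data.Nat.Induction using (<-rec)
  open import Data.Nat.Primality using (Prime; prime⇒nonTrivial)
  open import Data.Nat.Primality.Factorisation using (factorise; PrimeFactorisation)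
  open import Data.List using ([]; _∷_)
  open import Data.Nat.ListAction using (product)
  open import Data.List.Relation.Unary.All using ([]; _∷_)
  open import Data.Integer as ℤ using (ℤ; +_; +0; +[1+_]; -[1+_]; _+_; _*_; _-_; -_; ∣_∣; 0ℤ; 1ℤ; _≤_; _<_)
  import Data.Integer.Properties as ℤₚ
  open import Data.Integer.DivMod using (_/ℕ_)
  open import Data.Integer.Tactic.RingSolver using (solve-∀)
  open import Data.Product using (∃; _×_; _,_; proj₁; proj₂)
  open import Data.Sum using (_⊎_; inj₁; inj₂; [_,_]′)
  open import Function using (_∘_; id; case_of_)
  open import Relation.Nullary using (¬_; Dec; yes; no)
  open import Relation.Binary.PropositionalEquality

  Pair : Set
  Pair = ℤ × ℤ

  pos-* : ∀ {m} z → 0 ℕ.< m → pos (z * + m) ≡ pos z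
  pos-* {suc m} +0       _ = refl
  pos-* {suc m} +[1+ _ ] _ = refl
  pos-* {suc m} -[1+ _ ] _ = refl

  prime-factor : ∀ K → 1 ℕ.< K → ∃ λ p → ∃ λ n → Prime p × K ≡ p ℕ.* n
  prime-factor K 1<K = go (factorise K {{ℕ.>-nonZero (ℕₚ.<-trans (s≤s z≤n) 1<K)}})
    where
    go : PrimeFactorisation K → ∃ λ p → ∃ λ n → Prime p × K ≡ p ℕ.* n
    go record { factors = [] ; isFactorisation = eq } = ⊥-elim (ℕₚ.<⇒≢ 1<K (sym eq))
    go record { factors = p ∷ ps ; isFactorisation = eq ; factorsPrime = pp ∷ _ } = p , product ps , pp , eq

  module BinaryForm (ε : ℤ) (disc : ℕ) (disc-≡ : + disc ≡ + 4 - ε * ε) (3≤disc : 3 ℕ.≤ disc) (disc≤4 : disc ℕ.≤ 4) where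

    form : ℤ → ℤ → ℤ → Pair → ℤ
    form A B C (x , y) = A * (x * x) + B * (x * y) + C * (y * y)

    Q : Pair → ℤ
    Q = form 1ℤ ε 1ℤ

    Represents : ℤ → ℤ → ℤ → ℤ → ℤ → Set
    Represents A B C n s = HasSum (λ v → δ (form A B C v - n)) s

    private
      transport : ∀ {A B C A′ B′ C′ n s} (f g : Pair → Pair) → (∀ v → g (f v) ≡ v) → (∀ v → f (g v) ≡ v) →
        (∀ v → form A B C (f v) ≡ form A′ B′ C′ v) → Represents A B C n s → Represents A′ B′ C′ n s
      transport {n = n} f g gf fg eq p = HasSum-cong (λ v → cong (λ z → δ (z - n)) (eq v)) (HasSum-bijection f g gf fg p)

      shift⁺ : ∀ A B C {n s} → Represents A (B - + 2 * A) (A - B + C) n s → Represents A B C n s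
      shift⁺ A B C {n} {s} = transport {A} {B - + 2 * A} {A - B + C} {A} {B} {C} (λ (x , y) → x + y , y) (λ (x , y) → x - y , y)
        (λ (x , y) → cong (_, y) (l₁ x y)) (λ (x , y) → cong (_, y) (l₂ x y)) (λ (x , y) → l A B C x y)
        where
        l₁ : ∀ x y → x + y - y ≡ x
        l₁ = solve-∀
        l₂ : ∀ x y → x - y + y ≡ x
        l₂ = solve-∀
        l : ∀ A B C x y → A * ((x + y) * (x + y)) + (B - + 2 * A) * ((x + y) * y) + (A - B + C) * (y * y) ≡ A * (x * x) + B * (x * y) + C * (y * y)
        l = solve-∀

      flip-y : ∀ A B C {n s} → Represents A (- B) C n s → Represents A B C n s
      flip-y A B C = transport {A} { - B} {C} {A} {B} {C} (λ (x , y) → x , - y) (λ (x , y) → x , - y)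
        (λ (x , y) → cong (x ,_) (ℤₚ.neg-involutive y)) (λ (x , y) → cong (x ,_) (ℤₚ.neg-involutive y)) (λ (x , y) → l A B C x y)
        where
        l : ∀ A B C x y → A * (x * x) + - B * (x * - y) + C * (- y * - y) ≡ A * (x * x) + B * (x * y) + C * (y * y)
        l = solve-∀

      exchange : ∀ A B C {n s} → Represents C B A n s → Represents A B C n s
      exchange A B C = transport {C} {B} {A} {A} {B} {C} (λ (x , y) → y , x) (λ (x , y) → y , x) (λ _ → refl) (λ _ → refl) (λ (x , y) → l A B C x y)
        where
        l : ∀ A B C x y → C * (y * y) + B * (y * x) + A * (x * x) ≡ A * (x * x) + B * (x * y) + C * (y * y)
        l = solve-∀

      ∣difference∣< : ∀ b u → 0 ℕ.< u → u ℕ.< b ℕ.+ b → ∣ + b - + u ∣ ℕ.< b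
      ∣difference∣< b u 0<u u<2b with ℕₚ.≤-total u b
      ... | inj₁ u≤b = subst (ℕ._< b) (sym (cong ∣_∣ (trans (ℤₚ.m-n≡m⊖n b u) (ℤₚ.⊖-≥ u≤b)))) (ℕₚ.∸-monoʳ-< 0<u u≤b)
      ... | inj₂ b≤u = subst (ℕ._< b) (sym (trans (cong ∣_∣ (trans (ℤₚ.m-n≡m⊖n b u) (ℤₚ.⊖-≤ b≤u))) (ℤₚ.∣-i∣≡∣i∣ (+ (u ℕ.∸ b)))))
        (ℕₚ.+-cancelʳ-< b (u ℕ.∸ b) b (subst (ℕ._< b ℕ.+ b) (sym (ℕₚ.m∸n+n≡m b≤u)) u<2b))

      positive : ∀ a C m → + 4 * (+[1+ a ] * C) ≡ +[1+ m ] → ∃ λ c → C ≡ +[1+ c ]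
      positive a +0       m eq with trans (sym (cong (+ 4 *_) (ℤₚ.*-zeroʳ +[1+ a ]))) eq
      ... | ()
      positive a +[1+ c ] m eq = c , refl
      positive a -[1+ c ] m ()

      discriminant-suc : ∀ B → ∃ λ m → B * B + + disc ≡ +[1+ m ]
      discriminant-suc B = ∣ B ∣ ℕ.* ∣ B ∣ ℕ.+ (disc ℕ.∸ 1) , trans (cong (_+ + disc) (square-ℕ B)) (cong +_ (trans (cong (∣ B ∣ ℕ.* ∣ B ∣ ℕ.+_) (sym (ℕₚ.m+[n∸m]≡n {1} (ℕₚ.≤-trans (s≤s z≤n) 3≤disc)))) (ℕₚ.+-suc _ _)))

      -- For the product `m` of the outer coefficients, reducedness gives `4 m = b² + disc ≤ m + 4`,
      -- so `m = 1`.
      minimal : ∀ a c b → b ℕ.≤ suc a → b ℕ.≤ suc c → 4 ℕ.* (suc a ℕ.* suc c) ≡ b ℕ.* b ℕ.+ disc → a ≡ 0 × c ≡ 0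
      minimal a c b b≤a b≤c eq = pick a c ac≤1
        where
        m = suc a ℕ.* suc c
        3m≤4 : 3 ℕ.* m ℕ.≤ 4
        3m≤4 = ℕₚ.+-cancelˡ-≤ m (3 ℕ.* m) 4 (ℕₚ.≤-trans (ℕₚ.≤-reflexive eq) (ℕₚ.+-mono-≤ (ℕₚ.*-mono-≤ b≤a b≤c) disc≤4))
        ac≤1 : m ℕ.≤ 1
        ac≤1 with m ℕ.≤? 1
        ... | yes le = le
        ... | no gt = ⊥-elim (ℕₚ.<⇒≱ (ℕₚ.≤-trans (ℕₚ.≤ᵇ⇒≤ 5 6 _) (ℕₚ.*-monoʳ-≤ 3 (ℕₚ.≰⇒> gt))) 3m≤4)
        pick : ∀ a c → suc a ℕ.* suc c ℕ.≤ 1 → a ≡ 0 × c ≡ 0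
        pick zero zero _ = refl , refl
        pick zero (suc c) (s≤s ())
        pick (suc a) zero (s≤s ())
        pick (suc a) (suc c) (s≤s ())

    -- Every positive form of the discriminant of Q is equivalent to Q.
    reduction : ∀ a B C → + 4 * (+[1+ a ] * C) ≡ B * B + + disc → ∀ {n s} → Represents 1ℤ ε 1ℤ n s → Represents +[1+ a ] B C n s
    reduction a B C eq {n} {s} p = go (suc ∣ B ∣) a B C (ℕₚ.n<1+n ∣ B ∣) eq
      where
      go : ∀ k a B C → ∣ B ∣ ℕ.< k → + 4 * (+[1+ a ] * C) ≡ B * B + + disc → Represents +[1+ a ] B C n s
      go′ : ∀ k a b C → b ℕ.< suc k → + 4 * (+[1+ a ] * C) ≡ + b * + b + + disc → Represents +[1+ a ] (+ b) C n s
      go (suc k) a (+ b) C b<k eq = go′ k a b C b<k eq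
      go (suc k) a B@(-[1+ b ]) C b<k eq = flip-y +[1+ a ] B C (go′ k a (suc b) C b<k eq)
      go′ k a b C b<k eq with positive a C (proj₁ (discriminant-suc (+ b))) (trans eq (proj₂ (discriminant-suc (+ b))))
      ... | c , refl with b ℕ.≤? suc a | b ℕ.≤? suc c
      ... | no b≰a | _ = shift⁺ +[1+ a ] (+ b) +[1+ c ] (go k a (+ b - + 2 * +[1+ a ]) (+[1+ a ] - + b + +[1+ c ])
          (ℕₚ.<-≤-trans (subst (λ z → ∣ + b - z ∣ ℕ.< b) (ℤₚ.pos-* 2 (suc a)) (∣difference∣< b (2 ℕ.* suc a) (s≤s z≤n) (subst (ℕ._< b ℕ.+ b) (cong (suc a ℕ.+_) (sym (ℕₚ.+-identityʳ (suc a)))) (ℕₚ.+-mono-< (ℕₚ.≰⇒> b≰a) (ℕₚ.≰⇒> b≰a))))) (ℕ.s≤s⁻¹ b<k))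
          (shifted +[1+ a ] (+ b) +[1+ c ] eq))
        where
        shifted : ∀ A B C → + 4 * (A * C) ≡ B * B + + disc → + 4 * (A * (A - B + C)) ≡ (B - + 2 * A) * (B - + 2 * A) + + disc
        shifted A B C e = trans (l A B C) (trans (cong (λ z → (B - + 2 * A) * (B - + 2 * A) + (z - B * B)) e) (l′ A B (+ disc)))
          where
          l : ∀ A B C → + 4 * (A * (A - B + C)) ≡ (B - + 2 * A) * (B - + 2 * A) + (+ 4 * (A * C) - B * B)
          l = solve-∀
          l′ : ∀ A B d → (B - + 2 * A) * (B - + 2 * A) + (B * B + d - B * B) ≡ (B - + 2 * A) * (B - + 2 * A) + d
          l′ = solve-∀
      ... | yes _ | no b≰c = exchange +[1+ a ] (+ b) +[1+ c ] (shift⁺ +[1+ c ] (+ b) +[1+ a ] (go k c (+ b - + 2 * +[1+ c ]) (+[1+ c ] - + b + +[1+ a ])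
          (ℕₚ.<-≤-trans (subst (λ z → ∣ + b - z ∣ ℕ.< b) (ℤₚ.pos-* 2 (suc c)) (∣difference∣< b (2 ℕ.* suc c) (s≤s z≤n) (subst (ℕ._< b ℕ.+ b) (cong (suc c ℕ.+_) (sym (ℕₚ.+-identityʳ (suc c)))) (ℕₚ.+-mono-< (ℕₚ.≰⇒> b≰c) (ℕₚ.≰⇒> b≰c))))) (ℕ.s≤s⁻¹ b<k))
          (shifted +[1+ a ] (+ b) +[1+ c ] eq)))
        where
        shifted : ∀ A B C → + 4 * (A * C) ≡ B * B + + disc → + 4 * (C * (C - B + A)) ≡ (B - + 2 * C) * (B - + 2 * C) + + disc
        shifted A B C e = trans (l A B C) (trans (cong (λ z → (B - + 2 * C) * (B - + 2 * C) + (z - B * B)) e) (l′ C B (+ disc)))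
          where
          l : ∀ A B C → + 4 * (C * (C - B + A)) ≡ (B - + 2 * C) * (B - + 2 * C) + (+ 4 * (A * C) - B * B)
          l = solve-∀
          l′ : ∀ A B d → (B - + 2 * A) * (B - + 2 * A) + (B * B + d - B * B) ≡ (B - + 2 * A) * (B - + 2 * A) + d
          l′ = solve-∀
      ... | yes b≤a | yes b≤c with minimal a c b b≤a b≤c (ℤₚ.+-injective (trans (ℤₚ.pos-* 4 (suc a ℕ.* suc c)) (trans eq (cong (_+ + disc) (sym (ℤₚ.pos-* b b))))))
      -- Both outer coefficients are 1, hence `b² = 4 - disc = ε²` and `b` is `ε` or `- ε`.
      ... | refl , refl with ℤₚ.i*j≡0⇒i≡0∨j≡0 (+ b - ε) {+ b + ε} (trans (l (+ b) ε) (trans (cong (λ z → + b * + b - (+ 4 - z)) (sym disc-≡)) (trans (l′ (+ b) (+ disc)) (trans (cong (_- + 4) (sym eq)) refl))))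
        where
        l : ∀ b e → (b - e) * (b + e) ≡ b * b - (+ 4 - (+ 4 - e * e))
        l = solve-∀
        l′ : ∀ b d → b * b - (+ 4 - d) ≡ b * b + d - + 4
        l′ = solve-∀
      ... | inj₁ e = subst (λ z → Represents 1ℤ z 1ℤ n s) (sym (ℤₚ.i-j≡0⇒i≡j (+ b) ε e)) p
      ... | inj₂ e = flip-y 1ℤ (+ b) 1ℤ (subst (λ z → Represents 1ℤ z 1ℤ n s) (sym (negated (+ b) ε e)) p)
        where
        negated : ∀ b e → b + e ≡ 0ℤ → - b ≡ e
        negated b e h = trans (l b e) (trans (cong (λ z → e - z) h) (ℤₚ.+-identityʳ e))
          where
          l : ∀ b e → - b ≡ e - (b + e)
          l = solve-∀

  module _ (p : ℕ) .{{_ : ℕ.NonZero p}} where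

    private
      exact : ∀ x → D p (x * + p) ≡ 1ℤ
      exact x = D-1 p (by x (sym (ℤₚ.+-identityˡ (x * + p))))

    HasSum-scale₁ : ∀ {w : Pair → ℤ} {s} → HasSum (λ (x , y) → w (x * + p , y)) s → HasSum (λ (x , y) → D p x * w (x , y)) s
    HasSum-scale₁ {w} = HasSum-reindex {A = Pair} {B = Pair} (λ (x , y) → x * + p , y) (λ (x , y) → x /ℕ p , y)
      (λ (x , y) _ → cong (_, y) (/ℕ-exact p x) , value x y)
      (λ (x , y) ne → let e = multiple p x (D≢0 p x (*≢0ˡ {_} {w (x , y)} ne)) in
        cong (_, y) e , trans (sym (value (x /ℕ p) y)) (cong (λ z → D p z * w (z , y)) e))
      where
      value : ∀ x y → D p (x * + p) * w (x * + p , y) ≡ w (x * + p , y)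
      value x y = trans (cong (_* w (x * + p , y)) (exact x)) (ℤₚ.*-identityˡ _)

    HasSum-scale₂ : ∀ {w : Pair → ℤ} {s} → HasSum (λ (x , y) → w (x , y * + p)) s → HasSum (λ (x , y) → D p y * w (x , y)) s
    HasSum-scale₂ {w} = HasSum-reindex {A = Pair} {B = Pair} (λ (x , y) → x , y * + p) (λ (x , y) → x , y /ℕ p)
      (λ (x , y) _ → cong (x ,_) (/ℕ-exact p y) , value x y)
      (λ (x , y) ne → let e = multiple p y (D≢0 p y (*≢0ˡ {_} {w (x , y)} ne)) in
        cong (x ,_) e , trans (sym (value x (y /ℕ p))) (cong (λ z → D p z * w (x , z)) e))
      where
      value : ∀ x y → D p (y * + p) * w (x , y * + p) ≡ w (x , y * + p)
      value x y = trans (cong (_* w (x , y * + p)) (exact y)) (ℤₚ.*-identityˡ _)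

    HasSum-scale : ∀ {w : Pair → ℤ} {s} → HasSum (λ (x , y) → w (x * + p , y * + p)) s → HasSum (λ (x , y) → D p x * D p y * w (x , y)) s
    HasSum-scale {w} q = HasSum-cong (λ (x , y) → l (D p y) (D p x) (w (x , y))) (HasSum-scale₂ {λ (x , y) → D p x * w (x , y)} (HasSum-scale₁ {λ (x , y) → w (x , y * + p)} q))
      where
      l : ∀ u v z → u * (v * z) ≡ v * u * z
      l = solve-∀

  module Counting (ε : ℤ) (disc : ℕ) (disc-≡ : + disc ≡ + 4 - ε * ε) (3≤disc : 3 ℕ.≤ disc) (disc≤4 : disc ℕ.≤ 4)
    (χ : ℤ → ℤ) (χ-* : ∀ x y → χ (x * y) ≡ χ x * χ y) where

    open BinaryForm ε disc disc-≡ 3≤disc disc≤4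

    -- The splitting types of `p`. A root `h` factors `Q` modulo `p` as `(x + h y) (x + (ε - h) y)`,
    -- and `2 h - ε` is the difference of the two roots `h` and `ε - h`.
    data Local (p : ℕ) : Set where
      split    : ∀ h → h * h - ε * h + 1ℤ ≈ 0ℤ [ p ] → ¬ (+ 2 * h - ε ≈ 0ℤ [ p ]) → χ (+ p) ≡ 1ℤ → Local p
      inert    : (∀ x y → Q (x , y) ≈ 0ℤ [ p ] → x ≈ 0ℤ [ p ] × y ≈ 0ℤ [ p ]) → χ (+ p) ≡ - 1ℤ → Local p
      ramified : ∀ h → h * h - ε * h + 1ℤ ≈ 0ℤ [ p ] → + 2 * h - ε ≈ 0ℤ [ p ] → χ (+ p) ≡ 0ℤ → Local p

    r S : ℤ → Pair → ℤ
    r n v = δ (Q v - n)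
    S n (a , x) = pos a * pos x * χ a * δ (a * x - n)

    -- The counts at `n / p`, which are zero unless `p ∣ n`. Multiplying the form by `p` avoids the
    -- division.
    r′ S′ : ℕ → ℕ → Pair → ℤ
    r′ p n v = δ (+ p * Q v - + n)
    S′ p n (a , x) = pos a * pos x * χ a * δ (+ p * (a * x) - + n)

    Claim : ℤ → ℕ → Set
    Claim w n = ∃ λ s → HasSum (S (+ n)) s × HasSum (r (+ n)) (w * s)

    Claim′ : ℤ → ℕ → ℕ → Set
    Claim′ w p n = ∃ λ s → HasSum (S′ p n) s × HasSum (r′ p n) (w * s)

    module _ (p : ℕ) (p-prime : Prime p) where

      open PrimeModulus p p-prime

      private
        0<p : 0 ℕ.< p
        0<p = ℕₚ.<-trans (s≤s z≤n) 1<p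

        +p-nonZero : ℤ.NonZero (+ p)
        +p-nonZero = ℤ.≢-nonZero λ e → ℕₚ.<⇒≢ 0<p (sym (ℤₚ.+-injective e))

        D≈ : ∀ {z} → z ≈ 0ℤ [ p ] → D p z ≡ 1ℤ
        D≈ = D-1 p

        on-equation : ∀ {z n} → z - + p * + n ≡ 0ℤ → z ≈ 0ℤ [ p ]
        on-equation {z} {n} e = by (+ n) (trans (ℤₚ.i-j≡0⇒i≡j z (+ p * + n) e) (trans (ℤₚ.*-comm (+ p) (+ n)) (sym (ℤₚ.+-identityˡ (+ n * + p)))))

        r-pn : ∀ n v → r (+ (p ℕ.* n)) v ≡ δ (Q v - + p * + n)
        r-pn n v = cong (λ z → δ (Q v - z)) (ℤₚ.pos-* p n)

        S-pn : ∀ n a x → S (+ (p ℕ.* n)) (a , x) ≡ pos a * pos x * χ a * δ (a * x - + p * + n)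
        S-pn n a x = cong (λ z → pos a * pos x * χ a * δ (a * x - z)) (ℤₚ.pos-* p n)

      primed : ∀ w n → (∀ m → n ≡ p ℕ.* m → Claim w m) → Claim′ w p n
      primed w n claim with p ℕ∣.∣? n
      ... | yes (ℕ∣.divides m eq) with claim m (trans eq (ℕₚ.*-comm m p))
      ...   | s , σ , ρ = s , HasSum-cong (λ (a , x) → cong (pos a * pos x * χ a *_) (same (a * x))) σ , HasSum-cong (λ v → same (Q v)) ρ
        where
        same : ∀ z → δ (z - + m) ≡ δ (+ p * z - + n)
        same z = trans (sym (δ-* (+ p) (z - + m) {{+p-nonZero}})) (cong δ (trans (l (+ p) z (+ m)) (cong (λ u → + p * z - u) (trans (sym (ℤₚ.pos-* m p)) (cong +_ (sym eq))))))
          where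
          l : ∀ p z m → p * (z - m) ≡ p * z - m * p
          l = solve-∀
      primed w n claim | no p∤n = 0ℤ , HasSum-0 (λ (a , x) → trans (cong (pos a * pos x * χ a *_) (none (a * x))) (ℤₚ.*-zeroʳ (pos a * pos x * χ a))) ,
          HasSum-subst (sym (ℤₚ.*-zeroʳ w)) (HasSum-0 λ v → none (Q v))
        where
        none : ∀ z → δ (+ p * z - + n) ≡ 0ℤ
        none z = δ-≢ λ e → p∤n (≈0⇒∣ (by z (trans (sym (ℤₚ.i-j≡0⇒i≡j (+ p * z) (+ n) e)) (trans (ℤₚ.*-comm (+ p) z) (sym (ℤₚ.+-identityˡ (z * + p)))))))

      -- On the sublattice `x ≡ - h y` modulo `p`, `Q` is `p` times a form of the same discriminant,
      -- hence equivalent to `Q` by `reduction`. Representations of `p n` in the sublattice thus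
      -- correspond to representations of `n`.
      sublattice : ∀ h n s → h * h - ε * h + 1ℤ ≈ 0ℤ [ p ] → HasSum (r (+ n)) s → HasSum (λ (x , y) → D p (x + h * y) * δ (Q (x , y) - + p * + n)) s
      sublattice h n s (by m eq) ρ = HasSum-cong (λ (x , y) → cong (λ z → D p (x + h * y) * δ (Q (z , y) - + p * + n)) (l₂ x (h * y)))
        (HasSum-bijection {w = λ (x , y) → D p x * δ (Q (x - h * y , y) - + p * + n)} (λ (x , y) → x + h * y , y) (λ (x , y) → x - h * y , y)
          (λ (x , y) → cong (_, y) (l₂ x (h * y))) (λ (x , y) → cong (_, y) (l₁ x (h * y)))
          (HasSum-scale₁ p {λ (x , y) → δ (Q (x - h * y , y) - + p * + n)} (HasSum-cong scaled (equivalent p 0<p refl))))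
        where
        l₁ : ∀ x z → x - z + z ≡ x
        l₁ = solve-∀
        l₂ : ∀ x z → x + z - z ≡ x
        l₂ = solve-∀
        mp : h * h - ε * h + 1ℤ ≡ m * + p
        mp = trans eq (ℤₚ.+-identityˡ (m * + p))
        equivalent : ∀ q → 0 ℕ.< q → q ≡ p → Represents (+ q) (ε - + 2 * h) m (+ n) s
        equivalent (suc q) _ q≡p = reduction q (ε - + 2 * h) m (trans (cong (λ z → + 4 * (+ z * m)) q≡p) (trans (cong (+ 4 *_) (trans (ℤₚ.*-comm (+ p) m) (sym mp)))
          (trans (l h ε) (cong (λ z → (ε - + 2 * h) * (ε - + 2 * h) + z) (sym disc-≡))))) ρ
          where
          l : ∀ h ε → + 4 * (h * h - ε * h + 1ℤ) ≡ (ε - + 2 * h) * (ε - + 2 * h) + (+ 4 - ε * ε)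
          l = solve-∀
        scaled : ∀ v → δ (form (+ p) (ε - + 2 * h) m v - + n) ≡ δ (Q (proj₁ v * + p - h * proj₂ v , proj₂ v) - + p * + n)
        scaled (u , y) = trans (sym (δ-* (+ p) (form (+ p) (ε - + 2 * h) m (u , y) - + n) {{+p-nonZero}})) (cong δ (trans (l (+ p) ε h m u y (+ n))
          (trans (cong (λ z → + p * (+ p * (u * u) + (ε - + 2 * h) * (u * y)) + z * (y * y) - + p * + n) (sym mp)) (l′ (+ p) ε h u y (+ n)))))
          where
          l : ∀ p ε h m u y n → p * (p * (u * u) + (ε - + 2 * h) * (u * y) + m * (y * y) - n) ≡ p * (p * (u * u) + (ε - + 2 * h) * (u * y)) + (m * p) * (y * y) - p * n
          l = solve-∀
          l′ : ∀ p ε h u y n → p * (p * (u * u) + (ε - + 2 * h) * (u * y)) + (h * h - ε * h + 1ℤ) * (y * y) - p * n ≡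
            1ℤ * ((u * p - h * y) * (u * p - h * y)) + ε * ((u * p - h * y) * y) + 1ℤ * (y * y) - p * n
          l′ = solve-∀

      private
        product-≈ : ∀ h x y → h * h - ε * h + 1ℤ ≈ 0ℤ [ p ] → Q (x , y) ≈ 0ℤ [ p ] → (x + h * y) * (x + (ε - h) * y) ≈ 0ℤ [ p ]
        product-≈ h x y hh q = subst (λ z → z ≈ 0ℤ [ p ]) (l ε h x y) (≈-- q (≈-scale (y * y) hh))
          where
          l : ∀ ε h x y → 1ℤ * (x * x) + ε * (x * y) + 1ℤ * (y * y) - y * y * (h * h - ε * h + 1ℤ) ≡ (x + h * y) * (x + (ε - h) * y)
          l = solve-∀

        conjugate : ∀ h → h * h - ε * h + 1ℤ ≈ 0ℤ [ p ] → (ε - h) * (ε - h) - ε * (ε - h) + 1ℤ ≈ 0ℤ [ p ]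
        conjugate h hh = subst (λ z → z ≈ 0ℤ [ p ]) (l ε h) hh
          where
          l : ∀ ε h → h * h - ε * h + 1ℤ ≡ (ε - h) * (ε - h) - ε * (ε - h) + 1ℤ
          l = solve-∀

        inclusion : ∀ {u v z} → u ≈ 0ℤ [ p ] ⊎ v ≈ 0ℤ [ p ] → D p u * z + D p v * z - D p u * D p v * z ≡ z
        inclusion {u} {v} {z} (inj₁ e) = trans (cong (λ d → d * z + D p v * z - d * D p v * z) (D≈ e)) (l (D p v) z)
          where
          l : ∀ d z → 1ℤ * z + d * z - 1ℤ * d * z ≡ z
          l = solve-∀
        inclusion {u} {v} {z} (inj₂ e) = trans (cong (λ d → D p u * z + d * z - D p u * d * z) (D≈ e)) (l (D p u) z)
          where
          l : ∀ d z → d * z + 1ℤ * z - d * 1ℤ * z ≡ z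
          l = solve-∀

        guarded : ∀ {u e} → (e ≡ 0ℤ → u * δ e ≡ δ e) → u * δ e ≡ δ e
        guarded {u} {e} f = [ f , (λ ne → trans (cong (u *_) ne) (trans (ℤₚ.*-zeroʳ u) (sym ne))) ]′ (zero-or e)
          where
          zero-or : ∀ e → e ≡ 0ℤ ⊎ δ e ≡ 0ℤ
          zero-or +0       = inj₁ refl
          zero-or +[1+ _ ] = inj₂ refl
          zero-or -[1+ _ ] = inj₂ refl

      -- If `a x = p n`, then `p` divides `a` or `x`. The recursion is inclusion and exclusion over
      -- these cases, a factor `p` of `a` contributing `χ p`.
      prime-step-S : ∀ n {s s′} → HasSum (S (+ n)) s → HasSum (S′ p n) s′ → HasSum (S (+ (p ℕ.* n))) (χ (+ p) * s + s - χ (+ p) * s′)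
      prime-step-S n {s} {s′} σ σ′ = HasSum-cong (λ (a , x) → trans (pointwise a x) (sym (S-pn n a x))) (HasSum-- {A = Pair} (HasSum-+ {A = Pair} first second) both)
        where
        T : Pair → ℤ
        T (a , x) = pos a * pos x * χ a * δ (a * x - + p * + n)
        first : HasSum {Pair} (λ (a , x) → D p a * T (a , x)) (χ (+ p) * s)
        first = HasSum-scale₁ p {T} (HasSum-cong (λ (a , x) → sym (trans (cong₂ (λ u v → u * pos x * v * δ (a * + p * x - + p * + n)) (pos-* a 0<p) (χ-* a (+ p)))
          (trans (cong (λ z → pos a * pos x * (χ a * χ (+ p)) * z) (trans (cong δ (l₁ a x (+ p) (+ n))) (δ-* (+ p) (a * x - + n) {{+p-nonZero}}))) (l₃ (pos a) (pos x) (χ a) (χ (+ p)) (δ (a * x - + n)))))) (HasSum-* {A = Pair} (χ (+ p)) σ))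
          where
          l₁ : ∀ a x p n → a * p * x - p * n ≡ p * (a * x - n)
          l₁ = solve-∀
          l₃ : ∀ u v c k d → u * v * (c * k) * d ≡ k * (u * v * c * d)
          l₃ = solve-∀
        second : HasSum {Pair} (λ (a , x) → D p x * T (a , x)) s
        second = HasSum-scale₂ p {T} (HasSum-cong (λ (a , x) → sym (cong₂ (λ u z → pos a * u * χ a * z) (pos-* x 0<p) (trans (cong δ (l₁ a x (+ p) (+ n))) (δ-* (+ p) (a * x - + n) {{+p-nonZero}})))) σ)
          where
          l₁ : ∀ a x p n → a * (x * p) - p * n ≡ p * (a * x - n)
          l₁ = solve-∀
        both : HasSum {Pair} (λ (a , x) → D p a * D p x * T (a , x)) (χ (+ p) * s′)
        both = HasSum-scale p {T} (HasSum-cong (λ (a , x) → sym (trans (cong₂ (λ u v → u * v * χ (a * + p) * δ (a * + p * (x * + p) - + p * + n)) (pos-* a 0<p) (pos-* x 0<p))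
          (trans (cong₂ (λ u z → pos a * pos x * u * z) (χ-* a (+ p)) (trans (cong δ (l₁ a x (+ p) (+ n))) (δ-* (+ p) (+ p * (a * x) - + n) {{+p-nonZero}}))) (l₃ (pos a) (pos x) (χ a) (χ (+ p)) (δ (+ p * (a * x) - + n)))))) (HasSum-* {A = Pair} (χ (+ p)) σ′))
          where
          l₁ : ∀ a x p n → a * p * (x * p) - p * n ≡ p * (p * (a * x) - n)
          l₁ = solve-∀
          l₃ : ∀ u v c k d → u * v * (c * k) * d ≡ k * (u * v * c * d)
          l₃ = solve-∀
        pointwise : ∀ a x → D p a * T (a , x) + D p x * T (a , x) - D p a * D p x * T (a , x) ≡ T (a , x)
        pointwise a x = trans (l (D p a) (D p x) (pos a * pos x * χ a) (δ (a * x - + p * + n))) (cong (pos a * pos x * χ a *_)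
          (guarded {D p a + D p x - D p a * D p x} {a * x - + p * + n} λ e → trans (l′ (D p a) (D p x) (δ (a * x - + p * + n))) (inclusion {a} {x} (euclid a x (on-equation {a * x} {n} e)))))
          where
          l : ∀ u v w d → u * (w * d) + v * (w * d) - u * v * (w * d) ≡ w * ((u + v - u * v) * d)
          l = solve-∀
          l′ : ∀ u v d → (u + v - u * v) * d ≡ u * d + v * d - u * v * d
          l′ = solve-∀

      -- The recursion of `prime-step-S` again, now from geometry: in the split case the solutions
      -- fill two sublattices meeting in the multiples of `p`, in the inert case all are multiples
      -- of `p`, and in the ramified case all lie in one sublattice.
      prime-step-r : Local p → ∀ n {s s′} → HasSum (r (+ n)) s → HasSum (r′ p n) s′ → HasSum (r (+ (p ℕ.* n))) (χ (+ p) * s + s - χ (+ p) * s′)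
      prime-step-r local n {s} {s′} ρ ρ′ = HasSum-cong (λ v → sym (r-pn n v)) (case local of λ
        { (split h hh h≉ χp) → HasSum-subst (trans (l₁ s s′) (cong (λ z → z * s + s - z * s′) (sym χp)))
            (HasSum-cong (split-pointwise h hh h≉) (HasSum-- {A = Pair} (HasSum-+ {A = Pair} (sublattice h n s hh ρ) (sublattice (ε - h) n s (conjugate h hh) ρ)) multiples))
        ; (inert f χp) → HasSum-subst (trans (l₂ s s′) (cong (λ z → z * s + s - z * s′) (sym χp))) (HasSum-cong (inert-pointwise f) multiples)
        ; (ramified h hh h≈ χp) → HasSum-subst (trans (l₃ s s′) (cong (λ z → z * s + s - z * s′) (sym χp))) (HasSum-cong (ramified-pointwise h hh h≈) (sublattice h n s hh ρ)) })
        where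
        l₁ : ∀ s s′ → s + s - s′ ≡ 1ℤ * s + s - 1ℤ * s′
        l₁ = solve-∀
        l₂ : ∀ s s′ → s′ ≡ - 1ℤ * s + s - - 1ℤ * s′
        l₂ = solve-∀
        l₃ : ∀ s s′ → s ≡ 0ℤ * s + s - 0ℤ * s′
        l₃ = solve-∀
        R : Pair → ℤ
        R v = δ (Q v - + p * + n)
        multiples : HasSum {Pair} (λ (x , y) → D p x * D p y * R (x , y)) s′
        multiples = HasSum-scale p {R} (HasSum-cong (λ (x , y) → trans (sym (δ-* (+ p) (+ p * Q (x , y) - + n) {{+p-nonZero}})) (cong δ (l ε x y (+ p) (+ n)))) ρ′)
          where
          l : ∀ ε x y p n → p * (p * (1ℤ * (x * x) + ε * (x * y) + 1ℤ * (y * y)) - n) ≡ 1ℤ * (x * p * (x * p)) + ε * (x * p * (y * p)) + 1ℤ * (y * p * (y * p)) - p * n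
          l = solve-∀
        inert-pointwise : (∀ x y → Q (x , y) ≈ 0ℤ [ p ] → x ≈ 0ℤ [ p ] × y ≈ 0ℤ [ p ]) → ∀ v → D p (proj₁ v) * D p (proj₂ v) * R v ≡ R v
        inert-pointwise f (x , y) = guarded {D p x * D p y} {Q (x , y) - + p * + n} λ e → let (x≈0 , y≈0) = f x y (on-equation {Q (x , y)} {n} e) in
          trans (cong₂ (λ u v → u * v * R (x , y)) (D≈ x≈0) (D≈ y≈0)) (ℤₚ.*-identityˡ (R (x , y)))
        ramified-pointwise : ∀ h → h * h - ε * h + 1ℤ ≈ 0ℤ [ p ] → + 2 * h - ε ≈ 0ℤ [ p ] → ∀ v → D p (proj₁ v + h * proj₂ v) * R v ≡ R v
        ramified-pointwise h hh h≈ (x , y) = guarded {D p (x + h * y)} {Q (x , y) - + p * + n} λ e → trans (cong (_* R (x , y)) (D≈ ([ id , (λ q → subst (λ z → z ≈ 0ℤ [ p ]) (l ε h x y) (≈-+ q (≈-scale y h≈))) ]′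
            (euclid (x + h * y) (x + (ε - h) * y) (product-≈ h x y hh (on-equation {Q (x , y)} {n} e)))))) (ℤₚ.*-identityˡ (R (x , y)))
          where
          l : ∀ ε h x y → x + (ε - h) * y + y * (+ 2 * h - ε) ≡ x + h * y
          l = solve-∀
        split-pointwise : ∀ h → h * h - ε * h + 1ℤ ≈ 0ℤ [ p ] → ¬ (+ 2 * h - ε ≈ 0ℤ [ p ]) → ∀ v →
          D p (proj₁ v + h * proj₂ v) * R v + D p (proj₁ v + (ε - h) * proj₂ v) * R v - D p (proj₁ v) * D p (proj₂ v) * R v ≡ R v
        split-pointwise h hh h≉ (x , y) = trans (cong (λ z → D p u * R (x , y) + D p u′ * R (x , y) - z * R (x , y)) (sym common))
          (trans (l (D p u) (D p u′) (R (x , y))) (guarded {D p u + D p u′ - D p u * D p u′} {Q (x , y) - + p * + n} λ e → trans (sym (l (D p u) (D p u′) (R (x , y))))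
            (inclusion {u} {u′} (euclid u u′ (product-≈ h x y hh (on-equation {Q (x , y)} {n} e))))))
          where
          u u′ : ℤ
          u = x + h * y
          u′ = x + (ε - h) * y
          l : ∀ u v d → u * d + v * d - u * v * d ≡ (u + v - u * v) * d
          l = solve-∀
          l₄ : ∀ ε h x y → x + h * y - (x + (ε - h) * y) ≡ (+ 2 * h - ε) * y
          l₄ = solve-∀
          l₅ : ∀ h x y → x + h * y - h * y ≡ x
          l₅ = solve-∀
          -- x + hy and x + (ε - h)y both vanish modulo p only if x and y do, as p ∤ 2h - ε.
          common : D p u * D p u′ ≡ D p x * D p y
          common = decide (≈? x 0ℤ) (≈? y 0ℤ)
            where
            both⇒ : u ≈ 0ℤ [ p ] → u′ ≈ 0ℤ [ p ] → x ≈ 0ℤ [ p ] × y ≈ 0ℤ [ p ]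
            both⇒ a b = subst (λ z → z ≈ 0ℤ [ p ]) (l₅ h x y) (≈-- a (≈-scale h y≈0)) , y≈0
              where
              y≈0 : y ≈ 0ℤ [ p ]
              y≈0 = [ (λ e → ⊥-elim (h≉ e)) , id ]′ (euclid (+ 2 * h - ε) y (subst (λ z → z ≈ 0ℤ [ p ]) (l₄ ε h x y) (≈-- a b)))
            not-both : ¬ (x ≈ 0ℤ [ p ] × y ≈ 0ℤ [ p ]) → D p u * D p u′ ≡ 0ℤ
            not-both ne = other (≈? u 0ℤ) (≈? u′ 0ℤ)
              where
              other : Dec (u ≈ 0ℤ [ p ]) → Dec (u′ ≈ 0ℤ [ p ]) → D p u * D p u′ ≡ 0ℤ
              other (yes a) (yes b) = ⊥-elim (ne (both⇒ a b))
              other (no a)  _       = trans (cong (_* D p u′) (D-0 p a)) (ℤₚ.*-zeroˡ (D p u′))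
              other _       (no b)  = trans (cong (D p u *_) (D-0 p b)) (ℤₚ.*-zeroʳ (D p u))
            decide : Dec (x ≈ 0ℤ [ p ]) → Dec (y ≈ 0ℤ [ p ]) → D p u * D p u′ ≡ D p x * D p y
            decide (yes a) (yes b) = trans (cong₂ _*_ (D≈ (≈-+ a (≈-scale h b))) (D≈ (≈-+ a (≈-scale (ε - h) b)))) (sym (cong₂ _*_ (D≈ a) (D≈ b)))
            decide (no a)  _       = trans (not-both (a ∘ proj₁)) (sym (trans (cong (_* D p y) (D-0 p a)) (ℤₚ.*-zeroˡ (D p y))))
            decide _       (no b)  = trans (not-both (b ∘ proj₂)) (sym (trans (cong (D p x *_) (D-0 p b)) (ℤₚ.*-zeroʳ (D p x))))

      prime-step : Local p → ∀ w n → Claim w n → Claim′ w p n → Claim w (p ℕ.* n)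
      prime-step local w n (s , σ , ρ) (s′ , σ′ , ρ′) = _ , prime-step-S n σ σ′ , HasSum-subst (l w (χ (+ p)) s s′) (prime-step-r local n ρ ρ′)
        where
        l : ∀ w c s s′ → c * (w * s) + w * s - c * (w * s′) ≡ w * (c * s + s - c * s′)
        l = solve-∀

    module _ (w : ℤ) (base : Claim w 1) (Ok : ℕ → Set) (Ok-factors : ∀ m n → Ok (m ℕ.* n) → Ok m × Ok n) (local : ∀ p → Prime p → Ok p → Local p) where

      -- Both counts obey the same recursion along the prime factors of `n`, so their
      -- proportionality spreads from `n = 1`. `Ok` restricts the primes for which local data have
      -- to be supplied.
      representations : ∀ n → 0 ℕ.< n → Ok n → Claim w n
      representations = <-rec (λ n → 0 ℕ.< n → Ok n → Claim w n) induct
        where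
        smaller : ∀ p n → 1 ℕ.< p → 0 ℕ.< p ℕ.* n → n ℕ.< p ℕ.* n × 0 ℕ.< n
        smaller p zero    1<p 0<pn = ⊥-elim (ℕₚ.<⇒≢ 0<pn (sym (ℕₚ.*-zeroʳ p)))
        smaller p (suc n) 1<p _    = subst (suc n ℕ.<_) (ℕₚ.*-comm (suc n) p) (ℕₚ.m<m*n (suc n) p 1<p) , s≤s z≤n
        induct : ∀ n → (∀ {m} → m ℕ.< n → 0 ℕ.< m → Ok m → Claim w m) → 0 ℕ.< n → Ok n → Claim w n
        induct n rec 0<n ok with n ℕ.≟ 1
        ... | yes refl = base
        ... | no n≢1 with prime-factor n (ℕₚ.≤∧≢⇒< 0<n (n≢1 ∘ sym))
        ...   | p , m , p-prime , refl = prime-step p p-prime (local p p-prime (proj₁ (Ok-factors p m ok))) w m (rec m<n 0<m ok-m)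
            (primed p p-prime w m λ k m≡pk → let (k<m , 0<k) = smaller p k 1<p (subst (0 ℕ.<_) m≡pk 0<m) in
              rec (ℕₚ.<-trans (subst (k ℕ.<_) (sym m≡pk) k<m) m<n) 0<k (proj₂ (Ok-factors p k (subst Ok m≡pk ok-m))))
          where
          1<p : 1 ℕ.< p
          1<p = ℕ.nonTrivial⇒n>1 p {{prime⇒nonTrivial p-prime}}
          m<n = proj₁ (smaller p m 1<p 0<n)
          0<m = proj₂ (smaller p m 1<p 0<n)
          ok-m = proj₂ (Ok-factors p m ok)

-- The forms `x² + y²` and `x² + x y + y²`.

module SquareAndHexagonalForms where

  open FiniteSums
  open Congruences
  open Progressions
  open PrimeModuli
  open BinaryForms
  open import Data.Empty using (⊥-elim)
  open import Data.List using ([]; _∷_)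
  open import Data.List.Relation.Unary.Any using (here)
  open import Data.List.Relation.Unary.All using ([]; _∷_)
  open import Data.List.Relation.Unary.AllPairs using ([]; _∷_)
  open import Data.Nat as ℕ using (ℕ; zero; suc; z≤n; s≤s)
  import Data.Nat.Properties as ℕₚ
  import Data.Nat.Divisibility as ℕ∣
  open import Data.Nat.DivMod using (m≡m%n+[m/n]*n; m%n<n)
  open import Data.Nat.Primality using (Prime; prime⇒irreducible)
  open import Data.Integer as ℤ using (ℤ; +_; +0; +[1+_]; -[1+_]; _+_; _*_; _-_; -_; ∣_∣; 0ℤ; 1ℤ; _≤_; _<_)
  import Data.Integer.Properties as ℤₚ
  open import Data.Integer.Tactic.RingSolver using (solve-∀)
  open import Data.Product using (∃; _×_; _,_; proj₁; proj₂)
  open import Data.Sum using ([_,_]′)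
  open import Data.Unit using (⊤; tt)
  open import Function using (_∘_; id)
  open import Relation.Nullary using (¬_; yes; no)
  open import Relation.Binary.PropositionalEquality

  divisorWeight : (ℤ → ℤ) → ℤ → ℤ × ℤ → ℤ
  divisorWeight χ K (a , x) = pos a * pos x * χ a * δ (a * x - K)

  divisors-of-nonpositive : ∀ χ K → K ≤ 0ℤ → HasSum {ℤ × ℤ} (divisorWeight χ K) 0ℤ
  divisors-of-nonpositive χ K K≤0 = HasSum-0 λ (a , x) → none a x
    where
    none : ∀ a x → divisorWeight χ K (a , x) ≡ 0ℤ
    none a x with (pos a * pos x) ℤ.≟ 0ℤ
    ... | yes e = trans (cong (λ z → z * χ a * δ (a * x - K)) e) refl
    ... | no ne = trans (cong (pos a * pos x * χ a *_) (δ-≢ λ e → ℤₚ.<⇒≱ (product (pos≢0 {a} (*≢0ˡ {_} {pos x} ne)) (pos≢0 {x} (*≢0ʳ {pos a} ne))) (ℤₚ.≤-trans (ℤₚ.≤-reflexive (ℤₚ.i-j≡0⇒i≡j (a * x) K e)) K≤0))) (ℤₚ.*-zeroʳ (pos a * pos x * χ a))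
      where
      product : ∀ {a x} → 0ℤ < a → 0ℤ < x → 0ℤ < a * x
      product {+[1+ m ]} {+[1+ n ]} _ _ = ℤ.+<+ (s≤s z≤n)
      product {+[1+ m ]} {+0} _ (ℤ.+<+ ())
      product {+0} (ℤ.+<+ ()) _

  divisors-of-1 : ∀ χ → HasSum {ℤ × ℤ} (divisorWeight χ 1ℤ) (χ 1ℤ)
  divisors-of-1 χ = HasSum-subst (trans (ℤₚ.+-identityʳ _) (l (χ 1ℤ))) (hasSum {ℤ × ℤ} ((1ℤ , 1ℤ) ∷ []) ([] ∷ []) (λ (a , x) ne → here (unit a x (pos≢0 {a} (*≢0ˡ {_} {pos x} (*≢0ˡ {_} {χ a} (*≢0ˡ {_} {δ (a * x - 1ℤ)} ne))))
      (pos≢0 {x} (*≢0ʳ {pos a} (*≢0ˡ {_} {χ a} (*≢0ˡ {_} {δ (a * x - 1ℤ)} ne)))) (ℤₚ.i-j≡0⇒i≡j (a * x) 1ℤ (δ≢0 (a * x - 1ℤ) (*≢0ʳ {pos a * pos x * χ a} ne))))) refl)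
    where
    l : ∀ u → 1ℤ * 1ℤ * u * 1ℤ ≡ u
    l = solve-∀
    unit : ∀ a x → 0ℤ < a → 0ℤ < x → a * x ≡ 1ℤ → (a , x) ≡ (1ℤ , 1ℤ)
    unit +[1+ m ] +[1+ n ] _ _ e = cong₂ (λ u v → + u , + v) (ℕₚ.m*n≡1⇒m≡1 (suc m) (suc n) (ℤₚ.+-injective e)) (ℕₚ.m*n≡1⇒n≡1 (suc m) (suc n) (ℤₚ.+-injective e))
    unit +[1+ m ] +0 _ (ℤ.+<+ ()) _
    unit +0 _ (ℤ.+<+ ()) _ _

  module Definite (ε : ℤ) (disc : ℕ) (disc-≡ : + disc ≡ + 4 - ε * ε) (3≤disc : 3 ℕ.≤ disc) (disc≤4 : disc ℕ.≤ 4) where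

    open BinaryForm ε disc disc-≡ 3≤disc disc≤4

    -- Completing the square shows definiteness and bounds both variables.
    quadruple-y : ∀ x y → + 4 * Q (x , y) ≡ + (∣ + 2 * x + ε * y ∣ ℕ.* ∣ + 2 * x + ε * y ∣ ℕ.+ disc ℕ.* (∣ y ∣ ℕ.* ∣ y ∣))
    quadruple-y x y = trans (l ε x y) (cong₂ _+_ (square-ℕ (+ 2 * x + ε * y)) (trans (cong₂ _*_ (sym disc-≡) (square-ℕ y)) (sym (ℤₚ.pos-* disc (∣ y ∣ ℕ.* ∣ y ∣)))))
      where
      l : ∀ ε x y → + 4 * (1ℤ * (x * x) + ε * (x * y) + 1ℤ * (y * y)) ≡ (+ 2 * x + ε * y) * (+ 2 * x + ε * y) + (+ 4 - ε * ε) * (y * y)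
      l = solve-∀

    Q-sym : ∀ x y → Q (x , y) ≡ Q (y , x)
    Q-sym x y = l ε x y
      where
      l : ∀ ε x y → 1ℤ * (x * x) + ε * (x * y) + 1ℤ * (y * y) ≡ 1ℤ * (y * y) + ε * (y * x) + 1ℤ * (x * x)
      l = solve-∀

    y-bound : ∀ x y n → Q (x , y) ≡ + n → 3 ℕ.* (∣ y ∣ ℕ.* ∣ y ∣) ℕ.≤ 4 ℕ.* n
    y-bound x y n e = ℕₚ.≤-trans (ℕₚ.*-monoˡ-≤ (∣ y ∣ ℕ.* ∣ y ∣) 3≤disc) (ℕₚ.≤-trans (ℕₚ.m≤n+m _ (∣ + 2 * x + ε * y ∣ ℕ.* ∣ + 2 * x + ε * y ∣))
      (ℕₚ.≤-reflexive (ℤₚ.+-injective (trans (sym (quadruple-y x y)) (trans (cong (+ 4 *_) e) (sym (ℤₚ.pos-* 4 n)))))))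

    x-bound : ∀ x y n → Q (x , y) ≡ + n → 3 ℕ.* (∣ x ∣ ℕ.* ∣ x ∣) ℕ.≤ 4 ℕ.* n
    x-bound x y n e = y-bound y x n (trans (Q-sym y x) e)

    ≤1 : ∀ m → 3 ℕ.* (m ℕ.* m) ℕ.≤ 4 → m ℕ.≤ 1
    ≤1 zero          _ = z≤n
    ≤1 (suc zero)    _ = s≤s z≤n
    ≤1 (suc (suc m)) h = ⊥-elim (ℕₚ.<⇒≱ (ℕₚ.≤-trans (ℕₚ.≤ᵇ⇒≤ 5 12 _) (ℕₚ.*-monoʳ-≤ 3 (ℕₚ.*-mono-≤ {2} {suc (suc m)} {2} {suc (suc m)} (s≤s (s≤s z≤n)) (s≤s (s≤s z≤n))))) h)

    ≡0 : ∀ m → 3 ℕ.* (∣ m ∣ ℕ.* ∣ m ∣) ℕ.≤ 0 → m ≡ 0ℤ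
    ≡0 +0       _ = refl

    representations-of-0 : HasSum {Pair} (λ v → δ (Q v - 0ℤ)) 1ℤ
    representations-of-0 = hasSum ((0ℤ , 0ℤ) ∷ []) ([] ∷ []) (λ (x , y) ne → let e = ℤₚ.i-j≡0⇒i≡j (Q (x , y)) 0ℤ (δ≢0 (Q (x , y) - 0ℤ) ne) in
      here (cong₂ _,_ (≡0 x (x-bound x y 0 e)) (≡0 y (y-bound x y 0 e)))) (trans (ℤₚ.+-identityʳ _) (cong (λ z → δ (z - 0ℤ)) (l ε)))
      where
      l : ∀ ε → 1ℤ * (0ℤ * 0ℤ) + ε * (0ℤ * 0ℤ) + 1ℤ * (0ℤ * 0ℤ) ≡ 0ℤ
      l = solve-∀

    representations-of-negative : ∀ n → HasSum {Pair} (λ v → δ (Q v - -[1+ n ])) 0ℤ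
    representations-of-negative n = HasSum-0 λ (x , y) → δ-≢ λ e → impossible (trans (sym (quadruple-y x y)) (cong (+ 4 *_) (ℤₚ.i-j≡0⇒i≡j (Q (x , y)) -[1+ n ] e)))
      where
      impossible : ∀ {m} → + m ≢ + 4 * -[1+ n ]
      impossible ()

    -- The total is left as a sum over a box. For the two values of `ε` it evaluates to 4 and 6, the
    -- constants of the representation formulas.
    representations-of-1 : HasSum {Pair} (λ v → δ (Q v - 1ℤ)) (∑ (box 1) (λ v → δ (Q v - 1ℤ)))
    representations-of-1 = HasSum-box {A = Pair} 1 λ (x , y) ne → let e = ℤₚ.i-j≡0⇒i≡j (Q (x , y)) 1ℤ (δ≢0 (Q (x , y) - 1ℤ) ne) in
      ℕₚ.⊔-lub (≤1 ∣ x ∣ (x-bound x y 1 e)) (≤1 ∣ y ∣ (y-bound x y 1 e))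

  residue-form : ∀ p m .{{_ : ℕ.NonZero m}} → p ≡ (p ℕ.% m) ℕ.+ (p ℕ./ m) ℕ.* m
  residue-form p m = m≡m%n+[m/n]*n p m

  module Gaussian where

    open Definite 0ℤ 4 refl (s≤s (s≤s (s≤s z≤n))) (ℕₚ.≤-refl)
    open BinaryForm 0ℤ 4 refl (s≤s (s≤s (s≤s z≤n))) (ℕₚ.≤-refl) using (Q)
    open Counting 0ℤ 4 refl (s≤s (s≤s (s≤s z≤n))) (ℕₚ.≤-refl) χ₄ χ₄-*

    Odd : ℕ → Set
    Odd n = ¬ (2 ℕ∣.∣ n)

    local : ∀ p → Prime p → Odd p → Local p
    local p p-prime odd = by-class (p ℕ.% 4) (p ℕ./ 4) (m%n<n p 4) (residue-form p 4)
      where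
      open PrimeModulus p p-prime
      even : ∀ k → p ≡ k ℕ.* 2 → Local p
      even k e = ⊥-elim (odd (ℕ∣.divides k e))
      2<p : 2 ℕ.< p
      2<p = ℕₚ.≤∧≢⇒< 1<p λ { refl → odd ℕ∣.∣-refl }
      by-class : ∀ r q → r ℕ.< 4 → p ≡ r ℕ.+ q ℕ.* 4 → Local p
      by-class 0 q _ e = even (q ℕ.* 2) (trans e (sym (ℕₚ.*-assoc q 2 2)))
      by-class 2 q _ e = even (suc (q ℕ.* 2)) (trans e (cong (2 ℕ.+_) (sym (ℕₚ.*-assoc q 2 2))))
      by-class 1 q _ e = split h (subst (λ z → z ≈ 0ℤ [ p ]) (l h) hh) h≉0 (χ₄-periodic {z = + 1} (by (+ q) (trans (cong +_ e) (cong (λ z → + 1 + z) (ℤₚ.pos-* q 4)))))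
        where
        root : ∃ λ h → h * h + 1ℤ ≈ 0ℤ [ p ]
        root = sqrt-1 q (trans e (cong suc (ℕₚ.*-comm q 4)))
        h : ℤ
        h = proj₁ root
        hh : h * h + 1ℤ ≈ 0ℤ [ p ]
        hh = proj₂ root
        l : ∀ h → h * h + 1ℤ ≡ h * h - 0ℤ * h + 1ℤ
        l = solve-∀
        h≉0 : ¬ (+ 2 * h - 0ℤ ≈ 0ℤ [ p ])
        h≉0 e′ = [ small-≉0 2 (s≤s z≤n) 2<p , (λ h≈0 → small-≉0 1 (s≤s z≤n) 1<p (subst (λ z → z ≈ 0ℤ [ p ]) (l′ h) (≈-- hh (≈-scale h h≈0)))) ]′ (euclid (+ 2) h (subst (λ z → z ≈ 0ℤ [ p ]) (ℤₚ.+-identityʳ (+ 2 * h)) e′))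
          where
          l′ : ∀ h → h * h + 1ℤ - h * h ≡ 1ℤ
          l′ = solve-∀
      by-class 3 q _ e = inert (λ x y h → inert₄ q p≡ y x (subst (λ z → z ≈ 0ℤ [ p ]) (l x y) h) , inert₄ q p≡ x y (subst (λ z → z ≈ 0ℤ [ p ]) (l′ x y) h))
        (χ₄-periodic {z = + 3} (by (+ q) (trans (cong +_ e) (cong (λ z → + 3 + z) (ℤₚ.pos-* q 4)))))
        where
        p≡ : p ≡ suc (2 ℕ.* suc (2 ℕ.* q))
        p≡ = trans e (cong suc (trans (cong (2 ℕ.+_) (trans (ℕₚ.*-comm q 4) (ℕₚ.*-assoc 2 2 q))) (sym (ℕₚ.*-suc 2 (2 ℕ.* q)))))
        l : ∀ x y → 1ℤ * (x * x) + 0ℤ * (x * y) + 1ℤ * (y * y) ≡ y * y + x * x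
        l = solve-∀
        l′ : ∀ x y → 1ℤ * (x * x) + 0ℤ * (x * y) + 1ℤ * (y * y) ≡ x * x + y * y
        l′ = solve-∀
      by-class (suc (suc (suc (suc r)))) q (s≤s (s≤s (s≤s (s≤s ())))) e

    two-squares : ∀ K → ¬ (K ≈ 0ℤ [ 2 ]) → ∃ λ s → HasSum {Pair} (divisorWeight χ₄ K) s × HasSum {Pair} (λ (x , y) → δ (x * x + y * y - K)) (+ 4 * s)
    two-squares +0 odd = ⊥-elim (odd ≈-refl)
    two-squares -[1+ n ] odd = 0ℤ , divisors-of-nonpositive χ₄ -[1+ n ] ℤ.-≤+ , HasSum-cong (λ (x , y) → cong (λ z → δ (z - -[1+ n ])) (l x y)) (representations-of-negative n)
      where
      l : ∀ x y → 1ℤ * (x * x) + 0ℤ * (x * y) + 1ℤ * (y * y) ≡ x * x + y * y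
      l = solve-∀
    two-squares K@(+[1+ n ]) odd = proj₁ claim , proj₁ (proj₂ claim) , HasSum-cong (λ (x , y) → cong (λ z → δ (z - K)) (l x y)) (proj₂ (proj₂ claim))
      where
      claim : Claim (+ 4) (suc n)
      claim = representations (+ 4) (1ℤ , divisors-of-1 χ₄ , representations-of-1) Odd
        (λ m n o → (λ d → o (ℕ∣.∣m⇒∣m*n n d)) , (λ d → o (ℕ∣.∣n⇒∣m*n m d))) local (suc n) (s≤s z≤n) (λ d → odd (∣⇒≈0 d))
      l : ∀ x y → 1ℤ * (x * x) + 0ℤ * (x * y) + 1ℤ * (y * y) ≡ x * x + y * y
      l = solve-∀

  module Eisenstein where

    open Definite 1ℤ 3 refl (s≤s (s≤s (s≤s z≤n))) (s≤s (s≤s (s≤s z≤n)))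
    open BinaryForm 1ℤ 3 refl (s≤s (s≤s (s≤s z≤n))) (s≤s (s≤s (s≤s z≤n))) using (Q)
    open Counting 1ℤ 3 refl (s≤s (s≤s (s≤s z≤n))) (s≤s (s≤s (s≤s z≤n))) χ₃ χ₃-*

    local : ∀ p → Prime p → Local p
    local p p-prime = by-class (p ℕ.% 3) (p ℕ./ 3) (m%n<n p 3) (residue-form p 3)
      where
      open PrimeModulus p p-prime
      by-class : ∀ r q → r ℕ.< 3 → p ≡ r ℕ.+ q ℕ.* 3 → Local p
      -- Here `p = 3`, and `h = 2` makes both `h² - h + 1` and `2 h - 1` equal to 3.
      by-class 0 q _ e = ramified (+ 2) three three (trans (cong (χ₃ ∘ +_) (sym 3≡p)) refl)
        where
        3≡p : 3 ≡ p
        3≡p = [ (λ ()) , id ]′ (prime⇒irreducible p-prime (ℕ∣.divides q e))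
        three : + 3 ≈ 0ℤ [ p ]
        three = by 1ℤ (trans (cong +_ 3≡p) (sym (trans (ℤₚ.+-identityˡ (1ℤ * + p)) (ℤₚ.*-identityˡ (+ p)))))
      by-class 1 q _ e = split h (subst (λ z → h * h - z + 1ℤ ≈ 0ℤ [ p ]) (sym (ℤₚ.*-identityˡ h)) hh) h≉ (χ₃-periodic {z = + 1} (by (+ q) (trans (cong +_ e) (cong (λ z → + 1 + z) (ℤₚ.pos-* q 3)))))
        where
        root : ∃ λ h → h * h - h + 1ℤ ≈ 0ℤ [ p ]
        root = cube-root q (trans e (cong suc (ℕₚ.*-comm q 3)))
        h : ℤ
        h = proj₁ root
        hh : h * h - h + 1ℤ ≈ 0ℤ [ p ]
        hh = proj₂ root
        3<p : 3 ℕ.< p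
        3<p = large q e
          where
          large : ∀ q → p ≡ 1 ℕ.+ q ℕ.* 3 → 3 ℕ.< p
          large zero    e = ⊥-elim (ℕₚ.<⇒≢ 1<p (sym e))
          large (suc q) e = subst (3 ℕ.<_) (sym e) (s≤s (s≤s (s≤s (s≤s z≤n))))
        h≉ : ¬ (+ 2 * h - 1ℤ ≈ 0ℤ [ p ])
        -- Since `4 (h² - h + 1) - (2 h - 1)² = 3`, a double root would make `p` divide 3.
        h≉ e′ = small-≉0 3 (s≤s z≤n) 3<p (subst (λ z → z ≈ 0ℤ [ p ]) (l h) (≈-- (≈-scale (+ 4) hh) (≈-scale (+ 2 * h - 1ℤ) e′)))
          where
          l : ∀ h → + 4 * (h * h - h + 1ℤ) - (+ 2 * h - 1ℤ) * (+ 2 * h - 1ℤ) ≡ + 3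
          l = solve-∀
      by-class 2 q _ e = inert (λ x y h → inert₃ q p≡ y x (subst (λ z → z ≈ 0ℤ [ p ]) (l x y) h) , inert₃ q p≡ x y (subst (λ z → z ≈ 0ℤ [ p ]) (l′ x y) h))
        (χ₃-periodic {z = + 2} (by (+ q) (trans (cong +_ e) (cong (λ z → + 2 + z) (ℤₚ.pos-* q 3)))))
        where
        p≡ : p ≡ suc (suc (3 ℕ.* q))
        p≡ = trans e (cong (2 ℕ.+_) (ℕₚ.*-comm q 3))
        l : ∀ x y → 1ℤ * (x * x) + 1ℤ * (x * y) + 1ℤ * (y * y) ≡ y * y + y * x + x * x
        l = solve-∀
        l′ : ∀ x y → 1ℤ * (x * x) + 1ℤ * (x * y) + 1ℤ * (y * y) ≡ x * x + x * y + y * y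
        l′ = solve-∀
      by-class (suc (suc (suc r))) q (s≤s (s≤s (s≤s ()))) e

    private
      plain : ∀ K v → δ (Q v - K) ≡ δ (proj₁ v * proj₁ v + proj₁ v * proj₂ v + proj₂ v * proj₂ v - K)
      plain K (x , y) = cong (λ z → δ (z - K)) (l x y)
        where
        l : ∀ x y → 1ℤ * (x * x) + 1ℤ * (x * y) + 1ℤ * (y * y) ≡ x * x + x * y + y * y
        l = solve-∀

    hexagonal : ∀ K → ∃ λ s → HasSum {Pair} (divisorWeight χ₃ K) s × HasSum {Pair} (λ (x , y) → δ (x * x + x * y + y * y - K)) (δ K + + 6 * s)
    hexagonal +0 = 0ℤ , divisors-of-nonpositive χ₃ 0ℤ (ℤ.+≤+ z≤n) , HasSum-cong (plain 0ℤ) representations-of-0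
    hexagonal -[1+ n ] = 0ℤ , divisors-of-nonpositive χ₃ -[1+ n ] ℤ.-≤+ , HasSum-cong (plain -[1+ n ]) (representations-of-negative n)
    hexagonal K@(+[1+ n ]) = proj₁ claim , proj₁ (proj₂ claim) , HasSum-subst (sym (ℤₚ.+-identityˡ (+ 6 * proj₁ claim))) (HasSum-cong (plain K) (proj₂ (proj₂ claim)))
      where
      claim : Claim (+ 6) (suc n)
      claim = representations (+ 6) (1ℤ , divisors-of-1 χ₃ , representations-of-1) (λ _ → ⊤) (λ _ _ _ → tt , tt) (λ p p-prime _ → local p p-prime) (suc n) (s≤s z≤n) tt

-- Parity decomposition of the quaternary count.

module QuaternaryForm where

  open FiniteSums
  open Congruences
  open LiouvilleIdentity
  open Progressions
  open InteriorTerms hiding (t)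
  open CubeOfEtaFunction
  open PrimeModuli
  open BinaryForms
  open SquareAndHexagonalForms
  open import Data.Fin using (Fin)
  import Data.Fin.Properties as Finₚ
  open import Data.Fin.Patterns
  open import Data.Nat as ℕ using (ℕ; z≤n)
  import Data.Nat.Properties as ℕₚ
  open import Data.Integer as ℤ using (ℤ; +_; _+_; _*_; _-_; -_; ∣_∣; 0ℤ; 1ℤ; _≤_)
  import Data.Integer.Properties as ℤₚ
  open import Data.Integer.DivMod using (_/ℕ_)
  open import Data.Integer.Tactic.RingSolver using (solve-∀)
  open import Data.Product using (_×_; _,_)
  open import Function using (_∘_)
  open import Relation.Nullary.Decidable using (True; toWitness)
  open import Relation.Binary.PropositionalEquality

  check₄ : ∀ {m n o p} {f g : Fin m → Fin n → Fin o → Fin p → ℤ} →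
    {True (Finₚ.all? λ i → Finₚ.all? λ j → Finₚ.all? λ k → Finₚ.all? λ l → f i j k l ℤ.≟ g i j k l)} → ∀ i j k l → f i j k l ≡ g i j k l
  check₄ {_} {_} {_} {_} {_} {_} {t} = toWitness t

  -- The three classes of an integer: odd, 2 modulo 4, divisible by 4; V is the square modulo 8.
  O T E V : Fin 3 → ℤ
  O 0F = 1ℤ
  O 1F = 0ℤ
  O 2F = 0ℤ
  T 0F = 0ℤ
  T 1F = 1ℤ
  T 2F = 0ℤ
  E 0F = 0ℤ
  E 1F = 1ℤ
  E 2F = 1ℤ
  V i = O i + + 4 * T i

  class : ℤ → Fin 3
  class z = of-residue (res 4 z)
    where
    of-residue : Fin 4 → Fin 3
    of-residue 0F = 2F
    of-residue 1F = 0F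
    of-residue 2F = 1F
    of-residue 3F = 0F

  class-periodic : ∀ {y z} → y ≈ z [ 4 ] → class y ≡ class z
  class-periodic p rewrite ≈⇒res p = refl

  o-class : ∀ z → o z ≡ O (class z)
  o-class = by-residues {4} o-periodic (λ p → cong O (class-periodic p)) check₁

  two-class : ∀ z → two z ≡ T (class z)
  two-class = by-residues {4} two-periodic (λ p → cong T (class-periodic p)) check₁

  even-class : ∀ z → D 2 z ≡ E (class z)
  even-class = by-residues {4} (λ p → D-periodic 2 (4⇒2 p)) (λ p → cong E (class-periodic p)) check₁

  8⇒4 : ∀ {y z} → y ≈ z [ 8 ] → y ≈ z [ 4 ]
  8⇒4 {z = z} (by q eq) = by (q * + 2) (trans eq (l z q))
    where
    l : ∀ z q → z + q * + 8 ≡ z + q * + 2 * + 4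
    l = solve-∀

  square-class : ∀ z → z * z ≈ V (class z) [ 8 ]
  square-class z = ≈-difference (D≢0 8 (z * z - V (class z)) λ e → 1≢0 (trans (sym (table z)) e))
    where
    1≢0 : 1ℤ ≢ 0ℤ
    1≢0 ()
    table : ∀ z → D 8 (z * z - V (class z)) ≡ 1ℤ
    table = by-residues {8} (λ {y} p → D-periodic 8 (≈-- (≈-* p p) (subst (λ i → V (class y) ≈ V i [ 8 ]) (class-periodic (8⇒4 p)) (≈-refl {z = V (class y)})))) (λ _ → refl) check₁

  square-nonneg : ∀ z → 0ℤ ≤ z * z
  square-nonneg z = ℤₚ.≤-trans (ℤ.+≤+ z≤n) (ℤₚ.≤-reflexive (sym (square-ℕ z)))

  diagonal : ℤ → ℤ → ℤ
  diagonal x v = o x * o v * D 4 (x - v)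

  diagonal-split : ∀ x v → o x * o v ≡ diagonal x v + diagonal x (- v)
  diagonal-split = by-residues₂ {4} {4} (λ p r → cong₂ _*_ (o-periodic p) (o-periodic r))
    (λ p r → cong₂ _+_ (cong₂ _*_ (cong₂ _*_ (o-periodic p) (o-periodic r)) (D-periodic 4 (≈-- p r)))
      (cong₂ _*_ (cong₂ _*_ (o-periodic p) (o-periodic (≈-neg r))) (D-periodic 4 (≈-- p (≈-neg r))))) check₂

  -- The difference of the two arguments is `4 b`, so the congruence holds by itself, and both
  -- arguments are odd exactly if one of `a`, `b` is odd and the other even.
  diagonal-rotated : ∀ a b → diagonal (a + + 3 * b) (a - b) ≡ o a + o b - + 2 * o a * o b
  diagonal-rotated = by-residues₂ {4} {4} (λ p r → let p′ = ≈-+ p (≈-* (≈-refl {z = + 3}) r) in cong₂ _*_ (cong₂ _*_ (o-periodic p′) (o-periodic (≈-- p r))) (D-periodic 4 (≈-- p′ (≈-- p r))))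
    (λ p r → cong₂ (λ u w → u + w - + 2 * u * w) (o-periodic p) (o-periodic r)) check₂

  D-shift : ∀ {y} → y ≈ + 3 [ 8 ] → D 8 (y - + 3) ≡ 1ℤ
  D-shift {y} p = D-1 8 (subst (λ z → y - + 3 ≈ z [ 8 ]) (ℤₚ.+-inverseʳ (+ 3)) (≈-- p (≈-refl {z = + 3})))

  module Lattice (N : ℕ) (N≈3 : + N ≈ + 3 [ 8 ]) where

    q : Quad → ℤ
    q (x , v , c , d) = x * x + + 3 * (v * v) + + 3 * (c * c) + + 3 * (d * d) - + N

    q-bounded : ∀ a → δ (q a) ≢ 0ℤ → size a ℕ.≤ N
    q-bounded (x , v , c , d) ne = ℕₚ.⊔-lub (le x x≤) (ℕₚ.⊔-lub (le v (triple (∣ v ∣ ℕ.* ∣ v ∣) v≤)) (ℕₚ.⊔-lub (le c (triple (∣ c ∣ ℕ.* ∣ c ∣) c≤)) (le d (triple (∣ d ∣ ℕ.* ∣ d ∣) d≤))))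
      where
      X V′ C D′ : ℕ
      X = ∣ x ∣ ℕ.* ∣ x ∣
      V′ = 3 ℕ.* (∣ v ∣ ℕ.* ∣ v ∣)
      C = 3 ℕ.* (∣ c ∣ ℕ.* ∣ c ∣)
      D′ = 3 ℕ.* (∣ d ∣ ℕ.* ∣ d ∣)
      three : ∀ z → + 3 * (z * z) ≡ + (3 ℕ.* (∣ z ∣ ℕ.* ∣ z ∣))
      three z = trans (cong (+ 3 *_) (square-ℕ z)) (sym (ℤₚ.pos-* 3 (∣ z ∣ ℕ.* ∣ z ∣)))
      sum : X ℕ.+ V′ ℕ.+ C ℕ.+ D′ ≡ N
      sum = ℤₚ.+-injective (trans (sym (cong₂ _+_ (cong₂ _+_ (cong₂ _+_ (square-ℕ x) (three v)) (three c)) (three d))) (ℤₚ.i-j≡0⇒i≡j _ (+ N) (δ≢0 (q (x , v , c , d)) ne)))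
      d≤ : D′ ℕ.≤ N
      d≤ = subst (D′ ℕ.≤_) sum (ℕₚ.m≤n+m D′ (X ℕ.+ V′ ℕ.+ C))
      xvc≤ : X ℕ.+ V′ ℕ.+ C ℕ.≤ N
      xvc≤ = subst (X ℕ.+ V′ ℕ.+ C ℕ.≤_) sum (ℕₚ.m≤m+n (X ℕ.+ V′ ℕ.+ C) D′)
      c≤ : C ℕ.≤ N
      c≤ = ℕₚ.≤-trans (ℕₚ.m≤n+m C (X ℕ.+ V′)) xvc≤
      xv≤ : X ℕ.+ V′ ℕ.≤ N
      xv≤ = ℕₚ.≤-trans (ℕₚ.m≤m+n (X ℕ.+ V′) C) xvc≤
      v≤ : V′ ℕ.≤ N
      v≤ = ℕₚ.≤-trans (ℕₚ.m≤n+m V′ X) xv≤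
      x≤ : X ℕ.≤ N
      x≤ = ℕₚ.≤-trans (ℕₚ.m≤m+n X V′) xv≤
      triple : ∀ m → 3 ℕ.* m ℕ.≤ N → m ℕ.≤ N
      triple m h = ℕₚ.≤-trans (ℕₚ.m≤n*m m 3) h
      le : ∀ z → ∣ z ∣ ℕ.* ∣ z ∣ ℕ.≤ N → ∣ z ∣ ℕ.≤ N
      le z h = ℕₚ.≤-trans (n≤n*n ∣ z ∣) h

    abstract
      ⟦_⟧ : (Quad → ℤ) → ℤ
      ⟦ u ⟧ = ∑ {Quad} (box N) (λ a → u a * δ (q a))

      ⟦⟧-HasSum : ∀ u → HasSum {Quad} (λ a → u a * δ (q a)) ⟦ u ⟧
      ⟦⟧-HasSum u = HasSum-box N λ a h → q-bounded a (*≢0ʳ {u a} h)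

    ⟦⟧-cong : ∀ {u v} → (∀ a → q a ≡ 0ℤ → u a ≡ v a) → ⟦ u ⟧ ≡ ⟦ v ⟧
    ⟦⟧-cong {u} {v} f = HasSum-unique (HasSum-cong (λ a → guard (q a) (f a)) (⟦⟧-HasSum u)) (⟦⟧-HasSum v)

    ⟦⟧-+ : ∀ u v → ⟦ (λ a → u a + v a) ⟧ ≡ ⟦ u ⟧ + ⟦ v ⟧
    ⟦⟧-+ u v = HasSum-unique (⟦⟧-HasSum (λ a → u a + v a))
      (HasSum-cong (λ a → sym (ℤₚ.*-distribʳ-+ (δ (q a)) (u a) (v a))) (HasSum-+ (⟦⟧-HasSum u) (⟦⟧-HasSum v)))

    ⟦⟧-* : ∀ k u → ⟦ (λ a → k * u a) ⟧ ≡ k * ⟦ u ⟧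
    ⟦⟧-* k u = HasSum-unique (⟦⟧-HasSum (λ a → k * u a)) (HasSum-cong (λ a → sym (ℤₚ.*-assoc k (u a) (δ (q a)))) (HasSum-* k (⟦⟧-HasSum u)))

    ⟦⟧-invariant : ∀ (σ : Quad → Quad) → (∀ a → σ (σ a) ≡ a) → (∀ a → q (σ a) ≡ q a) → ∀ u → ⟦ u ∘ σ ⟧ ≡ ⟦ u ⟧
    ⟦⟧-invariant σ σσ qσ u = HasSum-unique (⟦⟧-HasSum (u ∘ σ)) (HasSum-cong (λ a → cong (λ z → u (σ a) * δ z) (qσ a)) (HasSum-bijection σ σ σσ σσ (⟦⟧-HasSum u)))

    Weight : Set
    Weight = Fin 3 → Fin 3 → Fin 3 → Fin 3 → ℤ

    by-class : Weight → Quad → ℤ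
    by-class U (x , v , c , d) = U (class x) (class v) (class c) (class d)

    -- The classes determine squares modulo 8, so this indicator selects the class vectors
    -- compatible with `N ≡ 3` modulo 8. Two weights that agree on them have the same total.
    [mod8] : Weight
    [mod8] i j k l = D 8 (V i + + 3 * V j + + 3 * V k + + 3 * V l - + 3)

    mod8-one : ∀ x v c d → q (x , v , c , d) ≡ 0ℤ → by-class [mod8] (x , v , c , d) ≡ 1ℤ
    mod8-one x v c d e = D-shift {V (class x) + + 3 * V (class v) + + 3 * V (class c) + + 3 * V (class d)} (≈-trans (≈-sym squares) (subst (λ z → z ≈ + 3 [ 8 ]) (sym (ℤₚ.i-j≡0⇒i≡j _ (+ N) e)) N≈3))
      where
      three : ∀ z → + 3 * (z * z) ≈ + 3 * V (class z) [ 8 ]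
      three z = ≈-* (≈-refl {z = + 3}) (square-class z)
      squares : x * x + + 3 * (v * v) + + 3 * (c * c) + + 3 * (d * d) ≈ V (class x) + + 3 * V (class v) + + 3 * V (class c) + + 3 * V (class d) [ 8 ]
      squares = ≈-+ (≈-+ (≈-+ (square-class x) (three v)) (three c)) (three d)

    ⟦⟧-mod8 : ∀ U U′ → (∀ i j k l → U i j k l * [mod8] i j k l ≡ U′ i j k l * [mod8] i j k l) → ⟦ by-class U ⟧ ≡ ⟦ by-class U′ ⟧
    ⟦⟧-mod8 U U′ table = ⟦⟧-cong λ (x , v , c , d) e → trans (sym (ℤₚ.*-identityʳ _)) (trans (cong (by-class U (x , v , c , d) *_) (sym (mod8-one x v c d e)))
      (trans (table (class x) (class v) (class c) (class d)) (trans (cong (by-class U′ (x , v , c , d) *_) (mod8-one x v c d e)) (ℤₚ.*-identityʳ _))))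

    t : ℤ
    t = ⟦ by-class (λ i j k l → O i * O j * O k * T l) ⟧

    swap-cd swap-vd negate-v : Quad → Quad
    swap-cd (x , v , c , d) = x , v , d , c
    swap-vd (x , v , c , d) = x , d , c , v
    negate-v (x , v , c , d) = x , - v , c , d

    ⟦⟧-swap-cd : ∀ u → ⟦ u ∘ swap-cd ⟧ ≡ ⟦ u ⟧
    ⟦⟧-swap-cd = ⟦⟧-invariant swap-cd (λ _ → refl) λ (x , v , c , d) → l x v c d (+ N)
      where
      l : ∀ x v c d n → x * x + + 3 * (v * v) + + 3 * (d * d) + + 3 * (c * c) - n ≡ x * x + + 3 * (v * v) + + 3 * (c * c) + + 3 * (d * d) - n
      l = solve-∀

    ⟦⟧-swap-vd : ∀ u → ⟦ u ∘ swap-vd ⟧ ≡ ⟦ u ⟧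
    ⟦⟧-swap-vd = ⟦⟧-invariant swap-vd (λ _ → refl) λ (x , v , c , d) → l x v c d (+ N)
      where
      l : ∀ x v c d n → x * x + + 3 * (d * d) + + 3 * (c * c) + + 3 * (v * v) - n ≡ x * x + + 3 * (v * v) + + 3 * (c * c) + + 3 * (d * d) - n
      l = solve-∀

    ⟦⟧-negate-v : ∀ u → ⟦ u ∘ negate-v ⟧ ≡ ⟦ u ⟧
    ⟦⟧-negate-v = ⟦⟧-invariant negate-v (λ (x , v , c , d) → cong (λ z → x , z , c , d) (ℤₚ.neg-involutive v)) λ (x , v , c , d) → l x v c d (+ N)
      where
      l : ∀ x v c d n → x * x + + 3 * (- v * - v) + + 3 * (c * c) + + 3 * (d * d) - n ≡ x * x + + 3 * (v * v) + + 3 * (c * c) + + 3 * (d * d) - n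
      l = solve-∀

    double-swap : ∀ U → ⟦ (λ a → by-class U a + by-class U (swap-cd a)) ⟧ ≡ + 2 * ⟦ by-class U ⟧
    double-swap U = trans (⟦⟧-+ (by-class U) (by-class U ∘ swap-cd)) (trans (cong (λ z → ⟦ by-class U ⟧ + z) (⟦⟧-swap-cd (by-class U))) (l ⟦ by-class U ⟧))
      where
      l : ∀ u → u + u ≡ + 2 * u
      l = solve-∀

    -- For odd `x` and `v` the equation modulo 8 leaves `c² + d² ≡ 5`, so one of `c`, `d` is odd and
    -- the other is 2 modulo 4. The two orders give the factor 2.
    odd-odd : ⟦ by-class (λ i j k l → O i * O j) ⟧ ≡ + 2 * t
    odd-odd = trans (⟦⟧-mod8 (λ i j k l → O i * O j) (λ i j k l → O i * O j * O k * T l + O i * O j * O l * T k) check₄) (double-swap (λ i j k l → O i * O j * O k * T l))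

    τ : ℤ
    τ = ⟦ by-class (λ i j k l → E i * E j * O k * T l) ⟧

    -- As `N` is odd, exactly one of `c`, `d` is odd, which gives the factor 2. Exchanging the even
    -- one with `v` moves the condition 2 modulo 4 to the last place.
    even-two : ⟦ by-class (λ i j k l → E i * T j) ⟧ ≡ + 2 * τ
    even-two = trans (⟦⟧-mod8 (λ i j k l → E i * T j) (λ i j k l → E i * T j * O k * E l + E i * T j * O l * E k) check₄)
      (trans (double-swap (λ i j k l → E i * T j * O k * E l)) (cong (+ 2 *_) (trans (⟦⟧-cong λ (x , v , c , d) _ → l (E (class x)) (T (class v)) (O (class c)) (E (class d)))
        (⟦⟧-swap-vd (by-class (λ i j k l → E i * E j * O k * T l))))))
      where
      l : ∀ a b c d → a * b * c * d ≡ a * d * c * b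
      l = solve-∀

    private
      rest : ℤ → ℤ → ℤ
      rest c d = O (class c) * T (class d)

      half₁ half₂ : Quad → ℤ
      half₁ (x , v , c , d) = diagonal x v * rest c d
      half₂ (x , v , c , d) = D 2 x * D 2 v * rest c d

    -- The rotation (x , v) ↦ ((x + 3v)/2 , (x - v)/2) of the hexagonal lattice.
    rotation : ⟦ half₁ ⟧ ≡ ⟦ half₂ ⟧
    rotation = sym (HasSum-unique (⟦⟧-HasSum half₂) (HasSum-reindex {A = Quad} {B = Quad} {v = u₂} f g fwd bwd (⟦⟧-HasSum half₁)))
      where
      u₁ u₂ : Quad → ℤ
      u₁ a = half₁ a * δ (q a)
      u₂ a = half₂ a * δ (q a)
      f g : Quad → Quad
      f (x , v , c , d) = + 2 * (v + (x - v) /ℕ 4) , + 2 * ((x - v) /ℕ 4) , c , d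
      g (x , v , c , d) = x /ℕ 2 + + 3 * (v /ℕ 2) , x /ℕ 2 - v /ℕ 2 , c , d
      even : ∀ a → D 2 (+ 2 * a) ≡ 1ℤ
      even a = D-1 2 (by a (trans (ℤₚ.*-comm (+ 2) a) (sym (ℤₚ.+-identityˡ (a * + 2)))))
      q-rotated : ∀ a b c d → q (a + + 3 * b , a - b , c , d) ≡ q (+ 2 * a , + 2 * b , c , d)
      q-rotated a b c d = l a b c d (+ N)
        where
        l : ∀ a b c d n → (a + + 3 * b) * (a + + 3 * b) + + 3 * ((a - b) * (a - b)) + + 3 * (c * c) + + 3 * (d * d) - n ≡ + 2 * a * (+ 2 * a) + + 3 * (+ 2 * b * (+ 2 * b)) + + 3 * (c * c) + + 3 * (d * d) - n
        l = solve-∀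
      -- For `c` odd and `d ≡ 2` modulo 4 the equation modulo 8 forces `a + b` to be odd, so the
      -- parity condition of `diagonal-rotated` is automatic.
      table : ∀ (i j k l : Fin 3) → (O i + O j - + 2 * O i * O j) * (O k * T l) * D 8 (+ 4 * V i + + 12 * V j + + 3 * V k + + 3 * V l - + 3) ≡ 1ℤ * (O k * T l) * D 8 (+ 4 * V i + + 12 * V j + + 3 * V k + + 3 * V l - + 3)
      table = check₄
      value : ∀ a b c d → u₁ (a + + 3 * b , a - b , c , d) ≡ u₂ (+ 2 * a , + 2 * b , c , d)
      value a b c d = trans (cong₂ (λ w e → w * rest c d * δ e) (trans (diagonal-rotated a b) (cong₂ (λ y z → y + z - + 2 * y * z) (o-class a) (o-class b))) (q-rotated a b c d))
        (trans (guard (q (+ 2 * a , + 2 * b , c , d)) at) (cong₂ (λ y z → y * z * rest c d * δ (q (+ 2 * a , + 2 * b , c , d))) (sym (even a)) (sym (even b))))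
        where
        at : q (+ 2 * a , + 2 * b , c , d) ≡ 0ℤ → (O (class a) + O (class b) - + 2 * O (class a) * O (class b)) * rest c d ≡ 1ℤ * 1ℤ * rest c d
        at e = trans (sym (ℤₚ.*-identityʳ _)) (trans (cong ((O (class a) + O (class b) - + 2 * O (class a) * O (class b)) * rest c d *_) (sym one))
          (trans (table (class a) (class b) (class c) (class d)) (trans (cong (1ℤ * rest c d *_) one) (ℤₚ.*-identityʳ _))))
          where
          scaled : ∀ k z → k * (z * z) ≈ k * V (class z) [ 8 ]
          scaled k z = ≈-* (≈-refl {z = k}) (square-class z)
          l : ∀ a b c d → + 2 * a * (+ 2 * a) + + 3 * (+ 2 * b * (+ 2 * b)) + + 3 * (c * c) + + 3 * (d * d) ≡ + 4 * (a * a) + + 12 * (b * b) + + 3 * (c * c) + + 3 * (d * d)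
          l = solve-∀
          squares : + 4 * (a * a) + + 12 * (b * b) + + 3 * (c * c) + + 3 * (d * d) ≈ + 4 * V (class a) + + 12 * V (class b) + + 3 * V (class c) + + 3 * V (class d) [ 8 ]
          squares = ≈-+ (≈-+ (≈-+ (scaled (+ 4) a) (scaled (+ 12) b)) (scaled (+ 3) c)) (scaled (+ 3) d)
          one : D 8 (+ 4 * V (class a) + + 12 * V (class b) + + 3 * V (class c) + + 3 * V (class d) - + 3) ≡ 1ℤ
          one = D-shift {+ 4 * V (class a) + + 12 * V (class b) + + 3 * V (class c) + + 3 * V (class d)} (≈-trans (≈-sym squares) (subst (λ z → z ≈ + 3 [ 8 ]) (sym (trans (sym (l a b c d)) (ℤₚ.i-j≡0⇒i≡j _ (+ N) e))) N≈3))
      quarter : ∀ a b → (a + + 3 * b - (a - b)) /ℕ 4 ≡ b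
      quarter a b = trans (cong (_/ℕ 4) (l a b)) (/ℕ-exact 4 b)
        where
        l : ∀ a b → a + + 3 * b - (a - b) ≡ b * + 4
        l = solve-∀
      halved : ∀ a → (+ 2 * a) /ℕ 2 ≡ a
      halved a = trans (cong (_/ℕ 2) (ℤₚ.*-comm (+ 2) a)) (/ℕ-exact 2 a)
      doubled : ∀ z → D 2 z ≢ 0ℤ → + 2 * (z /ℕ 2) ≡ z
      doubled z ne = trans (ℤₚ.*-comm (+ 2) (z /ℕ 2)) (multiple 2 z (D≢0 2 z ne))
      fwd : ∀ a → u₁ a ≢ 0ℤ → g (f a) ≡ a × u₂ (f a) ≡ u₁ a
      fwd (x , v , c , d) ne = trans (cong₂ (λ y z → y + + 3 * z , y - z , c , d) (halved (v + b)) (halved b)) back , trans (sym (value (v + b) b c d)) (cong u₁ back)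
        where
        b = (x - v) /ℕ 4
        four : b * + 4 ≡ x - v
        four = multiple 4 (x - v) (D≢0 4 (x - v) (*≢0ʳ {o x * o v} (*≢0ˡ {_} {rest c d} (*≢0ˡ {_} {δ (q (x , v , c , d))} ne))))
        l₁ : ∀ v b → v + b + + 3 * b ≡ v + b * + 4
        l₁ = solve-∀
        l₂ : ∀ v b → v + b - b ≡ v
        l₂ = solve-∀
        l₃ : ∀ x v → v + (x - v) ≡ x
        l₃ = solve-∀
        back : (v + b + + 3 * b , v + b - b , c , d) ≡ (x , v , c , d)
        back = cong₂ (λ y z → y , z , c , d) (trans (l₁ v b) (trans (cong (λ z → v + z) four) (l₃ x v))) (l₂ v b)
      bwd : ∀ a → u₂ a ≢ 0ℤ → f (g a) ≡ a × u₁ (g a) ≡ u₂ a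
      bwd (x , v , c , d) ne = trans (cong (λ z → + 2 * (x /ℕ 2 - v /ℕ 2 + z) , + 2 * z , c , d) (quarter (x /ℕ 2) (v /ℕ 2))) (cong₂ (λ y z → y , z , c , d) (trans (cong (+ 2 *_) (l (x /ℕ 2) (v /ℕ 2))) x≡) v≡) ,
        trans (value (x /ℕ 2) (v /ℕ 2) c d) (cong₂ (λ y z → u₂ (y , z , c , d)) x≡ v≡)
        where
        l : ∀ a b → a - b + b ≡ a
        l = solve-∀
        x≡ : + 2 * (x /ℕ 2) ≡ x
        x≡ = doubled x (*≢0ˡ {_} {D 2 v} (*≢0ˡ {_} {rest c d} (*≢0ˡ {_} {δ (q (x , v , c , d))} ne)))
        v≡ : + 2 * (v /ℕ 2) ≡ v
        v≡ = doubled v (*≢0ʳ {D 2 x} (*≢0ˡ {_} {rest c d} (*≢0ˡ {_} {δ (q (x , v , c , d))} ne)))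

    -- Odd `x` and `v` satisfy exactly one of `x ≡ v` and `x ≡ - v` modulo 4, and `rotation` carries
    -- each half to the points counted by `τ`.
    t-τ : t ≡ + 2 * τ
    t-τ = trans (⟦⟧-cong λ (x , v , c , d) _ → trans (l (O (class x)) (O (class v)) (O (class c)) (T (class d))) (trans (cong (_* rest c d) (trans (sym (cong₂ _*_ (o-class x) (o-class v))) (diagonal-split x v))) (ℤₚ.*-distribʳ-+ (rest c d) (diagonal x v) (diagonal x (- v)))))
      (trans (⟦⟧-+ half₁ (half₁ ∘ negate-v)) (trans (cong (λ z → ⟦ half₁ ⟧ + z) (⟦⟧-negate-v half₁)) (trans (cong (λ z → z + z) (trans rotation (⟦⟧-cong λ (x , v , c , d) _ →
        trans (cong₂ (λ y z → y * z * rest c d) (even-class x) (even-class v)) (sym (l (E (class x)) (E (class v)) (O (class c)) (T (class d))))))) (l₂ τ))))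
      where
      l : ∀ a b c d → a * b * c * d ≡ a * b * (c * d)
      l = solve-∀
      l₂ : ∀ u → u + u ≡ + 2 * u
      l₂ = solve-∀

    Λ ℭ : ℤ
    Λ = ⟦ (λ (x , v , c , d) → D 2 (x - v)) ⟧
    ℭ = ⟦ (λ (x , v , c , d) → D 2 x * κ v) ⟧

    -- For even `x` and `v` the weight 1 is `κ v` plus twice the indicator of `v ≡ 2` modulo 4. By
    -- `even-two` with `t-τ` the latter contributes `2 t`, and by `odd-odd` the points with `x`, `v`
    -- odd contribute another `2 t`.
    quarter-difference : Λ ≡ ℭ + + 4 * t
    quarter-difference = trans (⟦⟧-cong λ (x , v , c , d) _ → trans (split x v) (cong₂ (λ y z → D 2 x * κ v + (y + z)) (cong (+ 2 *_) (cong₂ _*_ (even-class x) (two-class v))) (cong₂ _*_ (o-class x) (o-class v))))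
      (trans (⟦⟧-+ (λ (x , v , c , d) → D 2 x * κ v) (λ (x , v , c , d) → + 2 * (E (class x) * T (class v)) + O (class x) * O (class v))) (cong (λ z → ℭ + z)
        (trans (⟦⟧-+ (λ (x , v , c , d) → + 2 * (E (class x) * T (class v))) (λ (x , v , c , d) → O (class x) * O (class v)))
          (trans (cong₂ _+_ (trans (⟦⟧-* (+ 2) (λ (x , v , c , d) → E (class x) * T (class v))) (cong (+ 2 *_) (trans even-two (sym t-τ)))) odd-odd) (l t)))))
      where
      l : ∀ u → + 2 * u + + 2 * u ≡ + 4 * u
      l = solve-∀
      split : ∀ x v → D 2 (x - v) ≡ D 2 x * κ v + (+ 2 * (D 2 x * two v) + o x * o v)
      split = by-residues₂ {4} {4} (λ p r → D-periodic 2 (4⇒2 (≈-- p r)))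
        (λ p r → cong₂ _+_ (cong₂ _*_ (D-periodic 2 (4⇒2 p)) (κ-periodic r)) (cong₂ _+_ (cong (+ 2 *_) (cong₂ _*_ (D-periodic 2 (4⇒2 p)) (two-periodic r))) (cong₂ _*_ (o-periodic p) (o-periodic r)))) check₂

-- From the points counted by `Λ` to divisor sums.

module DivisorIdentity where

  open FiniteSums
  open Congruences
  open LiouvilleIdentity
  open Progressions
  open InteriorTerms hiding (t)
  open DivisorPairs
  open BoundaryTerms
  open CubeOfEtaFunction
  open PrimeModuli
  open BinaryForms
  open SquareAndHexagonalForms
  open QuaternaryForm
  open import Data.Nat as ℕ using (ℕ; suc; z≤n; s≤s)
  import Data.Nat.Properties as ℕₚ
  open import Data.Integer as ℤ using (ℤ; +_; +0; +[1+_]; -[1+_]; _+_; _*_; _-_; -_; ∣_∣; 0ℤ; 1ℤ; _≤_; _<_)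
  import Data.Integer.Properties as ℤₚ
  open import Data.Integer.DivMod using (_/ℕ_)
  open import Data.Integer.Tactic.RingSolver using (solve-∀)
  open import Data.Product using (∃; _×_; _,_; proj₁; proj₂)
  open import Data.Sum using (_⊎_; inj₁; inj₂; [_,_]′)
  open import Function using (case_of_)
  open import Relation.Nullary using (¬_; yes; no)
  open import Relation.Binary.PropositionalEquality

  -- `θ` marks one half of the support, and the involution `σ` exchanges the two halves without
  -- changing the weight.
  HasSum-half : ∀ {A : Set} {{_ : Grid A}} {w : A → ℤ} {s} (σ : A → A) (θ : A → ℤ) → (∀ a → σ (σ a) ≡ a) → (∀ a → w (σ a) ≡ w a) →
    (∀ a → w a ≡ θ a * w a + θ (σ a) * w a) → HasSum w s → ∃ λ t → HasSum (λ a → θ a * w a) t × s ≡ + 2 * t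
  HasSum-half {w = w} {s} σ θ σσ wσ split p = t , pt , trans (HasSum-unique p (HasSum-cong (λ a → sym (split a)) (HasSum-+ pt (HasSum-cong (λ a → cong (θ (σ a) *_) (wσ a)) (HasSum-bijection σ σ σσ σσ pt))))) (l t)
    where
    restricted : ∃ λ t → HasSum (λ a → θ a * w a) t
    restricted = HasSum-restrict θ p
    t : ℤ
    t = proj₁ restricted
    pt : HasSum (λ a → θ a * w a) t
    pt = proj₂ restricted
    l : ∀ t → t + t ≡ + 2 * t
    l = solve-∀

  c-split : ∀ a x → c a x ≡ pos a * c a x + pos (- a) * c a x
  c-split +0       _ = refl
  c-split +[1+ m ] x = sym (trans (ℤₚ.+-identityʳ _) (ℤₚ.*-identityˡ _))
  c-split -[1+ m ] x = sym (trans (ℤₚ.+-identityˡ _) (ℤₚ.*-identityˡ _))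

  c-pos : ∀ a x → pos a * c a x ≡ pos a * pos x
  c-pos +0       _ = refl
  c-pos +[1+ m ] x = l (pos x)
    where
    l : ∀ p → 1ℤ * (1ℤ * p - 0ℤ) ≡ 1ℤ * p
    l = solve-∀
  c-pos -[1+ m ] _ = refl

  positiveWeight : (ℤ → ℤ → ℤ) → ℕ → ℤ × ℤ → ℤ
  positiveWeight f n (a , x) = pos a * pos x * f a x * δ (a * x - + n)

  module _ (f : ℤ → ℤ → ℤ) (n : ℕ) where

    positiveWeight≢0 : ∀ a x → positiveWeight f n (a , x) ≢ 0ℤ → 0ℤ < a × 0ℤ < x × f a x ≢ 0ℤ × a * x ≡ + n
    positiveWeight≢0 a x ne = pos≢0 {a} (*≢0ˡ {_} {pos x} pp) , pos≢0 {x} (*≢0ʳ {pos a} pp) , *≢0ʳ {pos a * pos x} ppf , ℤₚ.i-j≡0⇒i≡j (a * x) (+ n) (δ≢0 (a * x - + n) (*≢0ʳ {pos a * pos x * f a x} ne))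
      where
      ppf : pos a * pos x * f a x ≢ 0ℤ
      ppf = *≢0ˡ {_} {δ (a * x - + n)} ne
      pp : pos a * pos x ≢ 0ℤ
      pp = *≢0ˡ {_} {f a x} ppf

    open Pairs n

    -- For odd `f` the sign in `ϖ` makes the two quadrants contribute equally.
    ⟪⟫-half : (∀ a x → f (- a) (- x) ≡ - f a x) → ∃ λ s → HasSum {ℤ × ℤ} (positiveWeight f n) s × ⟪ f ⟫ ≡ + 2 * s
    ⟪⟫-half odd = proj₁ half , HasSum-cong {ℤ × ℤ} (λ (a , x) → trans (l₀ (pos a) (f a x) (c a x) (δ (a * x - + n))) (cong (λ z → z * f a x * δ (a * x - + n)) (c-pos a x))) (proj₁ (proj₂ half)) , proj₂ (proj₂ half)
      where
      w : ℤ × ℤ → ℤ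
      w (a , x) = f a x * ϖ (a , x)
      l₀ : ∀ p f c d → p * (f * (c * d)) ≡ p * c * f * d
      l₀ = solve-∀
      half : ∃ λ s → HasSum {ℤ × ℤ} (λ (a , x) → pos a * w (a , x)) s × ⟪ f ⟫ ≡ + 2 * s
      half = HasSum-half {A = ℤ × ℤ} {w = w} (λ (a , x) → - a , - x) (λ (a , x) → pos a) (λ (a , x) → cong₂ _,_ (ℤₚ.neg-involutive a) (ℤₚ.neg-involutive x))
        (λ (a , x) → trans (cong₂ _*_ (odd a x) (cong₂ (λ p r → p * δ (r - + n)) (c-neg a x) (l a x))) (l′ (f a x) (c a x) (δ (a * x - + n))))
        (λ (a , x) → trans (cong (λ z → f a x * (z * δ (a * x - + n))) (c-split a x)) (l″ (f a x) (pos a) (pos (- a)) (c a x) (δ (a * x - + n))))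
        (⟪⟫-HasSum f)
        where
        l : ∀ a x → - a * - x ≡ a * x
        l = solve-∀
        l′ : ∀ r s t → - r * (- s * t) ≡ r * (s * t)
        l′ = solve-∀
        l″ : ∀ p a b c d → p * ((a * c + b * c) * d) ≡ a * (p * (c * d)) + b * (p * (c * d))
        l″ = solve-∀

  module _ {A : Set} (u f : A → ℤ) (m : ℕ) .{{_ : ℕ.NonZero m}} where

    dilate : ∀ {R s} K → + m * K ≡ R → HasSum (λ a → u a * δ (f a - K)) s → HasSum (λ a → u a * δ (+ m * f a - R)) s
    dilate K refl = HasSum-cong λ a → cong (u a *_) (trans (sym (δ-* (+ m) (f a - K) {{ℤ.≢-nonZero λ e → ℕₚ.<⇒≢ (ℕ.>-nonZero⁻¹ m) (sym (ℤₚ.+-injective e))}})) (cong δ (l (+ m) (f a) K)))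
      where
      l : ∀ m f K → m * (f - K) ≡ m * f - m * K
      l = solve-∀

    dilate-0 : ∀ {R} → ¬ (R ≈ 0ℤ [ m ]) → HasSum (λ a → u a * δ (+ m * f a - R)) 0ℤ
    dilate-0 {R} h = HasSum-0 λ a → trans (cong (u a *_) (δ-≢ λ e → h (by (f a) (trans (sym (ℤₚ.i-j≡0⇒i≡j _ R e)) (trans (ℤₚ.*-comm (+ m) (f a)) (sym (ℤₚ.+-identityˡ (f a * + m)))))))) (ℤₚ.*-zeroʳ (u a))

  divides? : ∀ m .{{_ : ℕ.NonZero m}} R → (∃ λ K → + m * K ≡ R) ⊎ ¬ (R ≈ 0ℤ [ m ])
  divides? m R with D m R ℤ.≟ 0ℤ
  ... | no  d≢0 = inj₁ (R /ℕ m , trans (ℤₚ.*-comm (+ m) (R /ℕ m)) (multiple m R (D≢0 m R d≢0)))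
  ... | yes d≡0 = inj₂ λ e → case trans (sym (D-1 m e)) d≡0 of λ ()

  pairSum : (ℤ → ℤ) → ℕ → ℤ → ℤ × ℤ → ℤ
  pairSum χ m R (a , x) = pos a * pos x * χ a * δ (+ m * (a * x) - R)

  -- The two-square theorem at `R / 3`, with both counts zero if 3 does not divide `R`. Oddness
  -- passes from `R` to the quotient.
  threefold-squares : ∀ R → ¬ (R ≈ 0ℤ [ 2 ]) → ∃ λ s → HasSum {ℤ × ℤ} (pairSum χ₄ 3 R) s × HasSum {ℤ × ℤ} (λ (x , y) → 1ℤ * δ (+ 3 * (x * x + y * y) - R)) (+ 4 * s)
  threefold-squares R odd = [ multiple-case , (λ h → 0ℤ , dilate-0 {ℤ × ℤ} (λ (a , x) → pos a * pos x * χ₄ a) (λ (a , x) → a * x) 3 h , dilate-0 {ℤ × ℤ} (λ _ → 1ℤ) (λ (x , y) → x * x + y * y) 3 h) ]′ (divides? 3 R)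
    where
    multiple-case : (∃ λ K → + 3 * K ≡ R) → ∃ λ s → HasSum {ℤ × ℤ} (pairSum χ₄ 3 R) s × HasSum {ℤ × ℤ} (λ (x , y) → 1ℤ * δ (+ 3 * (x * x + y * y) - R)) (+ 4 * s)
    multiple-case (K , e) = proj₁ claim , dilate {ℤ × ℤ} (λ (a , x) → pos a * pos x * χ₄ a) (λ (a , x) → a * x) 3 K e (proj₁ (proj₂ claim)) ,
      dilate {ℤ × ℤ} (λ _ → 1ℤ) (λ (x , y) → x * x + y * y) 3 K e (HasSum-cong {ℤ × ℤ} (λ (x , y) → sym (ℤₚ.*-identityˡ (δ (x * x + y * y - K)))) (proj₂ (proj₂ claim)))
      where
      claim = Gaussian.two-squares K λ K≈0 → odd (subst (λ z → z ≈ 0ℤ [ 2 ]) e (≈-* (≈-refl {z = + 3}) K≈0))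

  -- The term `δ R` is the zero vector, which the divisor sum does not see.
  fourfold-hexagonal : ∀ R → ∃ λ s → HasSum {ℤ × ℤ} (pairSum χ₃ 4 R) s × HasSum {ℤ × ℤ} (λ (x , y) → 1ℤ * δ (+ 4 * (x * x + x * y + y * y) - R)) (δ R + + 6 * s)
  fourfold-hexagonal R = [ multiple-case , other-case ]′ (divides? 4 R)
    where
    Goal : Set
    Goal = ∃ λ s → HasSum {ℤ × ℤ} (pairSum χ₃ 4 R) s × HasSum {ℤ × ℤ} (λ (x , y) → 1ℤ * δ (+ 4 * (x * x + x * y + y * y) - R)) (δ R + + 6 * s)
    multiple-case : (∃ λ K → + 4 * K ≡ R) → Goal
    multiple-case (K , e) = proj₁ claim , dilate {ℤ × ℤ} (λ (a , x) → pos a * pos x * χ₃ a) (λ (a , x) → a * x) 4 K e (proj₁ (proj₂ claim)) ,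
      HasSum-subst (cong (_+ + 6 * proj₁ claim) (trans (sym (δ-* (+ 4) K)) (cong δ e))) (dilate {ℤ × ℤ} (λ _ → 1ℤ) (λ (x , y) → x * x + x * y + y * y) 4 K e
        (HasSum-cong {ℤ × ℤ} (λ (x , y) → sym (ℤₚ.*-identityˡ (δ (x * x + x * y + y * y - K)))) (proj₂ (proj₂ claim))))
      where
      claim = Eisenstein.hexagonal K
    other-case : ¬ (R ≈ 0ℤ [ 4 ]) → Goal
    other-case h = 0ℤ , dilate-0 {ℤ × ℤ} (λ (a , x) → pos a * pos x * χ₃ a) (λ (a , x) → a * x) 4 h ,
      HasSum-subst (sym (trans (ℤₚ.+-identityʳ (δ R)) (δ-≢ λ { refl → h ≈-refl }))) (dilate-0 {ℤ × ℤ} (λ _ → 1ℤ) (λ (x , y) → x * x + x * y + y * y) 4 h)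

  module FirstIdentity (N : ℕ) (N≈3 : + N ≈ + 3 [ 8 ]) where

    open Lattice N N≈3
    open Convolution N using (ω; ⟨⟩-HasSum; negate₁; negate₂)
    open Interior N using (q₃)
    open Boundary N (8⇒4 N≈3) using (e₁; e₂; s₀; convolution-sum)

    hex : ℤ × ℤ → ℤ
    hex (a , b) = a * a + a * b + b * b

    P : (ℤ × ℤ) × (ℤ × ℤ) → ℤ
    P (v , c , d) = 1ℤ * δ (+ 3 * (c * c + d * d) - (+ N - + 4 * hex v))

    -- With `x = 2 a + b` and `v = b` the condition `x ≡ v` modulo 2 is built in, and
    -- `x² + 3 v² = 4 (a² + a b + b²)`.
    Λ-HasSum : HasSum P Λ
    Λ-HasSum = HasSum-reindex {A = Quad} {B = (ℤ × ℤ) × (ℤ × ℤ)} {v = P} f g fwd (λ b _ → fg b , value b) (⟦⟧-HasSum (λ (x , v , c , d) → D 2 (x - v)))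
      where
      f : Quad → (ℤ × ℤ) × (ℤ × ℤ)
      f (x , v , c , d) = ((x - v) /ℕ 2 , v) , c , d
      g : (ℤ × ℤ) × (ℤ × ℤ) → Quad
      g ((a , b) , c , d) = a * + 2 + b , b , c , d
      l₀ : ∀ a b → a + b - b ≡ a
      l₀ = solve-∀
      fg : ∀ b → f (g b) ≡ b
      fg ((a , b) , c , d) = cong (λ z → (z , b) , c , d) (trans (cong (_/ℕ 2) (l₀ (a * + 2) b)) (/ℕ-exact 2 a))
      u : Quad → ℤ
      u v@(x , y , c , d) = D 2 (x - y) * δ (q v)
      value : ∀ b → u (g b) ≡ P b
      value ((a , b) , c , d) = cong₂ _*_ (D-1 2 (by a (trans (l₀ (a * + 2) b) (sym (ℤₚ.+-identityˡ (a * + 2)))))) (cong δ (l a b c d (+ N)))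
        where
        l : ∀ a b c d n → (a * + 2 + b) * (a * + 2 + b) + + 3 * (b * b) + + 3 * (c * c) + + 3 * (d * d) - n ≡ + 3 * (c * c + d * d) - (n - + 4 * (a * a + a * b + b * b))
        l = solve-∀
      fwd : ∀ a → u a ≢ 0ℤ → g (f a) ≡ a × P (f a) ≡ u a
      fwd (x , v , c , d) ne = back , trans (sym (value (f (x , v , c , d)))) (cong u back)
        where
        l : ∀ x v → x - v + v ≡ x
        l = solve-∀
        back : g (f (x , v , c , d)) ≡ (x , v , c , d)
        back = cong (λ z → z , v , c , d) (trans (cong (_+ v) (multiple 2 (x - v) (D≢0 2 (x - v) (*≢0ˡ {_} {δ (q (x , v , c , d))} ne)))) (l x v))

    Q : (ℤ × ℤ) × (ℤ × ℤ) → ℤ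
    Q (v , p) = pairSum χ₄ 3 (+ N - + 4 * hex v) p

    Q-bounded : ∀ w → Q w ≢ 0ℤ → size w ℕ.≤ N
    Q-bounded ((a , b) , d , e) ne = bound (pos≢0 {d} (*≢0ˡ {_} {pos e} (*≢0ˡ {_} {χ₄ d} (*≢0ˡ {_} {δ R} ne)))) (pos≢0 {e} (*≢0ʳ {pos d} (*≢0ˡ {_} {χ₄ d} (*≢0ˡ {_} {δ R} ne)))) (δ≢0 R (*≢0ʳ {pos d * pos e * χ₄ d} ne))
      where
      R : ℤ
      R = + 3 * (d * e) - (+ N - + 4 * hex (a , b))
      three : ∀ z → + 3 * (z * z) ≡ + (3 ℕ.* (∣ z ∣ ℕ.* ∣ z ∣))
      three z = trans (cong (+ 3 *_) (square-ℕ z)) (sym (ℤₚ.pos-* 3 (∣ z ∣ ℕ.* ∣ z ∣)))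
      bound : 0ℤ < d → 0ℤ < e → R ≡ 0ℤ → size ((a , b) , d , e) ℕ.≤ N
      bound (ℤ.+<+ {n = suc d′} _) (ℤ.+<+ {n = suc e′} _) R≡0 = ℕₚ.⊔-lub (ℕₚ.⊔-lub (small (+ 2 * b + a) a (trans (cong (λ z → + (3 ℕ.* X) + z) (l a b)) total-≡))
          (small (+ 2 * a + b) b (trans (cong (λ z → + (3 ℕ.* X) + z) (l′ a b)) total-≡)))
        (ℕₚ.⊔-lub (ℕₚ.≤-trans (ℕₚ.m≤m*n (suc d′) (suc e′)) X≤) (ℕₚ.≤-trans (ℕₚ.m≤n*m (suc e′) (suc d′)) X≤))
        where
        X : ℕ
        X = suc d′ ℕ.* suc e′
        l : ∀ a b → (+ 2 * b + a) * (+ 2 * b + a) + + 3 * (a * a) ≡ + 4 * (a * a + a * b + b * b)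
        l = solve-∀
        l′ : ∀ a b → (+ 2 * a + b) * (+ 2 * a + b) + + 3 * (b * b) ≡ + 4 * (a * a + a * b + b * b)
        l′ = solve-∀
        l″ : ∀ p n h → p + h ≡ p - (n - h) + n
        l″ = solve-∀
        total-≡ : + (3 ℕ.* X) + + 4 * hex (a , b) ≡ + N
        total-≡ = trans (l″ (+ (3 ℕ.* X)) (+ N) (+ 4 * hex (a , b))) (trans (cong (_+ + N) (trans (cong (_- (+ N - + 4 * hex (a , b))) (ℤₚ.pos-* 3 X)) R≡0)) (ℤₚ.+-identityˡ (+ N)))
        parts : ∀ y z → + (3 ℕ.* X) + (y * y + + 3 * (z * z)) ≡ + N → 3 ℕ.* X ℕ.+ (∣ y ∣ ℕ.* ∣ y ∣ ℕ.+ 3 ℕ.* (∣ z ∣ ℕ.* ∣ z ∣)) ≡ N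
        parts y z eq = ℤₚ.+-injective (trans (cong (λ w → + (3 ℕ.* X) + w) (sym (cong₂ _+_ (square-ℕ y) (three z)))) eq)
        small : ∀ y z → + (3 ℕ.* X) + (y * y + + 3 * (z * z)) ≡ + N → ∣ z ∣ ℕ.≤ N
        small y z eq = ℕₚ.≤-trans (n≤n*n ∣ z ∣) (ℕₚ.≤-trans (ℕₚ.m≤n*m (∣ z ∣ ℕ.* ∣ z ∣) 3) (ℕₚ.≤-trans (ℕₚ.m≤n+m _ (∣ y ∣ ℕ.* ∣ y ∣)) (ℕₚ.≤-trans (ℕₚ.m≤n+m _ (3 ℕ.* X)) (ℕₚ.≤-reflexive (parts y z eq)))))
        X≤ : X ℕ.≤ N
        X≤ = ℕₚ.≤-trans (ℕₚ.m≤n*m X 3) (ℕₚ.≤-trans (ℕₚ.m≤m+n (3 ℕ.* X) _) (ℕₚ.≤-reflexive (parts (+ 2 * a + b) b (trans (cong (λ z → + (3 ℕ.* X) + z) (l′ a b)) total-≡))))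

    abstract
      -- The intermediate stage in which `(c , d)` has been replaced by a divisor pair while the
      -- hexagonal vector is still present, to be summed next.
      ℓ : ℤ
      ℓ = ∑ {(ℤ × ℤ) × (ℤ × ℤ)} (box N) Q

      ℓ-HasSum : HasSum Q ℓ
      ℓ-HasSum = HasSum-box N Q-bounded

    -- For each hexagonal vector the number `N - 4 h` is odd, as the two-square theorem requires.
    Λ≡4ℓ : Λ ≡ + 4 * ℓ
    Λ≡4ℓ = HasSum-unique {A = ℤ × ℤ} (HasSum-fubini Λ-HasSum λ v → proj₂ (proj₂ (inner v))) (HasSum-* (+ 4) (HasSum-fubini ℓ-HasSum λ v → proj₁ (proj₂ (inner v))))
      where
      odd : ∀ h → ¬ (+ N - + 4 * h ≈ 0ℤ [ 2 ])
      odd h p = case trans (sym (D-1 2 (≈-trans (≈-sym (≈-trans (≈-- (4⇒2 (8⇒4 N≈3)) (≈-* {m = 2} {z′ = h} (by {+ 4} {0ℤ} (+ 2) refl) ≈-refl)) (subst (λ z → + 3 - z ≈ + 3 [ 2 ]) (sym (ℤₚ.*-zeroˡ h)) ≈-refl))) p))) refl of λ ()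
      inner : ∀ v → _
      inner v = threefold-squares (+ N - + 4 * hex v) (odd (hex v))

    -- The positive pairs with `a = 3 e` and `x = d`; these are the terms of `ℓ` in which the
    -- hexagonal vector is zero.
    s₀-half : ∃ λ s → HasSum {ℤ × ℤ} (λ (d , e) → pos d * pos e * χ₄ d * δ (+ N - + 3 * (d * e))) s × s₀ ≡ + 2 * s
    s₀-half = proj₁ half , HasSum-reindex {A = ℤ × ℤ} {B = ℤ × ℤ} {u = u} {v = v} (λ (a , x) → x , a /ℕ 3) (λ (d , e) → e * + 3 , d)
        (λ (a , x) ne → let e = cong (_, x) (multiple 3 a (D≢0 3 a (*≢0ˡ {_} {χ₄ x} (proj₁ (proj₂ (proj₂ (positiveWeight≢0 φ N a x ne))))))) in e , trans (sym (value x (a /ℕ 3))) (cong u e))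
        (λ (d , e) _ → cong (d ,_) (/ℕ-exact 3 e) , value d e) (proj₁ (proj₂ half)) , proj₂ (proj₂ half)
      where
      φ : ℤ → ℤ → ℤ
      φ a x = D 3 a * χ₄ x
      u v : ℤ × ℤ → ℤ
      u = positiveWeight φ N
      v (d , e) = pos d * pos e * χ₄ d * δ (+ N - + 3 * (d * e))
      half : ∃ λ s → HasSum u s × s₀ ≡ + 2 * s
      half = ⟪⟫-half φ N λ a x → trans (cong₂ _*_ (D-neg 3 a) (χ₄-neg x)) (sym (ℤₚ.neg-distribʳ-* (D 3 a) (χ₄ x)))
      value : ∀ d e → u (e * + 3 , d) ≡ v (d , e)
      value d e = trans (cong₂ (λ p r → p * pos d * (r * χ₄ d) * δ (e * + 3 * d - + N)) (pos-* e (s≤s z≤n)) (D-1 3 (by e (sym (ℤₚ.+-identityˡ (e * + 3))))))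
        (trans (cong (pos e * pos d * (1ℤ * χ₄ d) *_) (trans (sym (δ-neg (e * + 3 * d - + N))) (cong δ (l₂ d e (+ N))))) (l₃ (pos e) (pos d) (χ₄ d) (δ (+ N - + 3 * (d * e)))))
        where
        l₂ : ∀ d e n → - (e * + 3 * d - n) ≡ n - + 3 * (d * e)
        l₂ = solve-∀
        l₃ : ∀ p r χ z → p * r * (1ℤ * χ) * z ≡ r * p * χ * z
        l₃ = solve-∀

    ℓ₁ : ℤ
    ℓ₁ = proj₁ s₀-half

    -- Each of the pairs `(a , x)` and `(b , y)` may be taken positive at the cost of a factor 2.
    -- Dividing 3 out of `a` and 4 out of `y` gives the shape `3 d e + 4 b y = N`.
    q₃-quarter : ∃ λ s → HasSum {(ℤ × ℤ) × (ℤ × ℤ)} (λ ((d , e) , r) → pos d * pos e * χ₄ d * pairSum χ₃ 4 (+ N - + 3 * (d * e)) r) s × q₃ ≡ + 4 * s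
    q₃-quarter = proj₁ half₂ , HasSum-reindex {A = Quad} {B = (ℤ × ℤ) × (ℤ × ℤ)} {u = u} {v = v} f g
        (λ a ne → let e = back a ne in e , trans (sym (value (f a))) (cong u e)) (λ b _ → fg b , value b) (proj₁ (proj₂ half₂)) ,
        trans (proj₂ (proj₂ half₁)) (trans (cong (+ 2 *_) (proj₂ (proj₂ half₂))) (l₀ (proj₁ half₂)))
      where
      l₀ : ∀ s → + 2 * (+ 2 * s) ≡ + 4 * s
      l₀ = solve-∀
      F w w₁ u : Quad → ℤ
      F (a , b , x , y) = (χ₃ b * D 4 y) * (D 3 a * χ₄ x)
      w v = F v * ω v
      w₁ v = pos (proj₁ v) * w v
      u v = pos (proj₁ (proj₂ v)) * w₁ v
      v : (ℤ × ℤ) × (ℤ × ℤ) → ℤ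
      v ((d , e) , r) = pos d * pos e * χ₄ d * pairSum χ₃ 4 (+ N - + 3 * (d * e)) r
      l : ∀ a x → - a * - x ≡ a * x
      l = solve-∀
      half₁ : ∃ λ s → HasSum w₁ s × q₃ ≡ + 2 * s
      half₁ = HasSum-half {A = Quad} {w = w} negate₁ (λ v → pos (proj₁ v)) (λ (a , b , x , y) → cong₂ (λ p r → p , b , r , y) (ℤₚ.neg-involutive a) (ℤₚ.neg-involutive x))
        (λ (a , b , x , y) → trans (cong₂ (λ p r → (χ₃ b * D 4 y) * (p * r) * ω (- a , b , - x , y)) (D-neg 3 a) (χ₄-neg x))
          (trans (cong₂ (λ p r → (χ₃ b * D 4 y) * (D 3 a * - χ₄ x) * (p * c b y * δ (r + b * y - + N))) (c-neg a x) (l a x)) (l′ (χ₃ b * D 4 y) (D 3 a) (χ₄ x) (c a x) (c b y) (δ (a * x + b * y - + N)))))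
        (λ (a , b , x , y) → trans (cong (λ z → F (a , b , x , y) * (z * c b y * δ (a * x + b * y - + N))) (c-split a x)) (l″ (F (a , b , x , y)) (pos a) (pos (- a)) (c a x) (c b y) (δ (a * x + b * y - + N))))
        (⟨⟩-HasSum F)
        where
        l′ : ∀ p D χ s t z → p * (D * - χ) * (- s * t * z) ≡ p * (D * χ) * (s * t * z)
        l′ = solve-∀
        l″ : ∀ p a b c t d → p * ((a * c + b * c) * t * d) ≡ a * (p * (c * t * d)) + b * (p * (c * t * d))
        l″ = solve-∀
      half₂ : ∃ λ s → HasSum u s × proj₁ half₁ ≡ + 2 * s
      half₂ = HasSum-half {A = Quad} {w = w₁} negate₂ (λ v → pos (proj₁ (proj₂ v))) (λ (a , b , x , y) → cong₂ (λ p r → a , p , x , r) (ℤₚ.neg-involutive b) (ℤₚ.neg-involutive y))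
        (λ (a , b , x , y) → cong (pos a *_) (trans (cong₂ (λ p r → (p * r) * (D 3 a * χ₄ x) * ω (a , - b , x , - y)) (χ₃-neg b) (D-neg 4 y))
          (trans (cong₂ (λ p r → (- χ₃ b * D 4 y) * (D 3 a * χ₄ x) * (c a x * p * δ (a * x + r - + N))) (c-neg b y) (l b y)) (l′ (χ₃ b) (D 4 y) (D 3 a * χ₄ x) (c a x) (c b y) (δ (a * x + b * y - + N))))))
        (λ (a , b , x , y) → trans (cong (λ z → pos a * (F (a , b , x , y) * (c a x * z * δ (a * x + b * y - + N)))) (c-split b y)) (l″ (pos a) (F (a , b , x , y)) (pos b) (pos (- b)) (c a x) (c b y) (δ (a * x + b * y - + N))))
        (proj₁ (proj₂ half₁))
        where
        l′ : ∀ χ D p s t z → - χ * D * p * (s * - t * z) ≡ χ * D * p * (s * t * z)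
        l′ = solve-∀
        l″ : ∀ q p a b t c d → q * (p * (t * (a * c + b * c) * d)) ≡ a * (q * (p * (t * c * d))) + b * (q * (p * (t * c * d)))
        l″ = solve-∀
      f : Quad → (ℤ × ℤ) × (ℤ × ℤ)
      f (a , b , x , y) = (x , a /ℕ 3) , b , y /ℕ 4
      g : (ℤ × ℤ) × (ℤ × ℤ) → Quad
      g ((d , e) , b , y) = e * + 3 , b , d , y * + 4
      fg : ∀ b → f (g b) ≡ b
      fg ((d , e) , b , y) = cong₂ (λ p r → (d , p) , b , r) (/ℕ-exact 3 e) (/ℕ-exact 4 y)
      back : ∀ a → u a ≢ 0ℤ → g (f a) ≡ a
      back (a , b , x , y) ne = cong₂ (λ p r → p , b , x , r) (multiple 3 a (D≢0 3 a (*≢0ˡ {_} {χ₄ x} (*≢0ʳ {χ₃ b * D 4 y} F≢0)))) (multiple 4 y (D≢0 4 y (*≢0ʳ {χ₃ b} (*≢0ˡ {_} {D 3 a * χ₄ x} F≢0))))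
        where
        F≢0 : F (a , b , x , y) ≢ 0ℤ
        F≢0 = *≢0ˡ {_} {ω (a , b , x , y)} (*≢0ʳ {pos a} (*≢0ʳ {pos b} ne))
      value : ∀ b → u (g b) ≡ v b
      value ((d , e) , b , y) = trans (l₁ (pos b) (pos (e * + 3)) (χ₃ b) (D 4 (y * + 4)) (D 3 (e * + 3)) (χ₄ d) (c (e * + 3) d) (c b (y * + 4)) (δ (e * + 3 * d + b * (y * + 4) - + N)))
        (trans (cong₂ (λ p r → p * r * (χ₃ b * D 4 (y * + 4)) * (D 3 (e * + 3) * χ₄ d) * δ (e * + 3 * d + b * (y * + 4) - + N))
            (trans (c-pos (e * + 3) d) (cong (_* pos d) (pos-* e (s≤s z≤n)))) (trans (c-pos b (y * + 4)) (cong (pos b *_) (pos-* y (s≤s z≤n)))))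
        (trans (cong₂ (λ p r → pos e * pos d * (pos b * pos y) * (χ₃ b * p) * (r * χ₄ d) * δ (e * + 3 * d + b * (y * + 4) - + N))
            (D-1 4 (by y (sym (ℤₚ.+-identityˡ (y * + 4))))) (D-1 3 (by e (sym (ℤₚ.+-identityˡ (e * + 3))))))
        (trans (cong (λ z → pos e * pos d * (pos b * pos y) * (χ₃ b * 1ℤ) * (1ℤ * χ₄ d) * δ z) (l₂ d e b y (+ N))) (l₃ (pos e) (pos d) (pos b) (pos y) (χ₃ b) (χ₄ d) (δ (+ 4 * (b * y) - (+ N - + 3 * (d * e))))))))
        where
        l₁ : ∀ p r χ D E ψ c c′ z → p * (r * (χ * D * (E * ψ) * (c * c′ * z))) ≡ r * c * (p * c′) * (χ * D) * (E * ψ) * z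
        l₁ = solve-∀
        l₂ : ∀ d e b y n → e * + 3 * d + b * (y * + 4) - n ≡ + 4 * (b * y) - (n - + 3 * (d * e))
        l₂ = solve-∀
        l₃ : ∀ e d b y χ ψ z → e * d * (b * y) * (χ * 1ℤ) * (1ℤ * ψ) * z ≡ d * e * ψ * (b * y * χ * z)
        l₃ = solve-∀

    ℓ₂ : ℤ
    ℓ₂ = proj₁ q₃-quarter

    -- The order of summation is reversed: for fixed `d`, `e` the hexagonal vectors are counted, the
    -- zero vector giving `ℓ₁` and the divisor sum giving `6 ℓ₂`.
    ℓ-split : ℓ ≡ ℓ₁ + + 6 * ℓ₂
    ℓ-split = HasSum-unique {A = ℤ × ℤ} (HasSum-fubini swapped λ (d , e) → HasSum-* (pos d * pos e * χ₄ d) (proj₂ (proj₂ (inner (d , e)))))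
      (HasSum-cong (λ (d , e) → l (pos d * pos e * χ₄ d) (δ (+ N - + 3 * (d * e))) (proj₁ (inner (d , e)))) (HasSum-+ (proj₁ (proj₂ s₀-half)) (HasSum-* (+ 6) (HasSum-fubini (proj₁ (proj₂ q₃-quarter))
        λ (d , e) → HasSum-* (pos d * pos e * χ₄ d) (proj₁ (proj₂ (inner (d , e))))))))
      where
      inner : ∀ v → _
      inner (d , e) = fourfold-hexagonal (+ N - + 3 * (d * e))
      l : ∀ k x s → k * x + + 6 * (k * s) ≡ k * (x + + 6 * s)
      l = solve-∀
      swapped : HasSum {(ℤ × ℤ) × (ℤ × ℤ)} (λ ((d , e) , v) → pos d * pos e * χ₄ d * (1ℤ * δ (+ 4 * hex v - (+ N - + 3 * (d * e))))) ℓ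
      swapped = HasSum-cong (λ ((d , e) , v) → trans (cong (λ z → pos d * pos e * χ₄ d * δ z) (l′ (d * e) (hex v) (+ N))) (cong (pos d * pos e * χ₄ d *_) (sym (ℤₚ.*-identityˡ _))))
        (HasSum-bijection {A = (ℤ × ℤ) × (ℤ × ℤ)} {B = (ℤ × ℤ) × (ℤ × ℤ)} (λ (p , v) → v , p) (λ (v , p) → p , v) (λ _ → refl) (λ _ → refl) ℓ-HasSum)
        where
        l′ : ∀ p h n → + 3 * p - (n - + 4 * h) ≡ + 4 * h - (n - + 3 * p)
        l′ = solve-∀

    -- `4 ℓ₁ + 24 ℓ₂` is `2 s₀ + 6 q₃`, the combination evaluated in `convolution-sum`.
    Λ-divisors : Λ ≡ e₁ - e₂
    Λ-divisors = trans Λ≡4ℓ (trans (cong (+ 4 *_) ℓ-split) (trans (l ℓ₁ ℓ₂) (sym (trans convolution-sum (cong₂ (λ x y → + 6 * x + + 2 * y) (proj₂ (proj₂ q₃-quarter)) (proj₂ (proj₂ s₀-half)))))))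
      where
      l : ∀ a b → + 4 * (a + + 6 * b) ≡ + 6 * (+ 4 * b) + + 2 * (+ 2 * a)
      l = solve-∀

-- The cuspidal sum `ℭ`.

module CuspIdentity where

  open FiniteSums
  open Congruences
  open LiouvilleIdentity
  open Progressions
  open InteriorTerms hiding (t)
  open CubeOfEtaFunction
  open PrimeModuli
  open BinaryForms
  open SquareAndHexagonalForms
  open QuaternaryForm
  open DivisorIdentity
  open import Data.List using (map)
  open import Data.List.Membership.Propositional.Properties
  import Data.List.Relation.Unary.Unique.DecPropositional.Properties as DecUniqueₚ
  open import Data.Nat using (ℕ)
  import Data.Nat.Properties as ℕₚ
  open import Data.Integer as ℤ using (ℤ; +_; -[1+_]; _+_; _*_; _-_; -_; ∣_∣; 0ℤ; 1ℤ; _≤_)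
  import Data.Integer.Properties as ℤₚ
  open import Data.Integer.Tactic.RingSolver using (solve-∀)
  open import Data.Product using (∃; _×_; _,_; proj₁; proj₂)
  open import Data.Sum using ([_,_]′)
  open import Function using (case_of_)
  open import Relation.Nullary using (¬_; yes; no)
  open import Relation.Binary.PropositionalEquality

  HasSum-slice : ∀ {A B : Set} {{_ : Grid B}} {w : A × B → ℤ} {s} → HasSum w s → ∀ a → ∃ λ t → HasSum (λ b → w (a , b)) t
  HasSum-slice p a = _ , hasSum _ (DecUniqueₚ.deduplicate-! _≟_ (map proj₂ (HasSum.support p)))
    (λ b h → ∈-deduplicate⁺ _≟_ (∈-map⁺ proj₂ (HasSum.covers p (a , b) h))) refl

  κ-even : ∀ i → κ i ≡ κ i * D 2 i
  κ-even = by-residues {4} κ-periodic (λ p → cong₂ _*_ (κ-periodic p) (D-periodic 2 (4⇒2 p))) check₁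

  module EvenSquares (M : ℕ) (M≈1 : + M ≈ + 1 [ 4 ]) where

    open CubeOfEta M M≈1

    -- `κ i` removes odd `i`. For even `i` the number `M - i²` is odd and the two-square theorem
    -- applies.
    inner : ∀ i → ∃ λ s → HasSum {ℤ × ℤ} (λ (d , e) → main (i , d , e) * w (i , d , e)) s × HasSum {ℤ × ℤ} (λ (c , d) → κ i * δ (i * i + (c * c + d * d) - + M)) (+ 4 * s)
    inner i with κ i ℤ.≟ 0ℤ
    ... | yes e = 0ℤ , HasSum-0 (λ (d , f) → trans (cong (λ z → z * χ₄ d * w (i , d , f)) e) refl) , HasSum-0 (λ (c , d) → cong (_* δ (i * i + (c * c + d * d) - + M)) e)
    ... | no ne = κ i * proj₁ claim , HasSum-cong {ℤ × ℤ} (λ (d , e) → trans (l (κ i) (pos d) (pos e) (χ₄ d) (δ (d * e - (+ M - i * i)))) (cong (λ z → κ i * χ₄ d * (pos d * pos e * δ z)) (l₁ i (d * e) (+ M)))) (HasSum-* (κ i) (proj₁ (proj₂ claim))) ,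
      HasSum-subst (l₂ (κ i) (proj₁ claim)) (HasSum-cong {ℤ × ℤ} (λ (c , d) → cong (λ z → κ i * δ z) (l₁ i (c * c + d * d) (+ M))) (HasSum-* (κ i) (proj₂ (proj₂ claim))))
      where
      even : i ≈ 0ℤ [ 2 ]
      even = D≢0 2 i (*≢0ʳ {κ i} λ e → ne (trans (κ-even i) e))
      odd : ¬ (+ M - i * i ≈ 0ℤ [ 2 ])
      odd p = case trans (sym (D-1 2 (≈-trans (≈-sym (≈-- (4⇒2 M≈1) (≈-* even even))) p))) refl of λ ()
      claim : ∃ λ s → HasSum {Pair} (divisorWeight χ₄ (+ M - i * i)) s × HasSum {Pair} (λ (x , y) → δ (x * x + y * y - (+ M - i * i))) (+ 4 * s)
      claim = Gaussian.two-squares (+ M - i * i) odd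
      l : ∀ k p q χ z → k * (p * q * χ * z) ≡ k * χ * (p * q * z)
      l = solve-∀
      l₁ : ∀ i u m → u - (m - i * i) ≡ i * i + u - m
      l₁ = solve-∀
      l₂ : ∀ k s → k * (+ 4 * s) ≡ + 4 * (k * s)
      l₂ = solve-∀

    three-squares : ∀ {t} → HasSum {ℤ × ℤ × ℤ} (λ (v , c , d) → κ v * δ (v * v + (c * c + d * d) - + M)) t → t ≡ + 4 * W main
    three-squares p = HasSum-unique {A = ℤ} (HasSum-fubini p λ v → proj₂ (proj₂ (inner v))) (HasSum-* (+ 4) (HasSum-fubini (W-HasSum main) λ v → proj₁ (proj₂ (inner v))))

  module SecondIdentity (N : ℕ) (N≈3 : + N ≈ + 3 [ 8 ]) where

    open Lattice N N≈3

    Z : ℤ × ℤ → ℤ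
    Z (x , y) = pos y * y * (χ₄ y * δ (x * x + + 3 * (y * y) - + N))

    base : ℤ × ℤ → ℤ
    base (x , y) = δ (x * x + + 3 * (y * y) - + N)

    base-HasSum : HasSum base (∑ {ℤ × ℤ} (box N) base)
    base-HasSum = HasSum-box N λ (x , y) ne → let b = q-bounded (x , y , 0ℤ , 0ℤ) (subst (_≢ 0ℤ) (cong δ (l x y (+ N))) ne) in
      ℕₚ.⊔-lub (ℕₚ.m⊔n≤o⇒m≤o ∣ x ∣ _ b) (ℕₚ.m⊔n≤o⇒m≤o ∣ y ∣ _ (ℕₚ.m⊔n≤o⇒n≤o ∣ x ∣ _ b))
      where
      l : ∀ x y n → x * x + + 3 * (y * y) - n ≡ x * x + + 3 * (y * y) + + 3 * (0ℤ * 0ℤ) + + 3 * (0ℤ * 0ℤ) - n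
      l = solve-∀

    abstract
      Z-sum : ∃ λ s → HasSum {ℤ × ℤ} (λ (x , y) → pos y * y * χ₄ y * base (x , y)) s
      Z-sum = HasSum-restrict (λ (x , y) → pos y * y * χ₄ y) base-HasSum

    -- The link between the two cuspidal sums: `ℭ` is `4 C`, and the sum over `a² + 3 b² = 4 N` in
    -- the theorem is `- 2 C`.
    C : ℤ
    C = proj₁ Z-sum

    C-HasSum : HasSum Z C
    C-HasSum = HasSum-cong {ℤ × ℤ} (λ (x , y) → ℤₚ.*-assoc (pos y * y) (χ₄ y) (base (x , y))) (proj₂ Z-sum)

    row : ℤ → ℤ × ℤ × ℤ → ℤ
    row x (v , c , d) = D 2 x * κ v * δ (q (x , v , c , d))

    Claim : ℤ → Set
    Claim x = ∃ λ s → HasSum (λ y → Z (x , y)) s × (∀ {t} → HasSum (row x) t → t ≡ + 4 * s)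

    trivial : ∀ x → (∀ y → Z (x , y) ≡ 0ℤ) → (∀ p → row x p ≡ 0ℤ) → Claim x
    trivial x f g = 0ℤ , HasSum-0 f , λ p → HasSum-unique p (HasSum-0 g)

    -- The factor `D 2 x` annihilates the row, and for odd `x` the congruence `x² + 3 y² ≡ 3` modulo
    -- 4 has no odd solution `y`.
    odd-row : ∀ x → D 2 x ≡ 0ℤ → Claim x
    odd-row x e = trivial x (λ y → trans (cong (pos y * y *_) (vanishing y)) (ℤₚ.*-zeroʳ (pos y * y))) (λ (v , c , d) → trans (cong (λ z → z * κ v * δ (q (x , v , c , d))) e) refl)
      where
      table : ∀ x y → (1ℤ - D 2 x) * χ₄ y * D 4 (x * x + + 3 * (y * y) - + 3) ≡ 0ℤ
      table = by-residues₂ {4} {4} (λ p r → cong₂ _*_ (cong₂ (λ u v → (1ℤ - u) * v) (D-periodic 2 (4⇒2 p)) (χ₄-periodic r))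
        (D-periodic 4 (≈-- (≈-+ (≈-* p p) (≈-* (≈-refl {z = + 3}) (≈-* r r))) (≈-refl {z = + 3})))) (λ _ _ → refl) check₂
      vanishing : ∀ y → χ₄ y * δ (x * x + + 3 * (y * y) - + N) ≡ 0ℤ
      vanishing y = trans (guard {χ₄ y} {0ℤ} (x * x + + 3 * (y * y) - + N) λ z → trans (sym (trans (ℤₚ.*-identityʳ _) (ℤₚ.*-identityˡ (χ₄ y))))
          (trans (cong₂ (λ u w → (1ℤ - u) * χ₄ y * w) (sym e) (sym (one z))) (table x y))) refl
        where
        one : x * x + + 3 * (y * y) - + N ≡ 0ℤ → D 4 (x * x + + 3 * (y * y) - + 3) ≡ 1ℤ
        one z = D-1 4 (subst (λ u → x * x + + 3 * (y * y) - + 3 ≈ u [ 4 ]) (trans (cong (_- + N) (ℤₚ.i-j≡0⇒i≡j (x * x + + 3 * (y * y)) (+ N) z)) (ℤₚ.+-inverseʳ (+ N)))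
          (≈-- (≈-refl {z = x * x + + 3 * (y * y)}) (≈-sym (8⇒4 N≈3))))

    module Even (x : ℤ) (x-even : x ≈ 0ℤ [ 2 ]) where

      R : ℤ
      R = + N - x * x

      q-R : ∀ v c d → q (x , v , c , d) ≡ + 3 * (v * v + (c * c + d * d)) - R
      q-R v c d = l x v c d (+ N)
        where
        l : ∀ x v c d n → x * x + + 3 * (v * v) + + 3 * (c * c) + + 3 * (d * d) - n ≡ + 3 * (v * v + (c * c + d * d)) - (n - x * x)
        l = solve-∀

      Z-R : ∀ y → pos y * y * χ₄ y * δ (+ 3 * (y * y) - R) ≡ Z (x , y)
      Z-R y = trans (ℤₚ.*-assoc (pos y * y) (χ₄ y) (δ (+ 3 * (y * y) - R))) (cong (λ z → pos y * y * (χ₄ y * δ z)) (l x y (+ N)))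
        where
        l : ∀ x y n → + 3 * (y * y) - (n - x * x) ≡ x * x + + 3 * (y * y) - n
        l = solve-∀

      insoluble : (∀ K → 0ℤ ≤ K → + 3 * K ≢ R) → Claim x
      insoluble h = trivial x (λ y → trans (sym (Z-R y)) (trans (cong (pos y * y * χ₄ y *_) (δ-≢ λ e → h (y * y) (square-nonneg y) (ℤₚ.i-j≡0⇒i≡j _ R e))) (ℤₚ.*-zeroʳ (pos y * y * χ₄ y))))
        (λ (v , c , d) → trans (cong (D 2 x * κ v *_) (δ-≢ λ e → h (v * v + (c * c + d * d)) (ℤₚ.+-mono-≤ (square-nonneg v) (ℤₚ.+-mono-≤ (square-nonneg c) (square-nonneg d)))
          (ℤₚ.i-j≡0⇒i≡j _ R (trans (sym (q-R v c d)) e)))) (ℤₚ.*-zeroʳ (D 2 x * κ v)))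

      -- For even `x`, `3 M = N - x²` is 3 modulo 4, so `M ≡ 1` modulo 4, as the identity for the
      -- cube of η requires.
      soluble : ∀ M → + 3 * + M ≡ R → Claim x
      soluble M e = W main , HasSum-cong Z-R (dilate (λ y → pos y * y * χ₄ y) (λ y → y * y) 3 (+ M) e (HasSum-cong (λ y → sym (ℤₚ.*-assoc (pos y * y) (χ₄ y) (δ (y * y - + M)))) cube-of-eta)) ,
        λ p → three-squares (HasSum-cong {ℤ × ℤ × ℤ} (λ (v , c , d) → trans (cong₂ (λ u z → u * κ v * δ z) (D-1 2 x-even) (q-R v c d))
          (trans (cong (_* δ (+ 3 * (v * v + (c * c + d * d)) - R)) (ℤₚ.*-identityˡ (κ v))) (cong (κ v *_) (trans (cong (λ z → δ (+ 3 * (v * v + (c * c + d * d)) - z)) (sym e)) (trans (cong δ (l (v * v + (c * c + d * d)) (+ M))) (δ-* (+ 3) (v * v + (c * c + d * d) - + M))))))) p)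
        where
        l : ∀ u m → + 3 * u - + 3 * m ≡ + 3 * (u - m)
        l = solve-∀
        square-even : x * x ≈ 0ℤ [ 4 ]
        square-even = by (factor x-even * factor x-even) (trans (cong (λ z → z * z) (equation x-even)) (l₁ (factor x-even)))
          where
          l₁ : ∀ f → (0ℤ + f * + 2) * (0ℤ + f * + 2) ≡ 0ℤ + f * f * + 4
          l₁ = solve-∀
        M≈1 : + M ≈ + 1 [ 4 ]
        M≈1 = ≈-trans (by (- (+ 2 * + M)) (l₂ (+ M))) (≈-trans (≈-* (≈-refl {z = + 3}) (subst (λ z → z ≈ + 3 - 0ℤ [ 4 ]) (sym e) (≈-- (8⇒4 N≈3) square-even))) (by (+ 2) refl))
          where
          l₂ : ∀ m → m ≡ + 3 * (+ 3 * m) + - (+ 2 * m) * + 4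
          l₂ = solve-∀
        open CubeOfEta M M≈1
        open EvenSquares M M≈1

      claim : Claim x
      claim = [ at-multiple , (λ h → insoluble λ K _ e → h (by K (trans (sym e) (trans (ℤₚ.*-comm (+ 3) K) (sym (ℤₚ.+-identityˡ (K * + 3))))))) ]′ (divides? 3 R)
        where
        at-multiple : (∃ λ K → + 3 * K ≡ R) → Claim x
        at-multiple (+ M , e)     = soluble M e
        at-multiple (-[1+ n ] , e) = insoluble λ K K≥0 e′ → case subst (0ℤ ≤_) (ℤₚ.*-cancelˡ-≡ (+ 3) K -[1+ n ] (trans e′ (sym e))) K≥0 of λ ()

    claim : ∀ x → Claim x
    claim x with D 2 x ℤ.≟ 0ℤ
    ... | yes e = odd-row x e
    ... | no ne = Even.claim x (D≢0 2 x ne)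

    ℭ≡4C : ℭ ≡ + 4 * C
    ℭ≡4C = HasSum-unique {A = ℤ} (HasSum-fubini total λ x → HasSum-subst (proj₂ (proj₂ (claim x)) (proj₂ (HasSum-slice total x))) (proj₂ (HasSum-slice total x)))
      (HasSum-* (+ 4) (HasSum-fubini C-HasSum λ x → proj₁ (proj₂ (claim x))))
      where
      total : HasSum {ℤ × ℤ × ℤ × ℤ} (λ (x , p) → row x p) ℭ
      total = ⟦⟧-HasSum (λ (x , v , c , d) → D 2 x * κ v)

-- The Jacobi symbol of 3 as a character modulo 12.

module JacobiSymbol where

  open import Defs hiding (sgn)
  open FiniteSums
  open Congruences
  open Progressions
  open DivisorPairs
  open PrimeModuli
  open import Data.Bool using (Bool; true; false; if_then_else_; T)
  open import Data.Bool.ListAction using (any)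
  import Data.Bool.Properties as Boolₚ
  open import Data.Empty using (⊥; ⊥-elim)
  open import Data.Fin using (toℕ)
  import Data.Fin.Properties as Finₚ
  open import Data.List using (applyUpTo)
  import Data.List.Membership.Propositional.Properties as ∈ₚ
  import Data.List.Relation.Unary.Any as Any
  import Data.List.Relation.Unary.Any.Properties as Anyₚ
  open import Data.Nat as ℕ using (ℕ; zero; suc; z≤n; s≤s)
  import Data.Nat.Properties as ℕₚ
  import Data.Nat.Divisibility as ℕ∣
  open import Data.Nat.Divisibility.Core using (hasNonTrivialDivisor)
  open import Data.Nat.DivMod using (m≡m%n+[m/n]*n; m%n<n; m/n<m; m*n/n≡m)
  open import Data.Nat.Primality using (Prime; prime?; prime⇒irreducible; prime⇒nonTrivial; rough∧∣⇒prime; _Rough_; 2-rough; ∤⇒rough-suc)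
  open import Data.Nat.Tactic.RingSolver using () renaming (solve-∀ to ℕ-solve)
  open import Data.Integer using (ℤ; +_; -[1+_]; _+_; _*_; _-_; -_; ∣_∣; 0ℤ; 1ℤ)
  import Data.Integer.Properties as ℤₚ
  open import Data.Integer.DivMod using (n%ℕd<d)
  open import Data.Integer.Tactic.RingSolver using (solve-∀)
  open import Data.Product using (∃; _×_; _,_; proj₁; proj₂)
  open import Data.Sum using ([_,_]′)
  open import Function using (case_of_; Equivalence)
  open import Relation.Nullary using (¬_; yes; no; does)
  open import Relation.Nullary.Decidable using (dec-true; dec-false; from-yes)
  open import Relation.Binary.PropositionalEquality

  module _ {m : ℕ} .{{_ : ℕ.NonZero m}} where

    %⇒≈ : ∀ {a b} → a ℕ.% m ≡ b ℕ.% m → + a ≈ + b [ m ]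
    %⇒≈ {a} {b} e = res⇒≈ (Finₚ.toℕ-injective (trans (Finₚ.toℕ-fromℕ< (n%ℕd<d (+ a) m)) (trans e (sym (Finₚ.toℕ-fromℕ< (n%ℕd<d (+ b) m))))))

    ≈⇒% : ∀ {a b} → + a ≈ + b [ m ] → a ℕ.% m ≡ b ℕ.% m
    ≈⇒% {a} {b} p = trans (sym (Finₚ.toℕ-fromℕ< (n%ℕd<d (+ a) m))) (trans (cong toℕ (≈⇒res p)) (Finₚ.toℕ-fromℕ< (n%ℕd<d (+ b) m)))

  module _ (a r : ℕ) (p∤a : ¬ (suc r ℕ∣.∣ a)) where

    private
      p = suc r

      square? : ℕ → Bool
      square? x = does ((x ℕ.* x) ℕ.% p ℕ.≟ a ℕ.% p)

      evaluate : ∀ b → any square? (applyUpTo (λ i → i) p) ≡ b → legendre a p ≡ (if b then + 1 else -[1+ 0 ])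
      evaluate b e = cong₂ (λ u v → if u then + 0 else if v then + 1 else -[1+ 0 ]) (dec-false (p ℕ∣.∣? a) p∤a) e

    legendre-residue : ∀ z → z * z ≈ + a [ p ] → legendre a p ≡ + 1
    legendre-residue z h = evaluate true (Equivalence.to Boolₚ.T-≡ (Anyₚ.any⁺ square? (Any.map witness (∈ₚ.∈-applyUpTo⁺ (λ i → i) (Finₚ.toℕ<n (res p z))))))
      where
      witness : ∀ {y} → toℕ (res p z) ≡ y → T (square? y)
      witness refl = Equivalence.from Boolₚ.T-≡ (dec-true (_ ℕ.≟ _) (≈⇒% (subst (λ u → u ≈ + a [ p ]) (sym (ℤₚ.pos-* (toℕ (res p z)) (toℕ (res p z)))) (≈-trans (≈-sym (≈-* (rep-res p z) (rep-res p z))) h))))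

    legendre-nonresidue : (∀ z → ¬ (z * z ≈ + a [ p ])) → legendre a p ≡ - 1ℤ
    legendre-nonresidue h = evaluate false (Boolₚ.¬-not λ e → none (Any.satisfied (Anyₚ.any⁻ square? (applyUpTo (λ i → i) p) (Equivalence.from Boolₚ.T-≡ e))))
      where
      none : (∃ λ x → T (square? x)) → ⊥
      none (x , t) = h (+ x) (subst (λ u → u ≈ + a [ p ]) (ℤₚ.pos-* x x) (%⇒≈ (ℕₚ.≡ᵇ⇒≡ ((x ℕ.* x) ℕ.% p) (a ℕ.% p) t)))

  -- The quadratic character of 3 is obtained from those of -1 and -3, which depend on `p` modulo 4
  -- and modulo 3.
  legendre-3 : ∀ p → Prime p → ¬ (2 ℕ∣.∣ p) → ¬ (3 ℕ∣.∣ p) → legendre 3 p ≡ χ₁₂ (+ p)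
  legendre-3 zero p-prime 2∤p _ = ⊥-elim (2∤p (ℕ∣.divides 0 refl))
  legendre-3 p@(suc p-1) p-prime 2∤p 3∤p = by-class (p ℕ.% 12) (p ℕ./ 12) (m%n<n p 12) (m≡m%n+[m/n]*n p 12)
    where
    open PrimeModulus p p-prime
    p∤3 : ¬ (p ℕ∣.∣ 3)
    p∤3 d = [ (λ e → ℕₚ.<⇒≢ 1<p (sym e)) , (λ e → 3∤p (subst (3 ℕ∣.∣_) (sym e) ℕ∣.∣-refl)) ]′ (prime⇒irreducible (from-yes (prime? 3)) d)
    2<p : 2 ℕ.< p
    2<p = ℕₚ.≤∧≢⇒< 1<p λ e → 2∤p (subst (2 ℕ∣.∣_) e ℕ∣.∣-refl)
    3≉0 : ¬ (+ 3 ≈ 0ℤ [ p ])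
    3≉0 e = p∤3 (≈0⇒∣ e)
    value : ∀ r q → p ≡ r ℕ.+ q ℕ.* 12 → χ₁₂ (+ p) ≡ χ₁₂ (+ r)
    value r q e = cong₂ _*_ (χ₃-periodic (by {+ p} {+ r} (+ q * + 4) (trans e′ (cong (λ z → + r + z) (l₁ (+ q)))))) (χ₄-periodic (by {+ p} {+ r} (+ q * + 3) (trans e′ (cong (λ z → + r + z) (l₂ (+ q))))))
      where
      e′ : + p ≡ + r + + q * + 12
      e′ = trans (cong +_ e) (cong (λ z → + r + z) (ℤₚ.pos-* q 12))
      l₁ : ∀ q → q * + 12 ≡ q * + 4 * + 3
      l₁ = solve-∀
      l₂ : ∀ q → q * + 12 ≡ q * + 3 * + 4
      l₂ = solve-∀
    even : ∀ k → p ≡ k ℕ.* 2 → legendre 3 p ≡ χ₁₂ (+ p)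
    even k e = ⊥-elim (2∤p (ℕ∣.divides k e))
    threefold : ∀ k → p ≡ k ℕ.* 3 → legendre 3 p ≡ χ₁₂ (+ p)
    threefold k e = ⊥-elim (3∤p (ℕ∣.divides k e))
    -3-root : ∀ h → h * h - h + 1ℤ ≈ 0ℤ [ p ] → (+ 2 * h - 1ℤ) * (+ 2 * h - 1ℤ) ≈ - (+ 3) [ p ]
    -3-root h hh = subst (λ z → z ≈ - (+ 3) [ p ]) (l h) (≈-- (≈-scale (+ 4) hh) (≈-refl {z = + 3}))
      where
      l : ∀ h → + 4 * (h * h - h + 1ℤ) - + 3 ≡ (+ 2 * h - 1ℤ) * (+ 2 * h - 1ℤ)
      l = solve-∀
    -3-nonresidue : ∀ k → p ≡ 2 ℕ.+ 3 ℕ.* k → ∀ z → ¬ (z * z ≈ - (+ 3) [ p ])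
    -3-nonresidue k e z h = small-≉0 2 (s≤s z≤n) 2<p (inert₃ k e (z - 1ℤ) (+ 2) (subst (λ u → u ≈ 0ℤ [ p ]) (l z) (≈-+ h (≈-refl {z = + 3}))))
      where
      l : ∀ z → z * z + + 3 ≡ (z - 1ℤ) * (z - 1ℤ) + (z - 1ℤ) * + 2 + + 2 * + 2
      l = solve-∀
    times-i : ∀ {i z a} → i * i + 1ℤ ≈ 0ℤ [ p ] → z * z ≈ a [ p ] → i * z * (i * z) ≈ - a [ p ]
    times-i {i} {z} {a} ii h = subst₂ (λ u v → u ≈ v [ p ]) (l₁ i z) (l₂ a) (≈-- (≈-* ii h) h)
      where
      l₁ : ∀ i z → (i * i + 1ℤ) * (z * z) - z * z ≡ i * z * (i * z)
      l₁ = solve-∀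
      l₂ : ∀ a → 0ℤ * a - a ≡ - a
      l₂ = solve-∀
    -- A square root of -1 times a square root of -3 is a square root of 3.
    class-1 : ∀ q → p ≡ 1 ℕ.+ q ℕ.* 12 → legendre 3 p ≡ + 1
    class-1 q e = legendre-residue 3 p-1 p∤3 (proj₁ i * (+ 2 * proj₁ h - 1ℤ)) (times-i {proj₁ i} {+ 2 * proj₁ h - 1ℤ} (proj₂ i) (-3-root (proj₁ h) (proj₂ h)))
      where
      i = sqrt-1 (3 ℕ.* q) (trans e (l q))
        where
        l : ∀ q → 1 ℕ.+ q ℕ.* 12 ≡ suc (4 ℕ.* (3 ℕ.* q))
        l = ℕ-solve
      h = cube-root (4 ℕ.* q) (trans e (l q))
        where
        l : ∀ q → 1 ℕ.+ q ℕ.* 12 ≡ suc (3 ℕ.* (4 ℕ.* q))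
        l = ℕ-solve
    -- A square root of 3 times one of -1 would be a square root of -3, which does not exist for
    -- `p ≡ 2` modulo 3.
    class-5 : ∀ q → p ≡ 5 ℕ.+ q ℕ.* 12 → legendre 3 p ≡ - 1ℤ
    class-5 q e = legendre-nonresidue 3 p-1 p∤3 λ z h → -3-nonresidue (1 ℕ.+ 4 ℕ.* q) (trans e (l₁ q)) (proj₁ i * z) (times-i {proj₁ i} {z} (proj₂ i) h)
      where
      l₁ : ∀ q → 5 ℕ.+ q ℕ.* 12 ≡ 2 ℕ.+ 3 ℕ.* (1 ℕ.+ 4 ℕ.* q)
      l₁ = ℕ-solve
      i = sqrt-1 (1 ℕ.+ 3 ℕ.* q) (trans e (l q))
        where
        l : ∀ q → 5 ℕ.+ q ℕ.* 12 ≡ suc (4 ℕ.* (1 ℕ.+ 3 ℕ.* q))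
        l = ℕ-solve
    -- From `z² = 3` and `s² = -3` follows `(z s)² + 3² = 0`, which for `p ≡ 3` modulo 4 would make
    -- `p` divide 3.
    class-7 : ∀ q → p ≡ 7 ℕ.+ q ℕ.* 12 → legendre 3 p ≡ - 1ℤ
    class-7 q e = legendre-nonresidue 3 p-1 p∤3 λ z k → 3≉0 (inert₄ (1 ℕ.+ 3 ℕ.* q) (trans e (l₁ q)) (z * (+ 2 * proj₁ h - 1ℤ)) (+ 3)
        (subst (λ u → u ≈ 0ℤ [ p ]) (l₂ z (+ 2 * proj₁ h - 1ℤ)) (≈-+ (≈-* k (-3-root (proj₁ h) (proj₂ h))) (≈-refl {z = + 9}))))
      where
      l₁ : ∀ q → 7 ℕ.+ q ℕ.* 12 ≡ suc (2 ℕ.* suc (2 ℕ.* (1 ℕ.+ 3 ℕ.* q)))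
      l₁ = ℕ-solve
      l₂ : ∀ z s → z * z * (s * s) + + 9 ≡ z * s * (z * s) + + 3 * + 3
      l₂ = solve-∀
      h = cube-root (2 ℕ.+ 4 ℕ.* q) (trans e (l q))
        where
        l : ∀ q → 7 ℕ.+ q ℕ.* 12 ≡ suc (3 ℕ.* (2 ℕ.+ 4 ℕ.* q))
        l = ℕ-solve
    -- Neither -1 nor -3 is a square here. Instead, `g = 3 ^ ((p - 1) / 2)` is 1 or -1, and
    -- `z = 3 ^ ((p + 1) / 4)` satisfies `z² = 3 g`; the value -1 would make -3 a square.
    class-11 : ∀ q → p ≡ 11 ℕ.+ q ℕ.* 12 → legendre 3 p ≡ + 1
    class-11 q e = [ (λ g≈1 → legendre-residue 3 p-1 p∤3 z (subst₂ (λ u v → u ≈ v [ p ]) (sym zz) (ℤₚ.*-identityʳ (+ 3)) (≈-* (≈-refl {z = + 3}) (≈-difference g≈1)))) ,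
        (λ g≈-1 → ⊥-elim (-3-nonresidue (3 ℕ.+ 4 ℕ.* q) (trans e (l₁ q)) z (subst₂ (λ u v → u ≈ v [ p ]) (l₅ g zz) refl (≈-- (≈-* (≈-refl {z = + 3}) g≈-1) (≈-refl {z = + 3}))))) ]′
        (euclid (g - 1ℤ) (g + 1ℤ) (subst (λ u → u ≈ 0ℤ [ p ]) (trans (cong (_- 1ℤ) (sym gg)) (l₄ g)) (≈-- (fermat-unit (+ 3) (10 ℕ.+ q ℕ.* 12) e 3≉0) (≈-refl {z = 1ℤ}))))
      where
      g z : ℤ
      g = (+ 3) ⋆ (5 ℕ.+ 6 ℕ.* q)
      z = (+ 3) ⋆ (3 ℕ.+ 3 ℕ.* q)
      l₁ : ∀ q → 11 ℕ.+ q ℕ.* 12 ≡ 2 ℕ.+ 3 ℕ.* (3 ℕ.+ 4 ℕ.* q)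
      l₁ = ℕ-solve
      l₂ : ∀ q → (3 ℕ.+ 3 ℕ.* q) ℕ.* 2 ≡ suc (5 ℕ.+ 6 ℕ.* q)
      l₂ = ℕ-solve
      l₃ : ∀ q → (5 ℕ.+ 6 ℕ.* q) ℕ.* 2 ≡ 10 ℕ.+ q ℕ.* 12
      l₃ = ℕ-solve
      l₄ : ∀ g → g * g - 1ℤ ≡ (g - 1ℤ) * (g + 1ℤ)
      l₄ = solve-∀
      l₅ : ∀ g {w} → w ≡ + 3 * g → + 3 * (g + 1ℤ) - + 3 ≡ w
      l₅ g refl = l g
        where
        l : ∀ g → + 3 * (g + 1ℤ) - + 3 ≡ + 3 * g
        l = solve-∀
      zz : z * z ≡ + 3 * g
      zz = trans (sym (⋆-2 z)) (trans (⋆-⋆ (+ 3) (3 ℕ.+ 3 ℕ.* q) 2) (trans (cong ((+ 3) ⋆_) (l₂ q)) (⋆-suc (+ 3) (5 ℕ.+ 6 ℕ.* q))))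
      gg : g * g ≡ (+ 3) ⋆ (10 ℕ.+ q ℕ.* 12)
      gg = trans (sym (⋆-2 g)) (trans (⋆-⋆ (+ 3) (5 ℕ.+ 6 ℕ.* q) 2) (cong ((+ 3) ⋆_) (l₃ q)))
    by-class : ∀ r q → r ℕ.< 12 → p ≡ r ℕ.+ q ℕ.* 12 → legendre 3 p ≡ χ₁₂ (+ p)
    by-class 0 q _ e = even (6 ℕ.* q) (trans e (l q))
      where
      l : ∀ q → 0 ℕ.+ q ℕ.* 12 ≡ 6 ℕ.* q ℕ.* 2
      l = ℕ-solve
    by-class 1 q _ e = trans (class-1 q e) (sym (value 1 q e))
    by-class 2 q _ e = even (1 ℕ.+ 6 ℕ.* q) (trans e (l q))
      where
      l : ∀ q → 2 ℕ.+ q ℕ.* 12 ≡ (1 ℕ.+ 6 ℕ.* q) ℕ.* 2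
      l = ℕ-solve
    by-class 3 q _ e = threefold (1 ℕ.+ 4 ℕ.* q) (trans e (l q))
      where
      l : ∀ q → 3 ℕ.+ q ℕ.* 12 ≡ (1 ℕ.+ 4 ℕ.* q) ℕ.* 3
      l = ℕ-solve
    by-class 4 q _ e = even (2 ℕ.+ 6 ℕ.* q) (trans e (l q))
      where
      l : ∀ q → 4 ℕ.+ q ℕ.* 12 ≡ (2 ℕ.+ 6 ℕ.* q) ℕ.* 2
      l = ℕ-solve
    by-class 5 q _ e = trans (class-5 q e) (sym (value 5 q e))
    by-class 6 q _ e = even (3 ℕ.+ 6 ℕ.* q) (trans e (l q))
      where
      l : ∀ q → 6 ℕ.+ q ℕ.* 12 ≡ (3 ℕ.+ 6 ℕ.* q) ℕ.* 2
      l = ℕ-solve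
    by-class 7 q _ e = trans (class-7 q e) (sym (value 7 q e))
    by-class 8 q _ e = even (4 ℕ.+ 6 ℕ.* q) (trans e (l q))
      where
      l : ∀ q → 8 ℕ.+ q ℕ.* 12 ≡ (4 ℕ.+ 6 ℕ.* q) ℕ.* 2
      l = ℕ-solve
    by-class 9 q _ e = threefold (3 ℕ.+ 4 ℕ.* q) (trans e (l q))
      where
      l : ∀ q → 9 ℕ.+ q ℕ.* 12 ≡ (3 ℕ.+ 4 ℕ.* q) ℕ.* 3
      l = ℕ-solve
    by-class 10 q _ e = even (5 ℕ.+ 6 ℕ.* q) (trans e (l q))
      where
      l : ∀ q → 10 ℕ.+ q ℕ.* 12 ≡ (5 ℕ.+ 6 ℕ.* q) ℕ.* 2
      l = ℕ-solve
    by-class 11 q _ e = trans (class-11 q e) (sym (value 11 q e))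
    by-class (suc (suc (suc (suc (suc (suc (suc (suc (suc (suc (suc (suc r)))))))))))) q
      (s≤s (s≤s (s≤s (s≤s (s≤s (s≤s (s≤s (s≤s (s≤s (s≤s (s≤s (s≤s ())))))))))))) e

  -- `k Rough m` records that no nontrivial divisor below `k` exists. By `m ≤ k + f` the search has
  -- reached `m` when the fuel is exhausted, and `m` is then its own least divisor.
  minDivFrom-divides : ∀ f k m → 1 ℕ.< k → m ℕ.≤ k ℕ.+ f → 1 ℕ.< m → k Rough m → let p = minDivFrom f k m in 1 ℕ.< p × p ℕ∣.∣ m × p Rough m
  minDivFrom-divides zero k m 1<k m≤ 1<m rough = 1<m , ℕ∣.∣-refl ,
    λ { (hasNonTrivialDivisor d<m d∣m) → rough (hasNonTrivialDivisor (ℕₚ.<-≤-trans d<m (subst (m ℕ.≤_) (ℕₚ.+-identityʳ k) m≤)) d∣m) }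
  minDivFrom-divides (suc f) k m 1<k m≤ 1<m rough with k ℕ∣.∣? m
  ... | yes k∣m = 1<k , k∣m , rough
  ... | no  k∤m = minDivFrom-divides f (suc k) m (ℕₚ.<-trans 1<k (ℕₚ.n<1+n k)) (subst (m ℕ.≤_) (ℕₚ.+-suc k f) m≤) 1<m (∤⇒rough-suc k∤m rough)

  lpf-prime : ∀ m → 1 ℕ.< m → Prime (lpf m) × lpf m ℕ∣.∣ m
  lpf-prime m 1<m = let (1<p , p∣m , rough) = minDivFrom-divides m 2 m (s≤s (s≤s z≤n)) (ℕₚ.m≤n+m m 2) 1<m 2-rough in
    rough∧∣⇒prime {{ℕ.n>1⇒nonTrivial 1<p}} rough p∣m , p∣m

  χ₁₂-* : ∀ x y → χ₁₂ (x * y) ≡ χ₁₂ x * χ₁₂ y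
  χ₁₂-* x y = trans (cong₂ _*_ (χ₃-* x y) (χ₄-* x y)) (l (χ₃ x) (χ₃ y) (χ₄ x) (χ₄ y))
    where
    l : ∀ a b c d → a * b * (c * d) ≡ a * c * (b * d)
    l = solve-∀

  jacobiAux-step : ∀ f a k r → lpf (suc (suc k)) ≡ suc r → jacobiAux (suc f) a (suc (suc k)) ≡ legendre a (suc r) * jacobiAux f a (suc (suc k) ℕ./ suc r)
  jacobiAux-step f a k r e with lpf (suc (suc k)) | e
  ... | _ | refl = refl

  -- Each round splits off the least prime factor, and `χ₁₂` is multiplicative. The fuel suffices
  -- because the quotient is smaller than `m`.
  jacobiAux-3 : ∀ f m → 0 ℕ.< m → m ℕ.≤ f → ¬ (2 ℕ∣.∣ m) → ¬ (3 ℕ∣.∣ m) → jacobiAux f 3 m ≡ χ₁₂ (+ m)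
  jacobiAux-3 zero    m 0<m m≤f _ _ = ⊥-elim (ℕₚ.<⇒≱ 0<m m≤f)
  jacobiAux-3 (suc f) (suc zero) _ _ _ _ = refl
  jacobiAux-3 (suc f) m@(suc (suc k)) _ m≤f 2∤m 3∤m = descend (lpf m) refl
    where
    p-prime : Prime (lpf m)
    p-prime = proj₁ (lpf-prime m (s≤s (s≤s z≤n)))
    descend : ∀ p → lpf m ≡ p → jacobiAux (suc f) 3 m ≡ χ₁₂ (+ m)
    descend zero    e = ⊥-elim (ℕₚ.<⇒≱ (ℕ.nonTrivial⇒n>1 (lpf m) {{prime⇒nonTrivial p-prime}}) (subst (ℕ._≤ 1) (sym e) z≤n))
    descend p@(suc r) e = factored (subst (ℕ∣._∣ m) e (proj₂ (lpf-prime m (s≤s (s≤s z≤n)))))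
      where
      prime : Prime p
      prime = subst Prime e p-prime
      factored : p ℕ∣.∣ m → jacobiAux (suc f) 3 m ≡ χ₁₂ (+ m)
      factored (ℕ∣.divides j m≡) = trans (jacobiAux-step f 3 k r e) (trans (cong₂ _*_ (legendre-3 p prime (λ d → 2∤m (ℕ∣.∣-trans d p∣m)) (λ d → 3∤m (ℕ∣.∣-trans d p∣m)))
          (trans (cong (jacobiAux f 3) m/p) (jacobiAux-3 f j 0<j (ℕ.s≤s⁻¹ (ℕₚ.<-≤-trans j<m m≤f)) (λ d → 2∤m (ℕ∣.∣-trans d j∣m)) (λ d → 3∤m (ℕ∣.∣-trans d j∣m)))))
        (trans (sym (χ₁₂-* (+ p) (+ j))) (cong χ₁₂ (trans (sym (ℤₚ.pos-* p j)) (cong +_ (trans (ℕₚ.*-comm p j) (sym m≡)))))))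
        where
        p∣m : p ℕ∣.∣ m
        p∣m = ℕ∣.divides j m≡
        j∣m : j ℕ∣.∣ m
        j∣m = ℕ∣.divides p (trans m≡ (ℕₚ.*-comm j p))
        m/p : m ℕ./ p ≡ j
        m/p = trans (cong (ℕ._/ p) m≡) (m*n/n≡m j p)
        0<j : 0 ℕ.< j
        0<j = ℕₚ.n≢0⇒n>0 λ { refl → case m≡ of λ () }
        j<m : j ℕ.< m
        j<m = subst (ℕ._< m) m/p (m/n<m m p (ℕ.nonTrivial⇒n>1 p {{prime⇒nonTrivial prime}}))

  jacobi-3 : ∀ m → 0 ℕ.< m → ¬ (2 ℕ∣.∣ m) → ¬ (3 ℕ∣.∣ m) → jacobi 3 m ≡ χ₁₂ (+ m)
  jacobi-3 m 0<m = jacobiAux-3 m m 0<m ℕₚ.≤-refl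

-- The sums `e₁` and `e₂` in terms of the divisors of `n₁`.

module DivisorSums where

  open import Defs hiding (sgn)
  open FiniteSums
  open Congruences
  open LiouvilleIdentity
  open Progressions
  open InteriorTerms hiding (t)
  open DivisorPairs
  open PrimeModuli
  open BinaryForms
  open DivisorIdentity
  open JacobiSymbol
  open import Data.Empty using (⊥-elim)
  open import Data.List using ([]; _∷_; applyUpTo; map)
  open import Data.List.Membership.Propositional using (_∈_)
  open import Data.List.Membership.Propositional.Properties
  open import Data.List.Relation.Unary.Unique.Propositional using (Unique)
  import Data.List.Relation.Unary.Unique.Propositional.Properties as Uniqueₚ
  open import Data.Nat as ℕ using (ℕ; zero; suc)
  import Data.Nat.Properties as ℕₚ
  import Data.Nat.Divisibility as ℕ∣
  open import Data.Nat.Primality using (prime?; euclidsLemma)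
  open import Data.Integer as ℤ using (ℤ; +_; _+_; _*_; _-_; -_; ∣_∣; 0ℤ; 1ℤ; _≤_; _<_)
  import Data.Integer.Properties as ℤₚ
  open import Data.Integer.DivMod using (_/ℕ_)
  open import Data.Integer.Tactic.RingSolver using (solve-∀)
  open import Data.Product using (∃; _×_; _,_; proj₁; proj₂)
  open import Data.Sum using ([_,_]′)
  open import Function using (_∘_)
  open import Relation.Nullary using (¬_; Dec; yes; no)
  open import Relation.Nullary.Decidable using (from-yes)
  open import Relation.Binary.PropositionalEquality

  sumℤ-map : ∀ {A : Set} (f : A → ℤ) xs → sumℤ (map f xs) ≡ ∑ xs f
  sumℤ-map f []       = refl
  sumℤ-map f (x ∷ xs) = cong (λ z → f x + z) (sumℤ-map f xs)

  applyUpTo-suc-unique : ∀ n → Unique (applyUpTo suc n)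
  applyUpTo-suc-unique n = Uniqueₚ.applyUpTo⁺₁ suc n λ i<j _ e → ℕₚ.<⇒≢ i<j (ℕₚ.suc-injective e)

  χ₁₂-neg : ∀ x → χ₁₂ (- x) ≡ χ₁₂ x
  χ₁₂-neg x = trans (cong₂ _*_ (χ₃-neg x) (χ₄-neg x)) (l (χ₃ x) (χ₄ x))
    where
    l : ∀ u v → - u * - v ≡ u * v
    l = solve-∀

  χ₁₂-cube : ∀ x → χ₁₂ x * (χ₁₂ x * χ₁₂ x) ≡ χ₁₂ x
  χ₁₂-cube x = trans (l (χ₃ x) (χ₄ x)) (cong₂ _*_ (cube₃ x) (cube₄ x))
    where
    l : ∀ u v → u * v * (u * v * (u * v)) ≡ u * (u * u) * (v * (v * v))
    l = solve-∀
    cube₃ : ∀ x → χ₃ x * (χ₃ x * χ₃ x) ≡ χ₃ x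
    cube₃ = by-residues {3} (λ p → cong (λ z → z * (z * z)) (χ₃-periodic p)) χ₃-periodic check₁
    cube₄ : ∀ x → χ₄ x * (χ₄ x * χ₄ x) ≡ χ₄ x
    cube₄ = by-residues {4} (λ p → cong (λ z → z * (z * z)) (χ₄-periodic p)) χ₄-periodic check₁

  χ₁₂-unit : ∀ n → ¬ (2 ℕ∣.∣ n) → ¬ (3 ℕ∣.∣ n) → χ₁₂ (+ n) * χ₁₂ (+ n) ≡ 1ℤ
  χ₁₂-unit n 2∤n 3∤n = trans (l (χ₃ (+ n)) (χ₄ (+ n))) (trans (cong₂ _*_ (trans (unit₃ (+ n)) (cong (λ z → 1ℤ - z) (D-0 3 {+ n} λ e → 3∤n (≈0⇒∣ e)))) (trans (unit₄ (+ n)) (cong (λ z → 1ℤ - z) (D-0 2 {+ n} λ e → 2∤n (≈0⇒∣ e))))) refl)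
    where
    l : ∀ u v → u * v * (u * v) ≡ u * u * (v * v)
    l = solve-∀
    unit₃ : ∀ x → χ₃ x * χ₃ x ≡ 1ℤ - D 3 x
    unit₃ = by-residues {3} (λ p → cong (λ z → z * z) (χ₃-periodic p)) (λ p → cong (λ z → 1ℤ - z) (D-periodic 3 p)) check₁
    unit₄ : ∀ x → χ₄ x * χ₄ x ≡ 1ℤ - D 2 x
    unit₄ = by-residues {4} (λ p → cong (λ z → z * z) (χ₄-periodic p)) (λ p → cong (λ z → 1ℤ - z) (D-periodic 2 (4⇒2 p))) check₁

  -- Euclid's lemma strips one factor 3 at a time from `a`.
  power-of-3-divides : ∀ β a x → 3 ℕ.^ β ℕ∣.∣ a ℕ.* x → ¬ (3 ℕ∣.∣ x) → 3 ℕ.^ β ℕ∣.∣ a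
  power-of-3-divides zero    a x _ _ = ℕ∣.1∣ a
  power-of-3-divides (suc β) a x d 3∤x = [ from , (λ e → ⊥-elim (3∤x e)) ]′ (euclidsLemma a x (from-yes (prime? 3)) (ℕ∣.∣-trans (ℕ∣.m∣m*n (3 ℕ.^ β)) d))
    where
    from : 3 ℕ∣.∣ a → 3 ℕ.^ suc β ℕ∣.∣ a
    from (ℕ∣.divides k refl) = subst (3 ℕ.^ suc β ℕ∣.∣_) (ℕₚ.*-comm 3 k) (ℕ∣.*-monoʳ-∣ 3 (power-of-3-divides β k x
      (ℕ∣.*-cancelˡ-∣ 3 (subst (3 ℕ.^ suc β ℕ∣.∣_) (trans (cong (ℕ._* x) (ℕₚ.*-comm k 3)) (ℕₚ.*-assoc 3 k x)) d)) 3∤x))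

  power-of-3-≈0 : ∀ β a x → a * x ≈ 0ℤ [ 3 ℕ.^ β ] → χ₁₂ x ≢ 0ℤ → a ≈ 0ℤ [ 3 ℕ.^ β ]
  power-of-3-≈0 β a x h χ≢0 = ∣∣⇒≈0 (power-of-3-divides β ∣ a ∣ ∣ x ∣ (subst (3 ℕ.^ β ℕ∣.∣_) (ℤₚ.abs-* a x) (≈0⇒∣ h)) λ d → χ≢0 (trans (cong (_* χ₄ x) (χ₃-periodic (∣∣⇒≈0 {3} {x} d))) (ℤₚ.*-zeroˡ (χ₄ x))))

  module Divisors (n : ℕ) (0<n : 0 ℕ.< n) (2∤n : ¬ (2 ℕ∣.∣ n)) (3∤n : ¬ (3 ℕ∣.∣ n)) where

    f : ℤ → ℤ → ℤ
    f a x = χ₁₂ x * x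

    -- A divisor `d` is matched with the pair `(n / d , d)`. Divisors of `n` are prime to 6, so the
    -- Jacobi symbol is `χ₁₂` on them.
    divSum-HasSum : HasSum {ℤ × ℤ} (positiveWeight f n) (divSum n)
    divSum-HasSum = HasSum-reindex {A = ℕ} {B = ℤ × ℤ} {u = v ∘ complement} {v = v} complement (λ (a , x) → ∣ x ∣) (λ d ne → back d ne , refl)
        (λ (a , x) ne → let e = forth a x (positiveWeight≢0 f n a x ne) in e , cong v e)
        (hasSum (divisors n) (Uniqueₚ.filter⁺ (ℕ∣._∣? n) (applyUpTo-suc-unique n)) covers′ (trans (∑-cong (divisors n) λ d d∈ → value d (proj₂ (∈-filter⁻ (ℕ∣._∣? n) {xs = applyUpTo suc n} d∈))) (sym (sumℤ-map (λ d → + d * jacobi 3 d) (divisors n)))))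
      where
      v : ℤ × ℤ → ℤ
      v = positiveWeight f n
      of : ∀ d → Dec (d ℕ∣.∣ n) → ℤ × ℤ
      of d (yes (ℕ∣.divides q _)) = + q , + d
      -- A dummy pair of weight zero.
      of d (no _)                 = 0ℤ , 0ℤ
      complement : ℕ → ℤ × ℤ
      complement d = of d (d ℕ∣.∣? n)
      back′ : ∀ d (d? : Dec (d ℕ∣.∣ n)) → v (of d d?) ≢ 0ℤ → d ℕ∣.∣ n × ∣ proj₂ (of d d?) ∣ ≡ d
      back′ d (yes d∣n@(ℕ∣.divides q _)) _ = d∣n , refl
      back′ d (no _) ne = ⊥-elim (ne refl)
      back : ∀ d → v (complement d) ≢ 0ℤ → ∣ proj₂ (complement d) ∣ ≡ d
      back d ne = proj₂ (back′ d (d ℕ∣.∣? n) ne)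
      forth : ∀ a x → 0ℤ < a × 0ℤ < x × f a x ≢ 0ℤ × a * x ≡ + n → complement ∣ x ∣ ≡ (a , x)
      forth .(+ suc a) .(+ suc x) (ℤ.+<+ {n = suc a} _ , ℤ.+<+ {n = suc x} _ , _ , e) = by-dec (suc x ℕ∣.∣? n)
        where
        ax : suc a ℕ.* suc x ≡ n
        ax = ℤₚ.+-injective e
        by-dec : ∀ d? → of (suc x) d? ≡ (+ suc a , + suc x)
        by-dec (yes (ℕ∣.divides q eq)) = cong (λ z → + z , + suc x) (ℕₚ.*-cancelʳ-≡ q (suc a) (suc x) (trans (sym eq) (sym ax)))
        by-dec (no ¬d) = ⊥-elim (¬d (ℕ∣.divides (suc a) (sym ax)))
      positive : ∀ d → d ℕ∣.∣ n → 0 ℕ.< d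
      positive d d∣n = ℕₚ.n≢0⇒n>0 λ { refl → ℕₚ.<⇒≢ 0<n (sym (ℕ∣.0∣⇒≡0 d∣n)) }
      covers′ : ∀ d → v (complement d) ≢ 0ℤ → d ∈ divisors n
      covers′ d ne = ∈-filter⁺ (ℕ∣._∣? n) (below d (positive d d∣n) (ℕ∣.∣⇒≤ {{ℕ.>-nonZero 0<n}} d∣n)) d∣n
        where
        d∣n : d ℕ∣.∣ n
        d∣n = proj₁ (back′ d (d ℕ∣.∣? n) ne)
        below : ∀ d → 0 ℕ.< d → d ℕ.≤ n → d ∈ applyUpTo suc n
        below (suc d) _ d<n = ∈-applyUpTo⁺ suc d<n
      value : ∀ d → d ℕ∣.∣ n → v (complement d) ≡ + d * jacobi 3 d
      value d d∣n = by-dec (d ℕ∣.∣? n)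
        where
        0<d : 0 ℕ.< d
        0<d = positive d d∣n
        by-dec : ∀ d? → v (of d d?) ≡ + d * jacobi 3 d
        by-dec (no ¬d) = ⊥-elim (¬d d∣n)
        by-dec (yes (ℕ∣.divides q eq)) = trans (cong₂ (λ y z → y * (χ₁₂ (+ d) * + d) * z) (cong₂ _*_ (pos-> {+ q} (ℤ.+<+ (ℕₚ.n≢0⇒n>0 λ { refl → ℕₚ.<⇒≢ 0<n (sym eq) }))) (pos-> {+ d} (ℤ.+<+ 0<d)))
            (δ-≡ (trans (cong (_- + n) (trans (sym (ℤₚ.pos-* q d)) (cong +_ (sym eq)))) (ℤₚ.+-inverseʳ (+ n)))))
          (trans (l (χ₁₂ (+ d)) (+ d)) (cong (+ d *_) (sym (jacobi-3 d 0<d (λ e → 2∤n (ℕ∣.∣-trans e d∣n)) (λ e → 3∤n (ℕ∣.∣-trans e d∣n))))))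
          where
          l : ∀ u d → 1ℤ * 1ℤ * (u * d) * 1ℤ ≡ d * u
          l = solve-∀

    module _ (β N : ℕ) (N≡ : N ≡ 3 ℕ.^ β ℕ.* n) where

      private
        P : ℕ
        P = 3 ℕ.^ β

        instance
          P-nonZero : ℕ.NonZero P
          P-nonZero = ℕₚ.m^n≢0 3 β

        0<P : 0 ℕ.< P
        0<P = ℕ.>-nonZero⁻¹ P

        +N : + N ≡ + P * + n
        +N = trans (cong +_ N≡) (ℤₚ.pos-* P n)

        δ-P : ∀ z w → z ≡ + P * w → δ (z - + N) ≡ δ (w - + n)
        δ-P z w e = trans (cong δ (trans (cong₂ _-_ e +N) (l (+ P) w (+ n)))) (δ-* (+ P) (w - + n) {{ℤ.≢-nonZero λ e′ → ℕₚ.<⇒≢ 0<P (sym (ℤₚ.+-injective e′))}})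
          where
          l : ∀ p w n → p * w - p * n ≡ p * (w - n)
          l = solve-∀

        ≈0 : ∀ {z} → z ≡ + N → z ≈ 0ℤ [ P ]
        ≈0 e = by (+ n) (trans e (trans +N (trans (ℤₚ.*-comm (+ P) (+ n)) (sym (ℤₚ.+-identityˡ (+ n * + P))))))

      open Pairs N

      -- Where `χ₁₂ x` is nonzero, 3 does not divide `x`. Hence the whole power of 3 in `N` divides
      -- `a`, and removing it leaves the pairs with product `n`.
      e₂-divSum : ⟪ (λ a x → χ₃ x * χ₄ x * x) ⟫ ≡ + 2 * divSum n
      e₂-divSum = trans (proj₂ (proj₂ half)) (cong (+ 2 *_) (HasSum-unique {A = ℤ × ℤ} (proj₁ (proj₂ half))
        (HasSum-reindex {A = ℤ × ℤ} {B = ℤ × ℤ} (λ (a , x) → a * + P , x) (λ (a , x) → a /ℕ P , x)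
          (λ (a , x) _ → cong (_, x) (/ℕ-exact P a) , value a x)
          (λ (a , x) ne → let (_ , _ , f≢0 , e) = positiveWeight≢0 f N a x ne
                              back = multiple P a (power-of-3-≈0 β a x (≈0 e) (*≢0ˡ {_} {x} f≢0)) in
            cong (_, x) back , trans (sym (value (a /ℕ P) x)) (cong (λ z → positiveWeight f N (z , x)) back))
          divSum-HasSum)))
        where
        half : ∃ λ s → HasSum {ℤ × ℤ} (positiveWeight f N) s × ⟪ f ⟫ ≡ + 2 * s
        half = ⟪⟫-half f N λ a x → trans (cong (_* - x) (χ₁₂-neg x)) (l (χ₁₂ x) x)
          where
          l : ∀ u x → u * - x ≡ - (u * x)
          l = solve-∀
        value : ∀ a x → positiveWeight f N (a * + P , x) ≡ positiveWeight f n (a , x)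
        value a x = cong₂ (λ y z → y * pos x * f a x * z) (pos-* a 0<P) (δ-P (a * + P * x) (a * x) (l a x (+ P)))
          where
          l : ∀ a x p → a * p * x ≡ p * (a * x)
          l = solve-∀

      -- The power of 3 now sits in `x` and comes out as the factor `P`. On `a x = n` the character
      -- is moved to `x` by `χ₁₂ a = χ₁₂ n * χ₁₂ x`.
      e₁-divSum : ⟪ (λ a x → χ₃ a * χ₄ a * x) ⟫ ≡ + 2 * (+ P * χ₁₂ (+ n) * divSum n)
      e₁-divSum = trans (proj₂ (proj₂ half)) (cong (+ 2 *_) (HasSum-unique {A = ℤ × ℤ} (proj₁ (proj₂ half))
        (HasSum-reindex {A = ℤ × ℤ} {B = ℤ × ℤ} {u = u} (λ (a , x) → a , x * + P) (λ (a , x) → a , x /ℕ P)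
          (λ (a , x) _ → cong (a ,_) (/ℕ-exact P x) , value a x)
          (λ (a , x) ne → let (_ , _ , g≢0 , e) = positiveWeight≢0 g N a x ne
                              back = multiple P x (power-of-3-≈0 β x a (≈0 (trans (ℤₚ.*-comm x a) e)) (*≢0ˡ {_} {x} g≢0)) in
            cong (a ,_) back , trans (sym (value a (x /ℕ P))) (cong (λ z → positiveWeight g N (a , z)) back))
          (HasSum-* (+ P * χ₁₂ (+ n)) divSum-HasSum))))
        where
        g : ℤ → ℤ → ℤ
        g a x = χ₁₂ a * x
        u : ℤ × ℤ → ℤ
        u p = + P * χ₁₂ (+ n) * positiveWeight f n p
        half : ∃ λ s → HasSum {ℤ × ℤ} (positiveWeight g N) s × ⟪ g ⟫ ≡ + 2 * s
        half = ⟪⟫-half g N λ a x → trans (cong (_* - x) (χ₁₂-neg a)) (l (χ₁₂ a) x)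
          where
          l : ∀ u x → u * - x ≡ - (u * x)
          l = solve-∀
        character : ∀ a x → a * x ≡ + n → χ₁₂ a ≡ χ₁₂ (+ n) * χ₁₂ x
        character a x e = trans (sym (trans (cong (λ z → χ₁₂ a * z) unit) (ℤₚ.*-identityʳ (χ₁₂ a)))) (trans (sym (ℤₚ.*-assoc (χ₁₂ a) (χ₁₂ x) (χ₁₂ x))) (cong (_* χ₁₂ x) (sym split)))
          where
          split : χ₁₂ (+ n) ≡ χ₁₂ a * χ₁₂ x
          split = trans (cong χ₁₂ (sym e)) (χ₁₂-* a x)
          l : ∀ a x → x * x ≡ x * x * 1ℤ
          l = solve-∀
          l₁ : ∀ a x → x * x * (a * x * (a * x)) ≡ a * a * (x * (x * (x * x)))
          l₁ = solve-∀
          l₂ : ∀ a x → a * a * (x * x) ≡ a * x * (a * x)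
          l₂ = solve-∀
          square : χ₁₂ a * χ₁₂ x * (χ₁₂ a * χ₁₂ x) ≡ 1ℤ
          square = trans (cong (λ z → z * z) (sym split)) (χ₁₂-unit n 2∤n 3∤n)
          unit : χ₁₂ x * χ₁₂ x ≡ 1ℤ
          unit = trans (l (χ₁₂ a) (χ₁₂ x)) (trans (cong (χ₁₂ x * χ₁₂ x *_) (sym square)) (trans (l₁ (χ₁₂ a) (χ₁₂ x))
            (trans (cong (λ z → χ₁₂ a * χ₁₂ a * (χ₁₂ x * z)) (χ₁₂-cube x)) (trans (l₂ (χ₁₂ a) (χ₁₂ x)) square))))
        value : ∀ a x → positiveWeight g N (a , x * + P) ≡ u (a , x)
        value a x = trans (cong₂ (λ y z → pos a * y * (χ₁₂ a * (x * + P)) * z) (pos-* x 0<P) (δ-P (a * (x * + P)) (a * x) (l a x (+ P))))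
          (trans (guard (a * x - + n) λ e → trans (cong (λ z → pos a * pos x * (z * (x * + P))) (character a x (ℤₚ.i-j≡0⇒i≡j (a * x) (+ n) e))) (l₁ (pos a * pos x) (χ₁₂ (+ n)) (χ₁₂ x) x (+ P)))
            (ℤₚ.*-assoc (+ P * χ₁₂ (+ n)) (pos a * pos x * f a x) (δ (a * x - + n))))
          where
          l : ∀ a x p → a * (x * p) ≡ p * (a * x)
          l = solve-∀
          l₁ : ∀ q k u x p → q * (k * u * (x * p)) ≡ p * k * (q * (u * x))
          l₁ = solve-∀

-- The sum over `a² + 3 b² = 4 N`.

module RepresentationSums where

  import Defs
  open import Defs hiding (sgn)
  open FiniteSums
  open Congruences
  open Progressions
  open InteriorTerms hiding (t)
  open PrimeModuli
  open QuaternaryForm using (module Lattice; diagonal; diagonal-split; diagonal-rotated; D-shift; 8⇒4)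
  open DivisorIdentity
  open CuspIdentity
  open DivisorSums
  open import Data.Bool using (true; false; if_then_else_; _∧_)
  open import Data.Empty using (⊥-elim)
  open import Data.List using (List; []; _∷_; applyUpTo; map; filter; concatMap; cartesianProduct; _++_)
  open import Data.List.Membership.Propositional using (_∈_)
  open import Data.List.Membership.Propositional.Properties
  open import Data.List.Relation.Unary.Unique.Propositional using (Unique)
  import Data.List.Relation.Unary.Unique.Propositional.Properties as Uniqueₚ
  open import Data.Nat as ℕ using (ℕ; zero; suc; z≤n; s≤s)
  import Data.Nat.Properties as ℕₚ
  import Data.Nat.Divisibility as ℕ∣
  open import Data.Nat.DivMod using (m≡m%n+[m/n]*n; m%n<n; m*n/n≡m)
  open import Data.Integer as ℤ using (ℤ; +_; +0; +[1+_]; -[1+_]; _+_; _*_; _-_; -_; ∣_∣; 0ℤ; 1ℤ; _<_)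
  import Data.Integer.Properties as ℤₚ
  open import Data.Integer.DivMod using (_/ℕ_)
  open import Data.Integer.Tactic.RingSolver using (solve-∀)
  open import Data.Product using (∃; _×_; _,_; proj₁; proj₂)
  open import Function using (_∘_; case_of_)
  open import Relation.Nullary using (¬_; does)
  open import Relation.Nullary.Decidable using (dec-true; dec-false)
  open import Relation.Binary.PropositionalEquality

  sgn-χ₄ : ∀ a → ¬ (2 ℕ∣.∣ a) → Defs.sgn ((a ℕ.∸ 1) ℕ./ 2) ≡ χ₄ (+ a)
  sgn-χ₄ a 2∤a = by-class (a ℕ.% 4) (a ℕ./ 4) (m%n<n a 4) (m≡m%n+[m/n]*n a 4)
    where
    even : ∀ k → a ≡ k ℕ.* 2 → Defs.sgn ((a ℕ.∸ 1) ℕ./ 2) ≡ χ₄ (+ a)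
    even k e = ⊥-elim (2∤a (ℕ∣.divides k e))
    sign : ∀ b d → does (2 ℕ∣.∣? d) ≡ b → Defs.sgn d ≡ (if b then + 1 else -[1+ 0 ])
    sign b d e = cong (λ b → if b then + 1 else -[1+ 0 ]) e
    χ : ∀ r q → a ≡ r ℕ.+ q ℕ.* 4 → χ₄ (+ a) ≡ χ₄ (+ r)
    χ r q e = χ₄-periodic (by {+ a} {+ r} (+ q) (trans (cong +_ e) (cong (λ z → + r + z) (ℤₚ.pos-* q 4))))
    by-class : ∀ r q → r ℕ.< 4 → a ≡ r ℕ.+ q ℕ.* 4 → Defs.sgn ((a ℕ.∸ 1) ℕ./ 2) ≡ χ₄ (+ a)
    by-class 0 q _ e = even (q ℕ.* 2) (trans e (sym (ℕₚ.*-assoc q 2 2)))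
    by-class 1 q _ e = trans (cong Defs.sgn (trans (cong (λ z → (z ℕ.∸ 1) ℕ./ 2) e) (trans (cong (ℕ._/ 2) (sym (ℕₚ.*-assoc q 2 2))) (m*n/n≡m (q ℕ.* 2) 2))))
      (trans (sign true (q ℕ.* 2) (dec-true (2 ℕ∣.∣? (q ℕ.* 2)) (ℕ∣.divides q refl))) (sym (χ 1 q e)))
    by-class 2 q _ e = even (suc (q ℕ.* 2)) (trans e (cong (2 ℕ.+_) (sym (ℕₚ.*-assoc q 2 2))))
    by-class 3 q _ e = trans (cong Defs.sgn (trans (cong (λ z → (z ℕ.∸ 1) ℕ./ 2) e) (trans (cong (λ z → (2 ℕ.+ z) ℕ./ 2) (sym (ℕₚ.*-assoc q 2 2))) (m*n/n≡m (suc (q ℕ.* 2)) 2))))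
      (trans (sign false (suc (q ℕ.* 2)) (dec-false (2 ℕ∣.∣? suc (q ℕ.* 2)) λ d → case ℕ∣.∣m+n∣m⇒∣n (subst (2 ℕ∣.∣_) (ℕₚ.+-comm 1 (q ℕ.* 2)) d) (ℕ∣.divides q refl) of λ 2∣1 → ℕₚ.<⇒≱ (s≤s (s≤s z≤n)) (ℕ∣.∣⇒≤ 2∣1))) (sym (χ 3 q e)))
    by-class (suc (suc (suc (suc r)))) q (s≤s (s≤s (s≤s (s≤s ())))) e

  odd⇒ : ∀ a → odd a ≡ true → ¬ (2 ℕ∣.∣ a)
  odd⇒ a e d = case trans (sym e) (cong (λ b → if b then false else true) (dec-true (2 ℕ∣.∣? a) d)) of λ ()

  ⇒odd : ∀ a → ¬ (2 ℕ∣.∣ a) → odd a ≡ true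
  ⇒odd a ¬d = cong (λ b → if b then false else true) (dec-false (2 ℕ∣.∣? a) ¬d)

  ∧-true : ∀ {a b} → a ∧ b ≡ true → a ≡ true × b ≡ true
  ∧-true {true} {true} _ = refl , refl

  pairs-cartesianProduct : ∀ {A B : Set} (xs : List A) (ys : List B) → concatMap (λ a → map (λ b → (a , b)) ys) xs ≡ cartesianProduct xs ys
  pairs-cartesianProduct []       ys = refl
  pairs-cartesianProduct (x ∷ xs) ys = cong (map (x ,_) ys ++_) (pairs-cartesianProduct xs ys)

  -- The summand extended to all integers. `χ₄ a * a` is even in `a`, so every sign quadrant has the
  -- same total.
  repWeight : ℕ → ℤ × ℤ → ℤ
  repWeight M (a , b) = o a * o b * (χ₄ a * a + χ₄ b * b) * δ (a * a + + 3 * (b * b) - + M)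

  repPairs-∈ : ∀ M {a b} → (a , b) ∈ repPairs M → ¬ (2 ℕ∣.∣ a) × ¬ (2 ℕ∣.∣ b) × a ℕ.* a ℕ.+ 3 ℕ.* (b ℕ.* b) ≡ M × 0 ℕ.< a × 0 ℕ.< b
  repPairs-∈ M {a} {b} p = odd⇒ a (proj₁ odds) , odd⇒ b (proj₂ odds) , proj₂ filtered , positive a (odd⇒ a (proj₁ odds)) , positive b (odd⇒ b (proj₂ odds))
    where
    filtered = ∈-filter⁻ _ {xs = filter _ (concatMap (λ a → map (λ b → (a , b)) (applyUpTo suc M)) (applyUpTo suc M))} p
    odds : odd a ≡ true × odd b ≡ true
    odds = ∧-true (proj₂ (∈-filter⁻ _ {xs = concatMap (λ a → map (λ b → (a , b)) (applyUpTo suc M)) (applyUpTo suc M)} (proj₁ filtered)))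
    positive : ∀ a → ¬ (2 ℕ∣.∣ a) → 0 ℕ.< a
    positive zero    h = ⊥-elim (h (ℕ∣.divides 0 refl))
    positive (suc a) _ = s≤s z≤n

  ∈-repPairs : ∀ M a b → ¬ (2 ℕ∣.∣ suc a) → ¬ (2 ℕ∣.∣ suc b) → suc a ℕ.* suc a ℕ.+ 3 ℕ.* (suc b ℕ.* suc b) ≡ M → (suc a , suc b) ∈ repPairs M
  ∈-repPairs M a b oa ob e = ∈-filter⁺ _ (∈-filter⁺ _ (subst ((suc a , suc b) ∈_) (sym (pairs-cartesianProduct (applyUpTo suc M) (applyUpTo suc M)))
      (∈-cartesianProduct⁺ (∈-applyUpTo⁺ suc (ℕₚ.≤-trans (ℕₚ.m≤m*n (suc a) (suc a)) (ℕₚ.≤-trans (ℕₚ.m≤m+n _ _) (ℕₚ.≤-reflexive e))))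
        (∈-applyUpTo⁺ suc (ℕₚ.≤-trans (ℕₚ.m≤m*n (suc b) (suc b)) (ℕₚ.≤-trans (ℕₚ.m≤n*m (suc b ℕ.* suc b) 3) (ℕₚ.≤-trans (ℕₚ.m≤n+m _ (suc a ℕ.* suc a)) (ℕₚ.≤-reflexive e)))))))
    (cong₂ _∧_ (⇒odd (suc a) oa) (⇒odd (suc b) ob))) e

  repSum-HasSum : ∀ M → HasSum {ℤ × ℤ} (λ (a , b) → pos b * (pos a * repWeight M (a , b))) (repSum M)
  repSum-HasSum M = HasSum-reindex {A = ℕ × ℕ} {B = ℤ × ℤ} {u = v ∘ f} {v = v} f (λ (a , b) → ∣ a ∣ , ∣ b ∣) (λ _ _ → refl , refl)
      (λ (a , b) ne → let e = cong₂ _,_ (nonneg a (pos≢0 (*≢0ˡ {_} {repWeight M (a , b)} (*≢0ʳ {pos b} ne)))) (nonneg b (pos≢0 (*≢0ˡ {_} {pos a * repWeight M (a , b)} ne))) in e , cong v e)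
      (hasSum (repPairs M) unique (λ (a , b) → covers a b) (trans (∑-cong (repPairs M) λ (a , b) → value a b) (sym (sumℤ-map _ (repPairs M)))))
    where
    v : ℤ × ℤ → ℤ
    v (a , b) = pos b * (pos a * repWeight M (a , b))
    f : ℕ × ℕ → ℤ × ℤ
    f (a , b) = + a , + b
    nonneg : ∀ a → 0ℤ < a → + ∣ a ∣ ≡ a
    nonneg (+ _) _ = refl
    unique : Unique (repPairs M)
    unique = Uniqueₚ.filter⁺ _ (Uniqueₚ.filter⁺ _ (subst Unique (sym (pairs-cartesianProduct (applyUpTo suc M) (applyUpTo suc M))) (Uniqueₚ.cartesianProduct⁺ (applyUpTo-suc-unique M) (applyUpTo-suc-unique M))))
    +square : ∀ a b → + a * + a + + 3 * (+ b * + b) ≡ + (a ℕ.* a ℕ.+ 3 ℕ.* (b ℕ.* b))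
    +square a b = cong₂ _+_ (sym (ℤₚ.pos-* a a)) (trans (cong (+ 3 *_) (sym (ℤₚ.pos-* b b))) (sym (ℤₚ.pos-* 3 (b ℕ.* b))))
    o≢0 : ∀ a → o (+ a) ≢ 0ℤ → ¬ (2 ℕ∣.∣ a)
    o≢0 a h d = h (cong (λ z → 1ℤ - z) (D-1 2 {+ a} (∣⇒≈0 d)))
    covers : ∀ a b → v (+ a , + b) ≢ 0ℤ → (a , b) ∈ repPairs M
    covers zero b ne = ⊥-elim (ne (ℤₚ.*-zeroʳ (pos (+ b))))
    covers (suc a) zero ne = ⊥-elim (ne refl)
    covers (suc a) (suc b) ne = ∈-repPairs M a b (o≢0 (suc a) (*≢0ˡ {_} {o (+ suc b)} oo)) (o≢0 (suc b) (*≢0ʳ {o (+ suc a)} oo))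
        (ℤₚ.+-injective (trans (sym (+square (suc a) (suc b))) (ℤₚ.i-j≡0⇒i≡j _ (+ M) (δ≢0 E (*≢0ʳ {o (+ suc a) * o (+ suc b) * (χ₄ (+ suc a) * + suc a + χ₄ (+ suc b) * + suc b)} w≢0)))))
      where
      E : ℤ
      E = + suc a * + suc a + + 3 * (+ suc b * + suc b) - + M
      w≢0 : repWeight M (+ suc a , + suc b) ≢ 0ℤ
      w≢0 = *≢0ʳ {pos (+ suc a)} (*≢0ʳ {pos (+ suc b)} ne)
      oo : o (+ suc a) * o (+ suc b) ≢ 0ℤ
      oo = *≢0ˡ {_} {χ₄ (+ suc a) * + suc a + χ₄ (+ suc b) * + suc b} (*≢0ˡ {_} {δ E} w≢0)
    value : ∀ a b → (a , b) ∈ repPairs M → v (+ a , + b) ≡ Defs.sgn ((a ℕ.∸ 1) ℕ./ 2) * + a + Defs.sgn ((b ℕ.∸ 1) ℕ./ 2) * + b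
    value a b p = by-∈ (repPairs-∈ M p)
      where
      by-∈ : ¬ (2 ℕ∣.∣ a) × ¬ (2 ℕ∣.∣ b) × a ℕ.* a ℕ.+ 3 ℕ.* (b ℕ.* b) ≡ M × 0 ℕ.< a × 0 ℕ.< b → v (+ a , + b) ≡ Defs.sgn ((a ℕ.∸ 1) ℕ./ 2) * + a + Defs.sgn ((b ℕ.∸ 1) ℕ./ 2) * + b
      by-∈ (oa , ob , e , 0<a , 0<b) = trans (cong₂ (λ y z → y * (z * repWeight M (+ a , + b))) (pos-> {+ b} (ℤ.+<+ 0<b)) (pos-> {+ a} (ℤ.+<+ 0<a)))
        (trans (cong₂ (λ y z → 1ℤ * (1ℤ * (y * (χ₄ (+ a) * + a + χ₄ (+ b) * + b) * z))) (cong₂ _*_ (o-1 a oa) (o-1 b ob)) (δ-≡ (trans (cong (_- + M) (trans (+square a b) (cong +_ e))) (ℤₚ.+-inverseʳ (+ M)))))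
        (trans (l (χ₄ (+ a) * + a + χ₄ (+ b) * + b)) (cong₂ (λ y z → y * + a + z * + b) (sym (sgn-χ₄ a oa)) (sym (sgn-χ₄ b ob)))))
        where
        l : ∀ u → 1ℤ * (1ℤ * (1ℤ * 1ℤ * u * 1ℤ)) ≡ u
        l = solve-∀
        o-1 : ∀ a → ¬ (2 ℕ∣.∣ a) → o (+ a) ≡ 1ℤ
        o-1 a oa = cong (λ z → 1ℤ - z) (D-0 2 {+ a} λ h → oa (≈0⇒∣ h))

  module RepresentationSum (N : ℕ) (N≈3 : + N ≈ + 3 [ 8 ]) where

    open SecondIdentity N N≈3 using (C; C-HasSum; base; base-HasSum)

    l² : ∀ x → - x * - x ≡ x * x
    l² = solve-∀

    -- The summand is odd in `x`, the form is even.
    x-sum : HasSum {ℤ × ℤ} (λ (x , y) → χ₄ y * x * base (x , y)) 0ℤ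
    x-sum = HasSum-subst (HasSum-antisymmetric {A = ℤ × ℤ} (λ (x , y) → - x , y) (λ (x , y) → cong (_, y) (ℤₚ.neg-involutive x))
      (λ (x , y) → trans (cong (λ z → χ₄ y * - x * δ (z + + 3 * (y * y) - + N)) (l² x)) (l (χ₄ y) x (base (x , y)))) (proj₂ sum)) (proj₂ sum)
      where
      sum : ∃ λ s → HasSum {ℤ × ℤ} (λ (x , y) → χ₄ y * x * base (x , y)) s
      sum = HasSum-restrict (λ (x , y) → χ₄ y * x) base-HasSum
      l : ∀ k x b → k * - x * b ≡ - (k * x * b)
      l = solve-∀

    y-sum : HasSum {ℤ × ℤ} (λ (x , y) → χ₄ y * y * base (x , y)) (+ 2 * C)
    y-sum = HasSum-subst (trans (proj₂ (proj₂ half)) (cong (+ 2 *_) (HasSum-unique {A = ℤ × ℤ} (HasSum-cong (λ (x , y) → l (pos y) (χ₄ y) y (base (x , y))) (proj₁ (proj₂ half))) C-HasSum))) (proj₂ sum)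
      where
      w : ℤ × ℤ → ℤ
      w (x , y) = χ₄ y * y * base (x , y)
      sum : ∃ λ s → HasSum w s
      sum = HasSum-restrict (λ (x , y) → χ₄ y * y) base-HasSum
      l : ∀ p k y b → p * (k * y * b) ≡ p * y * (k * b)
      l = solve-∀
      split : ∀ y b → χ₄ y * y * b ≡ pos y * (χ₄ y * y * b) + pos (- y) * (χ₄ y * y * b)
      split +0 b = refl
      split y@(+[1+ n ]) b = sym (trans (ℤₚ.+-identityʳ _) (ℤₚ.*-identityˡ (χ₄ y * y * b)))
      split y@(-[1+ n ]) b = sym (trans (ℤₚ.+-identityˡ _) (ℤₚ.*-identityˡ (χ₄ y * y * b)))
      half : ∃ λ t → HasSum {ℤ × ℤ} (λ (x , y) → pos y * w (x , y)) t × proj₁ sum ≡ + 2 * t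
      half = HasSum-half {A = ℤ × ℤ} {w = w} (λ (x , y) → x , - y) (λ (x , y) → pos y) (λ (x , y) → cong (x ,_) (ℤₚ.neg-involutive y))
        (λ (x , y) → cong₂ _*_ (trans (cong (_* - y) (χ₄-neg y)) (l₁ (χ₄ y) y)) (cong (λ z → δ (x * x + + 3 * z - + N)) (l² y)))
        (λ (x , y) → split y (base (x , y))) (proj₂ sum)
        where
        l₁ : ∀ k y → - k * - y ≡ k * y
        l₁ = solve-∀

    v₁ : ℤ × ℤ → ℤ
    v₁ (a , b) = diagonal a b * (χ₄ a * a + χ₄ b * b) * δ (a * a + + 3 * (b * b) - + (4 ℕ.* N))

    -- The substitution is `a = x + 3 y`, `b = x - y`. As `N ≡ 3` modulo 8 forces `y` odd and
    -- `4 ∣ x`, both `a` and `b` are `- y` modulo 4, so the summand becomes `-2 χ₄ y (x + y)`, of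
    -- which only the part with `y` survives.
    diagonal-HasSum : HasSum v₁ (- (+ 4 * C))
    diagonal-HasSum = HasSum-reindex {A = ℤ × ℤ} {B = ℤ × ℤ} {u = u} {v = v₁} (λ (x , y) → x + + 3 * y , x - y) (λ (a , b) → b + (a - b) /ℕ 4 , (a - b) /ℕ 4)
        (λ (x , y) _ → cong₂ _,_ (trans (cong (λ z → x - y + z) (quarter x y)) (l₁ x y)) (quarter x y) , value x y)
        (λ (a , b) ne → let e = back a b ne in e , trans (sym (value (b + (a - b) /ℕ 4) ((a - b) /ℕ 4))) (cong v₁ e))
        (HasSum-subst (l₀ C) (HasSum-* (- (+ 2)) (HasSum-+ {A = ℤ × ℤ} x-sum y-sum)))
      where
      u : ℤ × ℤ → ℤ
      u (x , y) = - (+ 2) * (χ₄ y * x * base (x , y) + χ₄ y * y * base (x , y))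
      l₀ : ∀ C → - (+ 2) * (0ℤ + + 2 * C) ≡ - (+ 4 * C)
      l₀ = solve-∀
      l₁ : ∀ x y → x - y + y ≡ x
      l₁ = solve-∀
      quarter : ∀ x y → (x + + 3 * y - (x - y)) /ℕ 4 ≡ y
      quarter x y = trans (cong (_/ℕ 4) (l x y)) (/ℕ-exact 4 y)
        where
        l : ∀ x y → x + + 3 * y - (x - y) ≡ y * + 4
        l = solve-∀
      back : ∀ a b → v₁ (a , b) ≢ 0ℤ → (b + (a - b) /ℕ 4 + + 3 * ((a - b) /ℕ 4) , b + (a - b) /ℕ 4 - (a - b) /ℕ 4) ≡ (a , b)
      back a b ne = cong₂ _,_ (trans (l₂ b ((a - b) /ℕ 4)) (trans (cong (λ z → b + z) (multiple 4 (a - b) (D≢0 4 (a - b) (*≢0ʳ {o a * o b} (*≢0ˡ {_} {χ₄ a * a + χ₄ b * b} (*≢0ˡ {_} {δ (a * a + + 3 * (b * b) - + (4 ℕ.* N))} ne)))))) (l₃ a b))) (l₄ b ((a - b) /ℕ 4))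
        where
        l₂ : ∀ b q → b + q + + 3 * q ≡ b + q * + 4
        l₂ = solve-∀
        l₃ : ∀ a b → b + (a - b) ≡ a
        l₃ = solve-∀
        l₄ : ∀ b q → b + q - q ≡ b
        l₄ = solve-∀
      [mod8] : ℤ → ℤ → ℤ
      [mod8] x y = D 8 (x * x + + 3 * (y * y) - + 3)
      [mod8]-periodic : ∀ {x x′ y y′} → x ≈ x′ [ 8 ] → y ≈ y′ [ 8 ] → [mod8] x y ≡ [mod8] x′ y′
      [mod8]-periodic p r = D-periodic 8 (≈-- (≈-+ (≈-* p p) (≈-* (≈-refl {z = + 3}) (≈-* r r))) (≈-refl {z = + 3}))
      corner : ℤ → ℤ → ℤ
      corner x y = o x + o y - + 2 * o x * o y
      corner-periodic : ∀ {x x′ y y′} → x ≈ x′ [ 8 ] → y ≈ y′ [ 8 ] → corner x y ≡ corner x′ y′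
      corner-periodic p r = cong₂ (λ u w → u + w - + 2 * u * w) (o-periodic (8⇒4 p)) (o-periodic (8⇒4 r))
      table₁ : ∀ x y → corner x y * χ₄ (x + + 3 * y) * [mod8] x y ≡ - χ₄ y * [mod8] x y
      table₁ = by-residues₂ {8} {8} (λ p r → cong₂ _*_ (cong₂ _*_ (corner-periodic p r) (χ₄-periodic (≈-+ (8⇒4 p) (≈-* (≈-refl {z = + 3}) (8⇒4 r))))) ([mod8]-periodic p r))
        (λ p r → cong₂ _*_ (cong -_ (χ₄-periodic (8⇒4 r))) ([mod8]-periodic p r)) check₂
      table₂ : ∀ x y → corner x y * χ₄ (x - y) * [mod8] x y ≡ - χ₄ y * [mod8] x y
      table₂ = by-residues₂ {8} {8} (λ p r → cong₂ _*_ (cong₂ _*_ (corner-periodic p r) (χ₄-periodic (≈-- (8⇒4 p) (8⇒4 r)))) ([mod8]-periodic p r))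
        (λ p r → cong₂ _*_ (cong -_ (χ₄-periodic (8⇒4 r))) ([mod8]-periodic p r)) check₂
      at : ∀ x y {u w} → x * x + + 3 * (y * y) - + N ≡ 0ℤ → u * [mod8] x y ≡ w * [mod8] x y → u ≡ w
      at x y {u} {w} e h = trans (sym (ℤₚ.*-identityʳ u)) (trans (cong (u *_) (sym one)) (trans h (trans (cong (w *_) one) (ℤₚ.*-identityʳ w))))
        where
        one : [mod8] x y ≡ 1ℤ
        one = D-shift {x * x + + 3 * (y * y)} (subst (λ z → z ≈ + 3 [ 8 ]) (sym (ℤₚ.i-j≡0⇒i≡j (x * x + + 3 * (y * y)) (+ N) e)) N≈3)
      value : ∀ x y → v₁ (x + + 3 * y , x - y) ≡ u (x , y)
      value x y = trans (cong₂ (λ r z → r * (χ₄ (x + + 3 * y) * (x + + 3 * y) + χ₄ (x - y) * (x - y)) * z) (diagonal-rotated x y) (trans (cong δ (trans (cong (λ z → (x + + 3 * y) * (x + + 3 * y) + + 3 * ((x - y) * (x - y)) - z) (ℤₚ.pos-* 4 N)) (l₅ x y (+ N)))) (δ-* (+ 4) (x * x + + 3 * (y * y) - + N))))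
        (trans (guard {corner x y * (χ₄ (x + + 3 * y) * (x + + 3 * y) + χ₄ (x - y) * (x - y))} { - χ₄ y * (x + + 3 * y) + - χ₄ y * (x - y)} (x * x + + 3 * (y * y) - + N) λ e → trans (l₆ (corner x y) (χ₄ (x + + 3 * y)) (χ₄ (x - y)) x y)
          (cong₂ (λ r z → r * (x + + 3 * y) + z * (x - y)) (at x y {corner x y * χ₄ (x + + 3 * y)} { - χ₄ y} e (table₁ x y)) (at x y {corner x y * χ₄ (x - y)} { - χ₄ y} e (table₂ x y)))) (l₇ (χ₄ y) x y (base (x , y))))
        where
        l₅ : ∀ x y n → (x + + 3 * y) * (x + + 3 * y) + + 3 * ((x - y) * (x - y)) - + 4 * n ≡ + 4 * (x * x + + 3 * (y * y) - n)
        l₅ = solve-∀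
        l₆ : ∀ k a b x y → k * (a * (x + + 3 * y) + b * (x - y)) ≡ k * a * (x + + 3 * y) + k * b * (x - y)
        l₆ = solve-∀
        l₇ : ∀ k x y b → (- k * (x + + 3 * y) + - k * (x - y)) * b ≡ - (+ 2) * (k * x * b + k * y * b)
        l₇ = solve-∀

    M : ℕ
    M = 4 ℕ.* N

    -- Odd `a` and `b` satisfy exactly one of `a ≡ b` and `a ≡ - b` modulo 4, and `b ↦ - b`
    -- exchanges these two halves.
    rep-HasSum : HasSum (repWeight M) (- (+ 8 * C))
    rep-HasSum = HasSum-subst (l₀ C) (HasSum-cong pointwise (HasSum-+ {A = ℤ × ℤ} diagonal-HasSum (HasSum-bijection {A = ℤ × ℤ} {B = ℤ × ℤ} (λ (a , b) → a , - b) (λ (a , b) → a , - b) σσ σσ diagonal-HasSum)))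
      where
      σσ : ∀ p → (proj₁ p , - (- proj₂ p)) ≡ p
      σσ (a , b) = cong (a ,_) (ℤₚ.neg-involutive b)
      l₀ : ∀ C → - (+ 4 * C) + - (+ 4 * C) ≡ - (+ 8 * C)
      l₀ = solve-∀
      l₁ : ∀ k b → - k * - b ≡ k * b
      l₁ = solve-∀
      l₂ : ∀ p q w d → p * w * d + q * w * d ≡ (p + q) * w * d
      l₂ = solve-∀
      pointwise : ∀ p → v₁ p + v₁ (proj₁ p , - proj₂ p) ≡ repWeight M p
      pointwise (a , b) = trans (cong₂ (λ y z → v₁ (a , b) + diagonal a (- b) * (χ₄ a * a + y) * δ (a * a + + 3 * z - + M)) (trans (cong (_* - b) (χ₄-neg b)) (l₁ (χ₄ b) b)) (l² b))
        (trans (l₂ (diagonal a b) (diagonal a (- b)) (χ₄ a * a + χ₄ b * b) (δ (a * a + + 3 * (b * b) - + M))) (cong (λ z → z * (χ₄ a * a + χ₄ b * b) * δ (a * a + + 3 * (b * b) - + M)) (sym (diagonal-split a b))))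

    -- The positive quadrant carries a quarter of the full total `- 8 C`.
    repSum-C : repSum (4 ℕ.* N) ≡ - (+ 2 * C)
    repSum-C = ℤₚ.*-cancelˡ-≡ (+ 4) _ _ (trans (cong (+ 4 *_) (HasSum-unique {A = ℤ × ℤ} (repSum-HasSum M) (proj₁ (proj₂ half₂))))
        (trans (l₀ (proj₁ half₂)) (trans (cong (+ 2 *_) (sym (proj₂ (proj₂ half₂)))) (trans (sym (proj₂ (proj₂ half₁))) (l₁ C)))))
      where
      l₀ : ∀ s → + 4 * s ≡ + 2 * (+ 2 * s)
      l₀ = solve-∀
      l₁ : ∀ C → - (+ 8 * C) ≡ + 4 * - (+ 2 * C)
      l₁ = solve-∀
      l₂ : ∀ k b → - k * - b ≡ k * b
      l₂ = solve-∀
      sign-split : ∀ a z → o a * z ≡ pos a * (o a * z) + pos (- a) * (o a * z)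
      sign-split +0 z = refl
      sign-split a@(+[1+ n ]) z = sym (trans (ℤₚ.+-identityʳ _) (ℤₚ.*-identityˡ (o a * z)))
      sign-split a@(-[1+ n ]) z = sym (trans (ℤₚ.+-identityˡ _) (ℤₚ.*-identityˡ (o a * z)))
      w₁ : ℤ × ℤ → ℤ
      w₁ (a , b) = pos a * repWeight M (a , b)
      half₁ : ∃ λ t → HasSum w₁ t × - (+ 8 * C) ≡ + 2 * t
      half₁ = HasSum-half {A = ℤ × ℤ} {w = repWeight M} (λ (a , b) → - a , b) (λ (a , b) → pos a) (λ (a , b) → cong (_, b) (ℤₚ.neg-involutive a))
        (λ (a , b) → cong₂ _*_ (cong₂ (λ y z → y * o b * (z + χ₄ b * b)) (o-neg a) (trans (cong (_* - a) (χ₄-neg a)) (l₂ (χ₄ a) a))) (cong (λ z → δ (z + + 3 * (b * b) - + M)) (l² a)))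
        (λ (a , b) → let z = o b * (χ₄ a * a + χ₄ b * b) * δ (a * a + + 3 * (b * b) - + M)
                         e = l (o a) (o b) (χ₄ a * a + χ₄ b * b) (δ (a * a + + 3 * (b * b) - + M)) in
          trans e (trans (sign-split a z) (cong (λ r → pos a * r + pos (- a) * r) (sym e))))
        rep-HasSum
        where
        l : ∀ a b c d → a * b * c * d ≡ a * (b * c * d)
        l = solve-∀
      half₂ : ∃ λ t → HasSum {ℤ × ℤ} (λ (a , b) → pos b * w₁ (a , b)) t × proj₁ half₁ ≡ + 2 * t
      half₂ = HasSum-half {A = ℤ × ℤ} {w = w₁} (λ (a , b) → a , - b) (λ (a , b) → pos b) (λ (a , b) → cong (a ,_) (ℤₚ.neg-involutive b))
        (λ (a , b) → cong (pos a *_) (cong₂ _*_ (cong₂ (λ y z → o a * y * (χ₄ a * a + z)) (o-neg b) (trans (cong (_* - b) (χ₄-neg b)) (l₂ (χ₄ b) b))) (cong (λ z → δ (a * a + + 3 * z - + M)) (l² b))))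
        (λ (a , b) → let z = pos a * o a * (χ₄ a * a + χ₄ b * b) * δ (a * a + + 3 * (b * b) - + M)
                         e = l (pos a) (o a) (o b) (χ₄ a * a + χ₄ b * b) (δ (a * a + + 3 * (b * b) - + M)) in
          trans e (trans (sign-split b z) (cong (λ r → pos b * r + pos (- b) * r) (sym e))))
        (proj₁ (proj₂ half₁))
        where
        l : ∀ p a b c d → p * (a * b * c * d) ≡ b * (p * a * c * d)
        l = solve-∀

-- Triangular numbers and the count of solutions.

module TriangularNumbers where

  open import Defs using (tri; TSol; HasCount)
  open FiniteSums
  open Congruences
  open LiouvilleIdentity
  open Progressions
  open InteriorTerms hiding (t)
  open PrimeModuli
  open QuaternaryForm
  open import Data.Empty using (⊥-elim)
  open import Data.Fin as Fin using (Fin)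
  open import Data.List using (List; []; _∷_; filter; length; lookup)
  open import Data.List.Membership.Propositional using (_∈_)
  open import Data.List.Membership.Propositional.Properties
  import Data.List.Relation.Unary.All as All
  import Data.List.Relation.Unary.Any as Any
  import Data.List.Relation.Unary.Any.Properties as Anyₚ
  open import Data.List.Relation.Unary.AllPairs using (_∷_)
  open import Data.List.Relation.Unary.Unique.Propositional using (Unique)
  import Data.List.Relation.Unary.Unique.Propositional.Properties as Uniqueₚ
  open import Data.Nat as ℕ using (ℕ; zero; suc; z≤n)
  import Data.Nat.Properties as ℕₚ
  import Data.Nat.Divisibility as ℕ∣
  open import Data.Nat.DivMod using (m/n*n≡m)
  open import Data.Integer as ℤ using (ℤ; +_; +0; +[1+_]; -[1+_]; _+_; _*_; _-_; -_; ∣_∣; 0ℤ; 1ℤ; _≤_)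
  import Data.Integer.Properties as ℤₚ
  open import Data.Integer.DivMod using (_/ℕ_)
  open import Data.Integer.Tactic.RingSolver using (solve-∀)
  open import Data.Product using (Σ; ∃; _×_; _,_; proj₁; proj₂)
  open import Function using (case_of_; _↔_; mk↔ₛ′)
  open import Relation.Nullary using (Dec; yes; no)
  open import Relation.Binary.PropositionalEquality

  lookup-injective : ∀ {A : Set} {xs : List A} → Unique xs → ∀ i j → lookup xs i ≡ lookup xs j → i ≡ j
  lookup-injective {xs = x ∷ xs} (x∉ ∷ u) Fin.zero    Fin.zero    _ = refl
  lookup-injective {xs = x ∷ xs} (x∉ ∷ u) Fin.zero    (Fin.suc j) e = ⊥-elim (All.lookup x∉ (∈-lookup {xs = xs} j) e)
  lookup-injective {xs = x ∷ xs} (x∉ ∷ u) (Fin.suc i) Fin.zero    e = ⊥-elim (All.lookup x∉ (∈-lookup {xs = xs} i) (sym e))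
  lookup-injective {xs = x ∷ xs} (x∉ ∷ u) (Fin.suc i) (Fin.suc j) e = cong Fin.suc (lookup-injective u i j e)

  -- A total of indicators is the length of the filtered support, and positions in that list give
  -- the bijection. Since `P` is proof-irrelevant, a solution is determined by its first component.
  HasSum-count : ∀ {A : Set} {P : A → Set} {F : A → ℤ} {s} → (∀ {a} (p p′ : P a) → p ≡ p′) →
    (∀ a → F a ≡ 0ℤ → P a) → (∀ a → P a → F a ≡ 0ℤ) → HasSum (λ a → δ (F a)) s → ∃ λ k → (Fin k ↔ Σ A P) × + k ≡ s
  HasSum-count {A} {P} {F} irrelevant F⇒P P⇒F p = length xs , mk↔ₛ′ to from to-from from-to , trans (sym (total-≡ (HasSum.support p))) (HasSum.total p)
    where
    zero? : ∀ a → Dec (F a ≡ 0ℤ)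
    zero? a = F a ℤ.≟ 0ℤ
    xs : List A
    xs = filter zero? (HasSum.support p)
    uxs : Unique xs
    uxs = Uniqueₚ.filter⁺ zero? (HasSum.unique p)
    total-≡ : ∀ zs → ∑ zs (λ a → δ (F a)) ≡ + length (filter zero? zs)
    total-≡ []       = refl
    total-≡ (z ∷ zs) with F z ℤ.≟ 0ℤ
    ... | yes e = cong₂ _+_ (δ-≡ e) (total-≡ zs)
    ... | no ne = trans (cong₂ _+_ (δ-≢ ne) (total-≡ zs)) (ℤₚ.+-identityˡ _)
    member : ∀ a → P a → a ∈ xs
    member a pa = ∈-filter⁺ zero? (HasSum.covers p a λ e → case trans (sym (δ-≡ (P⇒F a pa))) e of λ ()) (P⇒F a pa)
    to : Fin (length xs) → Σ A P
    to i = lookup xs i , F⇒P _ (proj₂ (∈-filter⁻ zero? {xs = HasSum.support p} (∈-lookup {xs = xs} i)))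
    from : Σ A P → Fin (length xs)
    from (a , pa) = Any.index (member a pa)
    to-from : ∀ y → to (from y) ≡ y
    to-from (a , pa) = same (sym (Anyₚ.lookup-index (member a pa)))
      where
      same : ∀ {a b} {pa : P a} {pb : P b} → a ≡ b → (a , pa) ≡ (b , pb)
      same refl = cong (_ ,_) (irrelevant _ _)
    from-to : ∀ i → from (to i) ≡ i
    from-to i = lookup-injective uxs _ i (sym (Anyₚ.lookup-index (member (proj₁ (to i)) (proj₂ (to i)))))

  tri-≡ : ∀ x → + 2 * + tri x ≡ x * (x - 1ℤ)
  tri-≡ x = trans (sym (ℤₚ.pos-* 2 (tri x))) (trans (cong +_ (trans (ℕₚ.*-comm 2 (tri x)) (m/n*n≡m even))) (ℤₚ.0≤i⇒+∣i∣≡i (nonneg x)))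
    where
    table : ∀ x → D 2 (x * (x - 1ℤ)) ≡ 1ℤ
    table = by-residues {2} (λ r → D-periodic 2 (≈-* r (≈-- r ≈-refl))) (λ _ → refl) check₁
    even : 2 ℕ∣.∣ ∣ x * (x - 1ℤ) ∣
    even = ≈0⇒∣ (D≢0 2 (x * (x - 1ℤ)) λ e → case trans (sym (table x)) e of λ ())
    nonneg : ∀ x → 0ℤ ≤ x * (x - 1ℤ)
    nonneg +0       = ℤ.+≤+ z≤n
    nonneg +[1+ m ] = subst (0ℤ ≤_) (ℤₚ.pos-* (suc m) m) (ℤ.+≤+ z≤n)
    nonneg -[1+ m ] = ℤ.+≤+ z≤n

  module Triangular (n : ℕ) (N≈3 : + (8 ℕ.* n ℕ.+ 19) ≈ + 3 [ 8 ]) where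

    N : ℕ
    N = 8 ℕ.* n ℕ.+ 19

    open Lattice N N≈3

    T-sum : Quad → ℕ
    T-sum (x , y , z , w) = 1 ℕ.* tri x ℕ.+ 3 ℕ.* tri y ℕ.+ 3 ℕ.* tri z ℕ.+ 12 ℕ.* tri w

    -- By `8 tri x + 1 = (2 x - 1)²` the triangular equation becomes quadratic, with
    -- `12 (2 w - 1)² = 3 (4 w - 2)²` for the last variable. The constant 19 is `1 + 3 + 3 + 12`.
    f g : Quad → Quad
    f (x , y , z , w) = (x + 1ℤ) /ℕ 2 , (y + 1ℤ) /ℕ 2 , (z + 1ℤ) /ℕ 2 , (w + + 2) /ℕ 4
    g (x , y , z , w) = x * + 2 - 1ℤ , y * + 2 - 1ℤ , z * + 2 - 1ℤ , w * + 4 - + 2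

    q-g : ∀ a → δ (q (g a)) ≡ δ (+ T-sum a - + n)
    q-g (x , y , z , w) = trans (cong δ (trans (cong (λ u → (x * + 2 - 1ℤ) * (x * + 2 - 1ℤ) + + 3 * ((y * + 2 - 1ℤ) * (y * + 2 - 1ℤ)) + + 3 * ((z * + 2 - 1ℤ) * (z * + 2 - 1ℤ)) + + 3 * ((w * + 4 - + 2) * (w * + 4 - + 2)) - u) (cong (λ z → z + + 19) (ℤₚ.pos-* 8 n)))
        (trans (l₁ x y z w (+ n)) (trans (cong (_- + 8 * + n) (cong₂ _+_ (cong₂ _+_ (cong₂ _+_ (cong (+ 4 *_) (sym (tri-≡ x))) (cong (+ 12 *_) (sym (tri-≡ y)))) (cong (+ 12 *_) (sym (tri-≡ z)))) (cong (+ 48 *_) (sym (tri-≡ w)))))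
          (trans (l₂ (+ tri x) (+ tri y) (+ tri z) (+ tri w) (+ n)) (cong (λ u → + 8 * (u - + n)) (sym casts)))))))
      (δ-* (+ 8) (+ T-sum (x , y , z , w) - + n))
      where
      l₁ : ∀ x y z w n → (x * + 2 - 1ℤ) * (x * + 2 - 1ℤ) + + 3 * ((y * + 2 - 1ℤ) * (y * + 2 - 1ℤ)) + + 3 * ((z * + 2 - 1ℤ) * (z * + 2 - 1ℤ)) + + 3 * ((w * + 4 - + 2) * (w * + 4 - + 2)) - (+ 8 * n + + 19)
        ≡ + 4 * (x * (x - 1ℤ)) + + 12 * (y * (y - 1ℤ)) + + 12 * (z * (z - 1ℤ)) + + 48 * (w * (w - 1ℤ)) - + 8 * n
      l₁ = solve-∀
      l₂ : ∀ x y z w n → + 4 * (+ 2 * x) + + 12 * (+ 2 * y) + + 12 * (+ 2 * z) + + 48 * (+ 2 * w) - + 8 * n ≡ + 8 * (+ 1 * x + + 3 * y + + 3 * z + + 12 * w - n)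
      l₂ = solve-∀
      casts : + T-sum (x , y , z , w) ≡ + 1 * + tri x + + 3 * + tri y + + 3 * + tri z + + 12 * + tri w
      casts = cong₂ _+_ (cong₂ _+_ (cong₂ _+_ (ℤₚ.pos-* 1 (tri x)) (ℤₚ.pos-* 3 (tri y))) (ℤₚ.pos-* 3 (tri z))) (ℤₚ.pos-* 12 (tri w))

    TSol-HasSum : HasSum {Quad} (λ a → δ (+ T-sum a - + n)) t
    TSol-HasSum = HasSum-reindex {A = Quad} {B = Quad} {u = u} f g (λ a ne → let e = back a ne in e , trans (sym (value (f a))) (cong u e)) (λ a _ → fg a , value a)
        (⟦⟧-HasSum (by-class (λ i j k l → O i * O j * O k * T l)))
      where
      u : Quad → ℤ
      u a = by-class (λ i j k l → O i * O j * O k * T l) a * δ (q a)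
      odd : ∀ x → O (class (x * + 2 - 1ℤ)) ≡ 1ℤ
      odd x = trans (sym (o-class (x * + 2 - 1ℤ))) (table x)
        where
        table : ∀ x → o (x * + 2 - 1ℤ) ≡ 1ℤ
        table = by-residues {4} (λ r → o-periodic (≈-- (≈-* r (≈-refl {z = + 2})) (≈-refl {z = 1ℤ}))) (λ _ → refl) check₁
      twice : ∀ w → T (class (w * + 4 - + 2)) ≡ 1ℤ
      twice w = trans (sym (two-class (w * + 4 - + 2))) (two-periodic {z = - (+ 2)} (by w (ℤₚ.+-comm (w * + 4) (- (+ 2)))))
      value : ∀ a → u (g a) ≡ δ (+ T-sum a - + n)
      value a@(x , y , z , w) = trans (cong₂ _*_ (cong₂ _*_ (cong₂ _*_ (cong₂ _*_ (odd x) (odd y)) (odd z)) (twice w)) (q-g a)) (ℤₚ.*-identityˡ _)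
      fg : ∀ a → f (g a) ≡ a
      fg (x , y , z , w) = cong₂ _,_ (half x) (cong₂ _,_ (half y) (cong₂ _,_ (half z) (trans (cong (_/ℕ 4) (l₂ (w * + 4))) (/ℕ-exact 4 w))))
        where
        l₁ : ∀ x → x - 1ℤ + 1ℤ ≡ x
        l₁ = solve-∀
        l₂ : ∀ x → x - + 2 + + 2 ≡ x
        l₂ = solve-∀
        half : ∀ x → (x * + 2 - 1ℤ + 1ℤ) /ℕ 2 ≡ x
        half x = trans (cong (_/ℕ 2) (l₁ (x * + 2))) (/ℕ-exact 2 x)
      back : ∀ a → u a ≢ 0ℤ → g (f a) ≡ a
      back (x , y , z , w) ne = cong₂ _,_ (unhalf x (*≢0ˡ {_} {O (class y)} xy)) (cong₂ _,_ (unhalf y (*≢0ʳ {O (class x)} xy)) (cong₂ _,_ (unhalf z (*≢0ʳ {O (class x) * O (class y)} xyz))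
          (trans (cong (_- + 2) (multiple 4 (w + + 2) (D≢0 4 (w + + 2) (subst (_≢ 0ℤ) (trans (sym (two-class w)) (tableT w)) (*≢0ʳ {O (class x) * O (class y) * O (class z)} xyzw))))) (l₂ w))))
        where
        xyzw : O (class x) * O (class y) * O (class z) * T (class w) ≢ 0ℤ
        xyzw = *≢0ˡ {_} {δ (q (x , y , z , w))} ne
        xyz : O (class x) * O (class y) * O (class z) ≢ 0ℤ
        xyz = *≢0ˡ {_} {T (class w)} xyzw
        xy : O (class x) * O (class y) ≢ 0ℤ
        xy = *≢0ˡ {_} {O (class z)} xyz
        l₁ : ∀ x → x + 1ℤ - 1ℤ ≡ x
        l₁ = solve-∀
        l₂ : ∀ x → x + + 2 - + 2 ≡ x
        l₂ = solve-∀
        tableO : ∀ x → o x ≡ D 2 (x + 1ℤ)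
        tableO = by-residues {4} o-periodic (λ r → D-periodic 2 (≈-+ (4⇒2 r) (≈-refl {z = 1ℤ}))) check₁
        tableT : ∀ x → two x ≡ D 4 (x + + 2)
        tableT = by-residues {4} two-periodic (λ r → D-periodic 4 (≈-+ r (≈-refl {z = + 2}))) check₁
        unhalf : ∀ x → O (class x) ≢ 0ℤ → ((x + 1ℤ) /ℕ 2) * + 2 - 1ℤ ≡ x
        unhalf x h = trans (cong (_- 1ℤ) (multiple 2 (x + 1ℤ) (D≢0 2 (x + 1ℤ) (subst (_≢ 0ℤ) (trans (sym (o-class x)) (tableO x)) h)))) (l₁ x)

    count : ∃ λ k → HasCount (TSol 1 3 3 12 n) k × + k ≡ t
    count = HasSum-count {A = Quad} ℕₚ.≡-irrelevant (λ a e → sym (ℤₚ.+-injective (ℤₚ.i-j≡0⇒i≡j (+ T-sum a) (+ n) e)))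
      (λ a e → trans (cong (λ z → + z - + n) (sym e)) (ℤₚ.+-inverseʳ (+ n))) TSol-HasSum

-- The count assembled from `Λ`, `ℭ` and the divisor sums.

module CountFormula where

  open import Defs using (TSol; HasCount; jacobi; divSum; repSum)
  open FiniteSums
  open Congruences
  open Progressions
  open InteriorTerms hiding (t)
  open BoundaryTerms
  open PrimeModuli
  open QuaternaryForm
  open DivisorIdentity
  open CuspIdentity
  open JacobiSymbol
  open DivisorSums
  open RepresentationSums
  open TriangularNumbers
  open DivisorPairs
  open import Data.Nat as ℕ using (ℕ)
  import Data.Nat.Divisibility as ℕ∣
  open import Data.Integer using (+_; _+_; _*_; _-_; -_; ∣_∣; _≤_)
  import Data.Integer.Properties as ℤₚ
  open import Data.Integer.Tactic.RingSolver using (solve-∀)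
  open import Data.Product using (∃; _×_; _,_; proj₁; proj₂)
  open import Function using (case_of_)
  open import Relation.Nullary using (¬_)
  open import Relation.Binary.PropositionalEquality

  -- Twice the claim is `4 t = Λ - ℭ = e₁ - e₂ - 4 C`, in which `e₁`, `e₂` are twice divisor sums
  -- and `- 2 C` is the representation sum; the factor 2 is cancelled.
  count-formula : ∀ n β n₁ → 1 ℕ.≤ n₁ → ¬ (3 ℕ∣.∣ n₁) → 8 ℕ.* n ℕ.+ 19 ≡ 3 ℕ.^ β ℕ.* n₁ →
    ∃ λ k → HasCount (TSol 1 3 3 12 n) k × + 2 * + k ≡ (+ (3 ℕ.^ β) * jacobi 3 n₁ - + 1) * divSum n₁ + repSum (4 ℕ.* (8 ℕ.* n ℕ.+ 19))
  count-formula n β n₁ 0<n₁ 3∤n₁ N≡ = proj₁ count , proj₁ (proj₂ count) , ℤₚ.*-cancelˡ-≡ (+ 2) _ _ (begin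
      + 2 * (+ 2 * + proj₁ count) ≡⟨ cong (λ z → + 2 * (+ 2 * z)) (proj₂ (proj₂ count)) ⟩
      + 2 * (+ 2 * t) ≡⟨ l₁ t ℭ ⟩
      ℭ + + 4 * t - ℭ ≡⟨ cong (_- ℭ) (trans (sym quarter-difference) Λ-divisors) ⟩
      e₁ - e₂ - ℭ ≡⟨ cong₂ _-_ (cong₂ _-_ (e₁-divSum β N N≡) (e₂-divSum β N N≡)) ℭ≡4C ⟩
      + 2 * (+ (3 ℕ.^ β) * χ₁₂ (+ n₁) * divSum n₁) - + 2 * divSum n₁ - + 4 * C ≡⟨ l₂ (+ (3 ℕ.^ β)) (χ₁₂ (+ n₁)) (divSum n₁) C ⟩
      + 2 * ((+ (3 ℕ.^ β) * χ₁₂ (+ n₁) - + 1) * divSum n₁ + - (+ 2 * C)) ≡⟨ cong₂ (λ y z → + 2 * ((+ (3 ℕ.^ β) * y - + 1) * divSum n₁ + z)) (sym (jacobi-3 n₁ 0<n₁ 2∤n₁ 3∤n₁)) (sym repSum-C) ⟩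
      + 2 * ((+ (3 ℕ.^ β) * jacobi 3 n₁ - + 1) * divSum n₁ + repSum (4 ℕ.* N)) ∎)
    where
    open ≡-Reasoning
    N : ℕ
    N = 8 ℕ.* n ℕ.+ 19
    N≈3 : + N ≈ + 3 [ 8 ]
    N≈3 = by (+ n + + 2) (trans (cong (_+ + 19) (ℤₚ.pos-* 8 n)) (l (+ n)))
      where
      l : ∀ n → + 8 * n + + 19 ≡ + 3 + (n + + 2) * + 8
      l = solve-∀
    2∤n₁ : ¬ (2 ℕ∣.∣ n₁)
    2∤n₁ d = case trans (sym (D-1 2 {+ N} (∣⇒≈0 (subst (2 ℕ∣.∣_) (sym N≡) (ℕ∣.∣n⇒∣m*n (3 ℕ.^ β) d))))) (D-periodic 2 (4⇒2 (8⇒4 N≈3))) of λ ()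
    open Lattice N N≈3 using (t; ℭ; quarter-difference)
    open Boundary N (8⇒4 N≈3) using (e₁; e₂)
    open FirstIdentity N N≈3 using (Λ-divisors)
    open SecondIdentity N N≈3 using (C; ℭ≡4C)
    open RepresentationSum N N≈3 using (repSum-C)
    open Divisors n₁ 0<n₁ 2∤n₁ 3∤n₁ using (e₁-divSum; e₂-divSum)
    open Triangular n N≈3 using (count)
    l₁ : ∀ t c → + 2 * (+ 2 * t) ≡ c + + 4 * t - c
    l₁ = solve-∀
    l₂ : ∀ p χ d c → + 2 * (p * χ * d) - + 2 * d - + 4 * c ≡ + 2 * ((p * χ - + 1) * d + - (+ 2 * c))
    l₂ = solve-∀

open import Defs
open import Data.Nat using (ℕ; _+_; _*_; _^_; _≥_)
open import Data.Nat.Divisibility using (_∣_)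
open import Data.Integer as ℤ using (ℤ; +_)
open import Data.Product using (Σ; _×_)
open import Relation.Nullary using (¬_)
open import Relation.Binary.PropositionalEquality using (_≡_)

theorem4p4 : (n β n₁ : ℕ) → n ≥ 1 → n₁ ≥ 1 → ¬ (3 ∣ n₁) →
    8 * n + 19 ≡ 3 ^ β * n₁ →
    Σ ℕ λ k → HasCount (TSol 1 3 3 12 n) k ×
    (+ 2 ℤ.* + k ≡ (+ (3 ^ β) ℤ.* jacobi 3 n₁ ℤ.- + 1) ℤ.* divSum n₁
    ℤ.+ repSum (4 * (8 * n + 19)))
theorem4p4 n β n₁ _ = CountFormula.count-formula n β n₁
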